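{- Let $\mathbb V$ be a Schubert representation of $\widehat H_n$ with equivariant parameters $t_1,\dots,t_n$. For $1\le i\le k$ let $R_i$ be the $\mathbb F$-linear operator on the span of $\{\mathcal Y_\nu:\nu\subseteq(n-k)^k\}$ given by $$R_i(\mathcal Y_\nu)=t_{\nu_i+k+1-i}\,\mathcal Y_\nu+\sum_\mu\bigl(\hbar-(p-q)t_{\mathtt h(\mu/\nu)}\bigr)p^{\operatorname{ht}(\mu/\nu)-1}q^{\operatorname{wd}(\mu/\nu)-1}\,\mathcal Y_\mu,$$ the sum over $\mu\subseteq(n-k)^k$ such that $\mu/\nu$ is a ribbon with head in row $i$. Then for $\lambda\subseteq(n-k)^k$ and $0\le r\le k$, $$e_r(x_1,\dots,x_k)\cdot\mathcal Y_\lambda=\sum_{1\le i_1<\cdots<i_r\le k}R_{i_r}\cdots R_{i_1}(\mathcal Y_\lambda).$$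
   Context: $\widehat H_n$: the $\mathbb Q[p,q,\hbar]$-algebra generated by $T_1,\dots,T_{n-1},x_1,\dots,x_n$ with $(T_i+p)(T_i-q)=0$, braid relations, $x_ix_j=x_jx_i$, $T_ix_j=x_jT_i$ ($j\ne i,i+1$), $T_ix_i=x_{i+1}T_i+(\hbar-(p-q)x_i)$, $T_ix_{i+1}=x_iT_i-(\hbar-(p-q)x_i)$; $T_w$ via reduced words. Schubert representation: field $\mathbb F$ with $t_1,\dots,t_n\in\mathbb F$, ring map $\mathbb Q[p,q,\hbar]\to\mathbb F$, $\mathbb F$-space $\mathbb V$ with $\widehat H_n$-action, basis $\mathcal Y_w=T_{w^{ -1}w_0}\mathcal Y_{w_0}$ ($w_0$ longest), and $\mathbb F$-linear $\operatorname{ev}$ with $\operatorname{ev}(\mathcal Y_w)\ne0\iff w=\mathrm{id}$, $\operatorname{ev}(x_i\mathcal Y_w)=t_i\operatorname{ev}(\mathcal Y_w)$. For $\nu\subseteq(n-k)^k$ ($n-k\ge\nu_1\ge\dots\ge\nu_k\ge0$), $w_\nu$ is given by $w_\nu(k+1-i)=\nu_i+k+1-i$ ($1\le i\le k$), increasing on $\{k+1,\dots,n\}$, and $\mathcal Y_\nu=\sum_{v\in S_k\times S_{n-k}}p^{\ell(v)}\mathcal Y_{w_\nu v}$. Ribbon: nonempty connected skew shape $\eta=\mu/\nu$ with no $2\times2$ square (Young diagrams, rows top to bottom); head = top-right box; $\operatorname{ht},\operatorname{wd}$ = numbers of rows, columns; if the head is in row $i$, $\mathtt h(\eta)=\mu_i+k+1-i$.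 -}

module Defs where

open import Level using (Level; 0ℓ; _⊔_) renaming (suc to lsuc)
open import Function.Base using (_∘_)
open import Function.Bundles using (_⇔_)
open import Function.Definitions using (Injective)
open import Data.Empty using (⊥-elim)
open import Data.Nat.Base as ℕ using (ℕ; zero; suc; _≤_; _<_; _∸_; z≤n; s≤s; ∣_-_∣)
import Data.Nat.Properties as ℕₚ
open import Data.Fin.Base as Fin using (Fin; zero; suc; toℕ; fromℕ<; inject₁; inject≤; opposite; punchOut)
import Data.Fin.Properties as Finₚ
open import Data.Fin.Permutation as Perm using (Permutation′; _⟨$⟩ʳ_; _∘ₚ_; insert; transpose; permutation)
import Data.Rational.Properties as ℚₚ
open import Data.Product.Base using (Σ; Σ-syntax; ∃; ∃-syntax; _×_; _,_; proj₁; proj₂)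
open import Data.Sum.Base using (_⊎_; inj₁; inj₂)
open import Data.List.Base as List using (List; []; _∷_; map; concatMap; filter; length; foldr; foldl; allFin; cartesianProduct; _++_)
open import Data.List.Membership.Propositional using (_∈_)
open import Data.List.Membership.Propositional.Properties using (∈-allFin; ∈-cartesianProduct⁺)
open import Data.List.Relation.Unary.Any using (here; there)
open import Relation.Nullary using (¬_; Dec; yes; no)
open import Relation.Nullary.Decidable using (_×-dec_; _→-dec_; _⊎-dec_; ¬?; map′)
open import Relation.Nullary.Negation using (contradiction)
open import Relation.Unary using (Pred; Decidable)
open import Relation.Binary.Core using (Rel)
open import Relation.Binary.Structures using (IsEquivalence)
open import Relation.Binary.Definitions as Rel₂ using ()
open import Relation.Binary.PropositionalEquality as ≡ using (_≡_; _≢_; refl)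
open import Relation.Binary.Construct.Closure.ReflexiveTransitive using (Star; ε; _◅_; _◅◅_)
open import Algebra.Bundles using (Ring; CommutativeRing)
open import Algebra.Apartness.Bundles using (HeytingField; HeytingCommutativeRing)
open import Algebra.Module.Bundles using (LeftModule)
import Algebra.Module.Structures as ModuleStructures
import Algebra.Module.Construct.TensorUnit as TensorUnit
open import Algebra.Module.Morphism.Structures using (module LeftModuleMorphisms)
open import Algebra.Morphism.Structures using (module RingMorphisms)
import Algebra.Properties.Semiring.Exp as Exp

-- The K-algebra on generators G subject to relations Rel: formal
-- expressions modulo the congruence generated by Rel, the ring axioms and
-- the requirement that con be a ring map with central image.

module Presented {c ℓ g} (K : CommutativeRing c ℓ) (G : Set g) where

  private module K = CommutativeRing K

  infixl 7 _⊗_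
  infixl 6 _⊕_
  infix  8 ⊖_

  data Term : Set (c ⊔ g) where
    con     : K.Carrier → Term
    gen     : G → Term
    _⊕_ _⊗_ : Term → Term → Term
    ⊖_      : Term → Term

  module _ {r} (Rel : Term → Term → Set r) where

    infix 4 _~_

    data _~_ : Term → Term → Set (c ⊔ ℓ ⊔ g ⊔ r) where
      rel         : ∀ {a b} → Rel a b → a ~ b

      ~-refl      : ∀ {a} → a ~ a
      ~-sym       : ∀ {a b} → a ~ b → b ~ a
      ~-trans     : ∀ {a b d} → a ~ b → b ~ d → a ~ d
      ⊕-cong      : ∀ {a a′ b b′} → a ~ a′ → b ~ b′ → a ⊕ b ~ a′ ⊕ b′
      ⊗-cong      : ∀ {a a′ b b′} → a ~ a′ → b ~ b′ → a ⊗ b ~ a′ ⊗ b′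
      ⊖-cong      : ∀ {a a′} → a ~ a′ → ⊖ a ~ ⊖ a′

      ⊕-assoc     : ∀ a b d → (a ⊕ b) ⊕ d ~ a ⊕ (b ⊕ d)
      ⊕-comm      : ∀ a b → a ⊕ b ~ b ⊕ a
      ⊕-identityˡ : ∀ a → con K.0# ⊕ a ~ a
      ⊖-inverseˡ  : ∀ a → ⊖ a ⊕ a ~ con K.0#
      ⊗-assoc     : ∀ a b d → (a ⊗ b) ⊗ d ~ a ⊗ (b ⊗ d)
      ⊗-identityˡ : ∀ a → con K.1# ⊗ a ~ a
      distribˡ    : ∀ a b d → a ⊗ (b ⊕ d) ~ (a ⊗ b) ⊕ (a ⊗ d)
      distribʳ    : ∀ a b d → (b ⊕ d) ⊗ a ~ (b ⊗ a) ⊕ (d ⊗ a)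

      con-cong    : ∀ {x y} → x K.≈ y → con x ~ con y
      con-+       : ∀ x y → con (x K.+ y) ~ con x ⊕ con y
      con-*       : ∀ x y → con (x K.* y) ~ con x ⊗ con y
      con-central : ∀ x a → con x ⊗ a ~ a ⊗ con x

    ring : Ring (c ⊔ g) (c ⊔ ℓ ⊔ g ⊔ r)
    ring = record
      { Carrier = Term
      ; _≈_ = _~_
      ; _+_ = _⊕_
      ; _*_ = _⊗_
      ; -_ = ⊖_
      ; 0# = con K.0#
      ; 1# = con K.1#
      ; isRing = record
        { +-isAbelianGroup = record
          { isGroup = record
            { isMonoid = record
              { isSemigroup = record
                { isMagma = record { isEquivalence = ~-isEquivalence ; ∙-cong = ⊕-cong }
                ; assoc = ⊕-assoc
                }
              ; identity = ⊕-identityˡ , λ a → ~-trans (⊕-comm _ _) (⊕-identityˡ a)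
              }
            ; inverse = ⊖-inverseˡ , λ a → ~-trans (⊕-comm _ _) (⊖-inverseˡ a)
            ; ⁻¹-cong = ⊖-cong
            }
          ; comm = ⊕-comm
          }
        ; *-cong = ⊗-cong
        ; *-assoc = ⊗-assoc
        ; *-identity = ⊗-identityˡ , λ a → ~-trans (~-sym (con-central _ a)) (⊗-identityˡ a)
        ; distrib = distribˡ , distribʳ
        }
      }
      where
      ~-isEquivalence : IsEquivalence _~_
      ~-isEquivalence = record { refl = ~-refl ; sym = ~-sym ; trans = ~-trans }

data Parameter : Set where
  p q ħ : Parameter

private module Poly = Presented ℚₚ.+-*-commutativeRing Parameter

data Commute : Poly.Term → Poly.Term → Set where
  commute : ∀ a b → Commute (Poly.gen a Poly.⊗ Poly.gen b) (Poly.gen b Poly.⊗ Poly.gen a)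

ℚ[p,q,ħ] : CommutativeRing 0ℓ 0ℓ
ℚ[p,q,ħ] = record
  { isCommutativeRing = record
    { isRing = Ring.isRing P
    ; *-comm = comm
    }
  }
  where
  open Poly using (con; gen; _⊕_; _⊗_; ⊖_; rel; con-central)
  P : Ring 0ℓ 0ℓ
  P = Poly.ring Commute
  open Ring P using (_≈_; sym; trans; +-cong; *-cong; *-assoc; -‿cong)
                renaming (refl to ≈-refl; distribˡ to dˡ; distribʳ to dʳ)
  open import Algebra.Properties.Ring P using (-‿distribˡ-*; -‿distribʳ-*)

  product-comm : ∀ {a b d} → a ⊗ d ≈ d ⊗ a → b ⊗ d ≈ d ⊗ b → (a ⊗ b) ⊗ d ≈ d ⊗ (a ⊗ b)
  product-comm {a} {b} {d} ad bd =
    trans (*-assoc a b d) (trans (*-cong ≈-refl bd) (trans (sym (*-assoc a d b))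
      (trans (*-cong ad ≈-refl) (*-assoc d a b))))

  gen-comm : ∀ a g → gen g ⊗ a ≈ a ⊗ gen g
  gen-comm (con x) g = sym (con-central x (gen g))
  gen-comm (gen h) g = rel (commute g h)
  gen-comm (a ⊕ b) g = trans (dˡ _ _ _) (trans (+-cong (gen-comm a g) (gen-comm b g)) (sym (dʳ _ _ _)))
  gen-comm (a ⊗ b) g = sym (product-comm (sym (gen-comm a g)) (sym (gen-comm b g)))
  gen-comm (⊖ a) g = trans (sym (-‿distribʳ-* _ _)) (trans (-‿cong (gen-comm a g)) (-‿distribˡ-* _ _))

  comm : ∀ a b → a ⊗ b ≈ b ⊗ a
  comm (con x) b = con-central x b
  comm (gen g) b = gen-comm b g
  comm (a ⊕ b) d = trans (dʳ _ _ _) (trans (+-cong (comm a d) (comm b d)) (sym (dˡ _ _ _)))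
  comm (a ⊗ b) d = product-comm (comm a d) (comm b d)
  comm (⊖ a) d = trans (sym (-‿distribˡ-* _ _)) (trans (-‿cong (comm a d)) (-‿distribʳ-* _ _))

indeterminate : Parameter → CommutativeRing.Carrier ℚ[p,q,ħ]
indeterminate = Poly.gen

-- Generators are indexed from 0: T i and x i stand for T_{i+1} and x_{i+1}.

data Generator (n : ℕ) : Set where
  T : Fin (n ∸ 1) → Generator n
  x : Fin n → Generator n

lo hi : ∀ {n} → Fin (n ∸ 1) → Fin n
lo {suc n} = inject₁
hi {suc n} = suc

module _ (n : ℕ) where

  private
    module H = Presented ℚ[p,q,ħ] (Generator n)
    open H using (Term; con; gen; _⊕_; _⊗_; ⊖_)

    param : Parameter → Term
    param a = con (indeterminate a)

    -- ħ − (p−q) xᵢ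
    correction : Fin n → Term
    correction i = param ħ ⊕ ⊖ ((param p ⊕ ⊖ param q) ⊗ gen (x i))

  data HeckeRel : Term → Term → Set where
    quadratic : ∀ i →
      HeckeRel ((gen (T i) ⊕ param p) ⊗ (gen (T i) ⊕ ⊖ param q)) (con (CommutativeRing.0# ℚ[p,q,ħ]))
    braid     : ∀ i j → toℕ j ≡ suc (toℕ i) →
      HeckeRel (gen (T i) ⊗ gen (T j) ⊗ gen (T i)) (gen (T j) ⊗ gen (T i) ⊗ gen (T j))
    far       : ∀ i j → 2 ≤ ∣ toℕ i - toℕ j ∣ →
      HeckeRel (gen (T i) ⊗ gen (T j)) (gen (T j) ⊗ gen (T i))
    xx        : ∀ i j →
      HeckeRel (gen (x i) ⊗ gen (x j)) (gen (x j) ⊗ gen (x i))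
    Tx-other  : ∀ i j → j ≢ lo i → j ≢ hi i →
      HeckeRel (gen (T i) ⊗ gen (x j)) (gen (x j) ⊗ gen (T i))
    Tx-lo     : ∀ i →
      HeckeRel (gen (T i) ⊗ gen (x (lo i))) (gen (x (hi i)) ⊗ gen (T i) ⊕ correction (lo i))
    Tx-hi     : ∀ i →
      HeckeRel (gen (T i) ⊗ gen (x (hi i))) (gen (x (lo i)) ⊗ gen (T i) ⊕ ⊖ correction (lo i))

  Ĥ : Ring 0ℓ 0ℓ
  Ĥ = H.ring HeckeRel

module _ {n : ℕ} where

  open Presented ℚ[p,q,ħ] (Generator n)
  open Ring (Ĥ n) using (_+_; _*_; 0#; 1#)

  scalar : CommutativeRing.Carrier ℚ[p,q,ħ] → Ring.Carrier (Ĥ n)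
  scalar = con

  𝕩 : Fin n → Ring.Carrier (Ĥ n)
  𝕩 i = gen (x i)

  T-word : List (Fin (n ∸ 1)) → Ring.Carrier (Ĥ n)
  T-word = foldr (λ i h → gen (T i) * h) 1#

-- The sublists of length r; for allFin k these are the sequences
-- i₁ < ⋯ < i_r.

choose : ∀ {a} {A : Set a} → ℕ → List A → List (List A)
choose zero    _        = [] ∷ []
choose (suc r) []       = []
choose (suc r) (y ∷ ys) = map (y ∷_) (choose r ys) ++ choose (suc r) ys

elementary : ∀ {n k} → k ≤ n → ℕ → Ring.Carrier (Ĥ n)
elementary {n} {k} k≤n r =
  foldr _+_ 0# (map (λ is → foldr _*_ 1# (map (λ i → 𝕩 (inject≤ i k≤n)) is)) (choose r (allFin k)))
  where open Ring (Ĥ n) using (_+_; _*_; 0#; 1#)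

infixl 7 _·_

_·_ : ∀ {n} → Permutation′ n → Permutation′ n → Permutation′ n
w · v = v ∘ₚ w     -- _∘ₚ_ applies its left argument first

_⁻¹ : ∀ {n} → Permutation′ n → Permutation′ n
w ⁻¹ = Perm.flip w

w₀ : ∀ {n} → Permutation′ n
w₀ = Perm.reverse

permutations : ∀ n → List (Permutation′ n)
permutations zero    = Perm.id ∷ []
permutations (suc n) = concatMap (λ j → map (insert zero j) (permutations n)) (allFin (suc n))

-- The number of inversions.

ℓ : ∀ {n} → Permutation′ n → ℕ
ℓ {n} w = length (filter inversion? (cartesianProduct (allFin n) (allFin n)))
  where
  inversion? : (ij : Fin n × Fin n) →
               Dec ((proj₁ ij Fin.< proj₂ ij) × (w ⟨$⟩ʳ proj₂ ij Fin.< w ⟨$⟩ʳ proj₁ ij))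
  inversion? (i , j) = (i Finₚ.<? j) ×-dec (w ⟨$⟩ʳ j Finₚ.<? w ⟨$⟩ʳ i)

s-word : ∀ {n} → List (Fin (n ∸ 1)) → Permutation′ n
s-word = foldr (λ i w → transpose (lo i) (hi i) · w) Perm.id

record IsReducedWord {n} (u : List (Fin (n ∸ 1))) (w : Permutation′ n) : Set where
  field
    word-of : s-word u Perm.≈ w
    reduced : length u ≡ ℓ w

-- S_k × S_{n−k} as the stabiliser of {1,…,k} in S_n.

InYoung : ∀ {n} → ℕ → Permutation′ n → Set
InYoung {n} k v = ∀ (j : Fin n) → toℕ j < k → toℕ (v ⟨$⟩ʳ j) < k

inYoung? : ∀ {n} k (v : Permutation′ n) → Dec (InYoung k v)
inYoung? k v = Finₚ.all? λ j → (toℕ j ℕₚ.<? k) →-dec (toℕ (v ⟨$⟩ʳ j) ℕₚ.<? k)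

young : ∀ n → ℕ → List (Permutation′ n)
young n k = filter (inYoung? k) (permutations n)

-- m ≥ ν₁ ≥ ⋯ ≥ ν_k ≥ 0: a first part a ≤ m, then a partition with parts ≤ a.

data Partition : (k m : ℕ) → Set where
  []  : ∀ {m} → Partition 0 m
  _∷_ : ∀ {k m} (a : Fin (suc m)) → Partition k (toℕ a) → Partition (suc k) m

part : ∀ {k m} → Partition k m → Fin k → ℕ
part (a ∷ ν) zero    = toℕ a
part (a ∷ ν) (suc i) = part ν i

partitions : ∀ k m → List (Partition k m)
partitions zero    m = [] ∷ []
partitions (suc k) m = concatMap (λ a → map (a ∷_) (partitions k (toℕ a))) (allFin (suc m))

part≤ : ∀ {k m} (ν : Partition k m) i → part ν i ≤ m
part≤ (a ∷ ν) zero    = Finₚ.toℕ≤pred[n] a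
part≤ (a ∷ ν) (suc i) = ℕₚ.≤-trans (part≤ ν i) (Finₚ.toℕ≤pred[n] a)

-- #{i : νᵢ ≤ b}; once one part is ≤ b so are all later ones.

countParts≤ : ∀ {k m} → Partition k m → ℕ → ℕ
countParts≤ []              b = 0
countParts≤ {suc k} (a ∷ ν) b with toℕ a ℕₚ.≤? b
... | yes _ = suc k
... | no  _ = countParts≤ ν b

count-≤k : ∀ {k m} (ν : Partition k m) b → countParts≤ ν b ≤ k
count-≤k []      b = z≤n
count-≤k (a ∷ ν) b with toℕ a ℕₚ.≤? b
... | yes _ = ℕₚ.≤-refl
... | no  _ = ℕₚ.m≤n⇒m≤1+n (count-≤k ν b)

count-mono : ∀ {k m} (ν : Partition k m) {b c} → b ≤ c → countParts≤ ν b ≤ countParts≤ ν c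
count-mono []      b≤c = z≤n
count-mono (a ∷ ν) {b} {c} b≤c with toℕ a ℕₚ.≤? b | toℕ a ℕₚ.≤? c
... | yes _   | yes _   = ℕₚ.≤-refl
... | yes a≤b | no  a≰c = contradiction (ℕₚ.≤-trans a≤b b≤c) a≰c
... | no  _   | yes _   = ℕₚ.m≤n⇒m≤1+n (count-≤k ν b)
... | no  _   | no  _   = count-mono ν b≤c

count-low : ∀ {k m} (ν : Partition k m) i {b} → part ν i ≤ b → toℕ (opposite i) < countParts≤ ν b
count-low (a ∷ ν) i {b} le with toℕ a ℕₚ.≤? b
... | yes _ = Finₚ.toℕ<n (opposite i)
count-low (a ∷ ν) zero    le | no a≰b = contradiction le a≰b
count-low (a ∷ ν) (suc i) le | no a≰b
  rewrite Finₚ.toℕ-inject₁ (opposite i) = count-low ν i le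

count-high : ∀ {k m} (ν : Partition k m) i {b} → b < part ν i → countParts≤ ν b ≤ toℕ (opposite i)
count-high (a ∷ ν) i {b} lt with toℕ a ℕₚ.≤? b
count-high {suc k} (a ∷ ν) zero {b} lt | yes a≤b = contradiction a≤b (ℕₚ.<⇒≱ lt)
count-high (a ∷ ν) (suc i) lt | yes a≤b =
  contradiction (ℕₚ.≤-trans (part≤ ν i) a≤b) (ℕₚ.<⇒≱ lt)
count-high {suc k} (a ∷ ν) zero {b} lt | no _
  rewrite Finₚ.toℕ-fromℕ k = count-≤k ν b
count-high (a ∷ ν) (suc i) lt | no _
  rewrite Finₚ.toℕ-inject₁ (opposite i) = count-high ν i lt

part-anti : ∀ {k m} (ν : Partition k m) {i j} → toℕ i ≤ toℕ j → part ν j ≤ part ν i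
part-anti (a ∷ ν) {zero}  {zero}  _         = ℕₚ.≤-refl
part-anti (a ∷ ν) {zero}  {suc j} _         = part≤ ν j
part-anti (a ∷ ν) {suc i} {suc j} (s≤s i≤j) = part-anti ν i≤j

injective⇒surjective : ∀ {n} {f : Fin n → Fin n} → Injective _≡_ _≡_ f → ∀ y → ∃[ i ] f i ≡ y
injective⇒surjective {suc n} {f} inj y with Finₚ.any? (λ i → f i Finₚ.≟ y)
... | yes r = r
... | no ¬r = ⊥-elim (ℕₚ.1+n≰n (Finₚ.injective⇒≤ {f = g} g-inj))
  where
  y≢ : ∀ i → y ≢ f i
  y≢ i y≡ = ¬r (i , ≡.sym y≡)
  g : Fin (suc n) → Fin n
  g i = punchOut (y≢ i)
  g-inj : Injective _≡_ _≡_ g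
  g-inj {i} {j} e = inj (Finₚ.punchOut-injective (y≢ i) (y≢ j) e)

fromInjective : ∀ {n} (f : Fin n → Fin n) → Injective _≡_ _≡_ f → Permutation′ n
fromInjective f inj = permutation f (proj₁ ∘ sur) (proj₂ ∘ sur) (λ i → inj (proj₂ (sur (f i))))
  where sur = injective⇒surjective inj

module Box {n k : ℕ} (k≤n : k ≤ n) where

  -- Rows are indexed from 0, so that opposite i is k+1−i minus 1, and
  -- shifted ν i is the index (from 0) of νᵢ+k+1−i.

  private
    shifted< : (ν : Partition k (n ∸ k)) (i : Fin k) → part ν i ℕ.+ toℕ (opposite i) < n
    shifted< ν i = ≡.subst (part ν i ℕ.+ toℕ (opposite i) <_) (ℕₚ.m∸n+n≡m k≤n)
      (ℕₚ.+-mono-≤-< (part≤ ν i) (Finₚ.toℕ<n (opposite i)))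

  shifted : Partition k (n ∸ k) → Fin k → Fin n
  shifted ν i = fromℕ< (shifted< ν i)

  private
    rest< : (ν : Partition k (n ∸ k)) (j : Fin n) → ¬ toℕ j < k →
            (toℕ j ∸ k) ℕ.+ countParts≤ ν (toℕ j ∸ k) < n
    rest< ν j j≮k = ≡.subst ((toℕ j ∸ k) ℕ.+ countParts≤ ν (toℕ j ∸ k) <_) (ℕₚ.m∸n+n≡m k≤n)
      (ℕₚ.+-mono-<-≤ (ℕₚ.∸-monoˡ-< (Finₚ.toℕ<n j) (ℕₚ.≮⇒≥ j≮k)) (count-≤k ν (toℕ j ∸ k)))

  -- The value at position k+1+b is the (b+1)-st element of the complement of
  -- {νᵢ+k+1−i}, namely b + 1 + #{i : νᵢ ≤ b}.

  one-line : Partition k (n ∸ k) → Fin n → Fin n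
  one-line ν j with toℕ j ℕₚ.<? k
  ... | yes j<k = shifted ν (opposite (fromℕ< j<k))
  ... | no  j≮k = fromℕ< (rest< ν j j≮k)

  private
    opp-cancel : ∀ {j} (j<k : j < k) → toℕ (opposite (opposite (fromℕ< j<k))) ≡ j
    opp-cancel j<k = ≡.trans (≡.cong toℕ (Finₚ.opposite-involutive (fromℕ< j<k))) (Finₚ.toℕ-fromℕ< j<k)

    high : Partition k (n ∸ k) → ℕ → ℕ
    high ν b = b ℕ.+ countParts≤ ν b

    shifted-mono : ∀ (ν : Partition k (n ∸ k)) {i j : Fin k} → toℕ (opposite i) < toℕ (opposite j) →
                   part ν i ℕ.+ toℕ (opposite i) < part ν j ℕ.+ toℕ (opposite j)
    shifted-mono ν {i} {j} lt = ℕₚ.+-mono-≤-< (part-anti ν j≤i) lt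
      where
      j≤i : toℕ j ≤ toℕ i
      j≤i = ℕₚ.≮⇒≥ λ i<j → ℕₚ.<⇒≱ lt (≡.subst₂ _≤_
        (≡.sym (Finₚ.opposite-prop j)) (≡.sym (Finₚ.opposite-prop i))
        (ℕₚ.∸-monoʳ-≤ k (s≤s (ℕₚ.<⇒≤ i<j))))

    shifted-inj : ∀ (ν : Partition k (n ∸ k)) {i j : Fin k} → part ν i ℕ.+ toℕ (opposite i) ≡ part ν j ℕ.+ toℕ (opposite j) →
                  toℕ (opposite i) ≡ toℕ (opposite j)
    shifted-inj ν {i} {j} e with ℕₚ.<-cmp (toℕ (opposite i)) (toℕ (opposite j))
    ... | Rel₂.tri≈ _ eq _ = eq
    ... | Rel₂.tri< lt _ _ = contradiction e (ℕₚ.<⇒≢ (shifted-mono ν {i} {j} lt))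
    ... | Rel₂.tri> _ _ gt = contradiction (≡.sym e) (ℕₚ.<⇒≢ (shifted-mono ν {j} {i} gt))

    high-mono : ∀ ν {b c} → b < c → high ν b < high ν c
    high-mono ν b<c = ℕₚ.+-mono-<-≤ b<c (count-mono ν (ℕₚ.<⇒≤ b<c))

    high-inj : ∀ ν {b c} → high ν b ≡ high ν c → b ≡ c
    high-inj ν {b} {c} e with ℕₚ.<-cmp b c
    ... | Rel₂.tri≈ _ eq _ = eq
    ... | Rel₂.tri< lt _ _ = contradiction e (ℕₚ.<⇒≢ (high-mono ν lt))
    ... | Rel₂.tri> _ _ gt = contradiction (≡.sym e) (ℕₚ.<⇒≢ (high-mono ν gt))

    disjoint : ∀ ν (i : Fin k) b → part ν i ℕ.+ toℕ (opposite i) ≢ high ν b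
    disjoint ν i b e with part ν i ℕₚ.≤? b
    ... | yes le = ℕₚ.<⇒≢ (ℕₚ.+-mono-≤-< le (count-low ν i le)) e
    ... | no  nle = ℕₚ.<⇒≢ (ℕₚ.+-mono-<-≤ (ℕₚ.≰⇒> nle) (count-high ν i (ℕₚ.≰⇒> nle))) (≡.sym e)

    one-line-injective : ∀ ν → Injective _≡_ _≡_ (one-line ν)
    one-line-injective ν {i} {j} e with toℕ i ℕₚ.<? k | toℕ j ℕₚ.<? k
    ... | yes i<k | yes j<k = Finₚ.toℕ-injective (≡.trans (≡.sym (opp-cancel i<k))
      (≡.trans (shifted-inj ν {opposite (fromℕ< i<k)} {opposite (fromℕ< j<k)} (Finₚ.fromℕ<-injective _ _ _ _ e))
        (opp-cancel j<k)))
    ... | yes i<k | no  j≮k = contradiction (Finₚ.fromℕ<-injective _ _ _ _ e) (disjoint ν (opposite (fromℕ< i<k)) _)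
    ... | no  i≮k | yes j<k = contradiction (≡.sym (Finₚ.fromℕ<-injective _ _ _ _ e)) (disjoint ν (opposite (fromℕ< j<k)) _)
    ... | no  i≮k | no  j≮k = Finₚ.toℕ-injective
      (ℕₚ.∸-cancelʳ-≡ (ℕₚ.≮⇒≥ i≮k) (ℕₚ.≮⇒≥ j≮k) (high-inj ν (Finₚ.fromℕ<-injective _ _ _ _ e)))

  w[_] : Partition k (n ∸ k) → Permutation′ n
  w[ ν ] = fromInjective (one-line ν) (one-line-injective ν)

  -- These two properties determine w_ν.

  w[]-values : ∀ ν (i : Fin k) → w[ ν ] ⟨$⟩ʳ inject≤ (opposite i) k≤n ≡ shifted ν i
  w[]-values ν i with toℕ (inject≤ (opposite i) k≤n) ℕₚ.<? k
  ... | yes j<k = ≡.cong (shifted ν) (≡.trans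
          (≡.cong opposite (Finₚ.toℕ-injective
            (≡.trans (Finₚ.toℕ-fromℕ< j<k) (Finₚ.toℕ-inject≤ (opposite i) k≤n))))
          (Finₚ.opposite-involutive i))
  ... | no  j≮k = contradiction
          (≡.subst (_< k) (≡.sym (Finₚ.toℕ-inject≤ (opposite i) k≤n)) (Finₚ.toℕ<n (opposite i))) j≮k

  w[]-increasing : ∀ ν (i j : Fin n) → k ≤ toℕ i → i Fin.< j → w[ ν ] ⟨$⟩ʳ i Fin.< w[ ν ] ⟨$⟩ʳ j
  w[]-increasing ν i j k≤i i<j with toℕ i ℕₚ.<? k | toℕ j ℕₚ.<? k
  ... | yes i<k | _       = contradiction k≤i (ℕₚ.<⇒≱ i<k)
  ... | no  _   | yes j<k = contradiction (ℕₚ.≤-trans k≤i (ℕₚ.<⇒≤ i<j)) (ℕₚ.<⇒≱ j<k)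
  ... | no  i≮k | no  j≮k = ≡.subst₂ _<_
          (≡.sym (Finₚ.toℕ-fromℕ< (rest< ν i i≮k))) (≡.sym (Finₚ.toℕ-fromℕ< (rest< ν j j≮k)))
          (high-mono ν (ℕₚ.∸-monoˡ-< i<j k≤i))

module Skew {k m : ℕ} (μ ν : Partition k m) where

  Square : Set
  Square = Fin k × Fin m

  row : Square → Fin k
  row = proj₁

  col : Square → Fin m
  col = proj₂

  InSkew : Square → Set
  InSkew b = part ν (row b) ≤ toℕ (col b) × toℕ (col b) < part μ (row b)

  Adjacent : Square → Square → Set
  Adjacent b c = ∣ toℕ (row b) - toℕ (row c) ∣ ℕ.+ ∣ toℕ (col b) - toℕ (col c) ∣ ≡ 1

  Step : Square → Square → Set
  Step b c = InSkew b × InSkew c × Adjacent b c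

  record TwoByTwo (b c : Square) : Set where
    field
      below       : toℕ (row c) ≡ suc (toℕ (row b))
      right       : toℕ (col c) ≡ suc (toℕ (col b))
      top-left    : InSkew (row b , col b)
      top-right   : InSkew (row b , col c)
      bottom-left : InSkew (row c , col b)
      bottom-right : InSkew (row c , col c)

  record IsRibbon : Set where
    field
      contained : ∀ i → part ν i ≤ part μ i
      nonempty  : ∃[ b ] InSkew b
      connected : ∀ b c → InSkew b → InSkew c → Star Step b c
      no-2×2    : ∀ b c → ¬ TwoByTwo b c

  -- Row 0 is the top row, so the head lies weakly above and to the right of
  -- every other box.

  IsHead : Square → Set
  IsHead b = InSkew b × (∀ c → InSkew c → row b Fin.≤ row c × col c Fin.≤ col b)

  RibbonWithHeadInRow : Fin k → Set
  RibbonWithHeadInRow i = IsRibbon × ∃[ j ] IsHead (i , j)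

  inSkew? : ∀ b → Dec (InSkew b)
  inSkew? b = (part ν (row b) ℕₚ.≤? toℕ (col b)) ×-dec (toℕ (col b) ℕₚ.<? part μ (row b))

  -- Only rows (columns) that meet μ/ν are counted.

  ht : ℕ
  ht = length (filter (λ i → Finₚ.any? λ j → inSkew? (i , j)) (allFin k))

  wd : ℕ
  wd = length (filter (λ j → Finₚ.any? λ i → inSkew? (i , j)) (allFin m))

  private
    _≟_ : (b c : Square) → Dec (b ≡ c)
    (i , j) ≟ (i′ , j′) = map′ (λ { (refl , refl) → refl }) (λ { refl → refl , refl })
      ((i Finₚ.≟ i′) ×-dec (j Finₚ.≟ j′))

    step? : ∀ b c → Dec (Step b c)
    step? b c = inSkew? b ×-dec inSkew? c ×-dec (_ ℕₚ.≟ 1)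

    -- Reachability through a given list of intermediate squares
    -- (Warshall's algorithm).

    Via : List Square → Square → Square → Set
    Via []       b c = b ≡ c ⊎ Step b c
    Via (v ∷ vs) b c = Via vs b c ⊎ (Via vs b v × Via vs v c)

    via? : ∀ vs b c → Dec (Via vs b c)
    via? []       b c = (b ≟ c) ⊎-dec step? b c
    via? (v ∷ vs) b c = via? vs b c ⊎-dec (via? vs b v ×-dec via? vs v c)

    sound : ∀ vs {b c} → Via vs b c → Star Step b c
    sound []       (inj₁ refl)    = ε
    sound []       (inj₂ s)       = s ◅ ε
    sound (v ∷ vs) (inj₁ r)       = sound vs r
    sound (v ∷ vs) (inj₂ (r , s)) = sound vs r ◅◅ sound vs s

    to-head : ∀ {v} vs {b} → Via (v ∷ vs) b v → Via vs b v
    to-head vs (inj₁ r)       = r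
    to-head vs (inj₂ (r , _)) = r

    from-head : ∀ {v} vs {c} → Via (v ∷ vs) v c → Via vs v c
    from-head vs (inj₁ r)       = r
    from-head vs (inj₂ (_ , r)) = r

    join : ∀ {vs v b c} → v ∈ vs → Via vs b v → Via vs v c → Via vs b c
    join {_ ∷ vs} (here refl) r s = inj₂ (to-head vs r , from-head vs s)
    join (there v∈) (inj₁ r)       (inj₁ s)       = inj₁ (join v∈ r s)
    join (there v∈) (inj₁ r)       (inj₂ (s , t)) = inj₂ (join v∈ r s , t)
    join (there v∈) (inj₂ (r , s)) (inj₁ t)       = inj₂ (r , join v∈ s t)
    join (there v∈) (inj₂ (r , _)) (inj₂ (_ , t)) = inj₂ (r , t)

    single : ∀ vs {b c} → b ≡ c ⊎ Step b c → Via vs b c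
    single []       s = s
    single (v ∷ vs) s = inj₁ (single vs s)

    squares : List Square
    squares = cartesianProduct (allFin k) (allFin m)

    complete : ∀ {b c} → Star Step b c → Via squares b c
    complete ε = single squares (inj₁ refl)
    complete (_◅_ {j = v} s ss) =
      join (∈-cartesianProduct⁺ (∈-allFin (row v)) (∈-allFin (col v)))
           (single squares (inj₂ s)) (complete ss)

    path? : ∀ b c → Dec (Star Step b c)
    path? b c = map′ (sound squares) complete (via? squares b c)

    ∀? : ∀ {ℓP} {P : Square → Set ℓP} → Decidable P → Dec (∀ b → P b)
    ∀? P? = map′ (λ f b → f (row b) (col b)) (λ f i j → f (i , j))
      (Finₚ.all? λ i → Finₚ.all? λ j → P? (i , j))

    ∃? : ∀ {ℓP} {P : Square → Set ℓP} → Decidable P → Dec (∃ P)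
    ∃? P? = map′ (λ (i , j , r) → (i , j) , r) (λ ((i , j) , r) → i , j , r)
      (Finₚ.any? λ i → Finₚ.any? λ j → P? (i , j))

    twoByTwo? : ∀ b c → Dec (TwoByTwo b c)
    twoByTwo? b c = map′
      (λ (a , b , d , e , f , g) → record { below = a ; right = b ; top-left = d ; top-right = e
                                          ; bottom-left = f ; bottom-right = g })
      (λ r → let open TwoByTwo r in below , right , top-left , top-right , bottom-left , bottom-right)
      ((_ ℕₚ.≟ _) ×-dec (_ ℕₚ.≟ _) ×-dec inSkew? _ ×-dec inSkew? _ ×-dec inSkew? _ ×-dec inSkew? _)

    isRibbon? : Dec IsRibbon
    isRibbon? = map′
      (λ (a , b , d , e) → record { contained = a ; nonempty = b ; connected = d ; no-2×2 = e })
      (λ r → let open IsRibbon r in contained , nonempty , connected , no-2×2)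
      (Finₚ.all? (λ i → part ν i ℕₚ.≤? part μ i)
        ×-dec ∃? inSkew?
        ×-dec ∀? (λ b → ∀? λ c → inSkew? b →-dec (inSkew? c →-dec path? b c))
        ×-dec ∀? (λ b → ∀? λ c → ¬? (twoByTwo? b c)))

    isHead? : ∀ b → Dec (IsHead b)
    isHead? b = inSkew? b ×-dec
      ∀? (λ c → inSkew? c →-dec ((row b Finₚ.≤? row c) ×-dec (col c Finₚ.≤? col b)))

  ribbonWithHeadInRow? : ∀ i → Dec (RibbonWithHeadInRow i)
  ribbonWithHeadInRow? i = isRibbon? ×-dec Finₚ.any? (λ j → isHead? (i , j))

module _ {r ℓr m ℓm} {R : Ring r ℓr} (M : LeftModule R m ℓm) where

  open LeftModule M

  sumᴹ : List Carrierᴹ → Carrierᴹ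
  sumᴹ = foldr _+ᴹ_ 0ᴹ

  module _ {i} {I : Set i} (f : I → Carrierᴹ) where

    data InSpan : Carrierᴹ → Set (r ⊔ m ⊔ ℓm ⊔ i) where
      member : ∀ a → InSpan (f a)
      0-in   : InSpan 0ᴹ
      +-in   : ∀ {u v} → InSpan u → InSpan v → InSpan (u +ᴹ v)
      neg-in : ∀ {v} → InSpan v → InSpan (-ᴹ v)
      *ₗ-in  : ∀ a {v} → InSpan v → InSpan (a *ₗ v)
      ≈-in   : ∀ {u v} → u ≈ᴹ v → InSpan u → InSpan v

    span : LeftModule R (r ⊔ m ⊔ ℓm ⊔ i) ℓm
    span = record
      { Carrierᴹ = Σ Carrierᴹ InSpan
      ; _≈ᴹ_ = λ u v → proj₁ u ≈ᴹ proj₁ v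
      ; _+ᴹ_ = λ (u , su) (v , sv) → u +ᴹ v , +-in su sv
      ; _*ₗ_ = λ a (v , sv) → a *ₗ v , *ₗ-in a sv
      ; 0ᴹ = 0ᴹ , 0-in
      ; -ᴹ_ = λ (v , sv) → -ᴹ v , neg-in sv
      ; isLeftModule = record
        { isLeftSemimodule = record
          { +ᴹ-isCommutativeMonoid = record
            { isMonoid = record
              { isSemigroup = record
                { isMagma = record
                  { isEquivalence = record { refl = ≈ᴹ-refl ; sym = ≈ᴹ-sym ; trans = ≈ᴹ-trans }
                  ; ∙-cong = +ᴹ-cong
                  }
                ; assoc = λ _ _ _ → +ᴹ-assoc _ _ _
                }
              ; identity = (λ _ → +ᴹ-identityˡ _) , (λ _ → +ᴹ-identityʳ _)
              }
            ; comm = λ _ _ → +ᴹ-comm _ _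
            }
          ; isPreleftSemimodule = record
            { *ₗ-cong = *ₗ-cong
            ; *ₗ-zeroˡ = λ _ → *ₗ-zeroˡ _
            ; *ₗ-distribʳ = λ _ _ _ → *ₗ-distribʳ _ _ _
            ; *ₗ-identityˡ = λ _ → *ₗ-identityˡ _
            ; *ₗ-assoc = λ _ _ _ → *ₗ-assoc _ _ _
            ; *ₗ-zeroʳ = λ _ → *ₗ-zeroʳ _
            ; *ₗ-distribˡ = λ _ _ _ → *ₗ-distribˡ _ _ _
            }
          }
        ; -ᴹ‿cong = -ᴹ‿cong
        ; -ᴹ‿inverse = (λ _ → -ᴹ‿inverseˡ _) , (λ _ → -ᴹ‿inverseʳ _)
        }
      }

    spanning : I → LeftModule.Carrierᴹ span
    spanning a = f a , member a

IsLinear : ∀ {r ℓr m₁ ℓm₁ m₂ ℓm₂} {R : Ring r ℓr}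
           (M : LeftModule R m₁ ℓm₁) (N : LeftModule R m₂ ℓm₂) →
           (LeftModule.Carrierᴹ M → LeftModule.Carrierᴹ N) → Set (r ⊔ m₁ ⊔ ℓm₁ ⊔ ℓm₂)
IsLinear M N = LeftModuleMorphisms.IsLeftModuleHomomorphism
  (LeftModule.rawLeftModule M) (LeftModule.rawLeftModule N)

-- Coefficients must respect equality of permutations, which is pointwise.

record IsBasis {r ℓr m ℓm n} {R : Ring r ℓr} (M : LeftModule R m ℓm)
               (f : Permutation′ n → LeftModule.Carrierᴹ M) : Set (r ⊔ ℓr ⊔ m ⊔ ℓm) where
  open Ring R using (Carrier; _≈_; 0#)
  open LeftModule M

  Extensional : (Permutation′ n → Carrier) → Set ℓr
  Extensional c = ∀ {v w} → v Perm.≈ w → c v ≈ c w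

  combination : (Permutation′ n → Carrier) → Carrierᴹ
  combination c = sumᴹ M (map (λ w → c w *ₗ f w) (permutations n))

  field
    f-cong      : ∀ {v w} → v Perm.≈ w → f v ≈ᴹ f w
    spans       : ∀ u → ∃[ c ] Extensional c × u ≈ᴹ combination c
    independent : ∀ c → Extensional c → combination c ≈ᴹ 0ᴹ → ∀ w → c w ≈ 0#

-- In a Heyting field, x # y is the positive form of x ≠ y (classically the
-- two coincide, since # is tight).

fieldRing : ∀ {c ℓ₁ ℓ₂} → HeytingField c ℓ₁ ℓ₂ → Ring c ℓ₁
fieldRing F = CommutativeRing.ring
  (HeytingCommutativeRing.commutativeRing (HeytingField.heytingCommutativeRing F))

record SchubertRepresentation {c ℓ₁ ℓ₂} (F : HeytingField c ℓ₁ ℓ₂) (n : ℕ)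
         (t : Fin n → HeytingField.Carrier F) (m ℓm : Level) : Set (c ⊔ ℓ₁ ⊔ ℓ₂ ⊔ lsuc (m ⊔ ℓm)) where
  open HeytingField F using (Carrier; _≈_; _#_; _+_; _*_; -_; 0#)

  field
    φ     : CommutativeRing.Carrier ℚ[p,q,ħ] → Carrier
    φ-hom : RingMorphisms.IsRingHomomorphism
              (CommutativeRing.rawRing ℚ[p,q,ħ]) (Ring.rawRing (fieldRing F)) φ
    V     : LeftModule (fieldRing F) m ℓm

  open LeftModule V public

  infixr 7 _▷_

  field
    _▷_          : Ring.Carrier (Ĥ n) → Carrierᴹ → Carrierᴹ
    ▷-isModule   : ModuleStructures.IsLeftModule (Ĥ n) _≈ᴹ_ _+ᴹ_ 0ᴹ -ᴹ_ _▷_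
    ▷-linear     : ∀ h a v → h ▷ (a *ₗ v) ≈ᴹ a *ₗ (h ▷ v)
    ▷-scalar     : ∀ a v → scalar a ▷ v ≈ᴹ φ a *ₗ v

    -- T_w is the product of the T's along a reduced word of w and does not
    -- depend on the word, so 𝒴-T is imposed for every reduced word.
    𝒴            : Permutation′ n → Carrierᴹ
    𝒴-isBasis    : IsBasis V 𝒴
    𝒴-T          : ∀ w u → IsReducedWord u (w ⁻¹ · w₀) → 𝒴 w ≈ᴹ T-word u ▷ 𝒴 w₀

    ev           : Carrierᴹ → Carrier
    ev-isLinear  : IsLinear V TensorUnit.leftModule ev
    ev-nonzero   : ∀ w → (ev (𝒴 w) # 0#) ⇔ (w Perm.≈ Perm.id)
    ev-x         : ∀ i w → ev (𝕩 i ▷ 𝒴 w) ≈ t i * ev (𝒴 w)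

  open Exp (Ring.semiring (fieldRing F)) public using (_^_)

  p̂ q̂ ħ̂ : Carrier
  p̂ = φ (indeterminate p)
  q̂ = φ (indeterminate q)
  ħ̂ = φ (indeterminate ħ)

  module Grassmannian {k : ℕ} (k≤n : k ≤ n) where

    open Box k≤n public

    𝒴[_] : Partition k (n ∸ k) → Carrierᴹ
    𝒴[ ν ] = sumᴹ V (map (λ v → (p̂ ^ ℓ v) *ₗ 𝒴 (w[ ν ] · v)) (young n k))

    Y-span : LeftModule (fieldRing F) (c ⊔ m ⊔ ℓm) ℓm
    Y-span = span V 𝒴[_]

    ⟦_⟧ : Partition k (n ∸ k) → LeftModule.Carrierᴹ Y-span
    ⟦_⟧ = spanning V 𝒴[_]

    -- For a ribbon μ/ν with head in row i, h(μ/ν) = μᵢ+k+1−i.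

    ribbonCoefficient : (i : Fin k) (μ ν : Partition k (n ∸ k)) → Carrier
    ribbonCoefficient i μ ν =
      (ħ̂ + - ((p̂ + - q̂) * t (shifted μ i))) * p̂ ^ (ht ∸ 1) * q̂ ^ (wd ∸ 1)
      where open Skew μ ν using (ht; wd)

    IsRibbonOperator : Fin k → (LeftModule.Carrierᴹ Y-span → LeftModule.Carrierᴹ Y-span) →
                       Set (c ⊔ m ⊔ ℓm)
    IsRibbonOperator i R = IsLinear Y-span Y-span R × (∀ ν → R ⟦ ν ⟧ ≈ˢ formula ν)
      where
      open LeftModule Y-span using () renaming (_≈ᴹ_ to _≈ˢ_; _+ᴹ_ to _+ˢ_; _*ₗ_ to _*ˢ_)
      formula : Partition k (n ∸ k) → LeftModule.Carrierᴹ Y-span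
      formula ν = (t (shifted ν i) *ˢ ⟦ ν ⟧) +ˢ
        sumᴹ Y-span (map (λ μ → ribbonCoefficient i μ ν *ˢ ⟦ μ ⟧)
          (filter (λ μ → Skew.ribbonWithHeadInRow? μ ν i) (partitions k (n ∸ k))))

    -- Σ R_{i_r} ⋯ R_{i_1} v over i₁ < ⋯ < i_r, with R_{i_1} applied first

    sumOfCompositions : (Fin k → LeftModule.Carrierᴹ Y-span → LeftModule.Carrierᴹ Y-span) →
                        ℕ → LeftModule.Carrierᴹ Y-span → LeftModule.Carrierᴹ Y-span
    sumOfCompositions R r v =
      sumᴹ Y-span (map (foldl (λ u i → R i u) v) (choose r (allFin k)))

{-# OPTIONS --safe #-}
-- Put T̄_i = T_i + p − q.  For a reduced word u of w the functional ev ∘ T̄_u is,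
-- up to the scalar ev(𝒴_id), the coefficient of 𝒴_w; on vectors v with
-- T̄_j v = p v for all j ≠ k, such as 𝒴_λ, the Grassmannian w = w_μ suffice.
-- Encode μ by a string of k beads and n − k gaps.  Then
--   T̄_{w_μ} ∏_{j≤k} (1 + z x_j) v = Σ_λ M_{μλ}(x) T̄_{w_λ} v,
-- where M is the transfer matrix of a vertex model whose horizontal line carries
-- a boson: this is clear for w_μ = id, and the T̄_i transport it from string to
-- string by a Yang–Baxter relation.  Under ev each x_j becomes t_j.
-- In ∏ (1 + z R_i) the operator R_i moves a bead upwards to make it the i-th from
-- the top, with a factor p for each bead and q for each gap that it passes.
-- Scanning the sites from the top and counting the beads that have been placed
-- but not yet taken away below yields the same M(t).

module Submission where

open import Defs
open import Level using (_⊔_)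
open import Algebra.Bundles using (CommutativeMonoid; Ring; CommutativeRing)
import Algebra.Properties.CommutativeSemigroup as CommutativeSemigroupProperties
import Algebra.Properties.Group as GroupProperties
open import Algebra.Module.Bundles using (LeftModule)
import Algebra.Module.Structures as ModuleStructures
import Algebra.Module.Construct.TensorUnit as TensorUnit
open import Algebra.Apartness.Bundles using (HeytingField; HeytingCommutativeRing)
open import Algebra.Module.Morphism.Structures using (module LeftModuleMorphisms)
open import Data.Bool.Base using (Bool; true; false)
open import Data.Empty using (⊥-elim)
open import Data.Fin.Base using (Fin; zero; suc; toℕ; fromℕ; fromℕ<; inject₁; inject≤; opposite; punchIn)
open import Data.List.Base using (List; []; _∷_; length; _++_; replicate; map; filter; foldl; foldr; concatMap; allFin; tabulate; cartesianProduct)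
open import Data.Nat.Base as ℕ using (ℕ; zero; suc; _∸_; ∣_-_∣; _≤_; _<_; s≤s; z≤n)
open import Data.Product.Base using (∃-syntax; _×_; _,_; proj₁; proj₂)
open import Data.Sum.Base using (_⊎_; inj₁; inj₂)
open import Data.List.Relation.Unary.All using (All; []; _∷_)
open import Relation.Nullary using (¬_; Dec; yes; no)
open import Relation.Binary.Definitions using (tri<; tri≈; tri>)
open import Relation.Binary.Construct.Closure.ReflexiveTransitive using (Star; ε; _◅_; _◅◅_; gmap; reverse)
open import Data.Unit.Polymorphic.Base using (⊤; tt)
open import Data.Vec.Base as Vec using (Vec; []; _∷_)
open import Relation.Binary.PropositionalEquality as ≡ using (_≡_; _≢_; refl)
import Algebra.Solver.Ring.NaturalCoefficients.Default as NaturalSolver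
import Algebra.Properties.Semiring.Exp as Exp
import Data.Nat.Properties as ℕₚ
import Data.List.Properties as Listₚ
open import Data.Fin.Permutation as Perm using (Permutation′; _⟨$⟩ʳ_; _⟨$⟩ˡ_; inverseˡ; inverseʳ; transpose)
open import Data.List.Membership.Propositional using (_∈_)
open import Data.List.Membership.Propositional.Properties using (∈-allFin; ∈-cartesianProduct⁺; ∈-map⁺)
open import Data.List.Membership.Propositional.Properties.WithK using (unique∧set⇒bag)
open import Data.List.Relation.Binary.BagAndSetEquality using (∼bag⇒↭)
open import Data.List.Relation.Binary.Permutation.Propositional.Properties using (filter-↭; ↭-length)
open import Data.List.Relation.Unary.Any using (here; there)
open import Data.List.Relation.Unary.Unique.Propositional using (Unique)
import Data.List.Relation.Unary.All as All
import Data.List.Relation.Unary.AllPairs as AllPairs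
import Data.List.Relation.Unary.Unique.Propositional.Properties as Uniqueₚ
open import Function.Bundles using (mk⇔; module Equivalence)
open import Relation.Nullary.Decidable using (_×-dec_; map′)
import Data.Fin.Properties as Finₚ
import Relation.Binary.Reasoning.Setoid as SetoidReasoning

-- As p or q may vanish in the field, T_i need not be invertible; T̄_i stands in for pq T_i⁻¹. It
-- sends 𝒴_w to 𝒴_{ws_i} + (p - q)𝒴_w at a descent of w and to pq 𝒴_{ws_i} at an ascent, so that
-- along a reduced word only coefficients 1 build the functional, whatever p and q are.
--
-- Why the w_μ suffice: for such v the vectors T̄_{w_μ} v span a space stable under every T̄_i,
-- which raises a bead, lowers it or multiplies by p. A functional that vanishes on them vanishes on
-- all words applied to v.
--
-- Why a boson: above a given site the output can have d more beads than the input. In the ribbon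
-- picture these are d removals still to act below. If one of them takes the bead at a site, those
-- before it pass a bead and those after it a gap, which gives the weight Σ pᵃqᵇ over a + b = d - 1.
-- The weight ħ - (p - q)t of a ribbon head is the correction that T̄_i leaves behind when it passes
-- x_i. The variable z is realised as the shift on sequences, so all r are treated at once.

-- Linear maps, power series and a solver for linear combinations

module LinearAlgebra {c ℓc} (K : CommutativeRing c ℓc) where

  open CommutativeRing K hiding (zero) renaming (refl to ≈-refl)

  Module : ∀ m ℓm → Set _
  Module = LeftModule ring

  interchange : ∀ {m ℓm} (M : Module m ℓm) → let open LeftModule M in
                ∀ u v w y → (u +ᴹ v) +ᴹ (w +ᴹ y) ≈ᴹ (u +ᴹ w) +ᴹ (v +ᴹ y)
  interchange M = CommutativeSemigroupProperties.interchange (CommutativeMonoid.commutativeSemigroup (LeftModule.+ᴹ-commutativeMonoid M))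

  record Linear {m₁ ℓm₁ m₂ ℓm₂} (M : Module m₁ ℓm₁) (N : Module m₂ ℓm₂)
                (f : LeftModule.Carrierᴹ M → LeftModule.Carrierᴹ N) : Set (c ⊔ m₁ ⊔ ℓm₁ ⊔ ℓm₂) where
    private
      module M = LeftModule M
      module N = LeftModule N
    field
      f-cong : ∀ {u v} → u M.≈ᴹ v → f u N.≈ᴹ f v
      f-+    : ∀ u v → f (u M.+ᴹ v) N.≈ᴹ f u N.+ᴹ f v
      f-*    : ∀ a v → f (a M.*ₗ v) N.≈ᴹ a N.*ₗ f v

    f-0 : f M.0ᴹ N.≈ᴹ N.0ᴹ
    f-0 = N.≈ᴹ-trans (f-cong (M.≈ᴹ-sym (M.*ₗ-zeroˡ M.0ᴹ))) (N.≈ᴹ-trans (f-* 0# M.0ᴹ) (N.*ₗ-zeroˡ _))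

  module _ {m ℓm} (M : Module m ℓm) where

    open LeftModule M

    -- Formal power series with coefficients in M, with multiplication by
    -- the variable as an operator.

    series : Module m ℓm
    series = record
      { Carrierᴹ = ℕ → Carrierᴹ
      ; _≈ᴹ_ = λ u v → ∀ r → u r ≈ᴹ v r
      ; _+ᴹ_ = λ u v r → u r +ᴹ v r
      ; _*ₗ_ = λ a u r → a *ₗ u r
      ; 0ᴹ = λ _ → 0ᴹ
      ; -ᴹ_ = λ u r → -ᴹ u r
      ; isLeftModule = record
        { isLeftSemimodule = record
          { +ᴹ-isCommutativeMonoid = record
            { isMonoid = record
              { isSemigroup = record
                { isMagma = record
                  { isEquivalence = record { refl = λ _ → ≈ᴹ-refl ; sym = λ e r → ≈ᴹ-sym (e r)
                                           ; trans = λ e f r → ≈ᴹ-trans (e r) (f r) }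
                  ; ∙-cong = λ e f r → +ᴹ-cong (e r) (f r)
                  }
                ; assoc = λ _ _ _ _ → +ᴹ-assoc _ _ _
                }
              ; identity = (λ _ _ → +ᴹ-identityˡ _) , (λ _ _ → +ᴹ-identityʳ _)
              }
            ; comm = λ _ _ _ → +ᴹ-comm _ _
            }
          ; isPreleftSemimodule = record
            { *ₗ-cong = λ e f r → *ₗ-cong e (f r)
            ; *ₗ-zeroˡ = λ _ _ → *ₗ-zeroˡ _
            ; *ₗ-distribʳ = λ _ _ _ _ → *ₗ-distribʳ _ _ _
            ; *ₗ-identityˡ = λ _ _ → *ₗ-identityˡ _
            ; *ₗ-assoc = λ _ _ _ _ → *ₗ-assoc _ _ _
            ; *ₗ-zeroʳ = λ _ _ → *ₗ-zeroʳ _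
            ; *ₗ-distribˡ = λ _ _ _ _ → *ₗ-distribˡ _ _ _
            }
          }
        ; -ᴹ‿cong = λ e r → -ᴹ‿cong (e r)
        ; -ᴹ‿inverse = (λ _ _ → -ᴹ‿inverseˡ _) , (λ _ _ → -ᴹ‿inverseʳ _)
        }
      }

    shift : (ℕ → Carrierᴹ) → ℕ → Carrierᴹ
    shift u zero    = 0ᴹ
    shift u (suc r) = u r

    constant : Carrierᴹ → ℕ → Carrierᴹ
    constant v zero    = v
    constant v (suc r) = 0ᴹ

    shift-linear : Linear series series shift
    shift-linear = record
      { f-cong = λ { e zero → ≈ᴹ-refl ; e (suc r) → e r }
      ; f-+ = λ { u v zero → ≈ᴹ-sym (+ᴹ-identityˡ _) ; u v (suc r) → ≈ᴹ-refl }
      ; f-* = λ { a v zero → ≈ᴹ-sym (*ₗ-zeroʳ _) ; a v (suc r) → ≈ᴹ-refl }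
      }

    constant-linear : Linear M series constant
    constant-linear = record
      { f-cong = λ { e zero → e ; e (suc r) → ≈ᴹ-refl }
      ; f-+ = λ { u v zero → ≈ᴹ-refl ; u v (suc r) → ≈ᴹ-sym (+ᴹ-identityˡ _) }
      ; f-* = λ { a v zero → ≈ᴹ-refl ; a v (suc r) → ≈ᴹ-sym (*ₗ-zeroʳ _) }
      }

  module _ {m₁ ℓm₁ m₂ ℓm₂} {M : Module m₁ ℓm₁} {N : Module m₂ ℓm₂}
           {f : LeftModule.Carrierᴹ M → LeftModule.Carrierᴹ N} (F : Linear M N f) where

    private module N = LeftModule N
    open Linear F

    series-linear : Linear (series M) (series N) (λ u r → f (u r))
    series-linear = record { f-cong = λ e r → f-cong (e r) ; f-+ = λ _ _ _ → f-+ _ _ ; f-* = λ _ _ _ → f-* _ _ }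

    series-shift : ∀ u r → f (shift M u r) N.≈ᴹ shift N (λ s → f (u s)) r
    series-shift u zero    = f-0
    series-shift u (suc r) = N.≈ᴹ-refl

    series-constant : ∀ v r → f (constant M v r) N.≈ᴹ constant N (f v) r
    series-constant v zero    = N.≈ᴹ-refl
    series-constant v (suc r) = f-0

  open NaturalSolver commutativeSemiring public
    using (Polynomial; con; _:+_; _:*_)
    renaming (var to scalarVar; ⟦_⟧ to ⟦_⟧ˢ; ⟦_⟧↓ to ⟦_⟧ˢ↓; prove to proveˢ)

  -- An identity of vectors is reduced to one polynomial identity for the coefficient of each vector
  -- variable. The polynomials have natural coefficients, so identities are arranged without
  -- subtraction; this is why q - p enters as an atom `N`.
  module ModuleSolver {m ℓm} (M : Module m ℓm) where

    open LeftModule M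

    infixl 6 _⊞_
    infixr 7 _⊡_

    data Combination (k n : ℕ) : Set where
      var : Fin n → Combination k n
      _⊞_ : Combination k n → Combination k n → Combination k n
      _⊡_ : Polynomial k → Combination k n → Combination k n
      nil : Combination k n

    module _ {k n} (ρ : Vec Carrier k) (σ : Vec Carrierᴹ n) where

      ⟦_⟧ᶜ : Combination k n → Carrierᴹ
      ⟦ var i ⟧ᶜ = Vec.lookup σ i
      ⟦ e ⊞ f ⟧ᶜ = ⟦ e ⟧ᶜ +ᴹ ⟦ f ⟧ᶜ
      ⟦ a ⊡ e ⟧ᶜ = ⟦ a ⟧ˢ ρ *ₗ ⟦ e ⟧ᶜ
      ⟦ nil ⟧ᶜ   = 0ᴹ

    unit : ∀ {k n} → Fin n → Fin n → Polynomial k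
    unit zero    zero    = con 1
    unit zero    (suc j) = con 0
    unit (suc i) zero    = con 0
    unit (suc i) (suc j) = unit i j

    coefficient : ∀ {k n} → Combination k n → Fin n → Polynomial k
    coefficient (var i) j = unit i j
    coefficient (e ⊞ f) j = coefficient e j :+ coefficient f j
    coefficient (a ⊡ e) j = a :* coefficient e j
    coefficient nil     j = con 0

    expand : ∀ {n} → (Fin n → Carrier) → Vec Carrierᴹ n → Carrierᴹ
    expand a []      = 0ᴹ
    expand a (v ∷ σ) = a zero *ₗ v +ᴹ expand (λ j → a (suc j)) σ

    expand-cong : ∀ {n} {a b : Fin n → Carrier} (σ : Vec Carrierᴹ n) → (∀ j → a j ≈ b j) →
                  expand a σ ≈ᴹ expand b σ
    expand-cong []      e = ≈ᴹ-refl
    expand-cong (v ∷ σ) e = +ᴹ-cong (*ₗ-congʳ (e zero)) (expand-cong σ (λ j → e (suc j)))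

    expand-+ : ∀ {n} (a b : Fin n → Carrier) (σ : Vec Carrierᴹ n) →
               expand a σ +ᴹ expand b σ ≈ᴹ expand (λ j → a j + b j) σ
    expand-+ a b []      = +ᴹ-identityˡ _
    expand-+ a b (v ∷ σ) = ≈ᴹ-trans (interchange M _ _ _ _)
      (+ᴹ-cong (≈ᴹ-sym (*ₗ-distribʳ _ _ _)) (expand-+ _ _ σ))

    expand-* : ∀ {n} s (a : Fin n → Carrier) (σ : Vec Carrierᴹ n) →
               s *ₗ expand a σ ≈ᴹ expand (λ j → s * a j) σ
    expand-* s a []      = *ₗ-zeroʳ s
    expand-* s a (v ∷ σ) = ≈ᴹ-trans (*ₗ-distribˡ _ _ _) (+ᴹ-cong (≈ᴹ-sym (*ₗ-assoc _ _ _)) (expand-* s _ σ))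

    private
      module _ {k} (ρ : Vec Carrier k) where

        expand-0 : ∀ {n} (σ : Vec Carrierᴹ n) → 0ᴹ ≈ᴹ expand (λ j → ⟦ con {k} 0 ⟧ˢ ρ) σ
        expand-0 []      = ≈ᴹ-refl
        expand-0 (v ∷ σ) = ≈ᴹ-trans (≈ᴹ-sym (+ᴹ-identityˡ _)) (+ᴹ-cong (≈ᴹ-sym (*ₗ-zeroˡ _)) (expand-0 σ))

        expand-unit : ∀ {n} i (σ : Vec Carrierᴹ n) → Vec.lookup σ i ≈ᴹ expand (λ j → ⟦ unit {k} i j ⟧ˢ ρ) σ
        expand-unit zero    (v ∷ σ) = ≈ᴹ-trans (≈ᴹ-sym (+ᴹ-identityʳ _))
          (+ᴹ-cong (≈ᴹ-sym (*ₗ-identityˡ v)) (expand-0 σ))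
        expand-unit (suc i) (v ∷ σ) = ≈ᴹ-trans (≈ᴹ-sym (+ᴹ-identityˡ _))
          (+ᴹ-cong (≈ᴹ-sym (*ₗ-zeroˡ _)) (expand-unit i σ))

      correct : ∀ {k n} (ρ : Vec Carrier k) (σ : Vec Carrierᴹ n) e →
                ⟦_⟧ᶜ ρ σ e ≈ᴹ expand (λ j → ⟦ coefficient e j ⟧ˢ ρ) σ
      correct ρ σ (var i) = expand-unit ρ i σ
      correct ρ σ (e ⊞ f) = ≈ᴹ-trans (+ᴹ-cong (correct ρ σ e) (correct ρ σ f)) (expand-+ _ _ σ)
      correct ρ σ (a ⊡ e) = ≈ᴹ-trans (*ₗ-congˡ (correct ρ σ e)) (expand-* _ _ σ)
      correct ρ σ nil     = expand-0 ρ σ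

    Coefficientwise : ∀ {k n} → Vec Carrier k → (a b : Fin n → Polynomial k) → Set ℓc
    Coefficientwise {n = zero}  ρ a b = ⊤
    Coefficientwise {n = suc n} ρ a b =
      (⟦ a zero ⟧ˢ↓ ρ ≈ ⟦ b zero ⟧ˢ↓ ρ) × Coefficientwise ρ (λ j → a (suc j)) (λ j → b (suc j))

    private
      pointwise : ∀ {k n} (ρ : Vec Carrier k) (a b : Fin n → Polynomial k) → Coefficientwise ρ a b →
                  ∀ j → ⟦ a j ⟧ˢ ρ ≈ ⟦ b j ⟧ˢ ρ
      pointwise ρ a b (e , _)  zero    = proveˢ ρ (a zero) (b zero) e
      pointwise ρ a b (_ , es) (suc j) = pointwise ρ (λ j → a (suc j)) (λ j → b (suc j)) es j

    module _ {k n} (ρ : Vec Carrier k) (σ : Vec Carrierᴹ n)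
             (eqn : Vec (Polynomial k) k → Vec (Combination k n) n → Combination k n × Combination k n) where

      private
        lhs rhs : Combination k n
        lhs = let (l , _) = eqn (Vec.tabulate scalarVar) (Vec.tabulate var) in l
        rhs = let (_ , r) = eqn (Vec.tabulate scalarVar) (Vec.tabulate var) in r

      solve : Coefficientwise ρ (coefficient lhs) (coefficient rhs) → ⟦_⟧ᶜ ρ σ lhs ≈ᴹ ⟦_⟧ᶜ ρ σ rhs
      solve es = ≈ᴹ-trans (correct ρ σ lhs)
        (≈ᴹ-trans (expand-cong σ (pointwise ρ (coefficient lhs) (coefficient rhs) es)) (≈ᴹ-sym (correct ρ σ rhs)))

  module _ {m₁ ℓm₁ m₂ ℓm₂} {M : Module m₁ ℓm₁} {N : Module m₂ ℓm₂} where

    private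
      module M = LeftModule M
      module N = LeftModule N
    open Linear
    open ModuleSolver N

    +-linear : ∀ {f g} → Linear M N f → Linear M N g → Linear M N (λ v → f v N.+ᴹ g v)
    +-linear F G = record
      { f-cong = λ e → N.+ᴹ-cong (f-cong F e) (f-cong G e)
      ; f-+ = λ u v → N.≈ᴹ-trans (N.+ᴹ-cong (f-+ F u v) (f-+ G u v))
          (interchange N _ _ _ _)
      ; f-* = λ a v → N.≈ᴹ-trans (N.+ᴹ-cong (f-* F a v) (f-* G a v)) (N.≈ᴹ-sym (N.*ₗ-distribˡ _ _ _))
      }

    *-linear : ∀ s {f} → Linear M N f → Linear M N (λ v → s N.*ₗ f v)
    *-linear s F = record
      { f-cong = λ e → N.*ₗ-congˡ (f-cong F e)
      ; f-+ = λ u v → N.≈ᴹ-trans (N.*ₗ-congˡ (f-+ F u v)) (N.*ₗ-distribˡ _ _ _)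
      ; f-* = λ a v → N.≈ᴹ-trans (N.*ₗ-congˡ (f-* F a v))
          (solve (s ∷ a ∷ []) (_ ∷ []) (λ { (s ∷ a ∷ []) (v ∷ []) → s ⊡ a ⊡ v , a ⊡ s ⊡ v }) (≈-refl , tt))
      }

  id-linear : ∀ {m ℓm} {M : Module m ℓm} → Linear M M (λ v → v)
  id-linear {M = M} = record { f-cong = λ e → e ; f-+ = λ _ _ → ≈ᴹ-refl ; f-* = λ _ _ → ≈ᴹ-refl }
    where open LeftModule M

  0-linear : ∀ {m₁ ℓm₁ m₂ ℓm₂} {M : Module m₁ ℓm₁} {N : Module m₂ ℓm₂} → Linear M N (λ _ → LeftModule.0ᴹ N)
  0-linear {N = N} = record
    { f-cong = λ _ → ≈ᴹ-refl ; f-+ = λ _ _ → ≈ᴹ-sym (+ᴹ-identityˡ _) ; f-* = λ _ _ → ≈ᴹ-sym (*ₗ-zeroʳ _) }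
    where open LeftModule N

  ∘-linear : ∀ {m₁ ℓm₁ m₂ ℓm₂ m₃ ℓm₃} {M₁ : Module m₁ ℓm₁} {M₂ : Module m₂ ℓm₂} {M₃ : Module m₃ ℓm₃} {f g} →
             Linear M₂ M₃ g → Linear M₁ M₂ f → Linear M₁ M₃ (λ v → g (f v))
  ∘-linear {M₃ = M₃} G F = record
    { f-cong = λ e → f-cong G (f-cong F e)
    ; f-+ = λ u v → ≈ᴹ-trans (f-cong G (f-+ F u v)) (f-+ G _ _)
    ; f-* = λ a v → ≈ᴹ-trans (f-cong G (f-* F a v)) (f-* G _ _)
    }
    where
    open LeftModule M₃
    open Linear

-- A bit string lists the sites from top to bottom, so that a site is
-- numbered (from 0) by the length of the string below it; true marks a bead.

data Raise : ℕ → List Bool → List Bool → Set where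
  here  : ∀ b → Raise (length b) (false ∷ true ∷ b) (true ∷ false ∷ b)
  there : ∀ {i b b′} β → Raise i b b′ → Raise i (β ∷ b) (β ∷ b′)

data Level₂ : ℕ → List Bool → Set where
  here  : ∀ β b → Level₂ (length b) (β ∷ β ∷ b)
  there : ∀ {i b} β → Level₂ i b → Level₂ i (β ∷ b)

raise-length : ∀ {i b b′} → Raise i b b′ → length b ≡ length b′
raise-length (here b)    = refl
raise-length (there β r) = ≡.cong suc (raise-length r)

raise-bound : ∀ {i b b′} → Raise i b b′ → suc i < length b
raise-bound (here b)    = ℕₚ.≤-refl
raise-bound (there β r) = ℕₚ.m≤n⇒m≤1+n (raise-bound r)

-- The vertex model and its Yang-Baxter relation

module Parameters {c ℓc} (K : CommutativeRing c ℓc) (P Q N H : CommutativeRing.Carrier K) where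

  open CommutativeRing K hiding (zero) renaming (refl to ≈-refl)
  open LinearAlgebra K
  open Exp semiring using (_^_) public

  -- (pᵈ − qᵈ) / (p − q)

  bracket : ℕ → Carrier
  bracket zero    = 0#
  bracket (suc d) = P * bracket d + Q ^ d

  record Operators {m ℓm} (W : Module m ℓm) : Set (c ⊔ m ⊔ ℓm) where
    open LeftModule W
    open Linear
    field
      X        : ℕ → Carrierᴹ → Carrierᴹ
      X-linear : ∀ j → Linear W W (X j)
      Z        : Carrierᴹ → Carrierᴹ
      Z-linear : Linear W W Z

    C : ℕ → Carrierᴹ → Carrierᴹ
    C j v = H *ₗ v +ᴹ N *ₗ X j v

    C-linear : ∀ j → Linear W W (C j)
    C-linear j = +-linear (*-linear H id-linear) (*-linear N (X-linear j))

    -- By `A-split` this is `P ^ d` times `factor j` plus `bracket d` times `Z (C j v)`: either the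
    -- bead stays while the d pending removals pass it, or one of them takes it away and a new bead
    -- is put on its site. The form chosen here is the one for which `𝕋-A-level` is visible.
    A : ℕ → ℕ → Carrierᴹ → Carrierᴹ
    A d j v = (P ^ d) *ₗ v +ᴹ Z ((Q ^ d) *ₗ X j v +ᴹ (H * bracket d) *ₗ v)

    A-linear : ∀ d j → Linear W W (A d j)
    A-linear d j = +-linear (*-linear (P ^ d) id-linear)
      (∘-linear Z-linear (+-linear (*-linear (Q ^ d) (X-linear j)) (*-linear (H * bracket d) id-linear)))

    factor : ℕ → Carrierᴹ → Carrierᴹ
    factor j v = v +ᴹ Z (X j v)

    factor-linear : ∀ j → Linear W W (factor j)
    factor-linear j = +-linear id-linear (∘-linear Z-linear (X-linear j))

    -- The row-to-row transfer matrix of a vertex model, from the input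
    -- string of f to the output string b.  Scanning from the top site, d
    -- counts the beads of the output that have been placed above the current
    -- site but whose partners in the input are still to come.

    M : ℕ → (List Bool → Carrierᴹ) → List Bool → Carrierᴹ
    M d       f (false ∷ b) = (Q ^ d) *ₗ M d (λ a → f (false ∷ a)) b
                                +ᴹ bracket d *ₗ M (ℕ.pred d) (λ a → f (true ∷ a)) b
    M d       f (true ∷ b)  = Z ((Q ^ d) *ₗ C (length b) (M (suc d) (λ a → f (false ∷ a)) b))
                                +ᴹ A d (length b) (M d (λ a → f (true ∷ a)) b)
    M zero    f []          = f []
    M (suc d) f []          = 0ᴹ

    M-cong : ∀ d {f g} b → (∀ a → length a ≡ length b → f a ≈ᴹ g a) → M d f b ≈ᴹ M d g b
    M-cong zero    []          e = e [] refl
    M-cong (suc d) []          e = ≈ᴹ-refl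
    M-cong d       (false ∷ b) e = +ᴹ-cong
      (*ₗ-congˡ (M-cong d b (λ a l → e _ (≡.cong suc l))))
      (*ₗ-congˡ (M-cong (ℕ.pred d) b (λ a l → e _ (≡.cong suc l))))
    M-cong d       (true ∷ b)  e = +ᴹ-cong
      (f-cong Z-linear (*ₗ-congˡ (f-cong (C-linear _) (M-cong (suc d) b (λ a l → e _ (≡.cong suc l))))))
      (f-cong (A-linear d _) (M-cong d b (λ a l → e _ (≡.cong suc l))))

    M-+ : ∀ d f g b → M d (λ a → f a +ᴹ g a) b ≈ᴹ M d f b +ᴹ M d g b
    M-+ zero    f g []          = ≈ᴹ-refl
    M-+ (suc d) f g []          = ≈ᴹ-sym (+ᴹ-identityˡ _)
    M-+ d       f g (false ∷ b) = ≈ᴹ-trans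
      (+ᴹ-cong (step id-linear (Q ^ d) d _ _) (step id-linear (bracket d) (ℕ.pred d) _ _)) (interchange W _ _ _ _)
      where
      step : ∀ {φ} → Linear W W φ → ∀ s d f g → s *ₗ φ (M d (λ a → f a +ᴹ g a) b)
               ≈ᴹ s *ₗ φ (M d f b) +ᴹ s *ₗ φ (M d g b)
      step F s d f g = ≈ᴹ-trans (f-cong (*-linear s F) (M-+ d f g b)) (f-+ (*-linear s F) _ _)
    M-+ d       f g (true ∷ b)  = ≈ᴹ-trans
      (+ᴹ-cong (step (∘-linear Z-linear (*-linear (Q ^ d) (C-linear _))) (suc d) _ _)
               (step (A-linear d _) d _ _)) (interchange W _ _ _ _)
      where
      step : ∀ {φ} → Linear W W φ → ∀ d f g → φ (M d (λ a → f a +ᴹ g a) b) ≈ᴹ φ (M d f b) +ᴹ φ (M d g b)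
      step F d f g = ≈ᴹ-trans (f-cong F (M-+ d f g b)) (f-+ F _ _)

  module _ {m₁ ℓm₁ m₂ ℓm₂} {W₁ : Module m₁ ℓm₁} {W₂ : Module m₂ ℓm₂}
           (S₁ : Operators W₁) (S₂ : Operators W₂) {φ} (Φ : Linear W₁ W₂ φ)
           (φ-Z : ∀ v → LeftModule._≈ᴹ_ W₂ (φ (Operators.Z S₁ v)) (Operators.Z S₂ (φ v))) where

    private
      module S₁ = Operators S₁
      module S₂ = Operators S₂
    open LeftModule W₂
    open Linear

    private
      φ-lin₂ : ∀ a b u v → φ (LeftModule._+ᴹ_ W₁ (LeftModule._*ₗ_ W₁ a u) (LeftModule._*ₗ_ W₁ b v))
                 ≈ᴹ a *ₗ φ u +ᴹ b *ₗ φ v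
      φ-lin₂ a b u v = ≈ᴹ-trans (f-+ Φ _ _) (+ᴹ-cong (f-* Φ _ _) (f-* Φ _ _))

    module _ {j} (φ-X : ∀ v → φ (Operators.X S₁ j v) ≈ᴹ Operators.X S₂ j (φ v)) where

      C-hom : ∀ v → φ (S₁.C j v) ≈ᴹ S₂.C j (φ v)
      C-hom v = ≈ᴹ-trans (φ-lin₂ _ _ _ _) (+ᴹ-congˡ (*ₗ-congˡ (φ-X v)))

      A-hom : ∀ d v → φ (S₁.A d j v) ≈ᴹ S₂.A d j (φ v)
      A-hom d v = ≈ᴹ-trans (f-+ Φ _ _) (+ᴹ-cong (f-* Φ _ _)
        (≈ᴹ-trans (φ-Z _) (f-cong S₂.Z-linear (≈ᴹ-trans (φ-lin₂ _ _ _ _) (+ᴹ-congʳ (*ₗ-congˡ (φ-X v)))))))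

    -- `M` at a string is built from `Z`, scalars and the `X j` with j below the length of the
    -- string. The bound on j is what lets `𝕋 i` pass once its sites lie above the string.
    M-hom : ∀ d f b → (∀ j → j < length b → ∀ v → φ (Operators.X S₁ j v) ≈ᴹ Operators.X S₂ j (φ v)) →
            φ (S₁.M d f b) ≈ᴹ S₂.M d (λ a → φ (f a)) b
    M-hom zero    f []          φ-X = ≈ᴹ-refl
    M-hom (suc d) f []          φ-X = f-0 Φ
    M-hom d       f (false ∷ b) φ-X = ≈ᴹ-trans (φ-lin₂ _ _ _ _)
      (+ᴹ-cong (*ₗ-congˡ (M-hom d _ b (λ j l → φ-X j (ℕₚ.m≤n⇒m≤1+n l))))
               (*ₗ-congˡ (M-hom (ℕ.pred d) _ b (λ j l → φ-X j (ℕₚ.m≤n⇒m≤1+n l)))))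
    M-hom d       f (true ∷ b)  φ-X = ≈ᴹ-trans (f-+ Φ _ _) (+ᴹ-cong
      (≈ᴹ-trans (φ-Z _) (f-cong S₂.Z-linear (≈ᴹ-trans (f-* Φ _ _) (*ₗ-congˡ
        (≈ᴹ-trans (C-hom (φ-X _ ℕₚ.≤-refl) _) (f-cong (S₂.C-linear _) (M-hom (suc d) _ b (λ j l → φ-X j (ℕₚ.m≤n⇒m≤1+n l)))))))))
      (≈ᴹ-trans (A-hom (φ-X _ ℕₚ.≤-refl) d _) (f-cong (S₂.A-linear d _) (M-hom d _ b (λ j l → φ-X j (ℕₚ.m≤n⇒m≤1+n l))))))

  -- 𝕋 i is T_{i+1} + p − q, and N is q − p.

  record HeckeAction {m ℓm} {W : Module m ℓm} (S : Operators W) (n : ℕ) : Set (c ⊔ ℓc ⊔ m ⊔ ℓm) where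
    open LeftModule W
    open Operators S
    field
      P+N≈Q     : P + N ≈ Q
      𝕋         : ℕ → Carrierᴹ → Carrierᴹ
      𝕋-linear  : ∀ i → Linear W W (𝕋 i)
      𝕋-Z       : ∀ i v → 𝕋 i (Z v) ≈ᴹ Z (𝕋 i v)
      X-Z       : ∀ j v → X j (Z v) ≈ᴹ Z (X j v)
      X-X       : ∀ i j v → X i (X j v) ≈ᴹ X j (X i v)
      quadratic′ : ∀ i v → suc i < n → 𝕋 i (𝕋 i v) +ᴹ N *ₗ 𝕋 i v ≈ᴹ (P * Q) *ₗ v
      braid′    : ∀ i v → suc (suc i) < n → 𝕋 i (𝕋 (suc i) (𝕋 i v)) ≈ᴹ 𝕋 (suc i) (𝕋 i (𝕋 (suc i) v))
      far′      : ∀ i j v → suc i < j → suc j < n → 𝕋 i (𝕋 j v) ≈ᴹ 𝕋 j (𝕋 i v)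
      𝕋-X       : ∀ i v → suc i < n → 𝕋 i (X i v) ≈ᴹ X (suc i) (𝕋 i v) +ᴹ C (suc i) v
      𝕋-X⁺      : ∀ i v → suc i < n → 𝕋 i (X (suc i) v) +ᴹ C (suc i) v ≈ᴹ X i (𝕋 i v)
      𝕋-X-other : ∀ i j v → suc i < n → j < n → j ≢ i → j ≢ suc i → 𝕋 i (X j v) ≈ᴹ X j (𝕋 i v)

  module Action {m ℓm} {W : Module m ℓm} {S : Operators W} {n : ℕ} (𝓗 : HeckeAction S n) where
    open LeftModule W
    open Operators S
    open HeckeAction 𝓗
    open Linear
    open ModuleSolver W
    open SetoidReasoning ≈ᴹ-setoid

    -- These are the relations satisfied by the vectors T̄_{w_μ} v for symmetric v. With `lower`,
    -- which follows from the quadratic relation, they make the span of the values stable under each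
    -- `𝕋 i` between two sites of the string.
    record Equivariant (l : ℕ) (f : List Bool → Carrierᴹ) : Set (c ⊔ m ⊔ ℓm) where
      field
        raise : ∀ {i b b′} → length b ≡ l → Raise i b b′ → 𝕋 i (f b) ≈ᴹ f b′
        level : ∀ {i b} → length b ≡ l → Level₂ i b → 𝕋 i (f b) ≈ᴹ P *ₗ f b

      lower : l ≤ n → ∀ {i b b′} → length b ≡ l → Raise i b b′ → 𝕋 i (f b′) +ᴹ N *ₗ f b′ ≈ᴹ (P * Q) *ₗ f b
      lower l≤n e r = ≈ᴹ-trans
        (+ᴹ-cong (f-cong (𝕋-linear _) (≈ᴹ-sym (raise e r))) (*ₗ-congˡ (≈ᴹ-sym (raise e r))))
        (quadratic′ _ _ (ℕₚ.≤-trans (≡.subst (_ <_) e (raise-bound r)) l≤n))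

    open Equivariant

    tail-equivariant : ∀ {l f} β → Equivariant (suc l) f → Equivariant l (λ b → f (β ∷ b))
    tail-equivariant β E = record
      { raise = λ e r → raise E (≡.cong suc e) (there β r)
      ; level = λ e s → level E (≡.cong suc e) (there β s)
      }

    -- `𝕋 i` plus `N` is the Hecke generator itself, with eigenvalue `Q` where `𝕋 i` has `P`. The
    -- relation says that T̄ C_i = C_{i+1} T: the added `N` absorbs the correction produced by
    -- `𝕋-X`.
    𝕋-C : ∀ i v → suc i < n → 𝕋 i (C i v) ≈ᴹ C (suc i) (𝕋 i v +ᴹ N *ₗ v)
    𝕋-C i v i<n = begin
      𝕋 i (H *ₗ v +ᴹ N *ₗ X i v)
        ≈⟨ ≈ᴹ-trans (f-+ (𝕋-linear i) _ _) (+ᴹ-cong (f-* (𝕋-linear i) _ _) (f-* (𝕋-linear i) _ _)) ⟩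
      H *ₗ 𝕋 i v +ᴹ N *ₗ 𝕋 i (X i v)
        ≈⟨ +ᴹ-congˡ (*ₗ-congˡ (𝕋-X i v i<n)) ⟩
      H *ₗ 𝕋 i v +ᴹ N *ₗ (X (suc i) (𝕋 i v) +ᴹ C (suc i) v)
        ≈⟨ solve (H ∷ N ∷ []) (𝕋 i v ∷ X (suc i) (𝕋 i v) ∷ C (suc i) v ∷ [])
             (λ { (H ∷ N ∷ []) (a ∷ b ∷ c ∷ []) → H ⊡ a ⊞ N ⊡ (b ⊞ c) , (H ⊡ a ⊞ N ⊡ b) ⊞ N ⊡ c })
             (≈-refl , ≈-refl , ≈-refl , tt) ⟩
      C (suc i) (𝕋 i v) +ᴹ N *ₗ C (suc i) v
        ≈⟨ ≈ᴹ-sym (≈ᴹ-trans (f-+ (C-linear _) _ _) (+ᴹ-congˡ (f-* (C-linear _) _ _))) ⟩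
      C (suc i) (𝕋 i v +ᴹ N *ₗ v) ∎

    -- The Yang–Baxter (RLL) relation for two adjacent sites.

    module _ {i} (i<n : suc i < n) where

      private
        D : Carrierᴹ → Carrierᴹ
        D v = Z (C (suc i) v)

        D-linear : Linear W W D
        D-linear = ∘-linear Z-linear (C-linear _)

        D-* : ∀ s v → Z (s *ₗ C (suc i) v) ≈ᴹ s *ₗ D v
        D-* s v = f-* Z-linear s _

        P-fix : ∀ {u} → 𝕋 i u ≈ᴹ P *ₗ u → 𝕋 i u +ᴹ N *ₗ u ≈ᴹ Q *ₗ u
        P-fix e = ≈ᴹ-trans (+ᴹ-congʳ e) (≈ᴹ-trans (≈ᴹ-sym (*ₗ-distribʳ _ _ _)) (*ₗ-congʳ P+N≈Q))

        𝕋-ZC : ∀ {s r u v} → 𝕋 i u +ᴹ N *ₗ u ≈ᴹ r *ₗ v → 𝕋 i (Z (s *ₗ C i u)) ≈ᴹ s *ₗ r *ₗ D v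
        𝕋-ZC {s} {r} {u} {v} e = begin
          𝕋 i (Z (s *ₗ C i u))               ≈⟨ f-cong (𝕋-linear i) (f-* Z-linear s _) ⟩
          𝕋 i (s *ₗ Z (C i u))               ≈⟨ f-* (𝕋-linear i) s _ ⟩
          s *ₗ 𝕋 i (Z (C i u))               ≈⟨ *ₗ-congˡ (𝕋-Z i _) ⟩
          s *ₗ Z (𝕋 i (C i u))               ≈⟨ *ₗ-congˡ (f-cong Z-linear (𝕋-C i u i<n)) ⟩
          s *ₗ D (𝕋 i u +ᴹ N *ₗ u)           ≈⟨ *ₗ-congˡ (f-cong D-linear e) ⟩
          s *ₗ D (r *ₗ v)                    ≈⟨ *ₗ-congˡ (f-* D-linear r v) ⟩
          s *ₗ r *ₗ D v                      ∎

        𝕋-A : ∀ d u → 𝕋 i (A d i u) ≈ᴹ (P ^ d) *ₗ 𝕋 i u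
                +ᴹ Z ((Q ^ d) *ₗ (X (suc i) (𝕋 i u) +ᴹ C (suc i) u) +ᴹ (H * bracket d) *ₗ 𝕋 i u)
        𝕋-A d u = ≈ᴹ-trans (f-+ (𝕋-linear i) _ _) (+ᴹ-cong (f-* (𝕋-linear i) _ _)
          (≈ᴹ-trans (𝕋-Z i _) (f-cong Z-linear (≈ᴹ-trans (f-+ (𝕋-linear i) _ _) (+ᴹ-cong
            (≈ᴹ-trans (f-* (𝕋-linear i) _ _) (*ₗ-congˡ (𝕋-X i u i<n))) (f-* (𝕋-linear i) _ _))))))

        𝕋-A-raise : ∀ d {u v} → 𝕋 i u ≈ᴹ v → 𝕋 i (A d i u) ≈ᴹ A d (suc i) v +ᴹ (Q ^ d) *ₗ D u
        𝕋-A-raise d {u} {v} e = begin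
          𝕋 i (A d i u)
            ≈⟨ 𝕋-A d u ⟩
          (P ^ d) *ₗ 𝕋 i u +ᴹ Z ((Q ^ d) *ₗ (X (suc i) (𝕋 i u) +ᴹ C (suc i) u) +ᴹ (H * bracket d) *ₗ 𝕋 i u)
            ≈⟨ +ᴹ-cong (*ₗ-congˡ e) (f-cong Z-linear (+ᴹ-cong (*ₗ-congˡ (+ᴹ-congʳ (f-cong (X-linear _) e))) (*ₗ-congˡ e))) ⟩
          (P ^ d) *ₗ v +ᴹ Z ((Q ^ d) *ₗ (X (suc i) v +ᴹ C (suc i) u) +ᴹ (H * bracket d) *ₗ v)
            ≈⟨ +ᴹ-congˡ (f-cong Z-linear (solve (Q ^ d ∷ H * bracket d ∷ []) (X (suc i) v ∷ C (suc i) u ∷ v ∷ [])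
                 (λ { (𝕢 ∷ h ∷ []) (a ∷ b ∷ v ∷ []) → 𝕢 ⊡ (a ⊞ b) ⊞ h ⊡ v , (𝕢 ⊡ a ⊞ h ⊡ v) ⊞ 𝕢 ⊡ b })
                 (≈-refl , ≈-refl , ≈-refl , tt))) ⟩
          (P ^ d) *ₗ v +ᴹ Z (((Q ^ d) *ₗ X (suc i) v +ᴹ (H * bracket d) *ₗ v) +ᴹ (Q ^ d) *ₗ C (suc i) u)
            ≈⟨ +ᴹ-congˡ (≈ᴹ-trans (f-+ Z-linear _ _) (+ᴹ-congˡ (D-* _ _))) ⟩
          (P ^ d) *ₗ v +ᴹ (Z ((Q ^ d) *ₗ X (suc i) v +ᴹ (H * bracket d) *ₗ v) +ᴹ (Q ^ d) *ₗ D u)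
            ≈⟨ ≈ᴹ-sym (+ᴹ-assoc _ _ _) ⟩
          A d (suc i) v +ᴹ (Q ^ d) *ₗ D u ∎

        -- The correction `C (suc i) u` supplies both changes from d to d + 1: its `N` part turns
        -- the factor P of `X` into Q, and its `H` part completes `P * bracket d` to
        -- `bracket (suc d)`.
        𝕋-A-level : ∀ d {u} → 𝕋 i u ≈ᴹ P *ₗ u → 𝕋 i (A d i u) ≈ᴹ A (suc d) (suc i) u
        𝕋-A-level d {u} e = begin
          𝕋 i (A d i u)
            ≈⟨ 𝕋-A d u ⟩
          (P ^ d) *ₗ 𝕋 i u +ᴹ Z ((Q ^ d) *ₗ (X (suc i) (𝕋 i u) +ᴹ C (suc i) u) +ᴹ (H * bracket d) *ₗ 𝕋 i u)
            ≈⟨ +ᴹ-cong (*ₗ-congˡ e) (f-cong Z-linear (+ᴹ-cong (*ₗ-congˡ (+ᴹ-congʳ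
                 (≈ᴹ-trans (f-cong (X-linear _) e) (f-* (X-linear _) _ _)))) (*ₗ-congˡ e))) ⟩
          (P ^ d) *ₗ P *ₗ u +ᴹ Z ((Q ^ d) *ₗ (P *ₗ Y +ᴹ (H *ₗ u +ᴹ N *ₗ Y)) +ᴹ (H * bracket d) *ₗ P *ₗ u)
            ≈⟨ +ᴹ-cong (solve (P ∷ P ^ d ∷ []) (u ∷ []) (λ { (𝕡 ∷ a ∷ []) (u ∷ []) → a ⊡ 𝕡 ⊡ u , (𝕡 :* a) ⊡ u })
                   (≈-refl , tt))
                 (f-cong Z-linear (solve (P ∷ N ∷ Q ^ d ∷ H ∷ bracket d ∷ []) (Y ∷ u ∷ [])
                 (λ { (𝕡 ∷ n ∷ 𝕢 ∷ h ∷ b ∷ []) (y ∷ u ∷ []) →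
                      𝕢 ⊡ (𝕡 ⊡ y ⊞ (h ⊡ u ⊞ n ⊡ y)) ⊞ (h :* b) ⊡ 𝕡 ⊡ u
                    , ((𝕡 :+ n) :* 𝕢) ⊡ y ⊞ (h :* (𝕡 :* b :+ 𝕢)) ⊡ u })
                 (≈-refl , ≈-refl , tt))) ⟩
          (P * P ^ d) *ₗ u +ᴹ Z (((P + N) * Q ^ d) *ₗ Y +ᴹ (H * (P * bracket d + Q ^ d)) *ₗ u)
            ≈⟨ +ᴹ-congˡ (f-cong Z-linear (+ᴹ-congʳ (*ₗ-congʳ (*-congʳ P+N≈Q)))) ⟩
          A (suc d) (suc i) u ∎
          where Y = X (suc i) u

      -- The indices of the `u` are the contents of the two input sites, the upper one first. `u₁₀′`
      -- comes from `M (suc (ℕ.pred d))` and `u₁₀` from `M d`; these differ for d = 0, but there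
      -- `bracket 0` removes the term, so agreement is required for d ≢ 0 only.
      rll : ∀ d {u₀₀ u₀₁ u₁₀ u₁₀′ u₁₁} → (d ≢ 0 → u₁₀′ ≡ u₁₀) →
            𝕋 i u₀₀ ≈ᴹ P *ₗ u₀₀ → 𝕋 i u₀₁ ≈ᴹ u₁₀ → 𝕋 i u₁₀ +ᴹ N *ₗ u₁₀ ≈ᴹ (P * Q) *ₗ u₀₁ → 𝕋 i u₁₁ ≈ᴹ P *ₗ u₁₁ →
            𝕋 i ((Q ^ d) *ₗ (Z ((Q ^ d) *ₗ C i u₀₀) +ᴹ A d i u₀₁)
                  +ᴹ bracket d *ₗ (Z ((Q ^ ℕ.pred d) *ₗ C i u₁₀′) +ᴹ A (ℕ.pred d) i u₁₁))
            ≈ᴹ Z ((Q ^ d) *ₗ C (suc i) ((Q ^ suc d) *ₗ u₀₀ +ᴹ bracket (suc d) *ₗ u₀₁))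
                +ᴹ A d (suc i) ((Q ^ d) *ₗ u₁₀ +ᴹ bracket d *ₗ u₁₁)
      rll d {u₀₀} {u₀₁} {u₁₀} {u₁₀′} {u₁₁} same e₀₀ e₀₁ e₁₀ e₁₁ = begin
        𝕋 i (a *ₗ (Z (a *ₗ C i u₀₀) +ᴹ A d i u₀₁) +ᴹ b *ₗ w)
          ≈⟨ ≈ᴹ-trans (f-+ (𝕋-linear i) _ _) (+ᴹ-cong (≈ᴹ-trans (f-* (𝕋-linear i) _ _)
               (*ₗ-congˡ (f-+ (𝕋-linear i) _ _))) (f-* (𝕋-linear i) _ _)) ⟩
        a *ₗ (𝕋 i (Z (a *ₗ C i u₀₀)) +ᴹ 𝕋 i (A d i u₀₁)) +ᴹ b *ₗ 𝕋 i w
          ≈⟨ +ᴹ-cong (*ₗ-congˡ (+ᴹ-cong (𝕋-ZC (P-fix e₀₀)) (𝕋-A-raise d e₀₁))) (second d same) ⟩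
        a *ₗ (a *ₗ Q *ₗ D u₀₀ +ᴹ (A d (suc i) u₁₀ +ᴹ a *ₗ D u₀₁)) +ᴹ b *ₗ (a *ₗ P *ₗ D u₀₁ +ᴹ A d (suc i) u₁₁)
          ≈⟨ solve (P ∷ Q ∷ a ∷ b ∷ []) (D u₀₀ ∷ D u₀₁ ∷ A d (suc i) u₁₀ ∷ A d (suc i) u₁₁ ∷ [])
               (λ { (𝕡 ∷ 𝕢 ∷ a ∷ b ∷ []) (d₀₀ ∷ d₀₁ ∷ a₁₀ ∷ a₁₁ ∷ []) →
                    a ⊡ (a ⊡ 𝕢 ⊡ d₀₀ ⊞ (a₁₀ ⊞ a ⊡ d₀₁)) ⊞ b ⊡ (a ⊡ 𝕡 ⊡ d₀₁ ⊞ a₁₁)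
                  , a ⊡ ((𝕢 :* a) ⊡ d₀₀ ⊞ (𝕡 :* b :+ a) ⊡ d₀₁) ⊞ (a ⊡ a₁₀ ⊞ b ⊡ a₁₁) })
               (≈-refl , ≈-refl , ≈-refl , ≈-refl , tt) ⟩
        a *ₗ ((Q * a) *ₗ D u₀₀ +ᴹ (P * b + a) *ₗ D u₀₁) +ᴹ (a *ₗ A d (suc i) u₁₀ +ᴹ b *ₗ A d (suc i) u₁₁)
          ≈⟨ +ᴹ-cong (≈ᴹ-trans (*ₗ-congˡ (≈ᴹ-sym (linear₂ D-linear))) (≈ᴹ-sym (D-* _ _))) (≈ᴹ-sym (linear₂ (A-linear d _))) ⟩
        Z (a *ₗ C (suc i) ((Q * a) *ₗ u₀₀ +ᴹ (P * b + a) *ₗ u₀₁)) +ᴹ A d (suc i) (a *ₗ u₁₀ +ᴹ b *ₗ u₁₁) ∎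
        where
        a = Q ^ d
        b = bracket d
        w = Z ((Q ^ ℕ.pred d) *ₗ C i u₁₀′) +ᴹ A (ℕ.pred d) i u₁₁
        linear₂ : ∀ {φ r s u v} → Linear W W φ → φ (r *ₗ u +ᴹ s *ₗ v) ≈ᴹ r *ₗ φ u +ᴹ s *ₗ φ v
        linear₂ F = ≈ᴹ-trans (f-+ F _ _) (+ᴹ-cong (f-* F _ _) (f-* F _ _))
        second : ∀ d → (d ≢ 0 → u₁₀′ ≡ u₁₀) →
                 bracket d *ₗ 𝕋 i (Z ((Q ^ ℕ.pred d) *ₗ C i u₁₀′) +ᴹ A (ℕ.pred d) i u₁₁)
                   ≈ᴹ bracket d *ₗ ((Q ^ d) *ₗ P *ₗ D u₀₁ +ᴹ A d (suc i) u₁₁)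
        second zero    same = ≈ᴹ-trans (*ₗ-zeroˡ _) (≈ᴹ-sym (*ₗ-zeroˡ _))
        second (suc d) same with same (λ ())
        ... | refl = *ₗ-congˡ (≈ᴹ-trans (f-+ (𝕋-linear i) _ _) (+ᴹ-cong
          (≈ᴹ-trans (𝕋-ZC e₁₀) (solve (P ∷ Q ∷ Q ^ d ∷ []) (D u₀₁ ∷ [])
            (λ { (𝕡 ∷ 𝕢 ∷ a ∷ []) (v ∷ []) → a ⊡ (𝕡 :* 𝕢) ⊡ v , (𝕢 :* a) ⊡ 𝕡 ⊡ v }) (≈-refl , tt)))
          (𝕋-A-level d e₁₁)))

    𝕋-M : ∀ i d f b → length b ≤ i → suc i < n → 𝕋 i (M d f b) ≈ᴹ M d (λ a → 𝕋 i (f a)) b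
    𝕋-M i d f b l i<n = M-hom S S (𝕋-linear i) (𝕋-Z i) d f b λ j j<l v →
      let j<i = ℕₚ.≤-trans j<l l in
      𝕋-X-other i j v i<n (ℕₚ.<-trans j<i (ℕₚ.<-trans ℕₚ.≤-refl i<n)) (ℕₚ.<⇒≢ j<i) (ℕₚ.<⇒≢ (ℕₚ.m≤n⇒m≤1+n j<i))

    scale-M : ∀ s d f b → s *ₗ M d f b ≈ᴹ M d (λ a → s *ₗ f a) b
    scale-M s d f b = M-hom S S (*-linear s id-linear) (λ v → ≈ᴹ-sym (f-* Z-linear s v)) d f b
      λ j _ v → ≈ᴹ-sym (f-* (X-linear j) s v)

    -- At the two sites concerned this is `rll`, its hypotheses being the relations of `f` carried
    -- through the transfer matrix of the part below. The sites above use only `X j` that commute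
    -- with `𝕋 i`, and the tails of `f` remain equivariant.
    raise-M : ∀ {l f} d {i b b′} → Equivariant l f → l ≤ n → length b ≡ l → Raise i b b′ →
              𝕋 i (M d f b) ≈ᴹ M d f b′
    raise-M {f = f} d E l≤n refl (here b) = rll l≤n d
      {M (suc d) (λ a → f (false ∷ false ∷ a)) b} {u₁₁ = M (ℕ.pred d) (λ a → f (true ∷ true ∷ a)) b} (same d)
      (≈ᴹ-trans (𝕋-M _ (suc d) _ b ℕₚ.≤-refl l≤n)
        (≈ᴹ-trans (M-cong (suc d) b (λ a e → ≡.subst (λ i → 𝕋 i _ ≈ᴹ _) e (level E (≡.cong (λ l → suc (suc l)) e) (here false a))))
          (≈ᴹ-sym (scale-M P (suc d) _ b))))
      (≈ᴹ-trans (𝕋-M _ d _ b ℕₚ.≤-refl l≤n)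
        (M-cong d b (λ a e → ≡.subst (λ i → 𝕋 i _ ≈ᴹ _) e (raise E (≡.cong (λ l → suc (suc l)) e) (here a)))))
      (≈ᴹ-trans (+ᴹ-cong (𝕋-M _ d _ b ℕₚ.≤-refl l≤n) (scale-M N d _ b))
        (≈ᴹ-trans (≈ᴹ-sym (M-+ d _ _ b))
          (≈ᴹ-trans (M-cong d b (λ a e → ≡.subst (λ i → 𝕋 i _ +ᴹ _ ≈ᴹ _) e (lower E l≤n (≡.cong (λ l → suc (suc l)) e) (here a))))
            (≈ᴹ-sym (scale-M (P * Q) d _ b)))))
      (≈ᴹ-trans (𝕋-M _ (ℕ.pred d) _ b ℕₚ.≤-refl l≤n)
        (≈ᴹ-trans (M-cong (ℕ.pred d) b (λ a e → ≡.subst (λ i → 𝕋 i _ ≈ᴹ _) e (level E (≡.cong (λ l → suc (suc l)) e) (here true a))))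
          (≈ᴹ-sym (scale-M P (ℕ.pred d) _ b))))
      where
      same : ∀ d → d ≢ 0 → M (suc (ℕ.pred d)) (λ a → f (true ∷ false ∷ a)) b ≡ M d (λ a → f (true ∷ false ∷ a)) b
      same zero    d≢0 = ⊥-elim (d≢0 refl)
      same (suc d) _   = refl
    raise-M {f = f} d {i} E l≤n refl (there {b = b} {b′} false r) =
      ≈ᴹ-trans (f-+ (𝕋-linear i) _ _) (+ᴹ-cong
        (≈ᴹ-trans (f-* (𝕋-linear i) _ _) (*ₗ-congˡ (raise-M d (tail-equivariant false E) (ℕₚ.<⇒≤ l≤n) refl r)))
        (≈ᴹ-trans (f-* (𝕋-linear i) _ _) (*ₗ-congˡ (raise-M (ℕ.pred d) (tail-equivariant true E) (ℕₚ.<⇒≤ l≤n) refl r))))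
    raise-M {f = f} d {i} E l≤n refl (there {b = b} {b′} true r) rewrite ≡.sym (raise-length r) =
      ≈ᴹ-trans (f-+ (𝕋-linear i) _ _) (+ᴹ-cong
        (≈ᴹ-trans (𝕋-Z i _) (f-cong Z-linear (≈ᴹ-trans (f-* (𝕋-linear i) _ _) (*ₗ-congˡ
          (≈ᴹ-trans (C-hom S S (𝕋-linear i) (𝕋-Z i) X-top _)
            (f-cong (C-linear _) (raise-M (suc d) (tail-equivariant false E) (ℕₚ.<⇒≤ l≤n) refl r)))))))
        (≈ᴹ-trans (A-hom S S (𝕋-linear i) (𝕋-Z i) X-top d _)
          (f-cong (A-linear d _) (raise-M d (tail-equivariant true E) (ℕₚ.<⇒≤ l≤n) refl r))))
      where
      i<b = raise-bound r
      X-top : ∀ v → 𝕋 i (X (length b) v) ≈ᴹ X (length b) (𝕋 i v)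
      X-top v = 𝕋-X-other i (length b) v (ℕₚ.<-trans i<b l≤n) l≤n
        (λ e → ℕₚ.<⇒≢ (ℕₚ.<-trans ℕₚ.≤-refl i<b) (≡.sym e)) (λ e → ℕₚ.<⇒≢ i<b (≡.sym e))

-- Strings of beads and gaps

ones zeros : List Bool → ℕ
ones []          = 0
ones (false ∷ b) = ones b
ones (true ∷ b)  = suc (ones b)
zeros []          = 0
zeros (false ∷ b) = suc (zeros b)
zeros (true ∷ b)  = zeros b

zeros+ones : ∀ b → zeros b ℕ.+ ones b ≡ length b
zeros+ones []          = refl
zeros+ones (false ∷ b) = ≡.cong suc (zeros+ones b)
zeros+ones (true ∷ b)  = ≡.trans (ℕₚ.+-suc _ _) (≡.cong suc (zeros+ones b))

_⇝_ : List Bool → List Bool → Set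
b ⇝ b′ = ∃[ i ] Raise i b b′

⇝-ones : ∀ {b b′} → b ⇝ b′ → ones b ≡ ones b′
⇝-ones (_ , here b)        = refl
⇝-ones (_ , there false r) = ⇝-ones (_ , r)
⇝-ones (_ , there true r)  = ≡.cong suc (⇝-ones (_ , r))

⇝-zeros : ∀ {b b′} → b ⇝ b′ → zeros b ≡ zeros b′
⇝-zeros (_ , here b)        = refl
⇝-zeros (_ , there false r) = ≡.cong suc (⇝-zeros (_ , r))
⇝-zeros (_ , there true r)  = ⇝-zeros (_ , r)

sorted : ℕ → ℕ → List Bool
sorted z k = replicate z false ++ replicate k true

extend : ∀ β {b b′} → Star _⇝_ b b′ → Star _⇝_ (β ∷ b) (β ∷ b′)
extend β = gmap (β ∷_) λ (i , r) → i , there β r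

slide : ∀ z b → Star _⇝_ (replicate z false ++ true ∷ b) (true ∷ replicate z false ++ b)
slide zero    b = ε
slide (suc z) b = extend false (slide z b) ◅◅ ((_ , here _) ◅ ε)

-- If the top site of `b` is a bead, the uppermost bead of the sorted string slides over all gaps
-- before anything below it moves. `Y` applies its operators in the same order.
sorted⇝ : ∀ b → Star _⇝_ (sorted (zeros b) (ones b)) b
sorted⇝ []          = ε
sorted⇝ (false ∷ b) = extend false (sorted⇝ b)
sorted⇝ (true ∷ b)  = slide (zeros b) _ ◅◅ extend true (sorted⇝ b)

data Sites (i : ℕ) (b : List Bool) : Set where
  equal   : Level₂ i b → Sites i b
  raises  : ∀ {b′} → Raise i b b′ → Sites i b
  raised  : ∀ {b′} → Raise i b′ b → Sites i b

sites : ∀ i b → suc i < length b → Sites i b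
sites i (β ∷ [])    (s≤s ())
sites i (β ∷ γ ∷ b) lt = step β γ lt (i ℕₚ.≟ length b) (sites i (γ ∷ b))
  where
  step : ∀ β γ → suc i < suc (suc (length b)) → Dec (i ≡ length b) →
         (suc i < suc (length b) → Sites i (γ ∷ b)) → Sites i (β ∷ γ ∷ b)
  step false false _ (yes refl) _ = equal (here false b)
  step false true  _ (yes refl) _ = raises (here b)
  step true  false _ (yes refl) _ = raised (here b)
  step true  true  _ (yes refl) _ = equal (here true b)
  step β γ (s≤s lt) (no i≢) below with below (s≤s (ℕₚ.≤∧≢⇒< (ℕₚ.≤-pred lt) i≢))
  ... | equal s  = equal (there β s)
  ... | raises r = raises (there β r)
  ... | raised r = raised (there β r)

ones-sorted : ∀ z k → ones (sorted z k) ≡ k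
ones-sorted zero    zero    = refl
ones-sorted zero    (suc k) = ≡.cong suc (ones-sorted zero k)
ones-sorted (suc z) k       = ones-sorted z k

zeros-sorted : ∀ z k → zeros (sorted z k) ≡ z
zeros-sorted zero    zero    = refl
zeros-sorted zero    (suc k) = zeros-sorted zero k
zeros-sorted (suc z) k       = ≡.cong suc (zeros-sorted z k)

-- The vectors T̄_w v for Grassmannian w

module Strands {c ℓc} (K : CommutativeRing c ℓc) {P Q N H : CommutativeRing.Carrier K}
  {m ℓm} {W : LeftModule (CommutativeRing.ring K) m ℓm} {S : Parameters.Operators K P Q N H W} {n : ℕ}
  (𝓗 : Parameters.HeckeAction K P Q N H S n) where

  open CommutativeRing K hiding (zero) renaming (refl to ≈-refl)
  open LinearAlgebra K
  open Parameters K P Q N H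
  open LeftModule W
  open Operators S
  open HeckeAction 𝓗
  open Action 𝓗 public
  open Linear
  open SetoidReasoning ≈ᴹ-setoid

  private
    𝕋≈ : ∀ i {u v} → u ≈ᴹ v → 𝕋 i u ≈ᴹ 𝕋 i v
    𝕋≈ i = f-cong (𝕋-linear i)

  -- T̄_{z+k−1} ⋯ T̄_k carries the bead at position k over z empty positions.

  B : ℕ → ℕ → Carrierᴹ → Carrierᴹ
  B k zero    v = v
  B k (suc z) v = 𝕋 (z ℕ.+ k) (B k z v)

  B-linear : ∀ k z → Linear W W (B k z)
  B-linear k zero    = id-linear
  B-linear k (suc z) = ∘-linear (𝕋-linear _) (B-linear k z)

  B-below : ∀ {k} z {j} v → suc j < k → z ℕ.+ k < n → 𝕋 j (B k z v) ≈ᴹ B k z (𝕋 j v)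
  B-below zero    v j<k l = ≈ᴹ-refl
  B-below {k} (suc z) {j} v j<k l = ≈ᴹ-trans (far′ j (z ℕ.+ k) _ (ℕₚ.≤-trans j<k (ℕₚ.m≤n+m k z)) l)
    (𝕋≈ _ (B-below z v j<k (ℕₚ.<⇒≤ l)))

  B-above : ∀ {k} z {j} v → z ℕ.+ k < j → suc j < n → 𝕋 j (B k z v) ≈ᴹ B k z (𝕋 j v)
  B-above zero    v j<k l = ≈ᴹ-refl
  B-above {k} (suc z) {j} v j<k l = ≈ᴹ-trans (≈ᴹ-sym (far′ (z ℕ.+ k) j _ j<k l))
    (𝕋≈ _ (B-above z v (ℕₚ.<⇒≤ j<k) l))

  -- Inside the range of the moving strand one braid relation carries `𝕋 (suc j)` through it, and
  -- the index drops by one; all other letters of `B k z` are far away.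
  B-shift : ∀ {k} z {j} v → k ≤ j → suc j < z ℕ.+ k → z ℕ.+ k < n → 𝕋 j (B k z v) ≈ᴹ B k z (𝕋 (suc j) v)
  B-shift zero    v k≤j j<k l = ⊥-elim (ℕₚ.<⇒≱ j<k (ℕₚ.m≤n⇒m≤1+n k≤j))
  B-shift {k} (suc z) {j} v k≤j (s≤s j<z) l with ℕₚ.m≤n⇒m<n∨m≡n j<z
  ... | inj₁ lt = ≈ᴹ-trans (far′ j (z ℕ.+ k) _ lt l) (𝕋≈ _ (B-shift z v k≤j lt (ℕₚ.<⇒≤ l)))
  B-shift {k} (suc zero)    {j} v k≤j (s≤s j<z) l | inj₂ e = ⊥-elim (ℕₚ.1+n≰n (ℕₚ.≤-trans (ℕₚ.≤-reflexive e) k≤j))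
  B-shift {k} (suc (suc z)) {.(z ℕ.+ k)} v k≤j (s≤s j<z) l | inj₂ refl =
    ≈ᴹ-trans (braid′ (z ℕ.+ k) _ l) (𝕋≈ _ (𝕋≈ _ (B-above z v ℕₚ.≤-refl l)))

  -- Two neighbouring beads are carried over z gaps. The last letter of `B k (suc z)` crosses them
  -- after the journey, the `𝕋 k` on the right before it; each gap passed costs one braid relation.
  B-exchange : ∀ k z v → suc (z ℕ.+ k) < n → B k (suc z) (B (suc k) z v) ≈ᴹ B k z (B (suc k) z (𝕋 k v))
  B-exchange k zero    v l = ≈ᴹ-refl
  B-exchange k (suc z) v l rewrite ℕₚ.+-suc z k = begin
    𝕋 s (𝕋 t (B k z (𝕋 s (B (suc k) z v))))  ≈⟨ 𝕋≈ _ (𝕋≈ _ (≈ᴹ-sym (B-above z _ ℕₚ.≤-refl l))) ⟩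
    𝕋 s (𝕋 t (𝕋 s (B k z (B (suc k) z v))))  ≈⟨ ≈ᴹ-sym (braid′ t _ l) ⟩
    𝕋 t (𝕋 s (𝕋 t (B k z (B (suc k) z v))))  ≈⟨ 𝕋≈ _ (𝕋≈ _ (B-exchange k z v (ℕₚ.<⇒≤ l))) ⟩
    𝕋 t (𝕋 s (B k z (B (suc k) z (𝕋 k v))))  ≈⟨ 𝕋≈ _ (B-above z _ ℕₚ.≤-refl l) ⟩
    𝕋 t (B k z (𝕋 s (B (suc k) z (𝕋 k v))))  ∎
    where
    s = suc (z ℕ.+ k)
    t = z ℕ.+ k

  -- The vectors on which T̄_v acts by p^ℓ(v) for v in S_k × S_z.

  Symmetric : ℕ → ℕ → Carrierᴹ → Set _
  Symmetric k z v = ∀ j → suc j < z ℕ.+ k → suc j ≢ k → 𝕋 j v ≈ᴹ P *ₗ v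

  -- Once the last bead has gone to the top, k beads and z gaps remain. The other beads have kept
  -- their positions while the gaps have moved down by one, which is the shift of index in
  -- `B-shift`.
  B-symmetric : ∀ {k z v} → z ℕ.+ k < n → Symmetric (suc k) z v → Symmetric k z (B k z v)
  B-symmetric {k} {z} {v} l sym j j<l j≢k with ℕₚ.<-cmp (suc j) k
  ... | tri< j<k _ _ = ≈ᴹ-trans (B-below z v j<k l) (≈ᴹ-trans
          (f-cong (B-linear k z) (sym j (ℕₚ.≤-trans (ℕₚ.m≤n⇒m≤1+n j<l) (ℕₚ.≤-reflexive (≡.sym (ℕₚ.+-suc z k))))
            (λ e → ℕₚ.<⇒≢ (ℕₚ.<-trans ℕₚ.≤-refl j<k) (ℕₚ.suc-injective e)))) (f-* (B-linear k z) _ _))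
  ... | tri≈ _ e _ = ⊥-elim (j≢k e)
  ... | tri> _ _ (s≤s k≤j) = ≈ᴹ-trans (B-shift z v k≤j j<l l) (≈ᴹ-trans
          (f-cong (B-linear k z) (sym (suc j) (ℕₚ.≤-trans (s≤s j<l) (ℕₚ.≤-reflexive (≡.sym (ℕₚ.+-suc z k))))
            (λ e → j≢k (ℕₚ.suc-injective e)))) (f-* (B-linear k z) _ _))

  -- When `b` has k beads and z gaps, this is T̄ along a reduced word of the Grassmannian
  -- permutation with string `b`. The value 0 for all other counts extends it to every string, so
  -- that the relations in `Equivariant` carry no condition on the counts, which raising a bead
  -- preserves.
  Y : List Bool → ℕ → ℕ → Carrierᴹ → Carrierᴹ
  Y (false ∷ b) k       zero    v = 0ᴹ
  Y (false ∷ b) k       (suc z) v = Y b k z v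
  Y (true ∷ b)  zero    z       v = 0ᴹ
  Y (true ∷ b)  (suc k) z       v = Y b k z (B k z v)
  Y []          zero    zero    v = v
  Y []          zero    (suc z) v = 0ᴹ
  Y []          (suc k) z       v = 0ᴹ

  Y-linear : ∀ b k z → Linear W W (Y b k z)
  Y-linear (false ∷ b) k       zero    = 0-linear
  Y-linear (false ∷ b) k       (suc z) = Y-linear b k z
  Y-linear (true ∷ b)  zero    z       = 0-linear
  Y-linear (true ∷ b)  (suc k) z       = ∘-linear (Y-linear b k z) (B-linear k z)
  Y-linear []          zero    zero    = id-linear
  Y-linear []          zero    (suc z) = 0-linear
  Y-linear []          (suc k) z       = 0-linear

  private
    𝕋-0 : ∀ i → 𝕋 i 0ᴹ ≈ᴹ 0ᴹ
    𝕋-0 i = f-0 (𝕋-linear i)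

  Y-above : ∀ b k z {i} v → z ℕ.+ k ≤ i → suc i < n → 𝕋 i (Y b k z v) ≈ᴹ Y b k z (𝕋 i v)
  Y-above (false ∷ b) k       zero    v l i<n = 𝕋-0 _
  Y-above (false ∷ b) k       (suc z) v l i<n = Y-above b k z v (ℕₚ.<⇒≤ l) i<n
  Y-above (true ∷ b)  zero    z       v l i<n = 𝕋-0 _
  Y-above (true ∷ b)  (suc k) z       v l i<n = ≈ᴹ-trans (Y-above b k z _ (ℕₚ.<⇒≤ l′) i<n)
    (f-cong (Y-linear b k z) (B-above z v l′ i<n))
    where l′ = ℕₚ.≤-trans (ℕₚ.≤-reflexive (≡.sym (ℕₚ.+-suc z k))) l
  Y-above []          zero    zero    v l i<n = ≈ᴹ-refl
  Y-above []          zero    (suc z) v l i<n = 𝕋-0 _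
  Y-above []          (suc k) z       v l i<n = 𝕋-0 _

  private
    shorter : ∀ {z k l} → z ℕ.+ suc k ≤ l → z ℕ.+ k < l
    shorter {z} {k} le = ℕₚ.≤-trans (ℕₚ.≤-reflexive (≡.sym (ℕₚ.+-suc z k))) le

    tail-length : ∀ {z k l} → suc l ≡ z ℕ.+ suc k → l ≡ z ℕ.+ k
    tail-length {z} {k} e = ℕₚ.suc-injective (≡.trans e (ℕₚ.+-suc z k))

  Y-raise : ∀ {k z v} → z ℕ.+ k ≤ n → Symmetric k z v → ∀ {i b b′} → length b ≡ z ℕ.+ k → Raise i b b′ →
            𝕋 i (Y b k z v) ≈ᴹ Y b′ k z v
  Y-raise {zero}  {zero}  l sym () (here b)
  Y-raise {suc k} {zero}  l sym e (here b) = 𝕋-0 _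
  Y-raise {zero}  {suc z} l sym e (here b) = 𝕋-0 _
  Y-raise {suc k} {suc z} {v} l sym e (here b) with tail-length {z} {k} (ℕₚ.suc-injective e)
  ... | e′ rewrite e′ = Y-above b k z (B k z v) ℕₚ.≤-refl (ℕₚ.≤-trans (s≤s (shorter {z} ℕₚ.≤-refl)) l)
  Y-raise {k}     {zero}  l sym e (there false r) = 𝕋-0 _
  Y-raise {k}     {suc z} l sym e (there false r) =
    Y-raise {k} {z} (ℕₚ.<⇒≤ l) (λ j j<l → sym j (ℕₚ.m≤n⇒m≤1+n j<l)) (ℕₚ.suc-injective e) r
  Y-raise {zero}  {z}     l sym e (there true r) = 𝕋-0 _
  Y-raise {suc k} {z}     l sym e (there true r) =
    Y-raise {k} {z} (ℕₚ.<⇒≤ (shorter {z} l)) (B-symmetric (shorter {z} l) sym) (tail-length {z} e) r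

  -- For two gaps on top the operator reaches `v` at two gap positions; for two beads on top
  -- `B-exchange` turns it into an operator at two bead positions of `v`. Both times the symmetry of
  -- `v` yields `P`.
  Y-level : ∀ {k z v} → z ℕ.+ k ≤ n → Symmetric k z v → ∀ {i b} → length b ≡ z ℕ.+ k → Level₂ i b →
            𝕋 i (Y b k z v) ≈ᴹ P *ₗ Y b k z v
  Y-level {k} {zero}        l sym e (here false b) = ≈ᴹ-trans (𝕋-0 _) (≈ᴹ-sym (*ₗ-zeroʳ _))
  Y-level {k} {suc zero}    l sym e (here false b) = ≈ᴹ-trans (𝕋-0 _) (≈ᴹ-sym (*ₗ-zeroʳ _))
  Y-level {k} {suc (suc z)} {v} l sym e (here false b) with ℕₚ.suc-injective (ℕₚ.suc-injective e)
  ... | e′ rewrite e′ = ≈ᴹ-trans (Y-above b k z v ℕₚ.≤-refl l) (≈ᴹ-trans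
    (f-cong (Y-linear b k z) (sym (z ℕ.+ k) ℕₚ.≤-refl λ e → ℕₚ.<⇒≢ (s≤s (ℕₚ.m≤n+m k z)) (≡.sym e)))
    (f-* (Y-linear b k z) _ _))
  Y-level {zero}        {z} l sym e (here true b) = ≈ᴹ-trans (𝕋-0 _) (≈ᴹ-sym (*ₗ-zeroʳ _))
  Y-level {suc zero}    {z} l sym e (here true b) = ≈ᴹ-trans (𝕋-0 _) (≈ᴹ-sym (*ₗ-zeroʳ _))
  Y-level {suc (suc k)} {z} {v} l sym e (here true b) with tail-length {z} {k} (tail-length {z} {suc k} e)
  ... | e′ rewrite e′ = ≈ᴹ-trans (Y-above b k z _ ℕₚ.≤-refl l′) (≈ᴹ-trans
    (f-cong (Y-linear b k z) (≈ᴹ-trans (B-exchange k z v l′) (≈ᴹ-trans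
      (f-cong (B-linear k z) (≈ᴹ-trans (f-cong (B-linear (suc k) z) (sym k k< λ e → ℕₚ.1+n≢n (≡.sym (ℕₚ.suc-injective e))))
        (f-* (B-linear (suc k) z) _ _)))
      (f-* (B-linear k z) _ _))))
    (f-* (Y-linear b k z) _ _))
    where
    l′ : suc (z ℕ.+ k) < n
    l′ = ℕₚ.≤-trans (s≤s (shorter {z} ℕₚ.≤-refl)) (shorter {z} l)
    k< : suc k < z ℕ.+ suc (suc k)
    k< = ℕₚ.m≤n+m (suc (suc k)) z
  Y-level {k}     {zero}  l sym e (there false s) = ≈ᴹ-trans (𝕋-0 _) (≈ᴹ-sym (*ₗ-zeroʳ _))
  Y-level {k}     {suc z} l sym e (there false s) =
    Y-level {k} {z} (ℕₚ.<⇒≤ l) (λ j j<l → sym j (ℕₚ.m≤n⇒m≤1+n j<l)) (ℕₚ.suc-injective e) s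
  Y-level {zero}  {z}     l sym e (there true s) = ≈ᴹ-trans (𝕋-0 _) (≈ᴹ-sym (*ₗ-zeroʳ _))
  Y-level {suc k} {z}     l sym e (there true s) =
    Y-level {k} {z} (ℕₚ.<⇒≤ (shorter {z} l)) (B-symmetric (shorter {z} l) sym) (tail-length {z} e) s

  Y-equivariant : ∀ {k z v} → z ℕ.+ k ≤ n → Symmetric k z v → Equivariant (z ℕ.+ k) (λ b → Y b k z v)
  Y-equivariant {k} {z} l sym = record { raise = Y-raise {k} {z} l sym ; level = Y-level {k} {z} l sym }

  Y-sorted : ∀ k z v → Y (sorted z k) k z v ≈ᴹ v
  Y-sorted zero    zero    v = ≈ᴹ-refl
  Y-sorted (suc k) zero    v = Y-sorted k zero v
  Y-sorted k       (suc z) v = Y-sorted k z v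

  -- ∏_{j<k} (1 + Z x_j), the generating function of the e_r(x_1, …, x_k).

  E : ℕ → Carrierᴹ → Carrierᴹ
  E zero    v = v
  E (suc k) v = factor k (E k v)

  𝕋-factor : ∀ i j v → suc i < n → j < n → j ≢ i → j ≢ suc i → 𝕋 i (factor j v) ≈ᴹ factor j (𝕋 i v)
  𝕋-factor i j v i<n j<n j≢i j≢si = ≈ᴹ-trans (f-+ (𝕋-linear i) _ _)
    (+ᴹ-congˡ (≈ᴹ-trans (𝕋-Z i _) (f-cong Z-linear (𝕋-X-other i j v i<n j<n j≢i j≢si))))

  -- The corrections in `𝕋-X⁺` and `𝕋-X` are the same vector once `C` has been moved past `X i`, so
  -- they cancel.
  𝕋-XX : ∀ i v → suc i < n → 𝕋 i (X (suc i) (X i v)) ≈ᴹ X (suc i) (X i (𝕋 i v))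
  𝕋-XX i v i<n = GroupProperties.∙-cancelʳ +ᴹ-group _ _ _ (begin
    𝕋 i (X (suc i) (X i v)) +ᴹ C (suc i) (X i v)
      ≈⟨ 𝕋-X⁺ i (X i v) i<n ⟩
    X i (𝕋 i (X i v))
      ≈⟨ f-cong (X-linear i) (𝕋-X i v i<n) ⟩
    X i (X (suc i) (𝕋 i v) +ᴹ C (suc i) v)
      ≈⟨ f-+ (X-linear i) _ _ ⟩
    X i (X (suc i) (𝕋 i v)) +ᴹ X i (C (suc i) v)
      ≈⟨ +ᴹ-cong (X-X i (suc i) _) (C-hom S S (X-linear i) (X-Z i) (X-X i (suc i)) v) ⟩
    X (suc i) (X i (𝕋 i v)) +ᴹ C (suc i) (X i v) ∎)

  -- `𝕋 i` commutes with the sum and the product of `X i` and `X (suc i)`, which are the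
  -- coefficients of the expanded product of the two factors.
  𝕋-factor₂ : ∀ i v → suc i < n → 𝕋 i (factor (suc i) (factor i v)) ≈ᴹ factor (suc i) (factor i (𝕋 i v))
  𝕋-factor₂ i v i<n = begin
    𝕋 i (factor s (factor i v))
      ≈⟨ 𝕋≈ i (expansion v) ⟩
    𝕋 i (v +ᴹ (Z (X i v +ᴹ X s v) +ᴹ Z (Z (X s (X i v)))))
      ≈⟨ ≈ᴹ-trans (f-+ (𝕋-linear i) _ _) (+ᴹ-congˡ (≈ᴹ-trans (f-+ (𝕋-linear i) _ _)
           (+ᴹ-cong (𝕋-Z i _) (≈ᴹ-trans (𝕋-Z i _) (f-cong Z-linear (𝕋-Z i _)))))) ⟩
    𝕋 i v +ᴹ (Z (𝕋 i (X i v +ᴹ X s v)) +ᴹ Z (Z (𝕋 i (X s (X i v)))))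
      ≈⟨ +ᴹ-congˡ (+ᴹ-cong (f-cong Z-linear sum) (f-cong Z-linear (f-cong Z-linear (𝕋-XX i v i<n)))) ⟩
    𝕋 i v +ᴹ (Z (X i (𝕋 i v) +ᴹ X s (𝕋 i v)) +ᴹ Z (Z (X s (X i (𝕋 i v)))))
      ≈⟨ ≈ᴹ-sym (expansion (𝕋 i v)) ⟩
    factor s (factor i (𝕋 i v)) ∎
    where
    s = suc i
    open ModuleSolver W
    expansion : ∀ v → factor s (factor i v) ≈ᴹ v +ᴹ (Z (X i v +ᴹ X s v) +ᴹ Z (Z (X s (X i v))))
    expansion v = begin
      (v +ᴹ Z (X i v)) +ᴹ Z (X s (v +ᴹ Z (X i v)))
        ≈⟨ +ᴹ-congˡ (f-cong Z-linear (≈ᴹ-trans (f-+ (X-linear s) _ _) (+ᴹ-congˡ (X-Z s _)))) ⟩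
      (v +ᴹ Z (X i v)) +ᴹ Z (X s v +ᴹ Z (X s (X i v)))
        ≈⟨ +ᴹ-congˡ (f-+ Z-linear _ _) ⟩
      (v +ᴹ Z (X i v)) +ᴹ (Z (X s v) +ᴹ Z (Z (X s (X i v))))
        ≈⟨ solve [] (v ∷ Z (X i v) ∷ Z (X s v) ∷ Z (Z (X s (X i v))) ∷ [])
             (λ { _ (a ∷ b ∷ c ∷ d ∷ []) → (a ⊞ b) ⊞ (c ⊞ d) , a ⊞ ((b ⊞ c) ⊞ d) }) (≈-refl , ≈-refl , ≈-refl , ≈-refl , tt) ⟩
      v +ᴹ ((Z (X i v) +ᴹ Z (X s v)) +ᴹ Z (Z (X s (X i v))))
        ≈⟨ +ᴹ-congˡ (+ᴹ-congʳ (≈ᴹ-sym (f-+ Z-linear _ _))) ⟩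
      v +ᴹ (Z (X i v +ᴹ X s v) +ᴹ Z (Z (X s (X i v)))) ∎
    sum : 𝕋 i (X i v +ᴹ X s v) ≈ᴹ X i (𝕋 i v) +ᴹ X s (𝕋 i v)
    sum = begin
      𝕋 i (X i v +ᴹ X s v)                          ≈⟨ f-+ (𝕋-linear i) _ _ ⟩
      𝕋 i (X i v) +ᴹ 𝕋 i (X s v)                    ≈⟨ +ᴹ-congʳ (𝕋-X i v i<n) ⟩
      (X s (𝕋 i v) +ᴹ C s v) +ᴹ 𝕋 i (X s v)         ≈⟨ solve [] (X s (𝕋 i v) ∷ C s v ∷ 𝕋 i (X s v) ∷ [])
        (λ { _ (a ∷ b ∷ c ∷ []) → (a ⊞ b) ⊞ c , (c ⊞ b) ⊞ a }) (≈-refl , ≈-refl , ≈-refl , tt) ⟩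
      (𝕋 i (X s v) +ᴹ C s v) +ᴹ X s (𝕋 i v)         ≈⟨ +ᴹ-congʳ (𝕋-X⁺ i v i<n) ⟩
      X i (𝕋 i v) +ᴹ X s (𝕋 i v)                    ∎

  𝕋-E : ∀ i k v → suc i < n → k ≤ n → suc i ≢ k → 𝕋 i (E k v) ≈ᴹ E k (𝕋 i v)
  𝕋-E i zero    v i<n k≤n i≢k = ≈ᴹ-refl
  𝕋-E i (suc k) v i<n k≤n i≢k with suc i ℕₚ.≟ k
  𝕋-E i (suc .(suc i)) v i<n k≤n i≢k | yes refl = ≈ᴹ-trans (𝕋-factor₂ i _ i<n)
    (f-cong (∘-linear (factor-linear (suc i)) (factor-linear i))
      (𝕋-E i i v i<n (ℕₚ.<⇒≤ (ℕₚ.<⇒≤ k≤n)) ℕₚ.1+n≢n))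
  ... | no si≢k = ≈ᴹ-trans (𝕋-factor i k _ i<n k≤n (λ e → i≢k (≡.cong suc (≡.sym e))) (λ e → si≢k (≡.sym e)))
    (f-cong (factor-linear k) (𝕋-E i k v i<n (ℕₚ.<⇒≤ k≤n) si≢k))

  E-linear : ∀ k → Linear W W (E k)
  E-linear zero    = id-linear
  E-linear (suc k) = ∘-linear (factor-linear k) (E-linear k)

  E-symmetric : ∀ {k z v} → z ℕ.+ k ≤ n → Symmetric k z v → Symmetric k z (E k v)
  E-symmetric {k} {z} l sym j j<l j≢k = ≈ᴹ-trans
    (𝕋-E j k _ (ℕₚ.≤-trans j<l l) (ℕₚ.≤-trans (ℕₚ.m≤n+m k z) l) j≢k)
    (≈ᴹ-trans (f-cong (E-linear k) (sym j j<l j≢k)) (f-* (E-linear k) _ _))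

  -- The counter can decrease only at a gap of the output, and here there is none.
  M-beads : ∀ d f k → M (suc d) f (replicate k true) ≈ᴹ 0ᴹ
  M-beads d f zero    = ≈ᴹ-refl
  M-beads d f (suc k) = ≈ᴹ-trans (+ᴹ-cong
    (zeroes (∘-linear Z-linear (*-linear _ (C-linear _))) (M-beads (suc d) _ k)) (zeroes (A-linear (suc d) _) (M-beads d _ k)))
    (+ᴹ-identityˡ _)
    where
    zeroes : ∀ {φ v} → Linear W W φ → v ≈ᴹ 0ᴹ → φ v ≈ᴹ 0ᴹ
    zeroes F e = ≈ᴹ-trans (f-cong F e) (f-0 F)

  A-zero : ∀ j v → A 0 j v ≈ᴹ factor j v
  A-zero j v = +ᴹ-cong (*ₗ-identityˡ v) (f-cong Z-linear (≈ᴹ-trans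
    (+ᴹ-cong (*ₗ-identityˡ _) (≈ᴹ-trans (*ₗ-congʳ (zeroʳ H)) (*ₗ-zeroˡ _))) (+ᴹ-identityʳ _)))

  -- Along the gaps the counter stays 0, since `bracket 0` vanishes. Along the beads an input gap
  -- would leave a pending bead for good (`M-beads`). So only the sorted input contributes, each
  -- bead with the weight `A 0`, which is `factor`.
  M-sorted : ∀ f k z → M 0 f (sorted z k) ≈ᴹ E k (f (sorted z k))
  M-sorted f zero    zero    = ≈ᴹ-refl
  M-sorted f (suc k) zero    = begin
    Z (1# *ₗ C _ (M 1 _ (replicate k true))) +ᴹ A 0 (length (replicate k true)) (M 0 _ (replicate k true))
      ≈⟨ +ᴹ-cong (≈ᴹ-trans (f-cong F (M-beads 0 _ k)) (f-0 F)) (A-zero _ _) ⟩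
    0ᴹ +ᴹ factor (length (replicate k true)) (M 0 _ (replicate k true))
      ≈⟨ +ᴹ-identityˡ _ ⟩
    factor (length (replicate k true)) (M 0 _ (replicate k true))
      ≡⟨ ≡.cong (λ j → factor j (M 0 g (replicate k true))) (Listₚ.length-replicate k) ⟩
    factor k (M 0 g (replicate k true))
      ≈⟨ f-cong (factor-linear k) (M-sorted g k zero) ⟩
    E (suc k) (f (replicate (suc k) true)) ∎
    where F = ∘-linear Z-linear (*-linear 1# (C-linear (length (replicate k true))))
          g = λ a → f (true ∷ a)
  M-sorted f k       (suc z) = ≈ᴹ-trans (+ᴹ-cong (*ₗ-identityˡ _) (*ₗ-zeroˡ _))
    (≈ᴹ-trans (+ᴹ-identityʳ _) (M-sorted _ k z))

  -- Both sides are carried along by the raising operators from the sorted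
  -- string, on which the transfer matrix is ∏ (1 + Z x_j).

  Y-E : ∀ {k z v} → z ℕ.+ k ≤ n → Symmetric k z v → ∀ b → ones b ≡ k → zeros b ≡ z →
        Y b k z (E k v) ≈ᴹ M 0 (λ a → Y a k z v) b
  Y-E {v = v} l sym b refl refl = along (sorted⇝ b) (ones-sorted z k) (zeros-sorted z k) (begin
    Y (sorted z k) k z (E k v)          ≈⟨ Y-sorted k z _ ⟩
    E k v                               ≈⟨ f-cong (E-linear k) (≈ᴹ-sym (Y-sorted k z v)) ⟩
    E k (Y (sorted z k) k z v)          ≈⟨ ≈ᴹ-sym (M-sorted _ k z) ⟩
    M 0 (λ a → Y a k z v) (sorted z k)  ∎)
    where
    k = ones b
    z = zeros b
    along : ∀ {a} → Star _⇝_ a b → ones a ≡ k → zeros a ≡ z → _ → Y b k z (E k v) ≈ᴹ M 0 (λ a → Y a k z v) b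
    along ε _ _ e = e
    along {a} (_◅_ {j = a′} (i , r) rs) o≡ z≡ e =
      along rs (≡.trans (≡.sym (⇝-ones (i , r))) o≡) (≡.trans (≡.sym (⇝-zeros (i , r))) z≡) (begin
        Y a′ k z (E k v)               ≈⟨ ≈ᴹ-sym (Y-raise {k} {z} l (E-symmetric {k} {z} l sym) len r) ⟩
        𝕋 i (Y a k z (E k v))          ≈⟨ 𝕋≈ i e ⟩
        𝕋 i (M 0 (λ a → Y a k z v) a)  ≈⟨ raise-M 0 (Y-equivariant {k} {z} l sym) l len r ⟩
        M 0 (λ a → Y a k z v) a′       ∎)
      where
      len : length a ≡ z ℕ.+ k
      len = ≡.trans (≡.sym (zeros+ones a)) (≡.cong₂ ℕ._+_ z≡ o≡)

  -- The last letter of a word acts last.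

  act : List ℕ → Carrierᴹ → Carrierᴹ
  act []      v = v
  act (i ∷ u) v = act u (𝕋 i v)

  act-linear : ∀ u → Linear W W (act u)
  act-linear []      = id-linear
  act-linear (i ∷ u) = ∘-linear (act-linear u) (𝕋-linear i)

  module _ {m₂ ℓm₂} {W₂ : Module m₂ ℓm₂} {φ} (Φ : Linear W W₂ φ)
           {l f} (𝓔 : Equivariant l f) (l≤n : l ≤ n) where
    private module W₂ = LeftModule W₂
    open W₂ using () renaming (_≈ᴹ_ to _≈₂_; 0ᴹ to 0₂; ≈ᴹ-trans to trans₂; ≈ᴹ-sym to sym₂)
    open Equivariant

    -- The span of the values of `f` is stable under every letter, so a map that kills the values
    -- kills all words applied to them.
    vanishing : (∀ b → length b ≡ l → φ (f b) ≈₂ 0₂) →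
                ∀ u → All (λ i → suc i < l) u → ∀ b → length b ≡ l → φ (act u (f b)) ≈₂ 0₂
    vanishing van []      []         b e = van b e
    vanishing van (i ∷ u) (i< ∷ u<) b e = split (sites i b (≡.subst (suc i <_) (≡.sym e) i<))
      where
      F = ∘-linear Φ (act-linear u)
      IH = vanishing van u u<
      multiple : ∀ {w} s a → length a ≡ l → w ≈ᴹ s *ₗ f a → φ (act u w) ≈₂ 0₂
      multiple s a e w≈ = trans₂ (f-cong F w≈) (trans₂ (f-* F s _) (trans₂ (W₂.*ₗ-congˡ (IH a e)) (W₂.*ₗ-zeroʳ s)))
      split : Sites i b → φ (act u (𝕋 i (f b))) ≈₂ 0₂
      split (equal s)  = multiple P b e (level 𝓔 e s)
      split (raises r) = trans₂ (f-cong F (raise 𝓔 e r)) (IH _ (≡.trans (≡.sym (raise-length r)) e))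
      -- `lower` describes `𝕋 i (f b)` plus `N *ₗ f b`; the second term may be added because its
      -- image is 0 by induction.
      split (raised {a} r) = trans₂ (sym₂ (W₂.+ᴹ-identityʳ _))
        (trans₂ (W₂.+ᴹ-congˡ (sym₂ (multiple N b e ≈ᴹ-refl)))
        (trans₂ (sym₂ (f-+ F _ _)) (multiple (P * Q) a a≡ (lower 𝓔 l≤n a≡ r))))
        where a≡ = ≡.trans (raise-length r) e

-- Ribbon operators on strings

module RibbonOperators {c ℓc} (K : CommutativeRing c ℓc) {P Q N H : CommutativeRing.Carrier K}
  {m ℓm} {W : LeftModule (CommutativeRing.ring K) m ℓm} (S : Parameters.Operators K P Q N H W) where

  open CommutativeRing K hiding (zero) renaming (refl to ≈-refl)
  open LinearAlgebra K
  open Parameters K P Q N H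
  open LeftModule W
  open Operators S
  open Linear

  -- Here the input is the string that is displayed: the value of an operator
  -- at b is the image of b under the linear map that sends each string a to g a.
  -- D takes away one bead, each time with p per bead and q per gap above it.

  D : (List Bool → Carrierᴹ) → List Bool → Carrierᴹ
  D g []          = 0ᴹ
  D g (false ∷ b) = Q *ₗ D (λ a → g (false ∷ a)) b
  D g (true ∷ b)  = g (false ∷ b) +ᴹ P *ₗ D (λ a → g (true ∷ a)) b

  -- `i` is the number of beads above the final place of the moved bead. With i = 0 and a gap on
  -- top, that place is either further down or this site, where a bead is put with weight `C` and
  -- `D` takes another one away below. With i > 0 no bead may be put above the first one, so a gap
  -- on top is left alone.
  R : ℕ → (List Bool → Carrierᴹ) → List Bool → Carrierᴹ
  R i       g []          = 0ᴹ
  R zero    g (false ∷ b) = R zero (λ a → g (false ∷ a)) b +ᴹ C (length b) (D (λ a → g (true ∷ a)) b)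
  R zero    g (true ∷ b)  = X (length b) (g (true ∷ b))
  R (suc i) g (false ∷ b) = R (suc i) (λ a → g (false ∷ a)) b
  R (suc i) g (true ∷ b)  = R i (λ a → g (true ∷ a)) b

  -- The product of the 1 + Z R_i over a list, the first factor acting first.

  ∏R : List ℕ → (List Bool → Carrierᴹ) → List Bool → Carrierᴹ
  ∏R []      g b = g b
  ∏R (i ∷ u) g b = ∏R u g b +ᴹ Z (R i (∏R u g) b)

  -- The product of all the 1 + Z R_i on strings of length l.

  Pr : ℕ → (List Bool → Carrierᴹ) → List Bool → Carrierᴹ
  Pr zero    g b           = g b
  Pr (suc l) g []          = 0ᴹ
  Pr (suc l) g (false ∷ b) = Pr l (λ a → g (false ∷ a)) b +ᴹ Z (C l (D (Pr l (λ a → g (true ∷ a))) b))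
  Pr (suc l) g (true ∷ b)  = factor l (Pr l (λ a → g (true ∷ a)) b)

  -- The bead counts in the hypotheses here and in `R-cong` serve `∏R≈Pr`, where the number of
  -- factors is read off the string.
  D-cong : ∀ {g h} b → (∀ a → length a ≡ length b → suc (ones a) ≡ ones b → g a ≈ᴹ h a) → D g b ≈ᴹ D h b
  D-cong []          e = ≈ᴹ-refl
  D-cong (false ∷ b) e = *ₗ-congˡ (D-cong b λ a l o → e _ (≡.cong suc l) o)
  D-cong (true ∷ b)  e = +ᴹ-cong (e _ refl refl) (*ₗ-congˡ (D-cong b λ a l o → e _ (≡.cong suc l) (≡.cong suc o)))

  D-+ : ∀ g h b → D (λ a → g a +ᴹ h a) b ≈ᴹ D g b +ᴹ D h b
  D-+ g h []          = ≈ᴹ-sym (+ᴹ-identityˡ _)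
  D-+ g h (false ∷ b) = ≈ᴹ-trans (*ₗ-congˡ (D-+ _ _ b)) (*ₗ-distribˡ _ _ _)
  D-+ g h (true ∷ b)  = ≈ᴹ-trans (+ᴹ-congˡ (*ₗ-congˡ (D-+ _ _ b)))
    (solve (P ∷ []) (_ ∷ _ ∷ _ ∷ _ ∷ [])
      (λ { (π ∷ []) (u ∷ v ∷ w ∷ y ∷ []) → (u ⊞ v) ⊞ π ⊡ (w ⊞ y) , (u ⊞ π ⊡ w) ⊞ (v ⊞ π ⊡ y) })
      (≈-refl , ≈-refl , ≈-refl , ≈-refl , tt))
    where open ModuleSolver W

  D-hom : ∀ {φ} → Linear W W φ → ∀ g b → φ (D g b) ≈ᴹ D (λ a → φ (g a)) b
  D-hom F g []          = f-0 F
  D-hom F g (false ∷ b) = ≈ᴹ-trans (f-* F _ _) (*ₗ-congˡ (D-hom F _ b))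
  D-hom F g (true ∷ b)  = ≈ᴹ-trans (f-+ F _ _) (+ᴹ-congˡ (≈ᴹ-trans (f-* F _ _) (*ₗ-congˡ (D-hom F _ b))))

  D-empty : ∀ g b → ones b ≡ 0 → D g b ≈ᴹ 0ᴹ
  D-empty g []          e = ≈ᴹ-refl
  D-empty g (false ∷ b) e = ≈ᴹ-trans (*ₗ-congˡ (D-empty _ b e)) (*ₗ-zeroʳ _)

  D^ : ℕ → (List Bool → Carrierᴹ) → List Bool → Carrierᴹ
  D^ zero    g = g
  D^ (suc d) g = D (D^ d g)

  D^-cong : ∀ d {g h} b → (∀ a → length a ≡ length b → g a ≈ᴹ h a) → D^ d g b ≈ᴹ D^ d h b
  D^-cong zero    b e = e b refl
  D^-cong (suc d) b e = D-cong b λ a l _ → D^-cong d a λ a′ l′ → e a′ (≡.trans l′ l)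

  D^-+ : ∀ d g h b → D^ d (λ a → g a +ᴹ h a) b ≈ᴹ D^ d g b +ᴹ D^ d h b
  D^-+ zero    g h b = ≈ᴹ-refl
  D^-+ (suc d) g h b = ≈ᴹ-trans (D-cong b λ a _ _ → D^-+ d g h a) (D-+ _ _ b)

  D^-hom : ∀ d {φ} → Linear W W φ → ∀ g b → φ (D^ d g b) ≈ᴹ D^ d (λ a → φ (g a)) b
  D^-hom zero    F g b = ≈ᴹ-refl
  D^-hom (suc d) F g b = ≈ᴹ-trans (D-hom F _ b) (D-cong b λ a _ _ → D^-hom d F g a)

  D^-suc : ∀ d g b → D^ d (D g) b ≈ᴹ D^ (suc d) g b
  D^-suc zero    g b = ≈ᴹ-refl
  D^-suc (suc d) g b = D-cong b λ a _ _ → D^-suc d g a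

  D^-false : ∀ d g b → D^ d g (false ∷ b) ≈ᴹ (Q ^ d) *ₗ D^ d (λ a → g (false ∷ a)) b
  D^-false zero    g b = ≈ᴹ-sym (*ₗ-identityˡ _)
  D^-false (suc d) g b = ≈ᴹ-trans
    (*ₗ-congˡ (≈ᴹ-trans (D-cong b λ a _ _ → D^-false d g a) (≈ᴹ-sym (D-hom (*-linear (Q ^ d) id-linear) _ b))))
    (≈ᴹ-sym (*ₗ-assoc _ _ _))

  -- Either all d removals pass the top bead, or one takes it. In the second case the earlier ones
  -- contribute a P and the later ones, which find a gap, a Q; summing over the position of the one
  -- that takes it gives `bracket d`.
  D^-true : ∀ d g b → D^ d g (true ∷ b) ≈ᴹ
    (P ^ d) *ₗ D^ d (λ a → g (true ∷ a)) b +ᴹ bracket d *ₗ D^ (ℕ.pred d) (λ a → g (false ∷ a)) b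
  D^-true zero    g b = ≈ᴹ-sym (≈ᴹ-trans (+ᴹ-cong (*ₗ-identityˡ _) (*ₗ-zeroˡ _)) (+ᴹ-identityʳ _))
  D^-true (suc d) g b = ≈ᴹ-trans
    (+ᴹ-cong (D^-false d g b) (*ₗ-congˡ (≈ᴹ-trans (D-cong b λ a _ _ → D^-true d g a) (≈ᴹ-trans (D-+ _ _ b)
      (+ᴹ-cong (≈ᴹ-sym (D-hom (*-linear (P ^ d) id-linear) _ b)) (≈ᴹ-sym (D-hom (*-linear (bracket d) id-linear) _ b)))))))
    (≈ᴹ-trans (+ᴹ-congˡ (*ₗ-congˡ (+ᴹ-congˡ (pred-suc d))))
    (solve (P ∷ P ^ d ∷ Q ^ d ∷ bracket d ∷ []) (_ ∷ _ ∷ [])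
      (λ { (π ∷ πᵈ ∷ κ ∷ β ∷ []) (u ∷ v ∷ []) →
           κ ⊡ u ⊞ π ⊡ (πᵈ ⊡ v ⊞ β ⊡ u) , (π :* πᵈ) ⊡ v ⊞ (π :* β :+ κ) ⊡ u })
      (≈-refl , ≈-refl , tt)))
    where
    open ModuleSolver W
    pred-suc : ∀ d → bracket d *ₗ D (D^ (ℕ.pred d) (λ a → g (false ∷ a))) b ≈ᴹ bracket d *ₗ D^ d (λ a → g (false ∷ a)) b
    pred-suc zero    = ≈ᴹ-trans (*ₗ-zeroˡ _) (≈ᴹ-sym (*ₗ-zeroˡ _))
    pred-suc (suc d) = ≈ᴹ-refl

  R-cong : ∀ i {g h} b → (∀ a → length a ≡ length b → ones a ≡ ones b → g a ≈ᴹ h a) → R i g b ≈ᴹ R i h b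
  R-cong i       []          e = ≈ᴹ-refl
  R-cong zero    (false ∷ b) e = +ᴹ-cong (R-cong zero b λ a l o → e _ (≡.cong suc l) o)
    (f-cong (C-linear _) (D-cong b λ a l o → e _ (≡.cong suc l) o))
  R-cong zero    (true ∷ b)  e = f-cong (X-linear _) (e _ refl refl)
  R-cong (suc i) (false ∷ b) e = R-cong (suc i) b λ a l o → e _ (≡.cong suc l) o
  R-cong (suc i) (true ∷ b)  e = R-cong i b λ a l o → e _ (≡.cong suc l) (≡.cong suc o)

  ∏R-cong : ∀ u {g h} b → (∀ a → length a ≡ length b → ones a ≡ ones b → g a ≈ᴹ h a) → ∏R u g b ≈ᴹ ∏R u h b
  ∏R-cong []      b e = e b refl refl
  ∏R-cong (i ∷ u) b e = +ᴹ-cong (∏R-cong u b e) (f-cong Z-linear (R-cong i b λ a l o →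
    ∏R-cong u a λ a′ l′ o′ → e a′ (≡.trans l′ l) (≡.trans o′ o)))

  ∏R-false : ∀ u g b → ∏R (map suc u) g (false ∷ b) ≈ᴹ ∏R (map suc u) (λ a → g (false ∷ a)) b
  ∏R-false []      g b = ≈ᴹ-refl
  ∏R-false (i ∷ u) g b = +ᴹ-cong (∏R-false u g b)
    (f-cong Z-linear (R-cong (suc i) b λ a _ _ → ∏R-false u g a))

  ∏R-true : ∀ u g b → ∏R (map suc u) g (true ∷ b) ≈ᴹ ∏R u (λ a → g (true ∷ a)) b
  ∏R-true []      g b = ≈ᴹ-refl
  ∏R-true (i ∷ u) g b = +ᴹ-cong (∏R-true u g b)
    (f-cong Z-linear (R-cong i b λ a _ _ → ∏R-true u g a))

  below : ℕ → List ℕ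
  below zero    = []
  below (suc k) = zero ∷ map suc (below k)

  -- R_i freezes the i top beads, so the product can be performed site by site.

  ∏R≈Pr : ∀ l b → length b ≡ l → ∀ g → ∏R (below (ones b)) g b ≈ᴹ Pr l g b
  ∏R≈Pr zero    []          e g = ≈ᴹ-refl
  ∏R≈Pr (suc l) (false ∷ b) e g with ones b in eq
  ... | zero  = ≈ᴹ-trans
          (≈ᴹ-trans (≡.subst (λ k → ∏R (below k) g₀ b ≈ᴹ Pr l g₀ b) eq (∏R≈Pr l b (ℕₚ.suc-injective e) g₀)) (≈ᴹ-sym (+ᴹ-identityʳ _)))
          (+ᴹ-congˡ (≈ᴹ-sym (≈ᴹ-trans (f-cong F (D-empty _ b eq)) (f-0 F))))
          where
          F = ∘-linear Z-linear (C-linear l)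
          g₀ = λ a → g (false ∷ a)
  ... | suc k = ≡.subst (λ j → ∏R (below (suc k)) g (false ∷ b) ≈ᴹ Pr l g₀ b +ᴹ Z (C j (D (Pr l g₁) b))) (ℕₚ.suc-injective e)
        (≈ᴹ-trans (+ᴹ-cong (∏R-false u g b) (≈ᴹ-trans (f-cong Z-linear (+ᴹ-cong
            (R-cong zero b λ a _ _ → ∏R-false u g a)
            (f-cong (C-linear _) (D-cong b λ a l′ o → ≈ᴹ-trans (∏R-true u g a)
              (≡.subst (λ k → ∏R (below k) g₁ a ≈ᴹ Pr l g₁ a) (ℕₚ.suc-injective (≡.trans o eq)) (∏R≈Pr l a (≡.trans l′ (ℕₚ.suc-injective e)) g₁))))))
          (f-+ Z-linear _ _)))
        (≈ᴹ-trans (≈ᴹ-sym (+ᴹ-assoc _ _ _))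
          (+ᴹ-congʳ (≡.subst (λ k → ∏R (below k) g₀ b ≈ᴹ Pr l g₀ b) eq (∏R≈Pr l b (ℕₚ.suc-injective e) g₀)))))
        where
        u = below k
        g₀ = λ a → g (false ∷ a)
        g₁ = λ a → g (true ∷ a)
  ∏R≈Pr (suc l) (true ∷ b)  e g rewrite ℕₚ.suc-injective e = f-cong (factor-linear _)
    (≈ᴹ-trans (∏R-true (below (ones b)) g b) (∏R≈Pr l b (ℕₚ.suc-injective e) _))

  private
    zero-hom : ∀ {φ} → Linear W W φ → 0ᴹ ≈ᴹ φ 0ᴹ
    zero-hom F = ≈ᴹ-sym (f-0 F)

    absorbʳ : ∀ {u v} → v ≈ᴹ 0ᴹ → u +ᴹ v ≈ᴹ u
    absorbʳ e = ≈ᴹ-trans (+ᴹ-congˡ e) (+ᴹ-identityʳ _)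

    absorbˡ : ∀ {u v} → v ≈ᴹ 0ᴹ → v +ᴹ u ≈ᴹ u
    absorbˡ e = ≈ᴹ-trans (+ᴹ-congʳ e) (+ᴹ-identityˡ _)

    vanish : ∀ {φ v} → Linear W W φ → v ≈ᴹ 0ᴹ → φ v ≈ᴹ 0ᴹ
    vanish F e = ≈ᴹ-trans (f-cong F e) (f-0 F)

  M-0 : ∀ d b → M d (λ _ → 0ᴹ) b ≈ᴹ 0ᴹ
  M-0 d b = ≈ᴹ-sym (M-hom S S (0-linear {M = W}) (λ _ → zero-hom Z-linear) d (λ _ → 0ᴹ) b λ j _ _ → zero-hom (X-linear j))

  D^-0 : ∀ d b → D^ d (λ _ → 0ᴹ) b ≈ᴹ 0ᴹ
  D^-0 d b = ≈ᴹ-sym (D^-hom d (0-linear {M = W}) (λ _ → 0ᴹ) b)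

  Pr-0 : ∀ l b → Pr l (λ _ → 0ᴹ) b ≈ᴹ 0ᴹ
  Pr-0 zero    b           = ≈ᴹ-refl
  Pr-0 (suc l) []          = ≈ᴹ-refl
  Pr-0 (suc l) (false ∷ b) = ≈ᴹ-trans (absorbʳ (vanish (∘-linear Z-linear (C-linear _))
    (≈ᴹ-trans (D-cong b λ a _ _ → Pr-0 l a) (D^-0 1 b)))) (Pr-0 l b)
  Pr-0 (suc l) (true ∷ b)  = vanish (factor-linear _) (Pr-0 l b)

  D^Pr-0 : ∀ d l b → D^ d (Pr l (λ _ → 0ᴹ)) b ≈ᴹ 0ᴹ
  D^Pr-0 d l b = ≈ᴹ-trans (D^-cong d b λ a _ → Pr-0 l a) (D^-0 d b)

  -- A Kronecker delta with value `e`. Used as the map `g` on strings it turns an operator into its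
  -- matrix entry at the first of the two strings.
  δ : Carrierᴹ → List Bool → List Bool → Carrierᴹ
  δ e []          []          = e
  δ e (false ∷ b) (false ∷ a) = δ e b a
  δ e (true ∷ b)  (true ∷ a)  = δ e b a
  δ e _           _           = 0ᴹ

  private
    D^Pr-false : ∀ d l g a → D^ d (Pr (suc l) g) (false ∷ a) ≈ᴹ
      (Q ^ d) *ₗ (D^ d (Pr l (λ b → g (false ∷ b))) a +ᴹ Z (C l (D^ (suc d) (Pr l (λ b → g (true ∷ b))) a)))
    D^Pr-false d l g a = ≈ᴹ-trans (D^-false d (Pr (suc l) g) a) (*ₗ-congˡ (≈ᴹ-trans (D^-+ d _ _ a)
      (+ᴹ-congˡ (≈ᴹ-trans (≈ᴹ-sym (D^-hom d ZC _ a)) (f-cong ZC (D^-suc d _ a))))))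
      where ZC = ∘-linear Z-linear (C-linear l)

    D^Pr-true : ∀ d l g a → D^ d (Pr (suc l) g) (true ∷ a) ≈ᴹ
      (P ^ d) *ₗ factor l (D^ d (Pr l (λ b → g (true ∷ b))) a)
        +ᴹ bracket d *ₗ (D^ (ℕ.pred d) (Pr l (λ b → g (false ∷ b))) a
                           +ᴹ Z (C l (D^ d (Pr l (λ b → g (true ∷ b))) a)))
    D^Pr-true d l g a = ≈ᴹ-trans (D^-true d (Pr (suc l) g) a) (+ᴹ-cong
      (*ₗ-congˡ (≈ᴹ-sym (D^-hom d (factor-linear l) _ a)))
      (≈ᴹ-trans (*ₗ-congˡ (≈ᴹ-trans (D^-+ (ℕ.pred d) _ _ a)
        (+ᴹ-congˡ (≈ᴹ-trans (≈ᴹ-sym (D^-hom (ℕ.pred d) ZC _ a)) (f-cong ZC (D^-suc (ℕ.pred d) _ a))))))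
        (last d)))
      where
      ZC = ∘-linear Z-linear (C-linear l)
      last : ∀ d → bracket d *ₗ (D^ (ℕ.pred d) (Pr l (λ b → g (false ∷ b))) a
                      +ᴹ Z (C l (D^ (suc (ℕ.pred d)) (Pr l (λ b → g (true ∷ b))) a)))
                 ≈ᴹ bracket d *ₗ (D^ (ℕ.pred d) (Pr l (λ b → g (false ∷ b))) a
                      +ᴹ Z (C l (D^ d (Pr l (λ b → g (true ∷ b))) a)))
      last zero    = ≈ᴹ-trans (*ₗ-zeroˡ _) (≈ᴹ-sym (*ₗ-zeroˡ _))
      last (suc d) = ≈ᴹ-refl

  module _ (P+N≈Q : P + N ≈ Q) where

    -- The quotient formula for `bracket` with the denominator cleared.
    bracket-N : ∀ d → bracket d * N + P ^ d ≈ Q ^ d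
    bracket-N zero    = trans (+-congʳ (zeroˡ N)) (+-identityˡ _)
    bracket-N (suc d) = trans
      (proveˢ (P ∷ N ∷ bracket d ∷ P ^ d ∷ Q ^ d ∷ []) ((π :* β :+ κ) :* ν :+ π :* πᵈ) (π :* (β :* ν :+ πᵈ) :+ ν :* κ) ≈-refl)
      (trans (+-congʳ (*-congˡ (bracket-N d))) (trans (sym (distribʳ _ _ _)) (*-congʳ P+N≈Q)))
      where
      π ν β πᵈ κ : Polynomial 5
      π = scalarVar zero
      ν = scalarVar (suc zero)
      β = scalarVar (suc (suc zero))
      πᵈ = scalarVar (suc (suc (suc zero)))
      κ = scalarVar (suc (suc (suc (suc zero))))

    A-split : ∀ d j v → A d j v ≈ᴹ (P ^ d) *ₗ factor j v +ᴹ bracket d *ₗ Z (C j v)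
    A-split d j v = ≈ᴹ-trans
      (+ᴹ-congˡ (≈ᴹ-trans (f-cong Z-linear (+ᴹ-congʳ (*ₗ-congʳ (sym (bracket-N d)))))
        (≈ᴹ-trans (f-cong Z-linear (solve (bracket d ∷ N ∷ P ^ d ∷ H ∷ []) (X j v ∷ v ∷ [])
          (λ { (β ∷ ν ∷ π ∷ η ∷ []) (y ∷ v ∷ []) →
               (β :* ν :+ π) ⊡ y ⊞ (η :* β) ⊡ v , π ⊡ y ⊞ β ⊡ (η ⊡ v ⊞ ν ⊡ y) })
          (≈-refl , ≈-refl , tt)))
          (≈ᴹ-trans (f-+ Z-linear _ _) (+ᴹ-cong (f-* Z-linear _ _) (f-* Z-linear _ _))))))
      (solve (P ^ d ∷ bracket d ∷ []) (v ∷ Z (X j v) ∷ Z (C j v) ∷ [])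
        (λ { (π ∷ β ∷ []) (v ∷ y ∷ w ∷ []) → π ⊡ v ⊞ (π ⊡ y ⊞ β ⊡ w) , π ⊡ (v ⊞ y) ⊞ β ⊡ w })
        (≈-refl , ≈-refl , ≈-refl , tt))
      where open ModuleSolver W

    -- `M` recurs on the output string `b`, `Pr` on the input string `a`; both are peeled at the top
    -- site and compared for the four possible pairs of contents. The d pending beads of `M` are the
    -- d removals that have passed the sites above and still have to act on `a`.
    M-δ : ∀ e d l b a → length b ≡ l → length a ≡ l → M d (λ b′ → δ e b′ a) b ≈ᴹ D^ d (Pr l (δ e b)) a
    M-δ e zero    zero    []          []          _ _ = ≈ᴹ-refl
    M-δ e (suc d) zero    []          []          _ _ = ≈ᴹ-refl
    M-δ e d       (suc l) (false ∷ b) (false ∷ a) refl l′ = ≈ᴹ-trans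
      (≈ᴹ-trans (absorbʳ (vanish (*-linear _ id-linear) (M-0 _ b))) (*ₗ-congˡ (M-δ e d l b a refl (ℕₚ.suc-injective l′))))
      (≈ᴹ-sym (≈ᴹ-trans (D^Pr-false d l _ a)
        (*ₗ-congˡ (absorbʳ (vanish (∘-linear Z-linear (C-linear _)) (D^Pr-0 (suc d) l a))))))
    M-δ e d       (suc l) (true ∷ b)  (false ∷ a) refl l′ = ≈ᴹ-trans
      (≈ᴹ-trans (absorbʳ (vanish (A-linear d _) (M-0 d b)))
        (≈ᴹ-trans (f-* Z-linear _ _)
          (*ₗ-congˡ (f-cong (∘-linear Z-linear (C-linear _)) (M-δ e (suc d) l b a refl (ℕₚ.suc-injective l′))))))
      (≈ᴹ-sym (≈ᴹ-trans (D^Pr-false d l _ a) (*ₗ-congˡ (absorbˡ (D^Pr-0 d l a)))))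
    M-δ e d       (suc l) (false ∷ b) (true ∷ a)  refl l′ = ≈ᴹ-trans
      (≈ᴹ-trans (absorbˡ (vanish (*-linear _ id-linear) (M-0 d b)))
        (*ₗ-congˡ (M-δ e (ℕ.pred d) l b a refl (ℕₚ.suc-injective l′))))
      (≈ᴹ-sym (≈ᴹ-trans (D^Pr-true d l _ a) (≈ᴹ-trans
        (absorbˡ (vanish (*-linear _ (factor-linear _)) (D^Pr-0 d l a)))
        (*ₗ-congˡ (absorbʳ (vanish (∘-linear Z-linear (C-linear _)) (D^Pr-0 d l a)))))))
    M-δ e d       (suc l) (true ∷ b)  (true ∷ a)  refl l′ = ≈ᴹ-trans
      (≈ᴹ-trans (absorbˡ (vanish (∘-linear Z-linear (*-linear _ (C-linear _))) (M-0 (suc d) b)))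
        (≈ᴹ-trans (f-cong (A-linear d _) (M-δ e d l b a refl (ℕₚ.suc-injective l′))) (A-split d _ _)))
      (≈ᴹ-sym (≈ᴹ-trans (D^Pr-true d l _ a) (+ᴹ-congˡ (*ₗ-congˡ (absorbˡ (D^Pr-0 (ℕ.pred d) l a))))))

module _ {c ℓc} (K : CommutativeRing c ℓc) {P Q N H : CommutativeRing.Carrier K}
  {m₁ ℓm₁ m₂ ℓm₂} {W₁ : LeftModule (CommutativeRing.ring K) m₁ ℓm₁} {W₂ : LeftModule (CommutativeRing.ring K) m₂ ℓm₂}
  (S₁ : Parameters.Operators K P Q N H W₁) (S₂ : Parameters.Operators K P Q N H W₂)
  {φ} (Φ : LinearAlgebra.Linear K W₁ W₂ φ) where

  private
    module S₁ = Parameters.Operators S₁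
    module S₂ = Parameters.Operators S₂
    module R₁ = RibbonOperators K S₁
    module R₂ = RibbonOperators K S₂
  open LeftModule W₂
  open LinearAlgebra.Linear Φ
  open LinearAlgebra.Linear using () renaming (f-cong to congruence)

  module _ (φ-X : ∀ j v → φ (S₁.X j v) ≈ᴹ S₂.X j (φ v)) where

    private
      D-φ : ∀ g b → φ (R₁.D g b) ≈ᴹ R₂.D (λ a → φ (g a)) b
      D-φ g []          = f-0
      D-φ g (false ∷ b) = ≈ᴹ-trans (f-* _ _) (*ₗ-congˡ (D-φ _ b))
      D-φ g (true ∷ b)  = ≈ᴹ-trans (f-+ _ _) (+ᴹ-congˡ (≈ᴹ-trans (f-* _ _) (*ₗ-congˡ (D-φ _ b))))

      C-φ : ∀ j v → φ (S₁.C j v) ≈ᴹ S₂.C j (φ v)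
      C-φ j v = ≈ᴹ-trans (f-+ _ _) (+ᴹ-cong (f-* _ _) (≈ᴹ-trans (f-* _ _) (*ₗ-congˡ (φ-X j v))))

    R-hom : ∀ i g b → φ (R₁.R i g b) ≈ᴹ R₂.R i (λ a → φ (g a)) b
    R-hom i       g []          = f-0
    R-hom zero    g (false ∷ b) = ≈ᴹ-trans (f-+ _ _) (+ᴹ-cong (R-hom zero _ b)
      (≈ᴹ-trans (C-φ _ _) (congruence (S₂.C-linear _) (D-φ _ b))))
    R-hom zero    g (true ∷ b)  = φ-X _ _
    R-hom (suc i) g (false ∷ b) = R-hom (suc i) _ b
    R-hom (suc i) g (true ∷ b)  = R-hom i _ b

    ∏R-hom : (∀ v → φ (S₁.Z v) ≈ᴹ S₂.Z (φ v)) →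
             ∀ u g b → φ (R₁.∏R u g b) ≈ᴹ R₂.∏R u (λ a → φ (g a)) b
    ∏R-hom φ-Z []      g b = ≈ᴹ-refl
    ∏R-hom φ-Z (i ∷ u) g b = ≈ᴹ-trans (f-+ _ _) (+ᴹ-cong (∏R-hom φ-Z u g b)
      (≈ᴹ-trans (φ-Z _) (congruence S₂.Z-linear (≈ᴹ-trans (R-hom i _ b)
        (R₂.R-cong i b λ a _ _ → ∏R-hom φ-Z u g a)))))

-- Partitions as strings, and the matrix entries of ribbon operators

-- The boundary path of the diagram from its upper right end, a gap for each column and a bead for
-- each row. As the remaining parts are bounded by `a`, the type of the tail supplies the number of
-- gaps that are left.
bits : ∀ {k m} → Partition k m → List Bool
bits {m = m} []      = replicate m false
bits {m = m} (a ∷ ν) = replicate (m ∸ toℕ a) false ++ true ∷ bits ν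

ones-zeros++ : ∀ z b → ones (replicate z false ++ b) ≡ ones b
ones-zeros++ zero    b = refl
ones-zeros++ (suc z) b = ones-zeros++ z b

zeros-zeros++ : ∀ z b → zeros (replicate z false ++ b) ≡ z ℕ.+ zeros b
zeros-zeros++ zero    b = refl
zeros-zeros++ (suc z) b = ≡.cong suc (zeros-zeros++ z b)

ones-bits : ∀ {k m} (ν : Partition k m) → ones (bits ν) ≡ k
ones-bits {m = m} []      = ≡.trans (≡.cong ones (≡.sym (Listₚ.++-identityʳ (replicate m false)))) (ones-zeros++ m [])
ones-bits {m = m} (a ∷ ν) = ≡.trans (ones-zeros++ (m ∸ toℕ a) _) (≡.cong suc (ones-bits ν))

zeros-bits : ∀ {k m} (ν : Partition k m) → zeros (bits ν) ≡ m
zeros-bits {m = m} []      = ≡.trans (≡.cong zeros (≡.sym (Listₚ.++-identityʳ (replicate m false))))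
  (≡.trans (zeros-zeros++ m []) (ℕₚ.+-identityʳ m))
zeros-bits {m = m} (a ∷ ν) = ≡.trans (zeros-zeros++ (m ∸ toℕ a) _)
  (≡.trans (≡.cong (m ∸ toℕ a ℕ.+_) (zeros-bits ν)) (ℕₚ.m∸n+n≡m (Finₚ.toℕ≤pred[n] a)))

length-bits : ∀ {k m} (ν : Partition k m) → length (bits ν) ≡ m ℕ.+ k
length-bits ν = ≡.trans (≡.sym (zeros+ones (bits ν))) (≡.cong₂ ℕ._+_ (zeros-bits ν) (ones-bits ν))

-- A gap on top widens the rectangle by one column and keeps the parts. The tail is transported
-- because its bound is `toℕ (inject₁ a)` instead of `toℕ a`.
lift-partition : ∀ {k m} (ν : Partition k m) → ∃[ ν′ ] bits {k} {suc m} ν′ ≡ false ∷ bits ν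
lift-partition []              = [] , refl
lift-partition {suc k} {m} (a ∷ ν) = lifted (toℕ (inject₁ a)) (Finₚ.toℕ-inject₁ a) refl
  where
  lifted : ∀ c → c ≡ toℕ a → toℕ (inject₁ a) ≡ c → ∃[ ν′ ] bits {suc k} {suc m} ν′ ≡ false ∷ bits (a ∷ ν)
  lifted c refl e = inject₁ a ∷ ≡.subst (Partition k) (≡.sym e) ν , ≡.trans
    (≡.cong₂ (λ z b → replicate z false ++ true ∷ b)
      (≡.trans (≡.cong (suc m ∸_) e) (ℕₚ.+-∸-assoc 1 (Finₚ.toℕ≤pred[n] a))) (transport e))
    refl
    where
    transport : ∀ {c} (e : c ≡ toℕ a) → bits (≡.subst (Partition k) (≡.sym e) ν) ≡ bits ν
    transport refl = refl

bits-surjective : ∀ {k m} b → ones b ≡ k → zeros b ≡ m → ∃[ ν ] bits {k} {m} ν ≡ b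
bits-surjective []          refl refl = [] , refl
bits-surjective (false ∷ b) refl refl with bits-surjective b refl refl
... | ν , e with lift-partition ν
...   | ν′ , e′ = ν′ , ≡.trans e′ (≡.cong (false ∷_) e)
bits-surjective (true ∷ b)  refl refl with bits-surjective b refl refl
... | ν , e = top (toℕ (fromℕ (zeros b))) (Finₚ.toℕ-fromℕ (zeros b)) refl
  where
  top : ∀ c → c ≡ zeros b → toℕ (fromℕ (zeros b)) ≡ c → ∃[ ν′ ] bits {suc (ones b)} {zeros b} ν′ ≡ true ∷ b
  top c refl e₂ = fromℕ (zeros b) ∷ ≡.subst (Partition (ones b)) (≡.sym e₂) ν ,
    ≡.cong₂ (λ z b → replicate z false ++ true ∷ b)
      (≡.trans (≡.cong (zeros b ∸_) e₂) (ℕₚ.n∸n≡0 (zeros b))) (≡.trans (transport e₂) e)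
    where
    transport : ∀ {c} (e : c ≡ zeros b) → bits (≡.subst (Partition (ones b)) (≡.sym e) ν) ≡ bits ν
    transport refl = refl

-- Tails of two partitions have different types when the first parts differ, so they are compared by
-- their parts alone.
SameParts : ∀ {k m m′} → Partition k m → Partition k m′ → Set
SameParts μ ν = ∀ r → part μ r ≡ part ν r

sameParts? : ∀ {k m m′} (μ : Partition k m) (ν : Partition k m′) → Dec (SameParts μ ν)
sameParts? μ ν = Finₚ.all? λ r → part μ r ℕₚ.≟ part ν r

sameParts⇒≡ : ∀ {k m} {μ ν : Partition k m} → SameParts μ ν → μ ≡ ν
sameParts⇒≡ {μ = []}    {[]}    e = refl
sameParts⇒≡ {μ = a ∷ μ} {b ∷ ν} e with Finₚ.toℕ-injective (e zero)
... | refl = ≡.cong (a ∷_) (sameParts⇒≡ λ r → e (suc r))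

-- Ribbons a′ ∷ μ / a ∷ ν with head in the first row; the two numbers are one
-- less than the numbers of rows and columns.

data Strip₀ : ∀ {k} (a′ : ℕ) → Partition k a′ → (a : ℕ) → Partition k a → ℕ → ℕ → Set where
  stop : ∀ {k a′ a} {μ : Partition k a′} {ν : Partition k a} → a < a′ → SameParts μ ν →
         Strip₀ a′ μ a ν 0 (a′ ∸ suc a)
  further   : ∀ {k a′ a b′ b h w} {μ : Partition k (toℕ b′)} {ν : Partition k (toℕ b)} → a < a′ → toℕ b′ ≡ suc a →
         Strip₀ (toℕ b′) μ (toℕ b) ν h w → Strip₀ a′ (b′ ∷ μ) a (b ∷ ν) (suc h) ((a′ ∸ suc a) ℕ.+ w)

data Strip : ∀ {k m} → Fin k → Partition k m → Partition k m → ℕ → ℕ → Set where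
  here  : ∀ {k m} {a′ a : Fin (suc m)} {μ : Partition k (toℕ a′)} {ν : Partition k (toℕ a)} {h w} →
          Strip₀ (toℕ a′) μ (toℕ a) ν h w → Strip zero (a′ ∷ μ) (a ∷ ν) h w
  there : ∀ {k m i} {a : Fin (suc m)} {μ ν : Partition k (toℕ a)} {h w} →
          Strip i μ ν h w → Strip (suc i) (a ∷ μ) (a ∷ ν) h w

strip₀-< : ∀ {k a′ a h w} {μ : Partition k a′} {ν : Partition k a} → Strip₀ a′ μ a ν h w → a < a′
strip₀-< (stop lt _)   = lt
strip₀-< (further lt _ _)   = lt

position : ∀ {k m} → Partition k m → Fin k → ℕ
position ν i = part ν i ℕ.+ toℕ (opposite i)

module RibbonEntries {c ℓc} (K : CommutativeRing c ℓc) {P Q N H : CommutativeRing.Carrier K}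
  {m ℓm} {W : LeftModule (CommutativeRing.ring K) m ℓm} (S : Parameters.Operators K P Q N H W)
  (e : LeftModule.Carrierᴹ W) where

  open CommutativeRing K hiding (zero) renaming (refl to ≈-refl)
  open LinearAlgebra K
  open Parameters K P Q N H
  open LeftModule W
  open Operators S
  open RibbonOperators K S
  open Linear

  private
    δₑ = δ e

    0^_ : ℕ → List Bool
    0^ z = replicate z false

  δ-refl : ∀ b → δₑ b b ≡ e
  δ-refl []          = refl
  δ-refl (false ∷ b) = δ-refl b
  δ-refl (true ∷ b)  = δ-refl b

  δ-prefix : ∀ z b a → δₑ (0^ z ++ b) (0^ z ++ a) ≡ δₑ b a
  δ-prefix zero    b a = refl
  δ-prefix (suc z) b a = δ-prefix z b a

  δ-prefix≢ : ∀ x′ y b a → x′ ≢ y → δₑ (0^ x′ ++ true ∷ b) (0^ y ++ true ∷ a) ≡ 0ᴹ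
  δ-prefix≢ zero    zero    b a x′≢y = ⊥-elim (x′≢y refl)
  δ-prefix≢ zero    (suc y) b a x′≢y = refl
  δ-prefix≢ (suc x′) zero    b a x′≢y = refl
  δ-prefix≢ (suc x′) (suc y) b a x′≢y = δ-prefix≢ x′ y b a (λ e → x′≢y (≡.cong suc e))

  private
    0^-+ : ∀ x′ y b → 0^ x′ ++ (0^ y ++ b) ≡ 0^ (x′ ℕ.+ y) ++ b
    0^-+ zero    y b = refl
    0^-+ (suc x′) y b = ≡.cong (false ∷_) (0^-+ x′ y b)

    0^-[] : ∀ x′ m → 0^ x′ ++ 0^ m ≡ 0^ (x′ ℕ.+ m)
    0^-[] zero    m = refl
    0^-[] (suc x′) m = ≡.cong (false ∷_) (0^-[] x′ m)

    pad : ∀ x′ {k m} (a : Fin (suc m)) (ν : Partition k (toℕ a)) →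
          0^ x′ ++ bits (a ∷ ν) ≡ 0^ (x′ ℕ.+ (m ∸ toℕ a)) ++ true ∷ bits ν
    pad x′ {m = m} a ν = 0^-+ x′ (m ∸ toℕ a) _

    gaps : ∀ x′ {m} (a : Fin (suc m)) → x′ ℕ.+ (m ∸ toℕ a) ℕ.+ toℕ a ≡ x′ ℕ.+ m
    gaps x′ {m} a = ≡.trans (ℕₚ.+-assoc x′ _ _) (≡.cong (x′ ℕ.+_) (ℕₚ.m∸n+n≡m (Finₚ.toℕ≤pred[n] a)))

    gaps-≡ : ∀ x′ y {m m′} (a : Fin (suc m)) (b : Fin (suc m′)) → x′ ℕ.+ m ≡ y ℕ.+ m′ → toℕ a ≡ toℕ b →
             x′ ℕ.+ (m ∸ toℕ a) ≡ y ℕ.+ (m′ ∸ toℕ b)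
    gaps-≡ x′ y {m} {m′} a b l e = ℕₚ.+-cancelʳ-≡ (toℕ a) _ _ (≡.trans (gaps x′ a)
      (≡.trans l (≡.trans (≡.sym (gaps y b)) (≡.cong (y ℕ.+ (m′ ∸ toℕ b) ℕ.+_) (≡.sym e)))))

    gaps-≢ : ∀ x′ y {m m′} (a : Fin (suc m)) (b : Fin (suc m′)) → x′ ℕ.+ m ≡ y ℕ.+ m′ → toℕ a ≢ toℕ b →
             x′ ℕ.+ (m ∸ toℕ a) ≢ y ℕ.+ (m′ ∸ toℕ b)
    gaps-≢ x′ y {m} {m′} a b l a≢b e = a≢b (ℕₚ.+-cancelˡ-≡ (x′ ℕ.+ (m ∸ toℕ a)) _ _ (≡.trans (gaps x′ a)
      (≡.trans l (≡.trans (≡.sym (gaps y b)) (≡.cong (ℕ._+ toℕ b) (≡.sym e))))))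

  -- The leading gaps `x′` and `y` make up for the different bounds m and m′, so that the two
  -- strings have equally many gaps.
  δ-same : ∀ x′ y {k m m′} (μ : Partition k m) (ν : Partition k m′) → x′ ℕ.+ m ≡ y ℕ.+ m′ → SameParts μ ν →
           δₑ (0^ x′ ++ bits μ) (0^ y ++ bits ν) ≡ e
  δ-same x′ y {m = m} {m′} [] [] l s rewrite 0^-[] x′ m | 0^-[] y m′ | l = δ-refl (0^ (y ℕ.+ m′))
  δ-same x′ y {m = m} {m′} (a ∷ μ) (b ∷ ν) l s rewrite pad x′ a μ | pad y b ν | gaps-≡ x′ y a b l (s zero) =
    ≡.trans (δ-prefix (y ℕ.+ (m′ ∸ toℕ b)) _ _) (δ-same 0 0 μ ν (s zero) (λ r → s (suc r)))

  δ-different : ∀ x′ y {k m m′} (μ : Partition k m) (ν : Partition k m′) → x′ ℕ.+ m ≡ y ℕ.+ m′ → ¬ SameParts μ ν →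
                δₑ (0^ x′ ++ bits μ) (0^ y ++ bits ν) ≡ 0ᴹ
  δ-different x′ y [] [] l s = ⊥-elim (s λ ())
  δ-different x′ y {m = m} {m′} (a ∷ μ) (b ∷ ν) l s rewrite pad x′ a μ | pad y b ν with toℕ a ℕₚ.≟ toℕ b
  ... | no a≢b = δ-prefix≢ _ _ _ _ (gaps-≢ x′ y a b l a≢b)
  ... | yes a≡b rewrite gaps-≡ x′ y a b l a≡b = ≡.trans (δ-prefix (y ℕ.+ (m′ ∸ toℕ b)) _ _)
    (δ-different 0 0 μ ν a≡b λ s′ → s λ { zero → a≡b ; (suc r) → s′ r })

  D-0 : ∀ b → D (λ _ → 0ᴹ) b ≈ᴹ 0ᴹ
  D-0 = D^-0 1

  private
    D-zeros : ∀ u g b → D g (0^ u ++ b) ≈ᴹ (Q ^ u) *ₗ D (λ a → g (0^ u ++ a)) b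
    D-zeros zero    g b = ≈ᴹ-sym (*ₗ-identityˡ _)
    D-zeros (suc u) g b = ≈ᴹ-trans (*ₗ-congˡ (D-zeros u _ b)) (≈ᴹ-sym (*ₗ-assoc _ _ _))

    D-first : ∀ u g b → D g (0^ u ++ true ∷ b) ≈ᴹ
      (Q ^ u) *ₗ (g (0^ suc u ++ b) +ᴹ P *ₗ D (λ a → g (0^ u ++ true ∷ a)) b)
    D-first u g b = ≈ᴹ-trans (D-zeros u g _) (*ₗ-congˡ (+ᴹ-congʳ (≈ᴹ-reflexive (≡.cong g (shuffle u)))))
      where
      shuffle : ∀ u → 0^ u ++ false ∷ b ≡ false ∷ 0^ u ++ b
      shuffle zero    = refl
      shuffle (suc u) = ≡.cong (false ∷_) (shuffle u)

    onlyˡ : ∀ {s u v u′} → u ≈ᴹ u′ → v ≈ᴹ 0ᴹ → s *ₗ (u +ᴹ P *ₗ v) ≈ᴹ s *ₗ u′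
    onlyˡ e₁ e₂ = *ₗ-congˡ (≈ᴹ-trans (+ᴹ-cong e₁ (≈ᴹ-trans (*ₗ-congˡ e₂) (*ₗ-zeroʳ _))) (+ᴹ-identityʳ _))

    onlyʳ : ∀ {s u v v′} → u ≈ᴹ 0ᴹ → v ≈ᴹ v′ → s *ₗ (u +ᴹ P *ₗ v) ≈ᴹ s *ₗ P *ₗ v′
    onlyʳ e₁ e₂ = *ₗ-congˡ (≈ᴹ-trans (+ᴹ-cong e₁ (*ₗ-congˡ e₂)) (+ᴹ-identityˡ _))

  data Removal {k} (a′ : ℕ) (μ : Partition k a′) (a : ℕ) (ν : Partition k a) (v : Carrierᴹ) : Set ℓm where
    strip : ∀ {h w} → Strip₀ a′ μ a ν h w → v ≈ᴹ (P ^ h) *ₗ (Q ^ w) *ₗ e → Removal a′ μ a ν v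
    none  : (∀ h w → ¬ Strip₀ a′ μ a ν h w) → v ≈ᴹ 0ᴹ → Removal a′ μ a ν v

  -- The new bead stands above the displayed string. If the first bead below it is taken away, the
  -- ribbon ends in this row. If that bead is passed, it becomes the next row of the result with one
  -- more gap below it, because a bead further down turns into a gap; hence the condition b′ = a + 1
  -- in `further`.
  D-entry : ∀ {k} a′ (μ : Partition k a′) a (ν : Partition k a) → a < a′ →
            Removal a′ μ a ν (D (δₑ (bits μ)) (0^ (a′ ∸ suc a) ++ true ∷ bits ν))
  D-entry a′ [] a [] a<a′ = strip (stop a<a′ λ ()) (≈ᴹ-trans (D-first u _ _) (≈ᴹ-trans
    (onlyˡ (≈ᴹ-reflexive (δ-same 0 (suc u) [] [] balance λ ())) (≈ᴹ-trans (D-cong (0^ a) (λ x′ _ _ → ≈ᴹ-reflexive (bead a′ u x′))) (D-0 (0^ a))))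
    (≈ᴹ-sym (*ₗ-identityˡ _))))
    where
    u = a′ ∸ suc a
    balance : a′ ≡ suc u ℕ.+ a
    balance = ≡.sym (≡.trans (≡.sym (ℕₚ.+-suc u a)) (ℕₚ.m∸n+n≡m a<a′))
    bead : ∀ y u x′ → δₑ (0^ y) (0^ u ++ true ∷ x′) ≡ 0ᴹ
    bead zero    zero    x′ = refl
    bead zero    (suc u) x′ = refl
    bead (suc y) zero    x′ = refl
    bead (suc y) (suc u) x′ = bead y u x′
  D-entry a′ (b′ ∷ μ) a (b ∷ ν) a<a′ with toℕ b′ ℕₚ.≟ suc a
  -- Here the bead must be passed: if it were taken away, the next bead would have part b, but b ≤ a
  -- < b′.
  ... | yes b′≡ = step (D-entry (toℕ b′) μ (toℕ b) ν b<b′)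
    where
    u = a′ ∸ suc a
    z≡ : a′ ∸ toℕ b′ ≡ u
    z≡ = ≡.cong (a′ ∸_) b′≡
    b<b′ : toℕ b < toℕ b′
    b<b′ = ℕₚ.≤-trans (s≤s (Finₚ.toℕ≤pred[n] b)) (ℕₚ.≤-reflexive (≡.sym b′≡))
    v = D (δₑ (bits (b′ ∷ μ))) (0^ u ++ true ∷ bits (b ∷ ν))
    v′ = D (δₑ (bits μ)) (0^ (toℕ b′ ∸ suc (toℕ b)) ++ true ∷ bits ν)
    different : ¬ SameParts (b′ ∷ μ) (b ∷ ν)
    different s = ℕₚ.<⇒≢ b<b′ (≡.sym (s zero))
    value : v ≈ᴹ (Q ^ u) *ₗ P *ₗ v′
    value = ≈ᴹ-trans (D-first u _ _) (onlyʳ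
      (≈ᴹ-reflexive (δ-different 0 (suc u) (b′ ∷ μ) (b ∷ ν)
        (≡.sym (≡.trans (≡.sym (ℕₚ.+-suc u a)) (ℕₚ.m∸n+n≡m a<a′))) different))
      (≈ᴹ-trans
        (D-cong (bits (b ∷ ν)) λ x′ _ _ → ≈ᴹ-reflexive (≡.trans
          (≡.cong (λ z → δₑ (0^ z ++ true ∷ bits μ) (0^ u ++ true ∷ x′)) z≡) (δ-prefix u _ _)))
        (≈ᴹ-reflexive (≡.cong (λ z → D (δₑ (bits μ)) (0^ (z ∸ suc (toℕ b)) ++ true ∷ bits ν)) (≡.sym b′≡)))))
    step : Removal (toℕ b′) μ (toℕ b) ν v′ → Removal a′ (b′ ∷ μ) a (b ∷ ν) v
    step (strip {h} {w} s e′) = strip (further a<a′ b′≡ s) (≈ᴹ-trans value (≈ᴹ-trans (*ₗ-congˡ (*ₗ-congˡ e′))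
      (≈ᴹ-trans
        (solve (P ∷ P ^ h ∷ Q ^ u ∷ Q ^ w ∷ []) (e ∷ [])
          (λ { (π ∷ πʰ ∷ κᵘ ∷ κʷ ∷ []) (v ∷ []) → κᵘ ⊡ π ⊡ πʰ ⊡ κʷ ⊡ v , (π :* πʰ) ⊡ (κᵘ :* κʷ) ⊡ v }) (≈-refl , tt))
        (*ₗ-congˡ (*ₗ-congʳ (sym (Exp.^-homo-* semiring Q u w)))))))
      where open ModuleSolver W
    step (none ¬s e′) = none
      (λ { _ _ (stop _ s) → different s ; _ _ (further _ _ s) → ¬s _ _ s })
      (≈ᴹ-trans value (≈ᴹ-trans (*ₗ-congˡ (≈ᴹ-trans (*ₗ-congˡ e′) (*ₗ-zeroʳ _))) (*ₗ-zeroʳ _)))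
  ... | no b′≢ = step (sameParts? (b′ ∷ μ) (b ∷ ν))
    where
    u = a′ ∸ suc a
    b′≤a′ = Finₚ.toℕ≤pred[n] b′
    balance : a′ ≡ suc u ℕ.+ a
    balance = ≡.sym (≡.trans (≡.sym (ℕₚ.+-suc u a)) (ℕₚ.m∸n+n≡m a<a′))
    z≢ : a′ ∸ toℕ b′ ≢ u
    z≢ e = b′≢ (ℕₚ.∸-cancelˡ-≡ b′≤a′ a<a′ e)
    v = D (δₑ (bits (b′ ∷ μ))) (0^ u ++ true ∷ bits (b ∷ ν))
    value : v ≈ᴹ (Q ^ u) *ₗ δₑ (bits (b′ ∷ μ)) (0^ suc u ++ bits (b ∷ ν))
    value = ≈ᴹ-trans (D-first u _ _) (onlyˡ ≈ᴹ-refl (≈ᴹ-trans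
      (D-cong (bits (b ∷ ν)) λ x′ _ _ → ≈ᴹ-reflexive (δ-prefix≢ (a′ ∸ toℕ b′) u _ _ z≢)) (D-0 (bits (b ∷ ν)))))
    step : Dec (SameParts (b′ ∷ μ) (b ∷ ν)) → Removal a′ (b′ ∷ μ) a (b ∷ ν) v
    step (yes s) = strip (stop a<a′ s) (≈ᴹ-trans value (≈ᴹ-trans
      (*ₗ-congˡ (≈ᴹ-reflexive (δ-same 0 (suc u) (b′ ∷ μ) (b ∷ ν) balance s))) (≈ᴹ-sym (*ₗ-identityˡ _))))
    step (no ¬s) = none (λ { _ _ (stop _ s) → ¬s s ; _ _ (further _ b′≡ _) → b′≢ b′≡ })
      (≈ᴹ-trans value (≈ᴹ-trans (*ₗ-congˡ (≈ᴹ-reflexive (δ-different 0 (suc u) (b′ ∷ μ) (b ∷ ν) balance ¬s))) (*ₗ-zeroʳ _)))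

  R-0 : ∀ i b → R i (λ _ → 0ᴹ) b ≈ᴹ 0ᴹ
  R-0 i       []          = ≈ᴹ-refl
  R-0 zero    (false ∷ b) = ≈ᴹ-trans (+ᴹ-cong (R-0 zero b) (≈ᴹ-trans (f-cong (C-linear _) (D-0 b)) (f-0 (C-linear _))))
    (+ᴹ-identityˡ _)
  R-0 zero    (true ∷ b)  = f-0 (X-linear _)
  R-0 (suc i) (false ∷ b) = R-0 (suc i) b
  R-0 (suc i) (true ∷ b)  = R-0 i b

  private
    R-suc : ∀ i z g b → R (suc i) g (0^ z ++ true ∷ b) ≡ R i (λ a → g (0^ z ++ true ∷ a)) b
    R-suc i zero    g b = refl
    R-suc i (suc z) g b = R-suc i z _ b

    plus-0ˡ : ∀ {u v w} → u ≈ᴹ 0ᴹ → v ≈ᴹ w → u +ᴹ v ≈ᴹ w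
    plus-0ˡ e₁ e₂ = ≈ᴹ-trans (+ᴹ-cong e₁ e₂) (+ᴹ-identityˡ _)

    plus-C0 : ∀ {u v w} j → u ≈ᴹ w → v ≈ᴹ 0ᴹ → u +ᴹ C j v ≈ᴹ w
    plus-C0 j e₁ e₂ = ≈ᴹ-trans (+ᴹ-cong e₁ (≈ᴹ-trans (f-cong (C-linear j) e₂) (f-0 (C-linear j)))) (+ᴹ-identityʳ _)

    R-same : ∀ z b′ b → R 0 (δₑ (0^ z ++ true ∷ b′)) (0^ z ++ true ∷ b) ≈ᴹ X (length b) (δₑ b′ b)
    R-same zero    b′ b = ≈ᴹ-refl
    R-same (suc z) b′ b = plus-C0 _ (R-same z b′ b) (D-0 (0^ z ++ true ∷ b))

    R-lower : ∀ z u b′ b → R 0 (δₑ (0^ z ++ true ∷ b′)) (0^ (z ℕ.+ suc u) ++ true ∷ b) ≈ᴹ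
              C (length (0^ u ++ true ∷ b)) (D (δₑ b′) (0^ u ++ true ∷ b))
    R-lower zero    u b′ b = plus-0ˡ (R-0 0 (0^ u ++ true ∷ b)) ≈ᴹ-refl
    R-lower (suc z) u b′ b = plus-C0 _ (R-lower z u b′ b) (D-0 (0^ (z ℕ.+ suc u) ++ true ∷ b))

    R-higher : ∀ z u b′ b → R 0 (δₑ (0^ (z ℕ.+ suc u) ++ true ∷ b′)) (0^ z ++ true ∷ b) ≈ᴹ 0ᴹ
    R-higher zero    u b′ b = f-0 (X-linear _)
    R-higher (suc z) u b′ b = plus-C0 _ (R-higher z u b′ b) (D-0 (0^ z ++ true ∷ b))

  data Entry {k l} (i : Fin k) (μ ν : Partition k l) (v : Carrierᴹ) : Set ℓm where
    same  : μ ≡ ν → v ≈ᴹ X (position ν i) e → Entry i μ ν v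
    strip : ∀ {h w} → Strip i μ ν h w → v ≈ᴹ C (position μ i) ((P ^ h) *ₗ (Q ^ w) *ₗ e) → Entry i μ ν v
    none  : μ ≢ ν → (∀ h w → ¬ Strip i μ ν h w) → v ≈ᴹ 0ᴹ → Entry i μ ν v

  -- The rows above i have to agree. In row i, a bead that has not moved gives the diagonal entry,
  -- one that has moved up leads to `D-entry`, and none can have moved down.
  R-entry : ∀ {k l} (i : Fin k) (μ ν : Partition k l) → Entry i μ ν (R (toℕ i) (δₑ (bits μ)) (bits ν))
  R-entry {suc k} {l} zero (a′ ∷ μ) (a ∷ ν) with ℕₚ.<-cmp (toℕ a) (toℕ a′)
  ... | tri≈ _ a≡a′ _ with Finₚ.toℕ-injective a≡a′
  ...   | refl = step (sameParts? μ ν)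
    where
    value = R-same (l ∸ toℕ a) (bits μ) (bits ν)
    step : Dec (SameParts μ ν) → _
    step (yes s) = same (≡.cong (a ∷_) (sameParts⇒≡ s)) (≈ᴹ-trans value (≈ᴹ-trans
      (f-cong (X-linear _) (≈ᴹ-reflexive (δ-same 0 0 μ ν refl s)))
      (≈ᴹ-reflexive (≡.cong (λ j → X j e) (≡.trans (length-bits ν) (≡.cong (toℕ a ℕ.+_) (≡.sym (Finₚ.toℕ-fromℕ k))))))))
    step (no ¬s) = none (λ { refl → ¬s λ _ → refl }) (λ { _ _ (here s) → ℕₚ.<-irrefl refl (strip₀-< s) })
      (≈ᴹ-trans value (≈ᴹ-trans (f-cong (X-linear _) (≈ᴹ-reflexive (δ-different 0 0 μ ν refl ¬s))) (f-0 (X-linear _))))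
  R-entry {suc k} {l} zero (a′ ∷ μ) (a ∷ ν) | tri< a<a′ _ _ = step (D-entry (toℕ a′) μ (toℕ a) ν a<a′)
    where
    u = toℕ a′ ∸ suc (toℕ a)
    a′≤l = Finₚ.toℕ≤pred[n] a′
    z≡ : l ∸ toℕ a ≡ (l ∸ toℕ a′) ℕ.+ suc u
    z≡ = ℕₚ.+-cancelʳ-≡ (toℕ a) _ _ (≡.trans (ℕₚ.m∸n+n≡m (Finₚ.toℕ≤pred[n] a))
      (≡.sym (≡.trans (ℕₚ.+-assoc (l ∸ toℕ a′) (suc u) (toℕ a)) (≡.trans (≡.cong ((l ∸ toℕ a′) ℕ.+_)
        (≡.trans (≡.sym (ℕₚ.+-suc u (toℕ a))) (ℕₚ.m∸n+n≡m a<a′))) (ℕₚ.m∸n+n≡m a′≤l)))))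
    position≡ : length (0^ u ++ true ∷ bits ν) ≡ position (a′ ∷ μ) zero
    position≡ = ≡.trans (Listₚ.length-++ (0^ u)) (≡.trans
      (≡.cong₂ ℕ._+_ (Listₚ.length-replicate u) (≡.cong suc (length-bits ν)))
      (≡.trans (≡.sym (ℕₚ.+-assoc u (suc (toℕ a)) k))
        (≡.cong₂ ℕ._+_ (ℕₚ.m∸n+n≡m a<a′) (≡.sym (Finₚ.toℕ-fromℕ k)))))
    value : R 0 (δₑ (bits (a′ ∷ μ))) (bits (a ∷ ν)) ≈ᴹ
            C (position (a′ ∷ μ) zero) (D (δₑ (bits μ)) (0^ u ++ true ∷ bits ν))
    value = ≈ᴹ-trans (≈ᴹ-reflexive (≡.cong (λ z → R 0 (δₑ (bits (a′ ∷ μ))) (0^ z ++ true ∷ bits ν)) z≡))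
      (≈ᴹ-trans (R-lower (l ∸ toℕ a′) u (bits μ) (bits ν)) (≈ᴹ-reflexive (≡.cong (λ j → C j (D (δₑ (bits μ)) (0^ u ++ true ∷ bits ν))) position≡)))
    step : Removal (toℕ a′) μ (toℕ a) ν _ → _
    step (strip s e′) = strip (here s) (≈ᴹ-trans value (f-cong (C-linear _) e′))
    step (none ¬s e′) = none (λ { refl → ℕₚ.<-irrefl refl a<a′ }) (λ { _ _ (here s) → ¬s _ _ s })
      (≈ᴹ-trans value (≈ᴹ-trans (f-cong (C-linear _) e′) (f-0 (C-linear _))))
  R-entry {suc k} {l} zero (a′ ∷ μ) (a ∷ ν) | tri> a≮a′ a≢a′ a′<a =
    none (λ { refl → a≢a′ refl }) (λ { _ _ (here s) → a≮a′ (strip₀-< s) })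
      (≈ᴹ-trans (≈ᴹ-reflexive (≡.cong (λ z → R 0 (δₑ (0^ z ++ true ∷ bits μ)) (bits (a ∷ ν))) z≡))
        (R-higher (l ∸ toℕ a) (toℕ a ∸ suc (toℕ a′)) (bits μ) (bits ν)))
    where
    z≡ : l ∸ toℕ a′ ≡ (l ∸ toℕ a) ℕ.+ suc (toℕ a ∸ suc (toℕ a′))
    z≡ = ℕₚ.+-cancelʳ-≡ (toℕ a′) _ _ (≡.trans (ℕₚ.m∸n+n≡m (Finₚ.toℕ≤pred[n] a′))
      (≡.sym (≡.trans (ℕₚ.+-assoc (l ∸ toℕ a) _ (toℕ a′)) (≡.trans (≡.cong ((l ∸ toℕ a) ℕ.+_)
        (≡.trans (≡.sym (ℕₚ.+-suc _ (toℕ a′))) (ℕₚ.m∸n+n≡m a′<a))) (ℕₚ.m∸n+n≡m (Finₚ.toℕ≤pred[n] a))))))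
  R-entry {suc k} {l} (suc i) (a′ ∷ μ) (a ∷ ν) with a′ Finₚ.≟ a
  ... | no a′≢a = none (λ { refl → a′≢a refl }) (λ { _ _ (there s) → a′≢a refl })
    (≈ᴹ-trans (≈ᴹ-reflexive (R-suc (toℕ i) (l ∸ toℕ a) _ (bits ν)))
      (≈ᴹ-trans (R-cong (toℕ i) (bits ν) λ x′ _ _ → ≈ᴹ-reflexive (δ-prefix≢ _ (l ∸ toℕ a) _ x′
        λ e → a′≢a (Finₚ.toℕ-injective (ℕₚ.∸-cancelˡ-≡ (Finₚ.toℕ≤pred[n] a′) (Finₚ.toℕ≤pred[n] a) e))))
        (R-0 (toℕ i) (bits ν))))
  ... | yes refl = step (R-entry i μ ν)
    where
    value : R (suc (toℕ i)) (δₑ (bits (a ∷ μ))) (bits (a ∷ ν)) ≈ᴹ R (toℕ i) (δₑ (bits μ)) (bits ν)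
    value = ≈ᴹ-trans (≈ᴹ-reflexive (R-suc (toℕ i) (l ∸ toℕ a) _ (bits ν)))
      (R-cong (toℕ i) (bits ν) λ x′ _ _ → ≈ᴹ-reflexive (δ-prefix (l ∸ toℕ a) _ _))
    position≡ : ∀ (ν : Partition k (toℕ a)) → position ν i ≡ position (a ∷ ν) (suc i)
    position≡ ν = ≡.cong (part ν i ℕ.+_) (≡.sym (Finₚ.toℕ-inject₁ (opposite i)))
    step : Entry i μ ν _ → _
    step (same μ≡ν e′)     = same (≡.cong (a ∷_) μ≡ν) (≈ᴹ-trans value (≈ᴹ-trans e′ (≈ᴹ-reflexive (≡.cong (λ j → X j e) (position≡ ν)))))
    step (strip {h} {w} s e′) = strip (there s) (≈ᴹ-trans value (≈ᴹ-trans e′ (≈ᴹ-reflexive (≡.cong (λ j → C j ((P ^ h) *ₗ (Q ^ w) *ₗ e)) (position≡ μ)))))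
    step (none μ≢ν ¬s e′) = none (λ { refl → μ≢ν refl }) (λ { _ _ (there s) → ¬s _ _ s }) (≈ᴹ-trans value e′)

-- The geometry of ribbons

-- In rows i to j, and only there, f exceeds g, consecutive rows of the
-- difference overlapping in exactly one column.

record Band {k} (f g : Fin k → ℕ) (i j : Fin k) : Set where
  field
    i≤j     : toℕ i ≤ toℕ j
    above   : ∀ r → toℕ r < toℕ i → f r ≡ g r
    under   : ∀ r → toℕ j < toℕ r → f r ≡ g r
    top     : g i < f i
    touch : ∀ r r′ → toℕ r′ ≡ suc (toℕ r) → toℕ i ≤ toℕ r → toℕ r < toℕ j → f r′ ≡ suc (g r)

_◂_ : ∀ {k} → ℕ → (Fin k → ℕ) → Fin (suc k) → ℕ
(a ◂ f) zero    = a
(a ◂ f) (suc r) = f r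

part-◂ : ∀ {k m} (a : Fin (suc m)) (ν : Partition k (toℕ a)) r → (toℕ a ◂ part ν) r ≡ part (a ∷ ν) r
part-◂ a ν zero    = refl
part-◂ a ν (suc r) = refl

band-cong : ∀ {k} {f f′ g g′ : Fin k → ℕ} {i j} → (∀ r → f r ≡ f′ r) → (∀ r → g r ≡ g′ r) → Band f g i j → Band f′ g′ i j
band-cong e e′ b = record
  { i≤j = i≤j
  ; above = λ r l → ≡.trans (≡.sym (e r)) (≡.trans (above r l) (e′ r))
  ; under = λ r l → ≡.trans (≡.sym (e r)) (≡.trans (under r l) (e′ r))
  ; top = ≡.subst₂ _<_ (e′ _) (e _) top
  ; touch = λ r r′ s l l′ → ≡.trans (≡.sym (e r′)) (≡.trans (touch r r′ s l l′) (≡.cong suc (e′ r)))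
  } where open Band b

module _ where

  open Band

  -- The lengths of the rows, each diminished by the column shared with the next one, telescope to
  -- the distance between the two ends.
  strip₀⇒band : ∀ {k a′ a h w} {μ : Partition k a′} {ν : Partition k a} → Strip₀ a′ μ a ν h w →
                ∃[ j ] Band (a′ ◂ part μ) (a ◂ part ν) zero j × h ≡ toℕ j × w ≡ a′ ∸ suc ((a ◂ part ν) j)
  strip₀⇒band (stop lt s) = zero , record
    { i≤j = z≤n ; above = λ _ () ; under = λ { (suc r) _ → s r } ; top = lt ; touch = λ _ _ _ _ () } , refl , refl
  strip₀⇒band (further {a′ = a′} {a} {b′} {b} {h} {w} {μ} {ν} lt e s) with strip₀⇒band s
  ... | j , band , h≡ , w≡ = suc j , record
      { i≤j = z≤n
      ; above = λ _ ()
      ; under = λ { (suc r) (s≤s l) → under band′ r l }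
      ; top = lt
      ; touch = λ { zero (suc zero) _ _ _ → e
                    ; zero (suc (suc r′)) () _ _
                    ; (suc r) (suc r′) eq _ (s≤s l) → touch band′ r r′ (ℕₚ.suc-injective eq) z≤n l }
      } , ≡.cong suc h≡ , ≡.trans (≡.cong ((a′ ∸ suc a) ℕ.+_) (≡.trans w≡ (≡.cong₂ (λ b g → b ∸ suc g) e (part-◂ b ν j))))
          telescope
      where
      band′ = band-cong (part-◂ b′ μ) (part-◂ b ν) band
      g = part (b ∷ ν) j
      telescope : (a′ ∸ suc a) ℕ.+ (a ∸ g) ≡ a′ ∸ suc g
      telescope = ≡.trans (≡.sym (ℕₚ.+-∸-assoc (a′ ∸ suc a) (part≤ (b ∷ ν) j)))
        (≡.trans (≡.cong (_∸ suc g) (≡.sym (ℕₚ.+-suc (a′ ∸ suc a) a))) (≡.cong (_∸ suc g) (ℕₚ.m∸n+n≡m lt)))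

  strip⇒band : ∀ {k m i h w} {μ ν : Partition k m} → Strip i μ ν h w →
               ∃[ j ] Band (part μ) (part ν) i j × h ≡ toℕ j ∸ toℕ i × w ≡ part μ i ∸ suc (part ν j)
  strip⇒band (here {a′ = a′} {a} {μ} {ν} s) with strip₀⇒band s
  ... | j , band , h≡ , w≡ = j , band-cong (part-◂ a′ μ) (part-◂ a ν) band , h≡ ,
          ≡.trans w≡ (≡.cong (λ g → toℕ a′ ∸ suc g) (part-◂ a ν j))
  strip⇒band (there s) with strip⇒band s
  ... | j , band , h≡ , w≡ = suc j , record
      { i≤j = s≤s (i≤j band)
      ; above = λ { zero _ → refl ; (suc r) (s≤s l) → above band r l }
      ; under = λ { (suc r) (s≤s l) → under band r l }
      ; top = top band
      ; touch = λ { (suc r) (suc r′) eq (s≤s l) (s≤s l′) → touch band r r′ (ℕₚ.suc-injective eq) l l′ }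
      } , h≡ , w≡

  band⇒strip₀ : ∀ {k a′ a} {μ : Partition k a′} {ν : Partition k a} j → Band (a′ ◂ part μ) (a ◂ part ν) zero j →
                ∃[ h ] ∃[ w ] Strip₀ a′ μ a ν h w
  band⇒strip₀ zero    band = _ , _ , stop (top band) (λ r → under band (suc r) (s≤s z≤n))
  band⇒strip₀ {μ = b′ ∷ μ} {b ∷ ν} (suc j) band with touch band zero (suc zero) refl z≤n (s≤s z≤n)
  ... | e with band⇒strip₀ {μ = μ} {ν} j (band-cong (λ r → ≡.sym (part-◂ b′ μ r)) (λ r → ≡.sym (part-◂ b ν r)) (record
      { i≤j = z≤n
      ; above = λ _ ()
      ; under = λ r l → under band (suc r) (s≤s l)
      ; top = ℕₚ.≤-trans (s≤s (Finₚ.toℕ≤pred[n] b)) (ℕₚ.≤-reflexive (≡.sym e))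
      ; touch = λ r r′ eq _ l → touch band (suc r) (suc r′) (≡.cong suc eq) z≤n (s≤s l)
      }))
  ... | h , w , s = _ , _ , further (top band) e s

  band⇒strip : ∀ {k m} i j {μ ν : Partition k m} → Band (part μ) (part ν) i j → ∃[ h ] ∃[ w ] Strip i μ ν h w
  band⇒strip zero    j {a′ ∷ μ} {a ∷ ν} band with band⇒strip₀ {μ = μ} {ν} j
      (band-cong (λ r → ≡.sym (part-◂ a′ μ r)) (λ r → ≡.sym (part-◂ a ν r)) band)
  ... | h , w , s = h , w , here s
  band⇒strip (suc i) zero    band with i≤j band
  ... | ()
  band⇒strip (suc i) (suc j) {a′ ∷ μ} {a ∷ ν} band with Finₚ.toℕ-injective (above band zero (s≤s z≤n))
  ... | refl with band⇒strip i j {μ} {ν} (record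
      { i≤j = ℕₚ.≤-pred (i≤j band)
      ; above = λ r l → above band (suc r) (s≤s l)
      ; under = λ r l → under band (suc r) (s≤s l)
      ; top = top band
      ; touch = λ r r′ eq l l′ → touch band (suc r) (suc r′) (≡.cong suc eq) (s≤s l) (s≤s l′)
      })
  ... | h , w , s = h , w , there s

last : ∀ {k ℓP} {P : Fin k → Set ℓP} → (∀ r → Dec (P r)) → ∀ {i} → P i → ∃[ j ] P j × (∀ r → toℕ j < toℕ r → ¬ P r)
last {suc k} {P = P} P? {i} pi with Finₚ.any? (λ r → P? (suc r))
... | yes (r , pr) with last (λ r → P? (suc r)) pr
...   | j , pj , max = suc j , pj , λ { (suc r) (s≤s l) → max r l }
last {suc k} P? {zero}  pi | no none = zero , pi , λ { (suc r) _ pr → none (r , pr) }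
last {suc k} P? {suc i} pi | no none = ⊥-elim (none (i , pi))

count-interval : ∀ n {ℓA ℓP} {A : Set ℓA} {P : A → Set ℓP} (P? : ∀ r → Dec (P r)) (f : Fin n → A) lo hi → hi ≤ n →
                 (∀ r → P (f r) → lo ≤ toℕ r × toℕ r < hi) → (∀ r → lo ≤ toℕ r → toℕ r < hi → P (f r)) →
                 length (filter P? (tabulate f)) ≡ hi ∸ lo
count-interval zero    P? f lo zero     z≤n to from = ≡.sym (ℕₚ.0∸n≡0 lo)
count-interval (suc n) P? f lo hi       le to from with P? (f zero)
... | yes pf with lo | hi | le | to zero pf | to | from
...   | zero | suc hi′ | s≤s le′ | _ | to′ | from′ = ≡.cong suc (count-interval n P? (λ r → f (suc r)) 0 hi′ le′
          (λ r pr → z≤n , ℕₚ.≤-pred (proj₂ (to′ (suc r) pr))) (λ r _ l → from′ (suc r) z≤n (s≤s l)))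
count-interval (suc n) P? f lo zero le to from | no ¬pf = ≡.trans (count-interval n P? (λ r → f (suc r)) lo 0 z≤n
    (λ r pr → ⊥-elim (ℕₚ.n≮0 (proj₂ (to (suc r) pr)))) (λ r _ ())) refl
count-interval (suc n) P? f zero (suc hi) le to from | no ¬pf = ⊥-elim (¬pf (from zero z≤n (s≤s z≤n)))
count-interval (suc n) P? f (suc lo) (suc hi) (s≤s le) to from | no ¬pf =
  count-interval n P? (λ r → f (suc r)) lo hi le
    (λ r pr → let (l , l′) = to (suc r) pr in ℕₚ.≤-pred l , ℕₚ.≤-pred l′) (λ r l l′ → from (suc r) (s≤s l) (s≤s l′))

adjacent-below : ∀ a b {d} → ∣ a - b ∣ ℕ.+ d ≡ 1 → a < b → b ≡ suc a × d ≡ 0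
adjacent-below zero    (suc zero) e lt = refl , ℕₚ.suc-injective e
adjacent-below (suc a) (suc b) e (s≤s lt) with adjacent-below a b e lt
... | e₁ , e₂ = ≡.cong suc e₁ , e₂

module Geometry {k m} (μ ν : Partition k m) where

  open Skew μ ν

  private
    column : ∀ r c → c < part μ r → Fin m
    column r c c<μ = fromℕ< (ℕₚ.≤-trans c<μ (part≤ μ r))

    toℕ-column : ∀ r c c<μ → toℕ (column r c c<μ) ≡ c
    toℕ-column r c c<μ = Finₚ.toℕ-fromℕ< _

    box : ∀ {r c} (c<μ : c < part μ r) → part ν r ≤ c → InSkew (r , column r c c<μ)
    box {r} {c} c<μ ν≤c = ≡.subst (part ν r ≤_) (≡.sym (toℕ-column r c c<μ)) ν≤c ,
                          ≡.subst (_< part μ r) (≡.sym (toℕ-column r c c<μ)) c<μ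

  module _ (ribbon : IsRibbon) {i c₀} (head : IsHead (i , c₀)) where

    open IsRibbon ribbon

    private
      -- A path that starts in a row up to r and ends below it must make a step across. By
      -- `adjacent-below` that step is vertical, so its column belongs to both rows.
      crossing : ∀ {b c} r → Star Step b c → toℕ (row b) ≤ r → r < toℕ (row c) →
                 ∃[ d ] ∃[ e ] Step d e × toℕ (row d) ≤ r × r < toℕ (row e)
      crossing r ε le lt = ⊥-elim (ℕₚ.<⇒≱ lt le)
      crossing r (_◅_ {i = b} {j = d} s ss) le lt with toℕ (row d) ℕₚ.≤? r
      ... | yes d≤r = crossing r ss d≤r lt
      ... | no  d≰r = b , d , s , le , ℕₚ.≰⇒> d≰r

      head-row : part ν i < part μ i
      head-row = let ((ν≤c , c<μ) , _) = head in ℕₚ.≤-<-trans ν≤c c<μ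

      nonempty? : ∀ r → Dec (part ν r < part μ r)
      nonempty? r = part ν r ℕₚ.<? part μ r

      bottom : ∃[ j ] part ν j < part μ j × (∀ r → toℕ j < toℕ r → ¬ part ν r < part μ r)
      bottom = last nonempty? head-row

      j : Fin k
      j = proj₁ bottom

      empty : ∀ r → ¬ part ν r < part μ r → part μ r ≡ part ν r
      empty r ¬lt = ℕₚ.≤-antisym (ℕₚ.≮⇒≥ ¬lt) (contained r)

      overlapping : ∀ r r′ → toℕ r′ ≡ suc (toℕ r) → toℕ i ≤ toℕ r → toℕ r < toℕ j → part μ r′ ≡ suc (part ν r)
      overlapping r r′ r′≡ i≤r r<j = ℕₚ.≤-antisym (ℕₚ.≮⇒≥ upper) lower
        where
        μ′≤μ : part μ r′ ≤ part μ r
        μ′≤μ = part-anti μ (ℕₚ.≤-trans (ℕₚ.n≤1+n _) (ℕₚ.≤-reflexive (≡.sym r′≡)))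
        ν′≤ν : part ν r′ ≤ part ν r
        ν′≤ν = part-anti ν (ℕₚ.≤-trans (ℕₚ.n≤1+n _) (ℕₚ.≤-reflexive (≡.sym r′≡)))
        upper : ¬ suc (part ν r) < part μ r′
        upper lt = no-2×2 (r , column r′ _ (ℕₚ.<⇒≤ lt)) (r′ , column r′ _ lt) (record
          { below = r′≡
          ; right = ≡.trans (toℕ-column r′ _ lt) (≡.cong suc (≡.sym (toℕ-column r′ _ (ℕₚ.<⇒≤ lt))))
          ; top-left = at r (ℕₚ.<⇒≤ lt) ℕₚ.≤-refl (ℕₚ.≤-trans (ℕₚ.<⇒≤ lt) μ′≤μ)
          ; top-right = at r lt (ℕₚ.n≤1+n _) (ℕₚ.≤-trans lt μ′≤μ)
          ; bottom-left = at r′ (ℕₚ.<⇒≤ lt) ν′≤ν (ℕₚ.<⇒≤ lt)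
          ; bottom-right = at r′ lt (ℕₚ.m≤n⇒m≤1+n ν′≤ν) lt
          })
          where
          at : ∀ s {c} (c<μ : c < part μ r′) → part ν s ≤ c → c < part μ s → InSkew (s , column r′ c c<μ)
          at s c<μ ν≤c c<μs = ≡.subst (part ν s ≤_) (≡.sym (toℕ-column r′ _ c<μ)) ν≤c ,
                              ≡.subst (_< part μ s) (≡.sym (toℕ-column r′ _ c<μ)) c<μs
        lower : part ν r < part μ r′
        lower with crossing (toℕ r) (connected _ _ (proj₁ head) (box (proj₁ (proj₂ bottom)) ℕₚ.≤-refl)) i≤r r<j
        ... | d , e , (d∈ , e∈ , adj) , d≤r , r<e with adjacent-below _ _ adj (ℕₚ.≤-<-trans d≤r r<e)
        ...   | e≡ , c≡ = ≡.subst₂ (λ s s′ → part ν s < part μ s′) d≡r e≡r′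
                  (ℕₚ.≤-<-trans (proj₁ d∈) (≡.subst (_< part μ (row e)) (≡.sym (ℕₚ.∣m-n∣≡0⇒m≡n c≡)) (proj₂ e∈)))
          where
          d≡r : row d ≡ r
          d≡r = Finₚ.toℕ-injective (ℕₚ.≤-antisym d≤r (ℕₚ.≤-pred (≡.subst (toℕ r <_) e≡ r<e)))
          e≡r′ : row e ≡ r′
          e≡r′ = Finₚ.toℕ-injective (≡.trans e≡ (≡.trans (≡.cong (λ s → suc (toℕ s)) d≡r) (≡.sym r′≡)))

    -- Connectedness gives consecutive rows at least one common column, and the absence of squares
    -- at most one. Rows above the head are empty by the definition of the head, rows below `j` by
    -- its choice as the last nonempty row.
    ribbon⇒band : ∃[ j ] Band (part μ) (part ν) i j
    ribbon⇒band = j , record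
      { i≤j = proj₁ (proj₂ head _ (box (proj₁ (proj₂ bottom)) ℕₚ.≤-refl))
      ; above = λ r r<i → empty r λ lt → ℕₚ.<⇒≱ r<i (proj₁ (proj₂ head _ (box lt ℕₚ.≤-refl)))
      ; under = λ r j<r → empty r (proj₂ (proj₂ bottom) r j<r)
      ; top = head-row
      ; touch = overlapping
      }

  module _ {i j : Fin k} (band : Band (part μ) (part ν) i j) where

    private
      module band = Band band

      previous : ∀ (r : Fin k) n → toℕ r ≡ suc n → ∃[ s ] toℕ s ≡ n
      previous r n e = fromℕ< n<k , Finₚ.toℕ-fromℕ< n<k
        where n<k = ℕₚ.<-trans (≡.subst (n <_) (≡.sym e) ℕₚ.≤-refl) (Finₚ.toℕ<n r)

      full : ∀ r → toℕ i ≤ toℕ r → toℕ r ≤ toℕ j → part ν r < part μ r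
      full r i≤r r≤j with ℕₚ.m≤n⇒m<n∨m≡n i≤r
      ... | inj₂ e rewrite Finₚ.toℕ-injective {i = r} {i} (≡.sym e) = band.top
      ... | inj₁ i<r with toℕ r in eq
      ...   | suc n with previous r n eq
      ...     | s , s≡ = ≡.subst (part ν r <_) (≡.sym (band.touch s r (≡.trans eq (≡.cong suc (≡.sym s≡)))
                  (≡.subst (toℕ i ≤_) (≡.sym s≡) (ℕₚ.≤-pred i<r)) (≡.subst (_< toℕ j) (≡.sym s≡) r≤j)))
                  (s≤s (part-anti ν (ℕₚ.≤-trans (ℕₚ.≤-reflexive s≡) (ℕₚ.≤-trans (ℕₚ.n≤1+n n) (ℕₚ.≤-reflexive (≡.sym eq))))))

      within : ∀ {b} → InSkew b → toℕ i ≤ toℕ (row b) × toℕ (row b) ≤ toℕ j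
      within {r , c} (ν≤c , c<μ) = ℕₚ.≮⇒≥ (λ l → nonempty (band.above r l)) , ℕₚ.≮⇒≥ (λ l → nonempty (band.under r l))
        where
        nonempty : part μ r ≢ part ν r
        nonempty e = ℕₚ.<⇒≢ (ℕₚ.≤-<-trans ν≤c c<μ) (≡.sym e)

      top-end : ∃[ c ] suc c ≡ part μ i
      top-end with part μ i | band.top
      ... | suc c | _ = c , refl

      head-column : Fin m
      head-column = column i (proj₁ top-end) (ℕₚ.≤-reflexive (proj₂ top-end))

      head-in : InSkew (i , head-column)
      head-in = box (ℕₚ.≤-reflexive (proj₂ top-end)) (ℕₚ.≤-pred (≡.subst (part ν i <_) (≡.sym (proj₂ top-end)) band.top))

      head-max : ∀ c → InSkew c → toℕ i ≤ toℕ (row c) × toℕ (col c) ≤ toℕ head-column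
      head-max (r , c) c∈ = proj₁ (within c∈) , ℕₚ.≤-pred (≡.subst (toℕ c <_)
        (≡.trans (≡.sym (proj₂ top-end)) (≡.cong suc (≡.sym (toℕ-column i _ (ℕₚ.≤-reflexive (proj₂ top-end))))))
        (ℕₚ.≤-trans (proj₂ c∈) (part-anti μ (proj₁ (within c∈)))))

      ∣n-n+1∣ : ∀ a → ∣ a - suc a ∣ ≡ 1
      ∣n-n+1∣ zero    = refl
      ∣n-n+1∣ (suc a) = ∣n-n+1∣ a

      ∣n+1-n∣ : ∀ a → ∣ suc a - a ∣ ≡ 1
      ∣n+1-n∣ zero    = refl
      ∣n+1-n∣ (suc a) = ∣n+1-n∣ a

      step-sym : ∀ {b c} → Step b c → Step c b
      step-sym {b} {c} (b∈ , c∈ , adj) = c∈ , b∈ , ≡.trans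
        (≡.cong₂ ℕ._+_ (ℕₚ.∣-∣-comm (toℕ (row c)) (toℕ (row b))) (ℕₚ.∣-∣-comm (toℕ (col c)) (toℕ (col b)))) adj

      along-row : ∀ d {r} {c c′ : Fin m} → toℕ c′ ≡ d ℕ.+ toℕ c → part ν r ≤ toℕ c → toℕ c′ < part μ r →
                  Star Step (r , c) (r , c′)
      along-row zero    e ν≤c c′<μ rewrite Finₚ.toℕ-injective e = ε
      along-row (suc d) {r} {c} {c′} e ν≤c c′<μ = along-row d c₁≡ ν≤c (ℕₚ.<-trans c₁<c′ c′<μ) ◅◅ (step ◅ ε)
        where
        c₁<c′ : toℕ (fromℕ< (ℕₚ.<-trans (≡.subst (d ℕ.+ toℕ c <_) (≡.sym e) ℕₚ.≤-refl) (Finₚ.toℕ<n c′))) < toℕ c′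
        c₁<c′ = ≡.subst₂ _<_ (≡.sym (Finₚ.toℕ-fromℕ< _)) (≡.sym e) ℕₚ.≤-refl
        c₁ : Fin m
        c₁ = fromℕ< (ℕₚ.<-trans (≡.subst (d ℕ.+ toℕ c <_) (≡.sym e) ℕₚ.≤-refl) (Finₚ.toℕ<n c′))
        c₁≡ : toℕ c₁ ≡ d ℕ.+ toℕ c
        c₁≡ = Finₚ.toℕ-fromℕ< _
        ν≤c₁ : part ν r ≤ toℕ c₁
        ν≤c₁ = ℕₚ.≤-trans ν≤c (ℕₚ.≤-trans (ℕₚ.m≤n+m (toℕ c) d) (ℕₚ.≤-reflexive (≡.sym c₁≡)))
        step : Step (r , c₁) (r , c′)
        step = (ν≤c₁ , ℕₚ.<-trans c₁<c′ c′<μ) , (ℕₚ.≤-trans ν≤c₁ (ℕₚ.<⇒≤ c₁<c′) , c′<μ) ,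
          ≡.cong₂ ℕ._+_ (ℕₚ.∣n-n∣≡0 (toℕ r))
            (≡.trans (≡.cong₂ ∣_-_∣ c₁≡ e) (∣n-n+1∣ (d ℕ.+ toℕ c)))

      -- Walk to the right as far as the column shared with the row above, which is the first column
      -- of that row, and step up; in row i walk on to the head.
      to-head : ∀ n {r c} → toℕ r ≡ n ℕ.+ toℕ i → InSkew (r , c) → Star Step (r , c) (i , head-column)
      to-head zero    {r} {c} e c∈ with Finₚ.toℕ-injective {i = r} {i} e
      ... | refl = along-row (toℕ head-column ∸ toℕ c) (≡.sym (ℕₚ.m∸n+n≡m (proj₂ (head-max _ c∈)))) (proj₁ c∈) (proj₂ head-in)
      to-head (suc n) {r} {c} e c∈ with previous r (n ℕ.+ toℕ i) e
      ... | s , s≡ = along-row (toℕ c₁ ∸ toℕ c) (≡.sym (ℕₚ.m∸n+n≡m c≤c₁)) (proj₁ c∈) c₁<μ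
                       ◅◅ (((proj₁ r∈ , c₁<μ) , s∈ , adj) ◅ to-head n s≡ s∈)
        where
        r≡ : toℕ r ≡ suc (toℕ s)
        r≡ = ≡.trans e (≡.cong suc (≡.sym s≡))
        i≤s : toℕ i ≤ toℕ s
        i≤s = ≡.subst (toℕ i ≤_) (≡.sym s≡) (ℕₚ.m≤n+m (toℕ i) n)
        s<j : toℕ s < toℕ j
        s<j = ≡.subst (_≤ toℕ j) r≡ (proj₂ (within c∈))
        μ≡ : part μ r ≡ suc (part ν s)
        μ≡ = band.touch s r r≡ i≤s s<j
        ν<μ : part ν s < part μ s
        ν<μ = full s i≤s (ℕₚ.<⇒≤ s<j)
        c₁ : Fin m
        c₁ = column s (part ν s) ν<μ
        c₁≡ : toℕ c₁ ≡ part ν s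
        c₁≡ = toℕ-column s _ ν<μ
        s∈ : InSkew (s , c₁)
        s∈ = box ν<μ ℕₚ.≤-refl
        c₁<μ : toℕ c₁ < part μ r
        c₁<μ = ≡.subst₂ _<_ (≡.sym c₁≡) (≡.sym μ≡) ℕₚ.≤-refl
        c≤c₁ : toℕ c ≤ toℕ c₁
        c≤c₁ = ℕₚ.≤-pred (≡.subst (toℕ c <_) (≡.trans μ≡ (≡.cong suc (≡.sym c₁≡))) (proj₂ c∈))
        r∈ : InSkew (r , c₁)
        r∈ = ℕₚ.≤-trans (proj₁ c∈) c≤c₁ , c₁<μ
        adj : Adjacent (r , c₁) (s , c₁)
        adj = ≡.cong₂ ℕ._+_ (≡.trans (≡.cong (λ t → ∣ t - toℕ s ∣) r≡) (∣n+1-n∣ (toℕ s))) (ℕₚ.∣n-n∣≡0 (toℕ c₁))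

      path : ∀ b → InSkew b → Star Step b (i , head-column)
      path (r , c) b∈ = to-head (toℕ r ∸ toℕ i) (≡.sym (ℕₚ.m∸n+n≡m (proj₁ (within b∈)))) b∈

    band⇒ribbon : RibbonWithHeadInRow i
    band⇒ribbon = record
      { contained = contained
      ; nonempty = _ , head-in
      ; connected = λ b c b∈ c∈ → path b b∈ ◅◅ reverse step-sym (path c c∈)
      ; no-2×2 = λ b c sqr → let open TwoByTwo sqr in ℕₚ.<⇒≱
          (≡.subst₂ _<_ right (band.touch (row b) (row c) below (proj₁ (within top-left))
            (≡.subst (_≤ toℕ j) below (proj₂ (within bottom-right)))) (proj₂ bottom-right))
          (s≤s (proj₁ top-left))
      } , head-column , head-in , head-max
      where
      contained : ∀ r → part ν r ≤ part μ r
      contained r with toℕ i ℕₚ.≤? toℕ r | toℕ r ℕₚ.≤? toℕ j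
      ... | no i≰r | _       = ℕₚ.≤-reflexive (≡.sym (band.above r (ℕₚ.≰⇒> i≰r)))
      ... | yes _  | no r≰j  = ℕₚ.≤-reflexive (≡.sym (band.under r (ℕₚ.≰⇒> r≰j)))
      ... | yes i≤r | yes r≤j = ℕₚ.<⇒≤ (full r i≤r r≤j)

    ht≡ : ht ≡ suc (toℕ j) ∸ toℕ i
    ht≡ = count-interval k (λ r → Finₚ.any? λ c → inSkew? (r , c)) (λ r → r) (toℕ i) (suc (toℕ j)) (Finₚ.toℕ<n j)
      (λ r (c , c∈) → proj₁ (within c∈) , s≤s (proj₂ (within c∈)))
      (λ r i≤r r≤j → _ , box (full r i≤r (ℕₚ.≤-pred r≤j)) ℕₚ.≤-refl)

    private
      -- If the column lies to the left of row r, it lies within the end of the next row, which by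
      -- `touch` ends in the first column of row r. So descending finds it, in row j at the latest.
      row-of : ∀ n (c : Fin m) r → n ℕ.+ toℕ r ≡ toℕ j → toℕ i ≤ toℕ r → part ν j ≤ toℕ c → toℕ c < part μ r →
               ∃[ r′ ] InSkew (r′ , c)
      row-of n c r e i≤r ν≤c c<μ with part ν r ℕₚ.≤? toℕ c
      ... | yes le = r , le , c<μ
      row-of zero    c r e i≤r ν≤c c<μ | no ν≰c rewrite Finₚ.toℕ-injective {i = r} {j} e = ⊥-elim (ν≰c ν≤c)
      row-of (suc n) c r e i≤r ν≤c c<μ | no ν≰c =
        row-of n c r′ (≡.trans (≡.cong (n ℕ.+_) r′≡) (≡.trans (ℕₚ.+-suc n (toℕ r)) e))
          (≡.subst (toℕ i ≤_) (≡.sym r′≡) (ℕₚ.m≤n⇒m≤1+n i≤r)) ν≤c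
          (≡.subst (toℕ c <_) (≡.sym (band.touch r r′ r′≡ i≤r r<j)) (ℕₚ.m≤n⇒m≤1+n (ℕₚ.≰⇒> ν≰c)))
        where
        r<j : toℕ r < toℕ j
        r<j = ≡.subst (toℕ r <_) e (s≤s (ℕₚ.m≤n+m (toℕ r) n))
        r′ : Fin k
        r′ = fromℕ< (ℕₚ.≤-<-trans r<j (Finₚ.toℕ<n j))
        r′≡ : toℕ r′ ≡ suc (toℕ r)
        r′≡ = Finₚ.toℕ-fromℕ< _

    wd≡ : wd ≡ part μ i ∸ part ν j
    wd≡ = count-interval m (λ c → Finₚ.any? λ r → inSkew? (r , c)) (λ c → c) (part ν j) (part μ i) (part≤ μ i)
      (λ c (r , c∈) → ℕₚ.≤-trans (part-anti ν (proj₂ (within c∈))) (proj₁ c∈)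
                    , ℕₚ.≤-trans (proj₂ c∈) (part-anti μ (proj₁ (within c∈))))
      (λ c ν≤c c<μ → row-of (toℕ j ∸ toℕ i) c i (ℕₚ.m∸n+n≡m band.i≤j) ℕₚ.≤-refl ν≤c c<μ)

  strip⇒ribbon : ∀ {i h w} → Strip i μ ν h w → RibbonWithHeadInRow i × ht ∸ 1 ≡ h × wd ∸ 1 ≡ w
  strip⇒ribbon {i} s with strip⇒band s
  ... | j , band , h≡ , w≡ = band⇒ribbon band ,
    ≡.trans (≡.cong (_∸ 1) (≡.trans (ht≡ band) (ℕₚ.+-∸-assoc 1 (Band.i≤j band)))) (≡.sym h≡) ,
    ≡.trans (≡.cong (_∸ 1) (wd≡ band)) (≡.trans (ℕₚ.∸-+-assoc (part μ i) (part ν j) 1)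
      (≡.trans (≡.cong (part μ i ∸_) (ℕₚ.+-comm (part ν j) 1)) (≡.sym w≡)))

  ribbon⇒strip : ∀ {i} → RibbonWithHeadInRow i → ∃[ h ] ∃[ w ] Strip i μ ν h w
  ribbon⇒strip {i} (ribbon , _ , head) with ribbon⇒band ribbon head
  ... | j , band = band⇒strip i j band

-- Permutations, inversions and reduced words

module _ {ℓA ℓP ℓQ} {A : Set ℓA} {P : A → Set ℓP} {Q : A → Set ℓQ} (P? : ∀ a → Dec (P a)) (Q? : ∀ a → Dec (Q a)) where

  count-≐ : (∀ a → P a → Q a) → (∀ a → Q a → P a) → ∀ as → length (filter P? as) ≡ length (filter Q? as)
  count-≐ to from as = ≡.cong length (Listₚ.filter-≐ P? Q? ((λ {a} → to a) , (λ {a} → from a)) as)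

  count-suc : ∀ {e} → (∀ a → Q a → P a ⊎ a ≡ e) → (∀ a → P a → Q a) → Q e → ¬ P e →
              ∀ {as} → Unique as → e ∈ as → length (filter Q? as) ≡ suc (length (filter P? as))
  count-suc {e} split P⊆Q qe ¬pe {a ∷ as} (a∉ AllPairs.∷ u) (here refl) with P? a | Q? a
  ... | yes pa | _      = ⊥-elim (¬pe pa)
  ... | no _   | no ¬qa = ⊥-elim (¬qa qe)
  ... | no _   | yes _  = ≡.cong suc (rest a∉)
    where
    rest : ∀ {as} → All (a ≢_) as → length (filter Q? as) ≡ length (filter P? as)
    rest [] = refl
    rest (_∷_ {b} a≢b a∉) with P? b | Q? b
    ... | yes _  | yes _  = ≡.cong suc (rest a∉)
    ... | no _   | no _   = rest a∉
    ... | yes pb | no ¬qb = ⊥-elim (¬qb (P⊆Q b pb))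
    ... | no ¬pb | yes qb with split b qb
    ...   | inj₁ pb  = ⊥-elim (¬pb pb)
    ...   | inj₂ b≡e = ⊥-elim (a≢b (≡.sym b≡e))
  count-suc {e} split P⊆Q qe ¬pe {a ∷ as} (a∉ AllPairs.∷ u) (there e∈) with P? a | Q? a
  ... | yes _  | yes _  = ≡.cong suc (count-suc split P⊆Q qe ¬pe u e∈)
  ... | no _   | no _   = count-suc split P⊆Q qe ¬pe u e∈
  ... | yes pa | no ¬qa = ⊥-elim (¬qa (P⊆Q a pa))
  ... | no ¬pa | yes qa with split a qa
  ...   | inj₁ pa   = ⊥-elim (¬pa pa)
  ...   | inj₂ refl = ⊥-elim (All.lookup a∉ e∈ refl)

count-map : ∀ {ℓA ℓB ℓP} {A : Set ℓA} {B : Set ℓB} {P : B → Set ℓP} (P? : ∀ b → Dec (P b)) (f : A → B) as →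
            length (filter P? (map f as)) ≡ length (filter (λ a → P? (f a)) as)
count-map P? f []       = refl
count-map P? f (a ∷ as) with P? (f a)
... | yes _ = ≡.cong suc (count-map P? f as)
... | no _  = count-map P? f as

-- Applying the involution to a complete list without repetitions only rearranges it.
count-involution : ∀ {ℓA ℓP} {A : Set ℓA} {P : A → Set ℓP} (P? : ∀ a → Dec (P a)) (f : A → A) → (∀ a → f (f a) ≡ a) →
                   ∀ {as} → Unique as → (∀ a → a ∈ as) →
                   length (filter P? as) ≡ length (filter (λ a → P? (f a)) as)
count-involution P? f inv {as} u complete = ≡.trans
  (↭-length (filter-↭ P? (∼bag⇒↭ (unique∧set⇒bag u
    (Uniqueₚ.map⁺ (λ {a} {b} e → ≡.trans (≡.sym (inv a)) (≡.trans (≡.cong f e) (inv b))) u)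
    (λ {a} → mk⇔ (λ _ → ≡.subst (_∈ map f as) (inv a) (∈-map⁺ f (complete (f a)))) (λ _ → complete a))))))
  (count-map P? f as)

toℕ-lo′ : ∀ n (i : Fin (n ∸ 1)) → toℕ (lo {n} i) ≡ toℕ i
toℕ-lo′ (suc n) i = Finₚ.toℕ-inject₁ i

toℕ-hi′ : ∀ n (i : Fin (n ∸ 1)) → toℕ (hi {n} i) ≡ suc (toℕ i)
toℕ-hi′ (suc n) i = refl

successor : ∀ n (a : Fin n) → suc (toℕ a) < n → ∃[ i ] lo {n} i ≡ a × toℕ (hi {n} i) ≡ suc (toℕ a)
successor (suc n) a (s≤s a<n) = fromℕ< a<n ,
  Finₚ.toℕ-injective (≡.trans (Finₚ.toℕ-inject₁ _) (Finₚ.toℕ-fromℕ< a<n)) , ≡.cong suc (Finₚ.toℕ-fromℕ< a<n)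

module SymmetricGroup (n : ℕ) where

  toℕ-lo : ∀ i → toℕ (lo {n} i) ≡ toℕ i
  toℕ-lo = toℕ-lo′ n

  toℕ-hi : ∀ i → toℕ (hi {n} i) ≡ suc (toℕ i)
  toℕ-hi = toℕ-hi′ n

  s : Fin (n ∸ 1) → Permutation′ n
  s i = transpose (lo {n} i) (hi {n} i)

  lo<hi : ∀ (i : Fin (n ∸ 1)) → toℕ (lo {n} i) < toℕ (hi {n} i)
  lo<hi i = ℕₚ.≤-reflexive (≡.trans (≡.cong suc (toℕ-lo i)) (≡.sym (toℕ-hi i)))

  hi≡suc-lo : ∀ (i : Fin (n ∸ 1)) → toℕ (hi {n} i) ≡ suc (toℕ (lo {n} i))
  hi≡suc-lo i = ≡.trans (toℕ-hi i) (≡.cong suc (≡.sym (toℕ-lo i)))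

  lo≢hi : ∀ (i : Fin (n ∸ 1)) → lo {n} i ≢ hi {n} i
  lo≢hi i e = ℕₚ.<⇒≢ (lo<hi i) (≡.cong toℕ e)

  s-lo : ∀ i → s i ⟨$⟩ʳ lo {n} i ≡ hi {n} i
  s-lo i with lo {n} i Finₚ.≟ lo {n} i
  ... | yes _ = refl
  ... | no e  = ⊥-elim (e refl)

  s-hi : ∀ i → s i ⟨$⟩ʳ hi {n} i ≡ lo {n} i
  s-hi i with hi {n} i Finₚ.≟ lo {n} i
  ... | yes e = e
  ... | no _ with hi {n} i Finₚ.≟ hi {n} i
  ...   | yes _ = refl
  ...   | no e  = ⊥-elim (e refl)

  s-other : ∀ i {a} → a ≢ lo {n} i → a ≢ hi {n} i → s i ⟨$⟩ʳ a ≡ a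
  s-other i {a} a≢lo a≢hi with a Finₚ.≟ lo {n} i
  ... | yes e = ⊥-elim (a≢lo e)
  ... | no _ with a Finₚ.≟ hi {n} i
  ...   | yes e = ⊥-elim (a≢hi e)
  ...   | no _  = refl

  data Position (i : Fin (n ∸ 1)) (a : Fin n) : Set where
    at-lo     : a ≡ lo {n} i → Position i a
    at-hi     : a ≡ hi {n} i → Position i a
    elsewhere : a ≢ lo {n} i → a ≢ hi {n} i → Position i a

  position? : ∀ i a → Position i a
  position? i a with a Finₚ.≟ lo {n} i | a Finₚ.≟ hi {n} i
  ... | yes e | _     = at-lo e
  ... | no _  | yes e = at-hi e
  ... | no e  | no e′ = elsewhere e e′

  s-involutive : ∀ i a → s i ⟨$⟩ʳ (s i ⟨$⟩ʳ a) ≡ a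
  s-involutive i a with position? i a
  ... | at-lo refl     = ≡.trans (≡.cong (s i ⟨$⟩ʳ_) (s-lo i)) (s-hi i)
  ... | at-hi refl     = ≡.trans (≡.cong (s i ⟨$⟩ʳ_) (s-hi i)) (s-lo i)
  ... | elsewhere e e′ = ≡.trans (≡.cong (s i ⟨$⟩ʳ_) (s-other i e e′)) (s-other i e e′)

  s-mono : ∀ i {a b : Fin n} → toℕ a < toℕ b → ¬ (a ≡ lo {n} i × b ≡ hi {n} i) → toℕ (s i ⟨$⟩ʳ a) < toℕ (s i ⟨$⟩ʳ b)
  s-mono i {a} {b} a<b ¬pair with position? i a | position? i b
  ... | at-lo refl     | at-lo refl      = ⊥-elim (ℕₚ.<-irrefl refl a<b)
  ... | at-lo a≡       | at-hi b≡        = ⊥-elim (¬pair (a≡ , b≡))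
  ... | at-lo refl     | elsewhere b≢ b≢′ rewrite s-lo i | s-other i b≢ b≢′ =
        ℕₚ.≤∧≢⇒< (≡.subst (_≤ toℕ b) (≡.sym (hi≡suc-lo i)) a<b) (λ e → b≢′ (Finₚ.toℕ-injective (≡.sym e)))
  ... | at-hi refl     | at-lo refl      = ⊥-elim (ℕₚ.<⇒≱ a<b (ℕₚ.<⇒≤ (lo<hi i)))
  ... | at-hi refl     | at-hi refl      = ⊥-elim (ℕₚ.<-irrefl refl a<b)
  ... | at-hi refl     | elsewhere b≢ b≢′ rewrite s-hi i | s-other i b≢ b≢′ = ℕₚ.<-trans (lo<hi i) a<b
  ... | elsewhere e e′ | at-lo refl rewrite s-lo i | s-other i e e′ = ℕₚ.<-trans a<b (lo<hi i)
  ... | elsewhere e e′ | at-hi refl rewrite s-hi i | s-other i e e′ =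
        ℕₚ.≤∧≢⇒< (ℕₚ.≤-pred (≡.subst (toℕ a <_) (hi≡suc-lo i) a<b)) (λ z → e (Finₚ.toℕ-injective z))
  ... | elsewhere e e′ | elsewhere b≢ b≢′ rewrite s-other i e e′ | s-other i b≢ b≢′ = a<b

  injective : ∀ (w : Permutation′ n) {a b} → w ⟨$⟩ʳ a ≡ w ⟨$⟩ʳ b → a ≡ b
  injective w {a} {b} e = ≡.trans (≡.sym (inverseˡ w)) (≡.trans (≡.cong (w ⟨$⟩ˡ_) e) (inverseˡ w))

  ⁻¹-cong : ∀ {v w : Permutation′ n} → v Perm.≈ w → v ⁻¹ Perm.≈ w ⁻¹
  ⁻¹-cong {v} {w} e a = injective v (≡.trans (inverseʳ v) (≡.trans (≡.sym (inverseʳ w)) (≡.sym (e _))))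

  private
    pairs : List (Fin n × Fin n)
    pairs = cartesianProduct (allFin n) (allFin n)

    pairs-unique : Unique pairs
    pairs-unique = Uniqueₚ.cartesianProduct⁺ (Uniqueₚ.allFin⁺ n) (Uniqueₚ.allFin⁺ n)

    pairs-complete : ∀ ab → ab ∈ pairs
    pairs-complete (a , b) = ∈-cartesianProduct⁺ (∈-allFin a) (∈-allFin b)

    Inversion : Permutation′ n → Fin n × Fin n → Set
    Inversion w (a , b) = toℕ a < toℕ b × toℕ (w ⟨$⟩ʳ b) < toℕ (w ⟨$⟩ʳ a)

    inversion? : ∀ w ab → Dec (Inversion w ab)
    inversion? w (a , b) = (a Finₚ.<? b) ×-dec (w ⟨$⟩ʳ b Finₚ.<? w ⟨$⟩ʳ a)

  ℓ-cong : ∀ {v w : Permutation′ n} → v Perm.≈ w → ℓ v ≡ ℓ w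
  ℓ-cong {v} {w} e = count-≐ (inversion? v) (inversion? w)
    (λ (a , b) (lt , inv) → lt , ≡.subst₂ (λ c d → toℕ c < toℕ d) (e b) (e a) inv)
    (λ (a , b) (lt , inv) → lt , ≡.subst₂ (λ c d → toℕ c < toℕ d) (≡.sym (e b)) (≡.sym (e a)) inv) pairs

  ℓ-identity : ∀ {w : Permutation′ n} → w Perm.≈ Perm.id → ℓ w ≡ 0
  ℓ-identity {w} e = ≡.cong length (Listₚ.filter-none (inversion? w) {pairs}
    (All.universal (λ (a , b) (lt , inv) → ℕₚ.<⇒≱ lt (ℕₚ.<⇒≤ (≡.subst₂ (λ c d → toℕ c < toℕ d) (e b) (e a) inv))) pairs))

  -- `s i` keeps the order of any two values except lo and hi, so the only new inversion is the pair
  -- of positions at which `w` takes these values.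
  ℓ-s· : ∀ i (w : Permutation′ n) → toℕ (w ⟨$⟩ˡ lo {n} i) < toℕ (w ⟨$⟩ˡ hi {n} i) → ℓ (s i · w) ≡ suc (ℓ w)
  ℓ-s· i w lt = count-suc (inversion? w) (inversion? (s i · w)) split include
    (lt , ≡.subst₂ (λ c d → toℕ (s i ⟨$⟩ʳ c) < toℕ (s i ⟨$⟩ʳ d)) (≡.sym (inverseʳ w)) (≡.sym (inverseʳ w))
            (≡.subst₂ (λ c d → toℕ c < toℕ d) (≡.sym (s-hi i)) (≡.sym (s-lo i)) (lo<hi i)))
    (λ (_ , inv) → ℕₚ.<⇒≱ inv (≡.subst₂ (λ c d → toℕ c ≤ toℕ d) (≡.sym (inverseʳ w)) (≡.sym (inverseʳ w)) (ℕₚ.<⇒≤ (lo<hi i))))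
    pairs-unique (pairs-complete _)
    where
    e : Fin n × Fin n
    e = w ⟨$⟩ˡ lo {n} i , w ⟨$⟩ˡ hi {n} i
    split : ∀ ab → Inversion (s i · w) ab → Inversion w ab ⊎ ab ≡ e
    split (a , b) (a<b , inv) with ℕₚ.<-cmp (toℕ (w ⟨$⟩ʳ a)) (toℕ (w ⟨$⟩ʳ b))
    ... | tri> _ _ gt = inj₁ (a<b , gt)
    ... | tri≈ _ eq _ = ⊥-elim (ℕₚ.<⇒≢ a<b (≡.cong toℕ (injective w (Finₚ.toℕ-injective eq))))
    ... | tri< lt _ _ with (w ⟨$⟩ʳ a Finₚ.≟ lo {n} i) ×-dec (w ⟨$⟩ʳ b Finₚ.≟ hi {n} i)
    ...   | yes (a≡ , b≡) = inj₂ (≡.cong₂ _,_ (≡.trans (≡.sym (inverseˡ w)) (≡.cong (w ⟨$⟩ˡ_) a≡))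
                                              (≡.trans (≡.sym (inverseˡ w)) (≡.cong (w ⟨$⟩ˡ_) b≡)))
    ...   | no ¬pair = ⊥-elim (ℕₚ.<-asym inv (s-mono i lt ¬pair))
    include : ∀ ab → Inversion w ab → Inversion (s i · w) ab
    include (a , b) (a<b , inv) = a<b , s-mono i inv λ (b≡ , a≡) → ℕₚ.<-asym a<b
      (≡.subst₂ (λ c d → toℕ c < toℕ d) (≡.trans (≡.cong (w ⟨$⟩ˡ_) (≡.sym b≡)) (inverseˡ w))
                                         (≡.trans (≡.cong (w ⟨$⟩ˡ_) (≡.sym a≡)) (inverseˡ w)) lt)

  -- Here the positions are exchanged. After all pairs have been reindexed by `s i`, the inversions
  -- of `w · s i` and of `w` differ by the single pair (hi, lo).
  ℓ-·s : ∀ i (w : Permutation′ n) → toℕ (w ⟨$⟩ʳ lo {n} i) < toℕ (w ⟨$⟩ʳ hi {n} i) → ℓ (w · s i) ≡ suc (ℓ w)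
  ℓ-·s i w lt = ≡.trans
    (count-involution (inversion? (w · s i)) flip (λ (a , b) → ≡.cong₂ _,_ (s-involutive i a) (s-involutive i b))
      pairs-unique pairs-complete)
    (count-suc (inversion? w) (λ ab → inversion? (w · s i) (flip ab)) split include
      (≡.subst₂ (λ c d → toℕ c < toℕ d) (≡.sym (s-hi i)) (≡.sym (s-lo i)) (lo<hi i) ,
       ≡.subst₂ (λ c d → toℕ (w ⟨$⟩ʳ c) < toℕ (w ⟨$⟩ʳ d)) (≡.sym (s-involutive i (lo {n} i))) (≡.sym (s-involutive i (hi {n} i))) lt)
      (λ (gt , _) → ℕₚ.<-asym gt (lo<hi i))
      pairs-unique (pairs-complete (hi {n} i , lo {n} i)))
    where
    flip : Fin n × Fin n → Fin n × Fin n
    flip (a , b) = s i ⟨$⟩ʳ a , s i ⟨$⟩ʳ b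
    split : ∀ ab → Inversion (w · s i) (flip ab) → Inversion w ab ⊎ ab ≡ (hi {n} i , lo {n} i)
    split (a , b) (s<s , inv) with ≡.subst₂ (λ c d → toℕ (w ⟨$⟩ʳ c) < toℕ (w ⟨$⟩ʳ d)) (s-involutive i b) (s-involutive i a) inv
    ... | inv′ with ℕₚ.<-cmp (toℕ a) (toℕ b)
    ...   | tri< a<b _ _ = inj₁ (a<b , inv′)
    ...   | tri≈ _ eq _ rewrite Finₚ.toℕ-injective {i = a} {b} eq = ⊥-elim (ℕₚ.<-irrefl refl s<s)
    ...   | tri> _ _ b<a with (b Finₚ.≟ lo {n} i) ×-dec (a Finₚ.≟ hi {n} i)
    ...     | yes (b≡ , a≡) = inj₂ (≡.cong₂ _,_ a≡ b≡)
    ...     | no ¬pair = ⊥-elim (ℕₚ.<-asym s<s (s-mono i b<a ¬pair))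
    include : ∀ ab → Inversion w ab → Inversion (w · s i) (flip ab)
    include (a , b) (a<b , inv) = s-mono i a<b (λ { (refl , refl) → ℕₚ.<-asym lt inv }) ,
      ≡.subst₂ (λ c d → toℕ (w ⟨$⟩ʳ c) < toℕ (w ⟨$⟩ʳ d)) (≡.sym (s-involutive i b)) (≡.sym (s-involutive i a)) inv

  Descent : Permutation′ n → Fin (n ∸ 1) → Set
  Descent w i = toℕ (w ⟨$⟩ʳ hi {n} i) < toℕ (w ⟨$⟩ʳ lo {n} i)

  Ascent : Permutation′ n → Fin (n ∸ 1) → Set
  Ascent w i = toℕ (w ⟨$⟩ʳ lo {n} i) < toℕ (w ⟨$⟩ʳ hi {n} i)

  direction : ∀ w i → Ascent w i ⊎ Descent w i
  direction w i with ℕₚ.<-cmp (toℕ (w ⟨$⟩ʳ lo {n} i)) (toℕ (w ⟨$⟩ʳ hi {n} i))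
  ... | tri< lt _ _ = inj₁ lt
  ... | tri≈ _ eq _ = ⊥-elim (lo≢hi i (injective w (Finₚ.toℕ-injective eq)))
  ... | tri> _ _ gt = inj₂ gt

  ascent-s : ∀ {w} i → Descent w i → Ascent (w · s i) i
  ascent-s {w} i d = ≡.subst₂ (λ c d → toℕ (w ⟨$⟩ʳ c) < toℕ (w ⟨$⟩ʳ d)) (≡.sym (s-lo i)) (≡.sym (s-hi i)) d

  descent-s : ∀ {w} i → Ascent w i → Descent (w · s i) i
  descent-s {w} i d = ≡.subst₂ (λ c d → toℕ (w ⟨$⟩ʳ c) < toℕ (w ⟨$⟩ʳ d)) (≡.sym (s-hi i)) (≡.sym (s-lo i)) d

  ·ss : ∀ (w : Permutation′ n) i → w · s i · s i Perm.≈ w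
  ·ss w i a = ≡.cong (w ⟨$⟩ʳ_) (s-involutive i a)

  -- An increasing permutation moves no point down; counting from the top
  -- instead, it moves no point up.

  ascents⇒identity : ∀ (w : Permutation′ n) → (∀ i → Ascent w i) → w Perm.≈ Perm.id
  ascents⇒identity w asc a = Finₚ.toℕ-injective (ℕₚ.≤-antisym
    (upper (n ∸ suc (toℕ a)) a (ℕₚ.m+[n∸m]≡n (Finₚ.toℕ<n a))) (lower (toℕ a) a refl))
    where
    step : ∀ {a b : Fin n} → toℕ b ≡ suc (toℕ a) → toℕ (w ⟨$⟩ʳ a) < toℕ (w ⟨$⟩ʳ b)
    step {a} {b} e with successor n a (≡.subst (_< n) e (Finₚ.toℕ<n b))
    ... | i , refl , hi≡ = ≡.subst (λ c → toℕ (w ⟨$⟩ʳ lo {n} i) < toℕ (w ⟨$⟩ʳ c)) (Finₚ.toℕ-injective (≡.trans hi≡ (≡.sym e))) (asc i)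
    lower : ∀ d (a : Fin n) → toℕ a ≡ d → toℕ a ≤ toℕ (w ⟨$⟩ʳ a)
    lower zero    a e = ≡.subst (_≤ toℕ (w ⟨$⟩ʳ a)) (≡.sym e) z≤n
    lower (suc d) a e = ≡.subst (_≤ toℕ (w ⟨$⟩ʳ a)) (≡.trans (≡.cong suc b≡) (≡.sym e))
      (ℕₚ.≤-<-trans (lower d b b≡) (step (≡.trans e (≡.cong suc (≡.sym b≡)))))
      where
      d<n : d < n
      d<n = ℕₚ.<-trans (≡.subst (d <_) (≡.sym e) ℕₚ.≤-refl) (Finₚ.toℕ<n a)
      b = fromℕ< d<n
      b≡ : toℕ b ≡ d
      b≡ = Finₚ.toℕ-fromℕ< d<n
    upper : ∀ d (a : Fin n) → suc (toℕ a) ℕ.+ d ≡ n → toℕ (w ⟨$⟩ʳ a) ≤ toℕ a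
    upper zero    a e = ℕₚ.≤-pred (ℕₚ.≤-trans (Finₚ.toℕ<n (w ⟨$⟩ʳ a)) (ℕₚ.≤-reflexive (≡.trans (≡.sym e) (ℕₚ.+-identityʳ _))))
    upper (suc d) a e = ℕₚ.≤-pred (ℕₚ.<-≤-trans (step b≡) (ℕₚ.≤-trans
      (upper d b (≡.trans (≡.cong (λ c → suc c ℕ.+ d) b≡) (≡.trans (≡.sym (ℕₚ.+-suc (suc (toℕ a)) d)) e))) (ℕₚ.≤-reflexive b≡)))
      where
      sa<n : suc (toℕ a) < n
      sa<n = ≡.subst (suc (toℕ a) <_) e (ℕₚ.m<m+n (suc (toℕ a)) {suc d} (s≤s z≤n))
      b = fromℕ< sa<n
      b≡ : toℕ b ≡ suc (toℕ a)
      b≡ = Finₚ.toℕ-fromℕ< sa<n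

  -- Descents are removed on the right until the identity is left, so that w s_{i₁} ⋯ s_{i_l} = id
  -- and the letters spell w⁻¹.
  data Word : Permutation′ n → List (Fin (n ∸ 1)) → Set where
    []  : ∀ {w} → w Perm.≈ Perm.id → Word w []
    _∷_ : ∀ {w i u} → Descent w i → Word (w · s i) u → Word w (i ∷ u)

  ℓ-descent : ∀ {w i} → Descent w i → ℓ (w ⁻¹) ≡ suc (ℓ ((w · s i) ⁻¹))
  ℓ-descent {w} {i} d = ≡.trans (ℓ-cong {v = w ⁻¹} {w = s i · (w · s i) ⁻¹} λ a → ≡.sym (inverseʳ (s i)))
    (ℓ-s· i ((w · s i) ⁻¹) (ascent-s {w = w} i d))

  word : ∀ w → ∃[ u ] Word w u
  word w = go (ℓ (w ⁻¹)) w refl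
    where
    go : ∀ l w → ℓ (w ⁻¹) ≡ l → ∃[ u ] Word w u
    go l w e with Finₚ.any? (λ i → toℕ (w ⟨$⟩ʳ hi {n} i) ℕₚ.<? toℕ (w ⟨$⟩ʳ lo {n} i))
    go zero    w e | yes (i , d) with ≡.trans (≡.sym e) (ℓ-descent {w = w} {i} d)
    ... | ()
    go (suc l) w e | yes (i , d) with go l (w · s i) (ℕₚ.suc-injective (≡.trans (≡.sym (ℓ-descent {w = w} {i} d)) e))
    ... | u , wu = i ∷ u , d ∷ wu
    go l w e | no none = [] , [] (ascents⇒identity w asc)
      where
      asc : ∀ i → Ascent w i
      asc i with direction w i
      ... | inj₁ a = a
      ... | inj₂ d = ⊥-elim (none (i , d))

  word⇒reduced : ∀ {w u} → Word w u → IsReducedWord u (w ⁻¹)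
  word⇒reduced {w} ([] e) = record
    { word-of = λ a → ≡.sym (⁻¹-cong {v = w} {w = Perm.id} e a)
    ; reduced = ≡.sym (ℓ-identity {w = w ⁻¹} (⁻¹-cong {v = w} {w = Perm.id} e)) }
  word⇒reduced {w} (_∷_ {i = i} d wu) = record
    { word-of = λ a → ≡.trans (≡.cong (s i ⟨$⟩ʳ_) (word-of a)) (inverseʳ (s i))
    ; reduced = ≡.trans (≡.cong suc reduced) (≡.sym (ℓ-descent {w = w} {i} d)) }
    where open IsReducedWord (word⇒reduced wu)

insert-cong : ∀ {n} j {π ρ : Permutation′ n} → π Perm.≈ ρ → Perm.insert zero j π Perm.≈ Perm.insert zero j ρ
insert-cong j e zero    = refl
insert-cong j e (suc i) = ≡.cong (punchIn j) (e i)

insert-injective : ∀ {n} j {π : Permutation′ n} {w : Permutation′ (suc n)} → Perm.insert zero j π Perm.≈ w → π Perm.≈ Perm.remove zero w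
insert-injective j {π} {w} e i = Finₚ.punchIn-injective (w ⟨$⟩ʳ zero) _ _ (≡.trans
  (≡.cong (λ c → punchIn c (π ⟨$⟩ʳ i)) (≡.sym (e zero))) (≡.trans (e (suc i)) (Perm.punchIn-permute w zero i)))

_≈?_ : ∀ {n} (v w : Permutation′ n) → Dec (v Perm.≈ w)
v ≈? w = Finₚ.all? λ i → (v ⟨$⟩ʳ i) Finₚ.≟ (w ⟨$⟩ʳ i)

_≟ᴾ_ : ∀ {k m} (μ ν : Partition k m) → Dec (μ ≡ ν)
μ ≟ᴾ ν = map′ sameParts⇒≡ (λ { refl _ → refl }) (sameParts? μ ν)

-- Sums over permutations and partitions

module Sums {c ℓc} (K : CommutativeRing c ℓc) {m ℓm} (V : LeftModule (CommutativeRing.ring K) m ℓm) where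

  open LeftModule V
  open LinearAlgebra K
  open Linear

  ∑ : ∀ {ℓI} {I : Set ℓI} → List I → (I → Carrierᴹ) → Carrierᴹ
  ∑ is f = sumᴹ V (map f is)

  module _ {ℓI} {I : Set ℓI} where

    ∑-cong : ∀ (is : List I) {f g} → (∀ i → f i ≈ᴹ g i) → ∑ is f ≈ᴹ ∑ is g
    ∑-cong []       e = ≈ᴹ-refl
    ∑-cong (i ∷ is) e = +ᴹ-cong (e i) (∑-cong is e)

    ∑-0 : ∀ (is : List I) {f} → (∀ i → f i ≈ᴹ 0ᴹ) → ∑ is f ≈ᴹ 0ᴹ
    ∑-0 []       e = ≈ᴹ-refl
    ∑-0 (i ∷ is) e = ≈ᴹ-trans (+ᴹ-cong (e i) (∑-0 is e)) (+ᴹ-identityˡ _)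

  module _ {ℓI} {I : Set ℓI} where

    ∑-+ : ∀ (is : List I) f g → ∑ is (λ i → f i +ᴹ g i) ≈ᴹ ∑ is f +ᴹ ∑ is g
    ∑-+ []       f g = ≈ᴹ-sym (+ᴹ-identityˡ _)
    ∑-+ (i ∷ is) f g = ≈ᴹ-trans (+ᴹ-congˡ (∑-+ is f g)) (interchange V _ _ _ _)

    ∑-++ : ∀ (is js : List I) f → ∑ (is ++ js) f ≈ᴹ ∑ is f +ᴹ ∑ js f
    ∑-++ []       js f = ≈ᴹ-sym (+ᴹ-identityˡ _)
    ∑-++ (i ∷ is) js f = ≈ᴹ-trans (+ᴹ-congˡ (∑-++ is js f)) (≈ᴹ-sym (+ᴹ-assoc _ _ _))

    ∑-map : ∀ {ℓJ} {J : Set ℓJ} (h : J → I) js f → ∑ (map h js) f ≈ᴹ ∑ js (λ j → f (h j))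
    ∑-map h []       f = ≈ᴹ-refl
    ∑-map h (j ∷ js) f = +ᴹ-congˡ (∑-map h js f)

    ∑-concatMap : ∀ {ℓJ} {J : Set ℓJ} (h : J → List I) js f → ∑ (concatMap h js) f ≈ᴹ ∑ js (λ j → ∑ (h j) f)
    ∑-concatMap h []       f = ≈ᴹ-refl
    ∑-concatMap h (j ∷ js) f = ≈ᴹ-trans (∑-++ (h j) _ f) (+ᴹ-congˡ (∑-concatMap h js f))

  module _ {ℓI} {I : Set ℓI} where

    ∑-swap : ∀ {ℓJ} {J : Set ℓJ} (is : List I) (js : List J) (f : I → J → Carrierᴹ) →
             ∑ is (λ i → ∑ js (f i)) ≈ᴹ ∑ js (λ j → ∑ is (λ i → f i j))
    ∑-swap []       js f = ≈ᴹ-sym (∑-0 js λ _ → ≈ᴹ-refl)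
    ∑-swap (i ∷ is) js f = ≈ᴹ-trans (+ᴹ-congˡ (∑-swap is js f)) (≈ᴹ-sym (∑-+ js _ _))

    ∑-linear : ∀ {m₂ ℓm₂} {V₂ : Module m₂ ℓm₂} {φ} → Linear V₂ V φ → ∀ (is : List I) f →
               φ (sumᴹ V₂ (map f is)) ≈ᴹ ∑ is (λ i → φ (f i))
    ∑-linear Φ []       f = f-0 Φ
    ∑-linear Φ (i ∷ is) f = ≈ᴹ-trans (f-+ Φ _ _) (+ᴹ-congˡ (∑-linear Φ is f))

  when : ∀ {ℓA} {A : Set ℓA} → Dec A → Carrierᴹ → Carrierᴹ
  when (yes _) v = v
  when (no _)  v = 0ᴹ

  when-yes : ∀ {ℓA} {A : Set ℓA} (d : Dec A) {v} → A → when d v ≈ᴹ v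
  when-yes (yes _) a = ≈ᴹ-refl
  when-yes (no ¬a) a = ⊥-elim (¬a a)

  when-no : ∀ {ℓA} {A : Set ℓA} (d : Dec A) {v} → ¬ A → when d v ≈ᴹ 0ᴹ
  when-no (yes a) ¬a = ⊥-elim (¬a a)
  when-no (no _)  ¬a = ≈ᴹ-refl

  module _ {ℓI} {I : Set ℓI} where

    ∑-filter : ∀ {ℓP} {P : I → Set ℓP} (P? : ∀ i → Dec (P i)) is f →
               ∑ (filter P? is) f ≈ᴹ ∑ is (λ i → when (P? i) (f i))
    ∑-filter P? []       f = ≈ᴹ-refl
    ∑-filter P? (i ∷ is) f with P? i
    ... | yes _ = +ᴹ-congˡ (∑-filter P? is f)
    ... | no _  = ≈ᴹ-trans (∑-filter P? is f) (≈ᴹ-sym (+ᴹ-identityˡ _))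

    ∑-tabulate : ∀ {n} (g : Fin n → I) f i → (∀ j → j ≢ i → f (g j) ≈ᴹ 0ᴹ) → ∑ (tabulate g) f ≈ᴹ f (g i)
    ∑-tabulate {suc n} g f zero    e = ≈ᴹ-trans (+ᴹ-congˡ (zeroes (λ j → g (suc j)) λ j → e (suc j) λ ())) (+ᴹ-identityʳ _)
      where
      zeroes : ∀ {n} (g : Fin n → I) → (∀ j → f (g j) ≈ᴹ 0ᴹ) → ∑ (tabulate g) f ≈ᴹ 0ᴹ
      zeroes {zero}  g e = ≈ᴹ-refl
      zeroes {suc n} g e = ≈ᴹ-trans (+ᴹ-cong (e zero) (zeroes (λ j → g (suc j)) λ j → e (suc j))) (+ᴹ-identityˡ _)
    ∑-tabulate {suc n} g f (suc i) e = ≈ᴹ-trans (+ᴹ-cong (e zero λ ())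
      (∑-tabulate (λ j → g (suc j)) f i λ j j≢i → e (suc j) λ { refl → j≢i refl })) (+ᴹ-identityˡ _)

  -- The list is built by choosing the image of zero, so exactly one of its entries is `≈` to `w`.
  -- That entry need not be `w` itself, hence the invariance hypothesis at `w`.
  ∑-permutations : ∀ {n} f (w : Permutation′ n) → (∀ {v} → v Perm.≈ w → f v ≈ᴹ f w) → (∀ v → ¬ v Perm.≈ w → f v ≈ᴹ 0ᴹ) →
                   ∑ (permutations n) f ≈ᴹ f w
  ∑-permutations {zero}  f w ext off = ≈ᴹ-trans (+ᴹ-identityʳ _) (ext λ ())
  ∑-permutations {suc n} f w ext off = ≈ᴹ-trans (∑-concatMap (λ j → map (Perm.insert zero j) (permutations n)) (allFin (suc n)) f) (≈ᴹ-trans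
    (∑-cong (allFin (suc n)) λ j → ∑-map (Perm.insert zero j) (permutations n) f)
    (≈ᴹ-trans
      (∑-tabulate (λ j → j) _ (w ⟨$⟩ʳ zero) λ j j≢ → ∑-0 (permutations n) λ π → off _ λ e → j≢ (e zero))
      (≈ᴹ-trans
        (∑-permutations (λ π → f (Perm.insert zero (w ⟨$⟩ʳ zero) π)) (Perm.remove zero w)
          (λ {π} e → ≈ᴹ-trans (ext λ i → ≡.trans (insert-cong (w ⟨$⟩ʳ zero) {π} {Perm.remove zero w} e i) (Perm.insert-remove zero w i))
            (≈ᴹ-sym (ext (Perm.insert-remove zero w))))
          (λ π ¬e → off _ λ e → ¬e (insert-injective (w ⟨$⟩ʳ zero) {π} {w} e)))
        (ext (Perm.insert-remove zero w)))))

  ∑-partitions : ∀ {k l} f (ν : Partition k l) → (∀ μ → μ ≢ ν → f μ ≈ᴹ 0ᴹ) → ∑ (partitions k l) f ≈ᴹ f ν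
  ∑-partitions {zero}  f []      off = +ᴹ-identityʳ _
  ∑-partitions {suc k} {l} f (a ∷ ν) off = ≈ᴹ-trans (∑-concatMap (λ b → map (b ∷_) (partitions k (toℕ b))) (allFin (suc l)) f) (≈ᴹ-trans
    (∑-cong (allFin (suc l)) λ b → ∑-map (b ∷_) (partitions k (toℕ b)) f) (≈ᴹ-trans
    (∑-tabulate (λ b → b) _ a λ b b≢a → ∑-0 (partitions k (toℕ b)) λ μ → off _ λ { refl → b≢a refl })
    (∑-partitions (λ μ → f (a ∷ μ)) ν λ μ μ≢ν → off _ λ { refl → μ≢ν refl })))

  -- Sum the indicator of u ≈ v σ over both u and v, in either order. This avoids rearranging the
  -- list, whose entries represent permutations only up to `≈`.
  ∑-reindex : ∀ {n} (f : Permutation′ n → Carrierᴹ) → (∀ {v w} → v Perm.≈ w → f v ≈ᴹ f w) →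
              ∀ (σ : Permutation′ n) → (∀ a → σ ⟨$⟩ʳ (σ ⟨$⟩ʳ a) ≡ a) →
              ∑ (permutations n) (λ v → f (v · σ)) ≈ᴹ ∑ (permutations n) f
  ∑-reindex {n} f ext σ inv = ≈ᴹ-trans
    (∑-cong (permutations n) λ v → ≈ᴹ-sym (≈ᴹ-trans
      (∑-permutations (λ u → when (u ≈? (v · σ)) (f u)) (v · σ)
        (λ {u} e → ≈ᴹ-trans (when-yes (u ≈? (v · σ)) e) (≈ᴹ-trans (ext {u} {v · σ} e) (≈ᴹ-sym (when-yes ((v · σ) ≈? (v · σ)) λ _ → refl))))
        (λ u → when-no (u ≈? (v · σ))))
      (when-yes ((v · σ) ≈? (v · σ)) λ _ → refl)))
    (≈ᴹ-trans (∑-swap (permutations n) (permutations n) _)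
    (∑-cong (permutations n) λ u → ≈ᴹ-trans
      (∑-permutations (λ v → when (u ≈? (v · σ)) (f u)) (u · σ)
        (λ {v} e → ≈ᴹ-trans (when-yes (u ≈? (v · σ)) (λ a → ≡.trans (≡.cong (u ⟨$⟩ʳ_) (≡.sym (inv a))) (≡.sym (e (σ ⟨$⟩ʳ a)))))
           (≈ᴹ-sym (when-yes (u ≈? (u · σ · σ)) (λ a → ≡.cong (u ⟨$⟩ʳ_) (≡.sym (inv a))))))
        (λ v ¬e → when-no (u ≈? (v · σ)) λ e → ¬e λ a → ≡.trans (≡.cong (v ⟨$⟩ʳ_) (≡.sym (inv a))) (≡.sym (e (σ ⟨$⟩ʳ a)))))
      (when-yes (u ≈? (u · σ · σ)) (λ a → ≡.cong (u ⟨$⟩ʳ_) (≡.sym (inv a))))))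

module Series {c ℓc} (K : CommutativeRing c ℓc) {P Q N H : CommutativeRing.Carrier K}
  {m ℓm} {V : LeftModule (CommutativeRing.ring K) m ℓm} (S : Parameters.Operators K P Q N H V) where

  open LinearAlgebra K
  open Parameters K P Q N H
  open LeftModule V
  open Operators S
  open Linear

  -- The variable of the generating function acts as the shift, and everything else acts on
  -- coefficients.
  seriesOperators : Operators (series V)
  seriesOperators = record
    { X = λ j u r → X j (u r)
    ; X-linear = λ j → series-linear (X-linear j)
    ; Z = shift V
    ; Z-linear = shift-linear V
    }

  module _ {n} (𝓗 : HeckeAction S n) where

    open HeckeAction 𝓗

    seriesAction : HeckeAction seriesOperators n
    seriesAction = record
      { P+N≈Q = P+N≈Q
      ; 𝕋 = λ i u r → 𝕋 i (u r)
      ; 𝕋-linear = λ i → series-linear (𝕋-linear i)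
      ; 𝕋-Z = λ i → series-shift (𝕋-linear i)
      ; X-Z = λ j → series-shift (X-linear j)
      ; X-X = λ i j v r → X-X i j (v r)
      ; quadratic′ = λ i v l r → quadratic′ i (v r) l
      ; braid′ = λ i v l r → braid′ i (v r) l
      ; far′ = λ i j v l l′ r → far′ i j (v r) l l′
      ; 𝕋-X = λ i v l r → 𝕋-X i (v r) l
      ; 𝕋-X⁺ = λ i v l r → 𝕋-X⁺ i (v r) l
      ; 𝕋-X-other = λ i j v l l′ e e′ r → 𝕋-X-other i j (v r) l l′ e e′
      }

    private
      module V = Strands K 𝓗
      module W = Strands K seriesAction

    B-series : ∀ k z u r → W.B k z u r ≡ V.B k z (u r)
    B-series k zero    u r = refl
    B-series k (suc z) u r = ≡.cong (𝕋 (z ℕ.+ k)) (B-series k z u r)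

    Y-series : ∀ b k z u r → W.Y b k z u r ≡ V.Y b k z (u r)
    Y-series (false ∷ b) k       zero    u r = refl
    Y-series (false ∷ b) k       (suc z) u r = Y-series b k z u r
    Y-series (true ∷ b)  zero    z       u r = refl
    Y-series (true ∷ b)  (suc k) z       u r = ≡.trans (Y-series b k z _ r) (≡.cong (V.Y b k z) (B-series k z u r))
    Y-series []          zero    zero    u r = refl
    Y-series []          zero    (suc z) u r = refl
    Y-series []          (suc k) z       u r = refl

-- The operators of a Schubert representation

module Representation {c ℓ₁ ℓ₂ m ℓm} (F : HeytingField c ℓ₁ ℓ₂) (n : ℕ) (t : Fin n → HeytingField.Carrier F)
  (rep : SchubertRepresentation F n t m ℓm) where

  K : CommutativeRing c ℓ₁
  K = HeytingCommutativeRing.commutativeRing (HeytingField.heytingCommutativeRing F)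

  open SchubertRepresentation rep hiding (_^_)
  open CommutativeRing K using (Carrier; _≈_; _+_; _*_; -_; 0#; +-congˡ; +-congʳ; +-assoc; +-comm; +-identityʳ; -‿inverseʳ)
    renaming (refl to ≈-refl; sym to ≈-sym; trans to ≈-trans)
  open LinearAlgebra K
  open Linear
  open ModuleSolver V
  open Presented ℚ[p,q,ħ] (Generator n) using (Term; con; gen; _⊕_; _⊗_; ⊖_; rel)
  open SetoidReasoning ≈ᴹ-setoid
  open SymmetricGroup n

  private
    module ▷ = ModuleStructures.IsLeftModule ▷-isModule
    module Ĥₙ = Ring (Ĥ n)

  A N : Carrier
  A = p̂ + - q̂
  N = q̂ + - p̂

  p+N≈q : p̂ + N ≈ q̂
  p+N≈q = ≈-trans (≈-trans (≈-sym (+-assoc _ _ _)) (≈-trans (+-congʳ (+-comm _ _)) (+-assoc _ _ _)))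
    (≈-trans (+-congˡ (-‿inverseʳ _)) (+-identityʳ _))

  A+q≈p : A + q̂ ≈ p̂
  A+q≈p = ≈-trans (+-assoc _ _ _) (≈-trans (+-congˡ (≈-trans (+-comm _ _) (-‿inverseʳ _))) (+-identityʳ _))

  A+N≈0 : A + N ≈ 0#
  A+N≈0 = ≈-trans (≈-sym (+-assoc _ _ _)) (≈-trans (+-congʳ A+q≈p) (-‿inverseʳ _))

  open Parameters K p̂ q̂ N ħ̂

  τ : Fin (n ∸ 1) → Carrierᴹ → Carrierᴹ
  τ i v = gen (T i) ▷ v

  ξ : Fin n → Carrierᴹ → Carrierᴹ
  ξ j v = gen (x j) ▷ v

  ▷-Linear : ∀ h → Linear V V (h ▷_)
  ▷-Linear h = record { f-cong = ▷.*ₗ-cong Ĥₙ.refl ; f-+ = ▷.*ₗ-distribˡ h ; f-* = λ a v → ▷-linear h a v }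

  private
    τ-linear : ∀ i → Linear V V (τ i)
    τ-linear i = ▷-Linear (gen (T i))

    ξ-linear : ∀ j → Linear V V (ξ j)
    ξ-linear j = ▷-Linear (gen (x j))

    relation : ∀ {a b} → HeckeRel n a b → ∀ v → a ▷ v ≈ᴹ b ▷ v
    relation r v = ▷.*ₗ-cong (rel r) ≈ᴹ-refl

    ⊖-cancel : ∀ a v → (⊖ a) ▷ v +ᴹ a ▷ v ≈ᴹ 0ᴹ
    ⊖-cancel a v = ≈ᴹ-trans (≈ᴹ-sym (▷.*ₗ-distribʳ v (⊖ a) a))
      (≈ᴹ-trans (▷.*ₗ-cong (Ĥₙ.-‿inverseˡ a) ≈ᴹ-refl) (▷.*ₗ-zeroˡ v))

    A+N-cancel : ∀ v → A *ₗ v +ᴹ N *ₗ v ≈ᴹ 0ᴹ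
    A+N-cancel v = ≈ᴹ-trans (≈ᴹ-sym (*ₗ-distribʳ v A N)) (≈ᴹ-trans (*ₗ-congʳ A+N≈0) (*ₗ-zeroˡ v))

    drop : ∀ {u v} → v ≈ᴹ 0ᴹ → u +ᴹ v ≈ᴹ u
    drop e = ≈ᴹ-trans (+ᴹ-congˡ e) (+ᴹ-identityʳ _)

  τ-quadratic : ∀ i v → τ i (τ i v) +ᴹ A *ₗ τ i v ≈ᴹ (p̂ * q̂) *ₗ v
  τ-quadratic i v = begin
    τ i (τ i v) +ᴹ A *ₗ τ i v
      ≈⟨ +ᴹ-cong (≈ᴹ-trans (f-cong (τ-linear i) (≈ᴹ-sym w+qv)) (≈ᴹ-trans (f-+ (τ-linear i) _ _) (+ᴹ-congˡ (f-* (τ-linear i) _ _))))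
           ≈ᴹ-refl ⟩
    (τ i w +ᴹ q̂ *ₗ τ i v) +ᴹ A *ₗ τ i v
      ≈⟨ solve (q̂ ∷ A ∷ []) (τ i w ∷ τ i v ∷ [])
           (λ { (κ ∷ α ∷ []) (a ∷ b ∷ []) → (a ⊞ κ ⊡ b) ⊞ α ⊡ b , a ⊞ (α :+ κ) ⊡ b }) (≈-refl , ≈-refl , tt) ⟩
    τ i w +ᴹ (A + q̂) *ₗ τ i v
      ≈⟨ +ᴹ-congˡ (*ₗ-cong A+q≈p (≈ᴹ-sym w+qv)) ⟩
    τ i w +ᴹ p̂ *ₗ (w +ᴹ q̂ *ₗ v)
      ≈⟨ solve (p̂ ∷ q̂ ∷ []) (τ i w ∷ w ∷ v ∷ [])
           (λ { (π ∷ κ ∷ []) (a ∷ w ∷ v ∷ []) → a ⊞ π ⊡ (w ⊞ κ ⊡ v) , (a ⊞ π ⊡ w) ⊞ (π :* κ) ⊡ v }) (≈-refl , ≈-refl , ≈-refl , tt) ⟩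
    (τ i w +ᴹ p̂ *ₗ w) +ᴹ (p̂ * q̂) *ₗ v
      ≈⟨ +ᴹ-congʳ vanishing ⟩
    0ᴹ +ᴹ (p̂ * q̂) *ₗ v
      ≈⟨ +ᴹ-identityˡ _ ⟩
    (p̂ * q̂) *ₗ v ∎
    where
    𝕡 𝕢 : Term
    𝕡 = con (indeterminate p)
    𝕢 = con (indeterminate q)
    w : Carrierᴹ
    w = (gen (T i) ⊕ ⊖ 𝕢) ▷ v
    w+qv : w +ᴹ q̂ *ₗ v ≈ᴹ τ i v
    w+qv = ≈ᴹ-trans (+ᴹ-cong (▷.*ₗ-distribʳ v (gen (T i)) (⊖ 𝕢)) (≈ᴹ-sym (▷-scalar _ v)))
      (≈ᴹ-trans (+ᴹ-assoc _ _ _) (drop (⊖-cancel 𝕢 v)))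
    vanishing : τ i w +ᴹ p̂ *ₗ w ≈ᴹ 0ᴹ
    vanishing = ≈ᴹ-trans (+ᴹ-congˡ (≈ᴹ-sym (▷-scalar _ w))) (≈ᴹ-trans (≈ᴹ-sym (▷.*ₗ-distribʳ w (gen (T i)) 𝕡))
      (≈ᴹ-trans (≈ᴹ-sym (▷.*ₗ-assoc _ _ v)) (≈ᴹ-trans (relation (quadratic i) v) (▷.*ₗ-zeroˡ v))))

  -- T_i + p − q, which is pq T_i⁻¹ when pq is invertible.

  T̄ : Fin (n ∸ 1) → Carrierᴹ → Carrierᴹ
  T̄ i v = τ i v +ᴹ A *ₗ v

  T̄-linear : ∀ i → Linear V V (T̄ i)
  T̄-linear i = +-linear (τ-linear i) (*-linear A id-linear)

  T̄τ : ∀ i v → T̄ i (τ i v) ≈ᴹ (p̂ * q̂) *ₗ v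
  T̄τ = τ-quadratic

  T̄-quadratic : ∀ i v → T̄ i (T̄ i v) +ᴹ N *ₗ T̄ i v ≈ᴹ (p̂ * q̂) *ₗ v
  T̄-quadratic i v = begin
    T̄ i (T̄ i v) +ᴹ N *ₗ T̄ i v
      ≈⟨ +ᴹ-congʳ (≈ᴹ-trans (f-+ (T̄-linear i) _ _) (+ᴹ-cong (T̄τ i v) (f-* (T̄-linear i) _ _))) ⟩
    ((p̂ * q̂) *ₗ v +ᴹ A *ₗ T̄ i v) +ᴹ N *ₗ T̄ i v
      ≈⟨ +ᴹ-assoc _ _ _ ⟩
    (p̂ * q̂) *ₗ v +ᴹ (A *ₗ T̄ i v +ᴹ N *ₗ T̄ i v)
      ≈⟨ drop (A+N-cancel _) ⟩
    (p̂ * q̂) *ₗ v ∎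

  private
    τττ : ∀ a b d v → (gen (T a) ⊗ gen (T b) ⊗ gen (T d)) ▷ v ≈ᴹ τ a (τ b (τ d v))
    τττ a b d v = ≈ᴹ-trans (▷.*ₗ-assoc _ _ v) (▷.*ₗ-assoc _ _ _)

    τ-combination : ∀ i r u s v → τ i (r *ₗ u +ᴹ s *ₗ v) ≈ᴹ r *ₗ τ i u +ᴹ s *ₗ τ i v
    τ-combination i r u s v = ≈ᴹ-trans (f-+ (τ-linear i) _ _) (+ᴹ-cong (f-* (τ-linear i) _ _) (f-* (τ-linear i) _ _))

    -- Once the square has been reduced by the quadratic relation, every term but the first is
    -- symmetric in i and j. The braid relation of the T therefore passes to the T̄.
    T̄T̄T̄ : ∀ i j v → T̄ i (T̄ j (T̄ i v)) ≈ᴹ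
      τ i (τ j (τ i v)) +ᴹ (A *ₗ (τ i (τ j v) +ᴹ τ j (τ i v)) +ᴹ ((A * (p̂ * q̂)) *ₗ v
        +ᴹ ((A * A) *ₗ (τ i v +ᴹ τ j v) +ᴹ (A * (A * A)) *ₗ v)))
    T̄T̄T̄ i j v = begin
      τ i (τ j (τ i v +ᴹ A *ₗ v) +ᴹ A *ₗ (τ i v +ᴹ A *ₗ v)) +ᴹ A *ₗ (τ j (τ i v +ᴹ A *ₗ v) +ᴹ A *ₗ (τ i v +ᴹ A *ₗ v))
        ≈⟨ +ᴹ-cong (f-cong (τ-linear i) inner) (*ₗ-congˡ inner) ⟩
      τ i (τ j (τ i v) +ᴹ (A *ₗ τ j v +ᴹ (A *ₗ τ i v +ᴹ (A * A) *ₗ v)))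
        +ᴹ A *ₗ (τ j (τ i v) +ᴹ (A *ₗ τ j v +ᴹ (A *ₗ τ i v +ᴹ (A * A) *ₗ v)))
        ≈⟨ +ᴹ-congʳ (≈ᴹ-trans (f-+ (τ-linear i) _ _) (+ᴹ-congˡ (≈ᴹ-trans (f-+ (τ-linear i) _ _)
             (+ᴹ-cong (f-* (τ-linear i) _ _) (τ-combination i A (τ i v) (A * A) v))))) ⟩
      (τ i (τ j (τ i v)) +ᴹ (A *ₗ τ i (τ j v) +ᴹ (A *ₗ τ i (τ i v) +ᴹ (A * A) *ₗ τ i v)))
        +ᴹ A *ₗ (τ j (τ i v) +ᴹ (A *ₗ τ j v +ᴹ (A *ₗ τ i v +ᴹ (A * A) *ₗ v)))
        ≈⟨ solve (A ∷ []) (τ i (τ j (τ i v)) ∷ τ i (τ j v) ∷ τ j (τ i v) ∷ τ i (τ i v) ∷ τ i v ∷ τ j v ∷ v ∷ [])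
             (λ { (α ∷ []) (iji ∷ ij ∷ ji ∷ ii ∷ i ∷ j ∷ v ∷ []) →
                  (iji ⊞ (α ⊡ ij ⊞ (α ⊡ ii ⊞ (α :* α) ⊡ i))) ⊞ α ⊡ (ji ⊞ (α ⊡ j ⊞ (α ⊡ i ⊞ (α :* α) ⊡ v)))
                , iji ⊞ (α ⊡ (ij ⊞ ji) ⊞ (α ⊡ (ii ⊞ α ⊡ i) ⊞ ((α :* α) ⊡ (i ⊞ j) ⊞ (α :* (α :* α)) ⊡ v))) })
             (≈-refl , ≈-refl , ≈-refl , ≈-refl , ≈-refl , ≈-refl , ≈-refl , tt) ⟩
      τ i (τ j (τ i v)) +ᴹ (A *ₗ (τ i (τ j v) +ᴹ τ j (τ i v)) +ᴹ (A *ₗ (τ i (τ i v) +ᴹ A *ₗ τ i v)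
        +ᴹ ((A * A) *ₗ (τ i v +ᴹ τ j v) +ᴹ (A * (A * A)) *ₗ v)))
        ≈⟨ +ᴹ-congˡ (+ᴹ-congˡ (+ᴹ-congʳ (≈ᴹ-trans (*ₗ-congˡ (τ-quadratic i v)) (≈ᴹ-sym (*ₗ-assoc _ _ _))))) ⟩
      τ i (τ j (τ i v)) +ᴹ (A *ₗ (τ i (τ j v) +ᴹ τ j (τ i v)) +ᴹ ((A * (p̂ * q̂)) *ₗ v
        +ᴹ ((A * A) *ₗ (τ i v +ᴹ τ j v) +ᴹ (A * (A * A)) *ₗ v))) ∎
      where
      inner : τ j (τ i v +ᴹ A *ₗ v) +ᴹ A *ₗ (τ i v +ᴹ A *ₗ v) ≈ᴹ
              τ j (τ i v) +ᴹ (A *ₗ τ j v +ᴹ (A *ₗ τ i v +ᴹ (A * A) *ₗ v))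
      inner = ≈ᴹ-trans (+ᴹ-congʳ (≈ᴹ-trans (f-+ (τ-linear j) _ _) (+ᴹ-congˡ (f-* (τ-linear j) _ _))))
        (solve (A ∷ []) (τ j (τ i v) ∷ τ j v ∷ τ i v ∷ v ∷ [])
          (λ { (α ∷ []) (ji ∷ j ∷ i ∷ v ∷ []) → (ji ⊞ α ⊡ j) ⊞ α ⊡ (i ⊞ α ⊡ v) , ji ⊞ (α ⊡ j ⊞ (α ⊡ i ⊞ (α :* α) ⊡ v)) })
          (≈-refl , ≈-refl , ≈-refl , ≈-refl , tt))

  T̄-braid : ∀ i j v → toℕ j ≡ suc (toℕ i) → T̄ i (T̄ j (T̄ i v)) ≈ᴹ T̄ j (T̄ i (T̄ j v))
  T̄-braid i j v e = ≈ᴹ-trans (T̄T̄T̄ i j v) (≈ᴹ-trans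
    (+ᴹ-cong (≈ᴹ-trans (≈ᴹ-sym (τττ i j i v)) (≈ᴹ-trans (relation (braid i j e) v) (τττ j i j v)))
      (+ᴹ-cong (*ₗ-congˡ (+ᴹ-comm _ _)) (+ᴹ-congˡ (+ᴹ-congʳ (*ₗ-congˡ (+ᴹ-comm _ _))))))
    (≈ᴹ-sym (T̄T̄T̄ j i v)))

  T̄-commute : ∀ i {φ} → Linear V V φ → (∀ v → τ i (φ v) ≈ᴹ φ (τ i v)) → ∀ v → T̄ i (φ v) ≈ᴹ φ (T̄ i v)
  T̄-commute i Φ comm v = ≈ᴹ-trans (+ᴹ-cong (comm v) (≈ᴹ-sym (f-* Φ _ _))) (≈ᴹ-sym (f-+ Φ _ _))

  T̄-far : ∀ i j v → 2 ≤ ∣ toℕ i - toℕ j ∣ → T̄ i (T̄ j v) ≈ᴹ T̄ j (T̄ i v)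
  T̄-far i j v l = T̄-commute i (T̄-linear j) (λ u → ≈ᴹ-trans (f-+ (τ-linear i) _ _)
    (+ᴹ-cong (≈ᴹ-trans (≈ᴹ-sym (▷.*ₗ-assoc _ _ u)) (≈ᴹ-trans (relation (far i j l) u) (▷.*ₗ-assoc _ _ u))) (f-* (τ-linear i) _ _))) v

  ξ-ξ : ∀ i j v → ξ i (ξ j v) ≈ᴹ ξ j (ξ i v)
  ξ-ξ i j v = ≈ᴹ-trans (≈ᴹ-sym (▷.*ₗ-assoc _ _ v)) (≈ᴹ-trans (relation (xx i j) v) (▷.*ₗ-assoc _ _ v))

  T̄-ξ-other : ∀ i j v → j ≢ lo i → j ≢ hi i → T̄ i (ξ j v) ≈ᴹ ξ j (T̄ i v)
  T̄-ξ-other i j v e e′ = T̄-commute i (ξ-linear j)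
    (λ u → ≈ᴹ-trans (≈ᴹ-sym (▷.*ₗ-assoc _ _ u)) (≈ᴹ-trans (relation (Tx-other i j e e′) u) (▷.*ₗ-assoc _ _ u))) v

  Cξ : Fin n → Carrierᴹ → Carrierᴹ
  Cξ j v = ħ̂ *ₗ v +ᴹ N *ₗ ξ j v

  private
    correction : Fin n → Term
    correction j = con (indeterminate ħ) ⊕ ⊖ ((con (indeterminate p) ⊕ ⊖ con (indeterminate q)) ⊗ gen (x j))

    p−q : ∀ u → (con (indeterminate p) ⊕ ⊖ con (indeterminate q)) ▷ u ≈ᴹ A *ₗ u
    p−q u = begin
      (𝕡 ⊕ ⊖ 𝕢) ▷ u
        ≈⟨ ≈ᴹ-trans (▷.*ₗ-distribʳ u 𝕡 (⊖ 𝕢)) (+ᴹ-congʳ (≈ᴹ-trans (▷-scalar _ u) (≈ᴹ-trans (*ₗ-congʳ (≈-sym A+q≈p)) (*ₗ-distribʳ u A q̂)))) ⟩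
      (A *ₗ u +ᴹ q̂ *ₗ u) +ᴹ (⊖ 𝕢) ▷ u
        ≈⟨ +ᴹ-assoc _ _ _ ⟩
      A *ₗ u +ᴹ (q̂ *ₗ u +ᴹ (⊖ 𝕢) ▷ u)
        ≈⟨ drop (≈ᴹ-trans (+ᴹ-comm _ _) (≈ᴹ-trans (+ᴹ-congˡ (≈ᴹ-sym (▷-scalar _ u))) (⊖-cancel 𝕢 u))) ⟩
      A *ₗ u ∎
      where
      𝕡 𝕢 : Term
      𝕡 = con (indeterminate p)
      𝕢 = con (indeterminate q)

    correction≈ : ∀ j v → correction j ▷ v +ᴹ A *ₗ ξ j v ≈ᴹ ħ̂ *ₗ v
    correction≈ j v = ≈ᴹ-trans (+ᴹ-cong (▷.*ₗ-distribʳ v _ _) (≈ᴹ-sym (≈ᴹ-trans (▷.*ₗ-assoc _ _ v) (p−q (ξ j v)))))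
      (≈ᴹ-trans (+ᴹ-assoc _ _ _) (≈ᴹ-trans (drop (⊖-cancel _ v)) (▷-scalar _ v)))

  -- For T the correction contains x_i. The summand (p - q) x_i of T̄ x_i reduces it to ħ, and
  -- rewriting x_{i+1} T as x_{i+1} T̄ - (p - q) x_{i+1} makes it the correction with x_{i+1}.
  T̄-ξ : ∀ i v → T̄ i (ξ (lo i) v) ≈ᴹ ξ (hi i) (T̄ i v) +ᴹ Cξ (hi i) v
  T̄-ξ i v = begin
    τ i (ξ (lo i) v) +ᴹ A *ₗ ξ (lo i) v
      ≈⟨ +ᴹ-congʳ (≈ᴹ-trans (≈ᴹ-sym (▷.*ₗ-assoc _ _ v)) (≈ᴹ-trans (relation (Tx-lo i) v)
           (≈ᴹ-trans (▷.*ₗ-distribʳ v _ _) (+ᴹ-congʳ (▷.*ₗ-assoc _ _ v))))) ⟩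
    (ξ (hi i) (τ i v) +ᴹ correction (lo i) ▷ v) +ᴹ A *ₗ ξ (lo i) v
      ≈⟨ ≈ᴹ-trans (+ᴹ-assoc _ _ _) (+ᴹ-congˡ (correction≈ (lo i) v)) ⟩
    ξ (hi i) (τ i v) +ᴹ ħ̂ *ₗ v
      ≈⟨ ≈ᴹ-sym (drop (A+N-cancel (ξ (hi i) v))) ⟩
    (ξ (hi i) (τ i v) +ᴹ ħ̂ *ₗ v) +ᴹ (A *ₗ ξ (hi i) v +ᴹ N *ₗ ξ (hi i) v)
      ≈⟨ solve (A ∷ N ∷ ħ̂ ∷ []) (ξ (hi i) (τ i v) ∷ v ∷ ξ (hi i) v ∷ [])
           (λ { (α ∷ ν ∷ η ∷ []) (a ∷ v ∷ b ∷ []) → (a ⊞ η ⊡ v) ⊞ (α ⊡ b ⊞ ν ⊡ b) , (a ⊞ α ⊡ b) ⊞ (η ⊡ v ⊞ ν ⊡ b) })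
           (≈-refl , ≈-refl , ≈-refl , tt) ⟩
    (ξ (hi i) (τ i v) +ᴹ A *ₗ ξ (hi i) v) +ᴹ Cξ (hi i) v
      ≈⟨ +ᴹ-congʳ (≈ᴹ-sym (≈ᴹ-trans (f-+ (ξ-linear (hi i)) _ _) (+ᴹ-congˡ (f-* (ξ-linear (hi i)) _ _)))) ⟩
    ξ (hi i) (T̄ i v) +ᴹ Cξ (hi i) v ∎

  T̄-ξ⁺ : ∀ i v → T̄ i (ξ (hi i) v) +ᴹ Cξ (hi i) v ≈ᴹ ξ (lo i) (T̄ i v)
  T̄-ξ⁺ i v = begin
    (τ i (ξ (hi i) v) +ᴹ A *ₗ ξ (hi i) v) +ᴹ (ħ̂ *ₗ v +ᴹ N *ₗ ξ (hi i) v)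
      ≈⟨ +ᴹ-cong (+ᴹ-congʳ (≈ᴹ-trans (≈ᴹ-sym (▷.*ₗ-assoc _ _ v)) (≈ᴹ-trans (relation (Tx-hi i) v)
           (≈ᴹ-trans (▷.*ₗ-distribʳ v _ _) (+ᴹ-congʳ (▷.*ₗ-assoc _ _ v)))))) (+ᴹ-congʳ (≈ᴹ-sym (correction≈ (lo i) v))) ⟩
    ((ξ (lo i) (τ i v) +ᴹ (⊖ κ) ▷ v) +ᴹ A *ₗ ξ (hi i) v) +ᴹ ((κ ▷ v +ᴹ A *ₗ ξ (lo i) v) +ᴹ N *ₗ ξ (hi i) v)
      ≈⟨ solve (A ∷ N ∷ []) (ξ (lo i) (τ i v) ∷ (⊖ κ) ▷ v ∷ ξ (hi i) v ∷ κ ▷ v ∷ ξ (lo i) v ∷ [])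
           (λ { (α ∷ ν ∷ []) (a ∷ b ∷ w ∷ d ∷ y ∷ []) →
                ((a ⊞ b) ⊞ α ⊡ w) ⊞ ((d ⊞ α ⊡ y) ⊞ ν ⊡ w) , ((a ⊞ α ⊡ y) ⊞ (b ⊞ d)) ⊞ (α ⊡ w ⊞ ν ⊡ w) })
           (≈-refl , ≈-refl , ≈-refl , ≈-refl , ≈-refl , tt) ⟩
    ((ξ (lo i) (τ i v) +ᴹ A *ₗ ξ (lo i) v) +ᴹ ((⊖ κ) ▷ v +ᴹ κ ▷ v)) +ᴹ (A *ₗ ξ (hi i) v +ᴹ N *ₗ ξ (hi i) v)
      ≈⟨ ≈ᴹ-trans (drop (A+N-cancel _)) (drop (⊖-cancel κ v)) ⟩
    ξ (lo i) (τ i v) +ᴹ A *ₗ ξ (lo i) v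
      ≈⟨ ≈ᴹ-sym (≈ᴹ-trans (f-+ (ξ-linear (lo i)) _ _) (+ᴹ-congˡ (f-* (ξ-linear (lo i)) _ _))) ⟩
    ξ (lo i) (T̄ i v) ∎
    where
    κ = correction (lo i)

  site : ∀ i → suc i < n → Fin (n ∸ 1)
  site i l = fromℕ< (ℕₚ.∸-monoˡ-≤ 1 l)

  toℕ-site : ∀ i l → toℕ (site i l) ≡ i
  toℕ-site i l = Finₚ.toℕ-fromℕ< (ℕₚ.∸-monoˡ-≤ 1 l)

  private
    at : ∀ {ℓA} {A : Set ℓA} → Dec A → (A → Carrierᴹ → Carrierᴹ) → Carrierᴹ → Carrierᴹ
    at (yes a) φ = φ a
    at (no _)  φ = λ _ → 0ᴹ

    at-linear : ∀ {ℓA} {A : Set ℓA} (d : Dec A) {φ} → (∀ a → Linear V V (φ a)) → Linear V V (at d φ)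
    at-linear (yes a) Φ = Φ a
    at-linear (no _)  Φ = 0-linear

  -- Here and in `Xₙ` an index out of range acts by 0, so that sites can be numbered by natural
  -- numbers.
  𝕋ₙ : ℕ → Carrierᴹ → Carrierᴹ
  𝕋ₙ i = at (suc i ℕₚ.<? n) λ l → T̄ (site i l)

  Xₙ : ℕ → Carrierᴹ → Carrierᴹ
  Xₙ j = at (j ℕₚ.<? n) λ l → ξ (fromℕ< l)

  𝕋ₙ≡ : ∀ i {j} v → toℕ i ≡ j → 𝕋ₙ j v ≡ T̄ i v
  𝕋ₙ≡ i v refl with suc (toℕ i) ℕₚ.<? n
  ... | yes l = ≡.cong (λ k → T̄ k v) (Finₚ.toℕ-injective (toℕ-site _ l))
  ... | no ¬l = ⊥-elim (¬l (≡.subst (_< n) (toℕ-hi i) (Finₚ.toℕ<n (hi i))))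

  Xₙ≡ : ∀ i {j} v → toℕ i ≡ j → Xₙ j v ≡ ξ i v
  Xₙ≡ i v refl with toℕ i ℕₚ.<? n
  ... | yes l = ≡.cong (λ k → ξ k v) (Finₚ.fromℕ<-toℕ i l)
  ... | no ¬l = ⊥-elim (¬l (Finₚ.toℕ<n i))

  Xₙ-linear : ∀ j → Linear V V (Xₙ j)
  Xₙ-linear j = at-linear (j ℕₚ.<? n) λ l → ξ-linear (fromℕ< l)

  𝕋ₙ-linear : ∀ i → Linear V V (𝕋ₙ i)
  𝕋ₙ-linear i = at-linear (suc i ℕₚ.<? n) λ l → T̄-linear (site i l)

  -- No variable acts on V itself; in `Series.seriesOperators` the zero map for `Z` is replaced by
  -- the shift.
  operators : Operators V
  operators = record { X = Xₙ ; X-linear = Xₙ-linear ; Z = λ _ → 0ᴹ ; Z-linear = 0-linear }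

  private
    Xₙ-Xₙ : ∀ i j v → Xₙ i (Xₙ j v) ≈ᴹ Xₙ j (Xₙ i v)
    Xₙ-Xₙ i j v with i ℕₚ.<? n | j ℕₚ.<? n
    ... | yes l | yes l′ = ξ-ξ (fromℕ< l) (fromℕ< l′) v
    ... | yes l | no _   = f-0 (ξ-linear (fromℕ< l))
    ... | no _  | yes l′ = ≈ᴹ-sym (f-0 (ξ-linear (fromℕ< l′)))
    ... | no _  | no _   = ≈ᴹ-refl

    module _ {i} (l : suc i < n) where
      toℕ-lo-site : toℕ (lo {n} (site i l)) ≡ i
      toℕ-lo-site = ≡.trans (toℕ-lo (site i l)) (toℕ-site i l)
      toℕ-hi-site : toℕ (hi {n} (site i l)) ≡ suc i
      toℕ-hi-site = ≡.trans (toℕ-hi (site i l)) (≡.cong suc (toℕ-site i l))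
      𝕋≡ : ∀ v → 𝕋ₙ i v ≡ T̄ (site i l) v
      𝕋≡ v = 𝕋ₙ≡ (site i l) v (toℕ-site i l)
      lo≡ : ∀ v → Xₙ i v ≡ ξ (lo (site i l)) v
      lo≡ v = Xₙ≡ (lo (site i l)) v toℕ-lo-site
      hi≡ : ∀ v → Xₙ (suc i) v ≡ ξ (hi (site i l)) v
      hi≡ v = Xₙ≡ (hi (site i l)) v toℕ-hi-site

  action : HeckeAction operators n
  action = record
    { P+N≈Q = p+N≈q
    ; 𝕋 = 𝕋ₙ
    ; 𝕋-linear = 𝕋ₙ-linear
    ; 𝕋-Z = λ i v → f-0 (𝕋ₙ-linear i)
    ; X-Z = λ j v → f-0 (Xₙ-linear j)
    ; X-X = Xₙ-Xₙ
    ; quadratic′ = λ i v l → ≡.subst₂ (λ u w → u +ᴹ N *ₗ w ≈ᴹ (p̂ * q̂) *ₗ v)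
        (≡.sym (≡.trans (≡.cong (𝕋ₙ i) (𝕋≡ l v)) (𝕋≡ l _))) (≡.sym (𝕋≡ l v)) (T̄-quadratic (site i l) v)
    ; braid′ = λ i v l → let l′ = ℕₚ.<⇒≤ l in ≡.subst₂ _≈ᴹ_
        (≡.sym (≡.trans (≡.cong (λ u → 𝕋ₙ i (𝕋ₙ (suc i) u)) (𝕋≡ l′ v)) (≡.trans (≡.cong (𝕋ₙ i) (𝕋≡ l _)) (𝕋≡ l′ _))))
        (≡.sym (≡.trans (≡.cong (λ u → 𝕋ₙ (suc i) (𝕋ₙ i u)) (𝕋≡ l v)) (≡.trans (≡.cong (𝕋ₙ (suc i)) (𝕋≡ l′ _)) (𝕋≡ l _))))
        (T̄-braid (site i l′) (site (suc i) l) v (≡.trans (toℕ-site (suc i) l) (≡.cong suc (≡.sym (toℕ-site i l′)))))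
    ; far′ = λ i j v i<j l → let l′ = ℕₚ.<-trans (ℕₚ.<-trans i<j ℕₚ.≤-refl) l in ≡.subst₂ _≈ᴹ_
        (≡.sym (≡.trans (≡.cong (𝕋ₙ i) (𝕋≡ l v)) (𝕋≡ l′ _))) (≡.sym (≡.trans (≡.cong (𝕋ₙ j) (𝕋≡ l′ v)) (𝕋≡ l _)))
        (T̄-far (site i l′) (site j l) v (≡.subst₂ (λ a b → 2 ≤ ∣ a - b ∣) (≡.sym (toℕ-site i l′)) (≡.sym (toℕ-site j l)) (distance i j i<j)))
    ; 𝕋-X = λ i v l → ≡.subst₂ _≈ᴹ_
        (≡.sym (≡.trans (≡.cong (𝕋ₙ i) (lo≡ l v)) (𝕋≡ l _)))
        (≡.sym (≡.cong₂ (λ u w → u +ᴹ (ħ̂ *ₗ v +ᴹ N *ₗ w)) (≡.trans (≡.cong (Xₙ (suc i)) (𝕋≡ l v)) (hi≡ l _)) (hi≡ l v)))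
        (T̄-ξ (site i l) v)
    ; 𝕋-X⁺ = λ i v l → ≡.subst₂ _≈ᴹ_
        (≡.sym (≡.cong₂ (λ u w → u +ᴹ (ħ̂ *ₗ v +ᴹ N *ₗ w)) (≡.trans (≡.cong (𝕋ₙ i) (hi≡ l v)) (𝕋≡ l _)) (hi≡ l v)))
        (≡.sym (≡.trans (≡.cong (Xₙ i) (𝕋≡ l v)) (lo≡ l _)))
        (T̄-ξ⁺ (site i l) v)
    ; 𝕋-X-other = λ i j v l j<n j≢i j≢si →
        let X≡ = λ u → Xₙ≡ (fromℕ< j<n) u (Finₚ.toℕ-fromℕ< j<n) in ≡.subst₂ _≈ᴹ_
        (≡.sym (≡.trans (≡.cong (𝕋ₙ i) (X≡ v)) (𝕋≡ l _))) (≡.sym (≡.trans (≡.cong (Xₙ j) (𝕋≡ l v)) (X≡ _)))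
        (T̄-ξ-other (site i l) (fromℕ< j<n) v
          (λ e → j≢i (≡.trans (≡.sym (Finₚ.toℕ-fromℕ< j<n)) (≡.trans (≡.cong toℕ e) (toℕ-lo-site l))))
          (λ e → j≢si (≡.trans (≡.sym (Finₚ.toℕ-fromℕ< j<n)) (≡.trans (≡.cong toℕ e) (toℕ-hi-site l)))))
    }
    where
    distance : ∀ i j → suc i < j → 2 ≤ ∣ i - j ∣
    distance zero    (suc zero)    (s≤s ())
    distance zero    (suc (suc j)) l       = s≤s (s≤s z≤n)
    distance (suc i) (suc j)       (s≤s l) = distance i j l

-- Grassmannian permutations and their strings

bit : List Bool → ℕ → Bool
bit []      r = false
bit (β ∷ b) r with r ℕₚ.≟ length b
... | yes _ = β
... | no _  = bit b r

bit-top : ∀ β b → bit (β ∷ b) (length b) ≡ β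
bit-top β b with length b ℕₚ.≟ length b
... | yes _ = refl
... | no e  = ⊥-elim (e refl)

bit-below : ∀ β b {r} → r ≢ length b → bit (β ∷ b) r ≡ bit b r
bit-below β b {r} r≢ with r ℕₚ.≟ length b
... | yes e = ⊥-elim (r≢ e)
... | no _  = refl

bit-bound : ∀ b {r} → bit b r ≡ true → r < length b
bit-bound (β ∷ b) {r} e with r ℕₚ.≟ length b
... | yes refl = ℕₚ.≤-refl
... | no _     = ℕₚ.m≤n⇒m≤1+n (bit-bound b e)

bit-zeros⁺ : ∀ z b {r} → bit b r ≡ true → bit (replicate z false ++ b) r ≡ true
bit-zeros⁺ zero    b e = e
bit-zeros⁺ (suc z) b {r} e = ≡.trans (bit-below false (replicate z false ++ b) (ℕₚ.<⇒≢ (bit-bound (replicate z false ++ b) (bit-zeros⁺ z b e)))) (bit-zeros⁺ z b e)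

bit-zeros⁻ : ∀ z b {r} → bit (replicate z false ++ b) r ≡ true → bit b r ≡ true
bit-zeros⁻ zero    b e = e
bit-zeros⁻ (suc z) b {r} e with r ℕₚ.≟ length (replicate z false ++ b)
bit-zeros⁻ (suc z) b {r} () | yes _
... | no _ = bit-zeros⁻ z b e

position-zero : ∀ {k m} (a : Fin (suc m)) (ν : Partition k (toℕ a)) → position (a ∷ ν) zero ≡ length (bits ν)
position-zero {k} a ν = ≡.trans (≡.cong (toℕ a ℕ.+_) (Finₚ.toℕ-fromℕ k)) (≡.sym (length-bits ν))

position-suc : ∀ {k m} (a : Fin (suc m)) (ν : Partition k (toℕ a)) i → position (a ∷ ν) (suc i) ≡ position ν i
position-suc a ν i = ≡.cong (part ν i ℕ.+_) (Finₚ.toℕ-inject₁ (opposite i))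

bit-bits⁺ : ∀ {k m} (ν : Partition k m) i → bit (bits ν) (position ν i) ≡ true
bit-bits⁺ {m = m} (a ∷ ν) zero    = bit-zeros⁺ (m ∸ toℕ a) (true ∷ bits ν)
  (≡.trans (≡.cong (bit (true ∷ bits ν)) (position-zero a ν)) (bit-top true (bits ν)))
bit-bits⁺ {m = m} (a ∷ ν) (suc i) = bit-zeros⁺ (m ∸ toℕ a) (true ∷ bits ν)
  (≡.trans (≡.cong (bit (true ∷ bits ν)) (position-suc a ν i))
    (≡.trans (bit-below true (bits ν) (ℕₚ.<⇒≢ (bit-bound (bits ν) (bit-bits⁺ ν i)))) (bit-bits⁺ ν i)))

bit-bits⁻ : ∀ {k m} (ν : Partition k m) {r} → bit (bits ν) r ≡ true → ∃[ i ] r ≡ position ν i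
bit-bits⁻ {m = m} [] {r} e with bit-zeros⁻ m [] {r} (≡.trans (≡.cong (λ b → bit b r) (Listₚ.++-identityʳ (replicate m false))) e)
... | ()
bit-bits⁻ {suc k} {m} (a ∷ ν) {r} e = split (r ℕₚ.≟ length (bits ν)) (bit-zeros⁻ (m ∸ toℕ a) (true ∷ bits ν) {r} e)
  where
  split : Dec (r ≡ length (bits ν)) → bit (true ∷ bits ν) r ≡ true → ∃[ i ] r ≡ position (a ∷ ν) i
  split (yes r≡) _  = zero , ≡.trans r≡ (≡.sym (position-zero a ν))
  split (no r≢)  e′ with bit-bits⁻ ν (≡.trans (≡.sym (bit-below true (bits ν) r≢)) e′)
  ... | i , r≡ = suc i , ≡.trans r≡ (≡.sym (position-suc a ν i))

module Values (n : ℕ) where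

  open SymmetricGroup n

  -- Permutations as maps ℕ → ℕ that fix all j ≥ n.

  val : Permutation′ n → ℕ → ℕ
  val w j with j ℕₚ.<? n
  ... | yes l = toℕ (w ⟨$⟩ʳ fromℕ< l)
  ... | no _  = j

  val-< : ∀ w {j} (l : j < n) → val w j ≡ toℕ (w ⟨$⟩ʳ fromℕ< l)
  val-< w {j} l with j ℕₚ.<? n
  ... | yes _ = refl
  ... | no ¬l = ⊥-elim (¬l l)

  val-≥ : ∀ w {j} → n ≤ j → val w j ≡ j
  val-≥ w {j} l with j ℕₚ.<? n
  ... | yes l′ = ⊥-elim (ℕₚ.<⇒≱ l′ l)
  ... | no _   = refl

  val-toℕ : ∀ w a → val w (toℕ a) ≡ toℕ (w ⟨$⟩ʳ a)
  val-toℕ w a = ≡.trans (val-< w (Finₚ.toℕ<n a)) (≡.cong (λ a → toℕ (w ⟨$⟩ʳ a)) (Finₚ.fromℕ<-toℕ a (Finₚ.toℕ<n a)))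

  val-inverse : ∀ w j → val w (val (w ⁻¹) j) ≡ j
  val-inverse w j with j ℕₚ.<? n
  ... | yes l = ≡.trans (val-toℕ w _) (≡.trans (≡.cong toℕ (inverseʳ w)) (Finₚ.toℕ-fromℕ< l))
  ... | no ¬l = val-≥ w (ℕₚ.≮⇒≥ ¬l)

  val-injective : ∀ w {i j} → val w i ≡ val w j → i ≡ j
  val-injective w {i} {j} e with i ℕₚ.<? n | j ℕₚ.<? n
  ... | yes l | yes l′ = Finₚ.fromℕ<-injective i j l l′ (injective w (Finₚ.toℕ-injective e))
  ... | yes l | no ¬l′ = ⊥-elim (¬l′ (≡.subst (_< n) e (Finₚ.toℕ<n _)))
  ... | no ¬l | yes l′ = ⊥-elim (¬l (≡.subst (_< n) (≡.sym e) (Finₚ.toℕ<n _)))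
  ... | no _  | no _   = e

  σ : ℕ → Permutation′ n
  σ i with suc i ℕₚ.<? n
  ... | yes l = s (fromℕ< (ℕₚ.∸-monoˡ-≤ 1 l))
  ... | no _  = Perm.id

  σ≡ : ∀ i {j} → toℕ i ≡ j → σ j ≡ s i
  σ≡ i refl with suc (toℕ i) ℕₚ.<? n
  ... | yes l = ≡.cong s (Finₚ.toℕ-injective (Finₚ.toℕ-fromℕ< (ℕₚ.∸-monoˡ-≤ 1 l)))
  ... | no ¬l = ⊥-elim (¬l (≡.subst (_< n) (toℕ-hi i) (Finₚ.toℕ<n (hi i))))

  index : ∀ j → suc j < n → ∃[ i ] toℕ {n ∸ 1} i ≡ j
  index j l = fromℕ< (ℕₚ.∸-monoˡ-≤ 1 l) , Finₚ.toℕ-fromℕ< (ℕₚ.∸-monoˡ-≤ 1 l)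

  val-σ : ∀ w j → suc j < n → val (w · σ j) j ≡ val w (suc j)
  val-σ w j l with index j l
  ... | i , refl rewrite σ≡ i refl = ≡.trans (≡.cong (val (w · s i)) (≡.sym (toℕ-lo i))) (≡.trans (val-toℕ (w · s i) (lo i))
    (≡.trans (≡.cong (λ a → toℕ (w ⟨$⟩ʳ a)) (s-lo i)) (≡.trans (≡.sym (val-toℕ w (hi i))) (≡.cong (val w) (toℕ-hi i)))))

  val-σ⁺ : ∀ w j → suc j < n → val (w · σ j) (suc j) ≡ val w j
  val-σ⁺ w j l with index j l
  ... | i , refl rewrite σ≡ i refl = ≡.trans (≡.cong (val (w · s i)) (≡.sym (toℕ-hi i))) (≡.trans (val-toℕ (w · s i) (hi i))
    (≡.trans (≡.cong (λ a → toℕ (w ⟨$⟩ʳ a)) (s-hi i)) (≡.trans (≡.sym (val-toℕ w (lo i))) (≡.cong (val w) (toℕ-lo i)))))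

  val-σ-other : ∀ w j → suc j < n → ∀ {r} → r ≢ j → r ≢ suc j → val (w · σ j) r ≡ val w r
  val-σ-other w j l {r} e e′ with index j l
  ... | i , refl rewrite σ≡ i refl with r ℕₚ.<? n
  ...   | no _   = refl
  ...   | yes l′ = ≡.cong (λ a → toℕ (w ⟨$⟩ʳ a)) (s-other i
          (λ z → e (≡.trans (≡.sym (Finₚ.toℕ-fromℕ< l′)) (≡.trans (≡.cong toℕ z) (toℕ-lo i))))
          (λ z → e′ (≡.trans (≡.sym (Finₚ.toℕ-fromℕ< l′)) (≡.trans (≡.cong toℕ z) (toℕ-hi i)))))

  -- w s_k ⋯ s_{z+k-1}, with the letters of `B k z` in the order in which they act. The value at
  -- position k moves to z + k, and the values between move down by one position.
  cycle : Permutation′ n → ℕ → ℕ → Permutation′ n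
  cycle w k zero    = w
  cycle w k (suc z) = cycle w k z · σ (z ℕ.+ k)

  cycle-outside : ∀ w k z → z ℕ.+ k < n → ∀ {j} → j < k ⊎ z ℕ.+ k < j → val (cycle w k z) j ≡ val w j
  cycle-outside w k zero    l o = refl
  cycle-outside w k (suc z) l {j} (inj₁ j<k) = ≡.trans
    (val-σ-other (cycle w k z) (z ℕ.+ k) l (ℕₚ.<⇒≢ j<) (ℕₚ.<⇒≢ (ℕₚ.m≤n⇒m≤1+n j<)))
    (cycle-outside w k z (ℕₚ.<⇒≤ l) (inj₁ j<k))
    where j< = ℕₚ.≤-trans j<k (ℕₚ.m≤n+m k z)
  cycle-outside w k (suc z) l {j} (inj₂ <j) = ≡.trans
    (val-σ-other (cycle w k z) (z ℕ.+ k) l (λ e → ℕₚ.<⇒≢ (ℕₚ.<⇒≤ <j) (≡.sym e)) (λ e → ℕₚ.<⇒≢ <j (≡.sym e)))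
    (cycle-outside w k z (ℕₚ.<⇒≤ l) (inj₂ (ℕₚ.<⇒≤ <j)))

  cycle-end : ∀ w k z → z ℕ.+ k < n → val (cycle w k z) (z ℕ.+ k) ≡ val w k
  cycle-end w k zero    l = refl
  cycle-end w k (suc z) l = ≡.trans (val-σ⁺ (cycle w k z) (z ℕ.+ k) l) (cycle-end w k z (ℕₚ.<⇒≤ l))

  cycle-inside : ∀ w k z → z ℕ.+ k < n → ∀ {j} → k ≤ j → j < z ℕ.+ k → val (cycle w k z) j ≡ val w (suc j)
  cycle-inside w k zero    l k≤j j<k = ⊥-elim (ℕₚ.<⇒≱ j<k k≤j)
  cycle-inside w k (suc z) l {j} k≤j (s≤s j≤) with ℕₚ.m≤n⇒m<n∨m≡n j≤
  ... | inj₂ refl = ≡.trans (val-σ (cycle w k z) (z ℕ.+ k) l) (cycle-outside w k z (ℕₚ.<⇒≤ l) (inj₂ ℕₚ.≤-refl))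
  ... | inj₁ j<   = ≡.trans
    (val-σ-other (cycle w k z) (z ℕ.+ k) l (ℕₚ.<⇒≢ j<) (ℕₚ.<⇒≢ (ℕₚ.m≤n⇒m≤1+n j<)))
    (cycle-inside w k z (ℕₚ.<⇒≤ l) k≤j j<)

  -- w is the minimal representative of its coset, and b its string.

  record Grass (b : List Bool) (k z : ℕ) (w : Permutation′ n) : Set where
    field
      fixes     : ∀ j → z ℕ.+ k ≤ j → val w j ≡ j
      beads     : ∀ j → j < k → bit b (val w j) ≡ true
      gaps      : ∀ j → k ≤ j → j < z ℕ.+ k → bit b (val w j) ≡ false
      inc-beads : ∀ i j → i < j → j < k → val w i < val w j
      inc-gaps  : ∀ i j → k ≤ i → i < j → j < z ℕ.+ k → val w i < val w j

    bounded : ∀ {j} → j < z ℕ.+ k → val w j < z ℕ.+ k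
    bounded {j} l with val w j ℕₚ.<? z ℕ.+ k
    ... | yes l′ = l′
    ... | no ¬l′ = ⊥-elim (ℕₚ.<⇒≱ l (≡.subst (z ℕ.+ k ≤_) (val-injective w (fixes _ (ℕₚ.≮⇒≥ ¬l′))) (ℕₚ.≮⇒≥ ¬l′)))

    preimage : ∀ {r} → r < z ℕ.+ k → ∃[ j ] val w j ≡ r × j < z ℕ.+ k
    preimage {r} l with val (w ⁻¹) r ℕₚ.<? z ℕ.+ k
    ... | yes l′ = val (w ⁻¹) r , val-inverse w r , l′
    ... | no ¬l′ = ⊥-elim (¬l′ (≡.subst (_< z ℕ.+ k)
            (≡.trans (≡.sym (val-inverse w r)) (fixes _ (ℕₚ.≮⇒≥ ¬l′))) l))

  open Grass

  private
    true≢false : true ≢ false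
    true≢false ()

  -- The largest value is a gap and the gaps increase, so it stands at the last position and is
  -- fixed.
  grass-false : ∀ {b k z w} → length (false ∷ b) ≡ z ℕ.+ k → Grass (false ∷ b) k z w →
                ∃[ z′ ] z ≡ suc z′ × Grass b k z′ w
  grass-false {b} {k} {z} {w} e g with preimage g (ℕₚ.≤-reflexive e)
  ... | j , j≡ , j<l with j ℕₚ.<? k
  ...   | yes j<k = ⊥-elim (true≢false (≡.trans (≡.sym (beads g j j<k)) (≡.trans (≡.cong (bit (false ∷ b)) j≡) (bit-top false b))))
  grass-false {b} {k} {zero}  {w} e g | j , j≡ , j<l | no j≮k = ⊥-elim (j≮k j<l)
  grass-false {b} {k} {suc z} {w} e g | j , j≡ , j<l | no j≮k = z , refl , record
    { fixes = λ i l → fixes′ i (ℕₚ.m≤n⇒m<n∨m≡n l)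
    ; beads = λ i i<k → let bead = beads g i i<k in ≡.trans (≡.sym (bit-below false b
        λ i≡ → true≢false (≡.trans (≡.sym bead) (≡.trans (≡.cong (bit (false ∷ b)) i≡) (bit-top false b))))) bead
    ; gaps = λ i k≤i i<l → ≡.trans (≡.sym (bit-below false b
        λ i≡ → ℕₚ.<⇒≢ i<l (≡.trans (val-injective w (≡.trans i≡ (≡.sym j≡))) j≡L)))
        (gaps g i k≤i (ℕₚ.m≤n⇒m≤1+n i<l))
    ; inc-beads = inc-beads g
    ; inc-gaps = λ i j k≤i i<j j<l → inc-gaps g i j k≤i i<j (ℕₚ.m≤n⇒m≤1+n j<l)
    }
    where
    L≡ : length b ≡ z ℕ.+ k
    L≡ = ℕₚ.suc-injective e
    j≡L : j ≡ z ℕ.+ k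
    j≡L with ℕₚ.m≤n⇒m<n∨m≡n (ℕₚ.≤-pred j<l)
    ... | inj₂ eq = eq
    ... | inj₁ j<L = ⊥-elim (ℕₚ.<⇒≱ (≡.subst (_< val w (z ℕ.+ k)) (≡.trans j≡ L≡) (inc-gaps g j (z ℕ.+ k) (ℕₚ.≮⇒≥ j≮k) j<L ℕₚ.≤-refl))
                       (ℕₚ.≤-pred (bounded g ℕₚ.≤-refl)))
    fixes′ : ∀ i → z ℕ.+ k < i ⊎ z ℕ.+ k ≡ i → val w i ≡ i
    fixes′ i (inj₁ l) = fixes g i l
    fixes′ i (inj₂ refl) = ≡.trans (≡.cong (val w) (≡.sym j≡L)) (≡.trans j≡ L≡)

  -- The largest value stands at the last bead position k′. `cycle` moves it to the end and keeps
  -- the order of the others. The inequality in the conclusion makes each letter of the cycle a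
  -- descent, as `dual-B` requires.
  grass-true : ∀ {b k z w} → z ℕ.+ k ≤ n → length (true ∷ b) ≡ z ℕ.+ k → Grass (true ∷ b) k z w →
               ∃[ k′ ] k ≡ suc k′ × z ℕ.+ k′ < n × (∀ i → k′ < i → i ≤ z ℕ.+ k′ → val w i < val w k′)
                 × Grass b k′ z (cycle w k′ z)
  grass-true {b} {k} {z} {w} l e g with preimage g (ℕₚ.≤-reflexive e)
  ... | j , j≡ , j<l with j ℕₚ.<? k
  ...   | no j≮k = ⊥-elim (true≢false (≡.trans (≡.sym (≡.trans (≡.cong (bit (true ∷ b)) j≡) (bit-top true b))) (gaps g j (ℕₚ.≮⇒≥ j≮k) j<l)))
  grass-true {b} {suc k} {z} {w} l e g | j , j≡ , j<l | yes j<k = k , refl , L<n , larger , record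
    { fixes = λ i l → fixes′ i (ℕₚ.m≤n⇒m<n∨m≡n l)
    ; beads = λ i i<k → ≡.trans (≡.cong (bit b) (cycle-outside w k z L<n (inj₁ i<k)))
        (≡.trans (≡.sym (below i (ℕₚ.<⇒≢ i<k))) (beads g i (ℕₚ.m≤n⇒m≤1+n i<k)))
    ; gaps = λ i k≤i i<l → ≡.trans (≡.cong (bit b) (cycle-inside w k z L<n k≤i i<l))
        (≡.trans (≡.sym (below (suc i) (λ z → ℕₚ.<⇒≢ (s≤s k≤i) (≡.sym z)))) (gaps g (suc i) (s≤s k≤i) (bump i<l)))
    ; inc-beads = λ i j i<j j<k → ≡.subst₂ _<_ (≡.sym (cycle-outside w k z L<n (inj₁ (ℕₚ.<-trans i<j j<k))))
        (≡.sym (cycle-outside w k z L<n (inj₁ j<k))) (inc-beads g i j i<j (ℕₚ.m≤n⇒m≤1+n j<k))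
    ; inc-gaps = λ i j k≤i i<j j<l → ≡.subst₂ _<_ (≡.sym (cycle-inside w k z L<n k≤i (ℕₚ.<-trans i<j j<l)))
        (≡.sym (cycle-inside w k z L<n (ℕₚ.≤-trans k≤i (ℕₚ.<⇒≤ i<j)) j<l))
        (inc-gaps g (suc i) (suc j) (s≤s k≤i) (s≤s i<j) (bump j<l))
    }
    where
    L<n : z ℕ.+ k < n
    L<n = ≡.subst (_≤ n) (ℕₚ.+-suc z k) l
    bump : ∀ {i} → i < z ℕ.+ k → suc i < z ℕ.+ suc k
    bump {i} i<l = ≡.subst (suc i <_) (≡.sym (ℕₚ.+-suc z k)) (s≤s i<l)
    L≡ : length b ≡ z ℕ.+ k
    L≡ = ℕₚ.suc-injective (≡.trans e (ℕₚ.+-suc z k))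
    at-k : val w k ≤ z ℕ.+ k
    at-k = ℕₚ.≤-pred (≡.subst (val w k <_) (ℕₚ.+-suc z k) (bounded g (ℕₚ.m≤n+m (suc k) z)))
    j≡k : j ≡ k
    j≡k with ℕₚ.m≤n⇒m<n∨m≡n (ℕₚ.≤-pred j<k)
    ... | inj₂ eq = eq
    ... | inj₁ j<k′ = ⊥-elim (ℕₚ.<⇒≱ (≡.subst (_< val w k) (≡.trans j≡ L≡) (inc-beads g j k j<k′ ℕₚ.≤-refl)) at-k)
    top : val w k ≡ z ℕ.+ k
    top = ≡.trans (≡.cong (val w) (≡.sym j≡k)) (≡.trans j≡ L≡)
    below : ∀ i → i ≢ k → bit (true ∷ b) (val w i) ≡ bit b (val w i)
    below i i≢k = bit-below true b λ i≡ → i≢k (val-injective w (≡.trans i≡ (≡.trans L≡ (≡.sym top))))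
    larger : ∀ i → k < i → i ≤ z ℕ.+ k → val w i < val w k
    larger i k<i i≤ = ≡.subst (val w i <_) (≡.sym top) (ℕₚ.≤∧≢⇒<
      (ℕₚ.≤-pred (≡.subst (val w i <_) (ℕₚ.+-suc z k) (bounded g (≡.subst (i <_) (≡.sym (ℕₚ.+-suc z k)) (s≤s i≤)))))
      λ i≡ → ℕₚ.<⇒≢ k<i (val-injective w (≡.trans top (≡.sym i≡))))
    fixes′ : ∀ i → z ℕ.+ k < i ⊎ z ℕ.+ k ≡ i → val (cycle w k z) i ≡ i
    fixes′ i (inj₁ l)    = ≡.trans (cycle-outside w k z L<n (inj₂ l)) (fixes g i (≡.subst (_≤ i) (≡.sym (ℕₚ.+-suc z k)) l))
    fixes′ i (inj₂ refl) = ≡.trans (cycle-end w k z L<n) top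

module GrassmannianPermutations {n k : ℕ} (k≤n : k ≤ n) where

  open SymmetricGroup n
  open Values n
  open Box k≤n

  shifted≡ : ∀ ν i → toℕ (shifted ν i) ≡ position ν i
  shifted≡ ν i = Finₚ.toℕ-fromℕ< _

  w-low : ∀ ν {a : Fin n} (l : toℕ a < k) → toℕ (w[ ν ] ⟨$⟩ʳ a) ≡ part ν (opposite (fromℕ< l)) ℕ.+ toℕ a
  w-low ν {a} l = ≡.trans (≡.cong (λ a → toℕ (w[ ν ] ⟨$⟩ʳ a)) (≡.sym injected)) (≡.trans (≡.cong toℕ (w[]-values ν i))
    (≡.trans (shifted≡ ν i) (≡.cong (part ν i ℕ.+_) opp)))
    where
    i = opposite (fromℕ< l)
    opp : toℕ (opposite i) ≡ toℕ a
    opp = ≡.trans (≡.cong toℕ (Finₚ.opposite-involutive (fromℕ< l))) (Finₚ.toℕ-fromℕ< l)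
    injected : inject≤ (opposite i) k≤n ≡ a
    injected = Finₚ.toℕ-injective (≡.trans (Finₚ.toℕ-inject≤ (opposite i) k≤n) opp)

  opposite-anti : ∀ {i j : Fin k} → toℕ i ≤ toℕ j → toℕ (opposite j) ≤ toℕ (opposite i)
  opposite-anti {i} {j} l = ≡.subst₂ _≤_ (≡.sym (Finₚ.opposite-prop j)) (≡.sym (Finₚ.opposite-prop i)) (ℕₚ.∸-monoʳ-≤ k (s≤s l))

  SameBlock : Fin n → Fin n → Set
  SameBlock a b = toℕ b < k ⊎ k ≤ toℕ a

  w-increasing : ∀ ν {a b} → toℕ a < toℕ b → SameBlock a b → toℕ (w[ ν ] ⟨$⟩ʳ a) < toℕ (w[ ν ] ⟨$⟩ʳ b)
  w-increasing ν {a} {b} a<b (inj₂ k≤a) = w[]-increasing ν a b k≤a a<b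
  w-increasing ν {a} {b} a<b (inj₁ b<k) = ≡.subst₂ _<_ (≡.sym (w-low ν a<k)) (≡.sym (w-low ν b<k))
    (ℕₚ.+-mono-≤-< (part-anti ν (opposite-anti (≡.subst₂ _≤_ (≡.sym (Finₚ.toℕ-fromℕ< a<k)) (≡.sym (Finₚ.toℕ-fromℕ< b<k)) (ℕₚ.<⇒≤ a<b)))) a<b)
    where a<k = ℕₚ.<-trans a<b b<k

  -- An injective map of the first k positions to themselves is onto, so no other position can have
  -- its value there.
  young-high : ∀ {v} → InYoung k v → ∀ {j} → k ≤ toℕ j → k ≤ toℕ (v ⟨$⟩ʳ j)
  young-high {v} y {j} k≤j with toℕ (v ⟨$⟩ʳ j) ℕₚ.<? k
  ... | no ≮  = ℕₚ.≮⇒≥ ≮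
  ... | yes l with injective⇒surjective {f = f} f-injective (fromℕ< l)
    where
    low : ∀ (i : Fin k) → toℕ (v ⟨$⟩ʳ inject≤ i k≤n) < k
    low i = y (inject≤ i k≤n) (≡.subst (_< k) (≡.sym (Finₚ.toℕ-inject≤ i k≤n)) (Finₚ.toℕ<n i))
    f : Fin k → Fin k
    f i = fromℕ< (low i)
    f-injective : ∀ {i i′} → f i ≡ f i′ → i ≡ i′
    f-injective {i} {i′} e = Finₚ.inject≤-injective k≤n k≤n i i′
      (injective v (Finₚ.toℕ-injective (Finₚ.fromℕ<-injective _ _ (low i) (low i′) e)))
  ...   | i , fi≡ = ⊥-elim (ℕₚ.<⇒≱ (≡.subst (_< k) (≡.trans (≡.sym (Finₚ.toℕ-inject≤ i k≤n)) (≡.cong toℕ (injective v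
            (Finₚ.toℕ-injective (Finₚ.fromℕ<-injective _ _ _ l fi≡))))) (Finₚ.toℕ<n i)) k≤j)

  private
    block : ∀ i → suc (toℕ i) ≢ k → SameBlock (lo {n} i) (hi i)
    block i i≢ with suc (toℕ i) ℕₚ.<? k
    ... | yes l = inj₁ (≡.subst (_< k) (≡.sym (toℕ-hi i)) l)
    ... | no ¬l = inj₂ (≡.subst (k ≤_) (≡.sym (toℕ-lo i)) (ℕₚ.≤-pred (ℕₚ.≤∧≢⇒< (ℕₚ.≮⇒≥ ¬l) (λ e → i≢ (≡.sym e)))))

    young-block : ∀ {v} → InYoung k v → ∀ {a b} → toℕ a < toℕ b → SameBlock a b → (toℕ (v ⟨$⟩ʳ a) < k × toℕ (v ⟨$⟩ʳ b) < k) ⊎ (k ≤ toℕ (v ⟨$⟩ʳ a) × k ≤ toℕ (v ⟨$⟩ʳ b))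
    young-block {v} y a<b (inj₁ b<k) = inj₁ (y _ (ℕₚ.<-trans a<b b<k) , y _ b<k)
    young-block {v} y a<b (inj₂ k≤a) = inj₂ (young-high {v} y k≤a , young-high {v} y (ℕₚ.≤-trans k≤a (ℕₚ.<⇒≤ a<b)))

  young-ascent : ∀ ν {v} → InYoung k v → ∀ i → suc (toℕ i) ≢ k → Ascent v i → Ascent (w[ ν ] · v) i
  young-ascent ν {v} y i i≢ asc with young-block {v} y (lo<hi i) (block i i≢)
  ... | inj₁ (_ , l) = w-increasing ν asc (inj₁ l)
  ... | inj₂ (l , _) = w-increasing ν asc (inj₂ l)

  young-descent : ∀ ν {v} → InYoung k v → ∀ i → suc (toℕ i) ≢ k → Descent v i → Descent (w[ ν ] · v) i
  young-descent ν {v} y i i≢ desc with young-block {v} y (lo<hi i) (block i i≢)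
  ... | inj₁ (l , _) = w-increasing ν desc (inj₁ l)
  ... | inj₂ (_ , l) = w-increasing ν desc (inj₂ l)

  young-s : ∀ {v} → InYoung k v → ∀ i → suc (toℕ i) ≢ k → InYoung k (v · s i)
  young-s {v} y i i≢ j j<k = y (s i ⟨$⟩ʳ j) (low (position? i j))
    where
    low : Position i j → toℕ (s i ⟨$⟩ʳ j) < k
    low (at-lo refl) = ≡.subst (λ a → toℕ a < k) (≡.sym (s-lo i)) (≡.subst (_< k) (≡.sym (toℕ-hi i))
      (ℕₚ.≤∧≢⇒< (≡.subst (_< k) (toℕ-lo i) j<k) i≢))
    low (at-hi refl) = ≡.subst (λ a → toℕ a < k) (≡.sym (s-hi i)) (ℕₚ.<-trans (lo<hi i) j<k)
    low (elsewhere e e′) = ≡.subst (λ a → toℕ a < k) (≡.sym (s-other i e e′)) j<k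

  w-determines : ∀ {μ ν} → w[ ν ] Perm.≈ w[ μ ] → μ ≡ ν
  w-determines {μ} {ν} e = sameParts⇒≡ λ i → ℕₚ.+-cancelʳ-≡ (toℕ (opposite i)) _ _
    (≡.trans (≡.sym (shifted≡ μ i)) (≡.trans (≡.cong toℕ
      (≡.trans (≡.sym (w[]-values μ i)) (≡.trans (≡.sym (e _)) (w[]-values ν i)))) (shifted≡ ν i)))

  -- A descent of `v` inside a block would be a descent of w_μ inside that block, and between the
  -- two blocks `v` always ascends. So `v` has no descent at all.
  young-unique : ∀ {μ ν v} → InYoung k v → w[ ν ] · v Perm.≈ w[ μ ] → v Perm.≈ Perm.id × μ ≡ ν
  young-unique {μ} {ν} {v} y e = v≈id , w-determines λ a → ≡.trans (≡.cong (w[ ν ] ⟨$⟩ʳ_) (≡.sym (v≈id a))) (e a)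
    where
    ascent : ∀ i → Ascent v i
    ascent i with direction v i
    ... | inj₁ a = a
    ... | inj₂ d with suc (toℕ i) ℕₚ.≟ k
    ...   | yes i≡ = ℕₚ.<-≤-trans (y (lo i) (ℕₚ.≤-reflexive (≡.trans (≡.cong suc (toℕ-lo i)) i≡)))
              (young-high {v} y (ℕₚ.≤-reflexive (≡.trans (≡.sym i≡) (≡.sym (toℕ-hi i)))))
    ...   | no i≢ = ⊥-elim (ℕₚ.<-asym (w-increasing μ (lo<hi i) (block i i≢))
              (≡.subst₂ (λ a b → toℕ a < toℕ b) (e (hi i)) (e (lo i)) (young-descent ν {v} y i i≢ d)))
    v≈id : v Perm.≈ Perm.id
    v≈id = ascents⇒identity v ascent

  w-grass : ∀ ν → Grass (bits ν) k (n ∸ k) w[ ν ]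
  w-grass ν = record
    { fixes = λ j l → val-≥ w[ ν ] (≡.subst (_≤ j) n≡ l)
    ; beads = bead
    ; gaps = gap
    ; inc-beads = λ i j i<j j<k → increasing (ℕₚ.<-≤-trans j<k k≤n) i<j (inj₁ j<k)
    ; inc-gaps = λ i j k≤i i<j j<n → increasing (≡.subst (j <_) n≡ j<n) i<j (inj₂ k≤i)
    }
    where
    n≡ : (n ∸ k) ℕ.+ k ≡ n
    n≡ = ℕₚ.m∸n+n≡m k≤n
    increasing : ∀ {i j} → j < n → i < j → j < k ⊎ k ≤ i → val w[ ν ] i < val w[ ν ] j
    increasing {i} {j} j<n i<j o = ≡.subst₂ _<_ (≡.sym (val-< w[ ν ] i<n)) (≡.sym (val-< w[ ν ] j<n))
      (w-increasing ν (≡.subst₂ _<_ (≡.sym (Finₚ.toℕ-fromℕ< i<n)) (≡.sym (Finₚ.toℕ-fromℕ< j<n)) i<j) (same o))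
      where
      i<n = ℕₚ.<-trans i<j j<n
      same : j < k ⊎ k ≤ i → SameBlock (fromℕ< i<n) (fromℕ< j<n)
      same (inj₁ l) = inj₁ (≡.subst (_< k) (≡.sym (Finₚ.toℕ-fromℕ< j<n)) l)
      same (inj₂ l) = inj₂ (≡.subst (k ≤_) (≡.sym (Finₚ.toℕ-fromℕ< i<n)) l)
    value : ∀ i → val w[ ν ] (toℕ (opposite i)) ≡ position ν i
    value i = ≡.trans (≡.cong (val w[ ν ]) (≡.sym (Finₚ.toℕ-inject≤ (opposite i) k≤n)))
      (≡.trans (val-toℕ w[ ν ] _) (≡.trans (≡.cong toℕ (w[]-values ν i)) (shifted≡ ν i)))
    bead : ∀ j → j < k → bit (bits ν) (val w[ ν ] j) ≡ true
    bead j j<k = ≡.trans (≡.cong (bit (bits ν)) (≡.trans (≡.cong (val w[ ν ]) (≡.sym opp)) (value i))) (bit-bits⁺ ν i)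
      where
      i = opposite (fromℕ< j<k)
      opp : toℕ (opposite i) ≡ j
      opp = ≡.trans (≡.cong toℕ (Finₚ.opposite-involutive (fromℕ< j<k))) (Finₚ.toℕ-fromℕ< j<k)
    gap : ∀ j → k ≤ j → j < (n ∸ k) ℕ.+ k → bit (bits ν) (val w[ ν ] j) ≡ false
    gap j k≤j j<n with bit (bits ν) (val w[ ν ] j) in eq
    ... | false = refl
    ... | true with bit-bits⁻ ν eq
    ...   | i , j≡ = ⊥-elim (ℕₚ.<⇒≱ (≡.subst (_< k) (val-injective w[ ν ] (≡.trans (value i) (≡.sym j≡))) (Finₚ.toℕ<n (opposite i))) k≤j)

-- Functionals dual to the basis, and the symmetry of 𝒴_ν

module Basis {c ℓ₁ ℓ₂ m ℓm} (F : HeytingField c ℓ₁ ℓ₂) (n : ℕ) (t : Fin n → HeytingField.Carrier F)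
  (rep : SchubertRepresentation F n t m ℓm) where

  open SchubertRepresentation rep hiding (_^_)
  open Representation F n t rep
  open CommutativeRing K using (Carrier; _≈_; _+_; _*_; 0#; 1#; +-cong; +-congˡ; +-identityˡ; +-identityʳ; *-cong; *-congˡ; *-congʳ; *-assoc; *-identityˡ; *-identityʳ; zeroˡ; zeroʳ; -‿inverseʳ)
    renaming (refl to ≈-refl; sym to ≈-sym; trans to ≈-trans)
  open LinearAlgebra K
  open Parameters K p̂ q̂ N ħ̂ using (_^_)
  open Linear
  open Presented ℚ[p,q,ħ] (Generator n) using (gen)
  open SymmetricGroup n
  open Values n
  open SetoidReasoning ≈ᴹ-setoid
  open Strands K action using (act; act-linear; B; B-linear; Y; Y-linear)

  private
    module ▷ = ModuleStructures.IsLeftModule ▷-isModule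
    module Vₛ = Sums K V

  𝔽 : Module c ℓ₁
  𝔽 = TensorUnit.leftModule

  private
    module 𝔽ₛ = Sums K 𝔽
    module ev = LeftModuleMorphisms.IsLeftModuleHomomorphism ev-isLinear

  open IsBasis 𝒴-isBasis renaming (f-cong to 𝒴-cong)

  ev-linear : Linear V 𝔽 ev
  ev-linear = record { f-cong = ev.⟦⟧-cong ; f-+ = ev.+ᴹ-homo ; f-* = ev.*ₗ-homo }

  ev₁ : Carrier
  ev₁ = ev (𝒴 Perm.id)

  -- By tightness, an element that is not apart from 0 equals 0.
  ev-off : ∀ w → ¬ w Perm.≈ Perm.id → ev (𝒴 w) ≈ 0#
  ev-off w w≉id = proj₁ (HeytingField.tight F _ _) λ a → w≉id (Equivalence.to (ev-nonzero w) a)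

  ev₁-cancel : ∀ a → a * ev₁ ≈ 0# → a ≈ 0#
  ev₁-cancel a e with HeytingField.#⇒invertible F (Equivalence.from (ev-nonzero Perm.id) λ _ → refl)
  ... | b , _ , inv = ≈-trans (≈-sym (*-identityʳ a)) (≈-trans (*-congˡ (≈-sym inv′)) (≈-trans (≈-sym (*-assoc a ev₁ b))
          (≈-trans (*-congʳ e) (zeroˡ b))))
    where
    inv′ : ev₁ * b ≈ 1#
    inv′ = ≈-trans (*-congʳ (≈-sym (≈-trans (+-congˡ (≈-trans (≈-sym (+-identityˡ _)) (-‿inverseʳ 0#))) (+-identityʳ ev₁)))) inv

  basis-ext : ∀ {m₂ ℓm₂} {M : Module m₂ ℓm₂} {φ ψ} → Linear V M φ → Linear V M ψ →
              (∀ w → LeftModule._≈ᴹ_ M (φ (𝒴 w)) (ψ (𝒴 w))) → ∀ u → LeftModule._≈ᴹ_ M (φ u) (ψ u)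
  basis-ext {M = M} Φ Ψ e u with spans u
  ... | a , _ , u≈ = M.≈ᴹ-trans (f-cong Φ u≈) (M.≈ᴹ-trans (Mₛ.∑-linear Φ (permutations n) _) (M.≈ᴹ-trans
        (Mₛ.∑-cong (permutations n) λ w → M.≈ᴹ-trans (f-* Φ _ _) (M.≈ᴹ-trans (M.*ₗ-congˡ (e w)) (M.≈ᴹ-sym (f-* Ψ _ _))))
        (M.≈ᴹ-trans (M.≈ᴹ-sym (Mₛ.∑-linear Ψ (permutations n) _)) (M.≈ᴹ-sym (f-cong Ψ u≈)))))
    where
    module M = LeftModule M
    module Mₛ = Sums K M

  ev-ξ : ∀ j u → ev (ξ j u) ≈ t j * ev u
  ev-ξ j = basis-ext (∘-linear ev-linear (▷-Linear (gen (x j)))) (*-linear (t j) ev-linear) (ev-x j)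

  private
    reduced-cong : ∀ {u v w} → IsReducedWord u v → v Perm.≈ w → IsReducedWord u w
    reduced-cong {u} {v} {w} r e = record
      { word-of = λ a → ≡.trans (IsReducedWord.word-of r a) (e a)
      ; reduced = ≡.trans (IsReducedWord.reduced r) (ℓ-cong {v} {w} e) }

  -- At a descent s_i w⁻¹ w₀ is longer by one than w⁻¹ w₀, so the letter i may be put in front of a
  -- reduced word of the latter.
  τ-descent : ∀ w i → Descent w i → τ i (𝒴 w) ≈ᴹ 𝒴 (w · s i)
  τ-descent w i d = ≈ᴹ-trans (f-cong (▷-Linear (gen (T i))) (𝒴-T w u reduced))
    (≈ᴹ-trans (≈ᴹ-sym (▷.*ₗ-assoc _ _ _)) (≈ᴹ-sym (𝒴-T (w · s i) (i ∷ u) (reduced-cong {v = (y ⁻¹)} (word⇒reduced (desc ∷ wu)) λ _ → refl))))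
    where
    -- `word⇒reduced` spells inverses, and w⁻¹ w₀ is the inverse of w₀ w. Multiplication by w₀ on
    -- the left turns the descent at i into an ascent of `z`, hence into a descent of `y`.
    z y : Permutation′ n
    z = w₀ · w
    y = z · s i
    asc : Ascent z i
    asc = ≡.subst₂ _<_ (≡.sym (Finₚ.opposite-prop (w ⟨$⟩ʳ lo i))) (≡.sym (Finₚ.opposite-prop (w ⟨$⟩ʳ hi i)))
      (ℕₚ.∸-monoʳ-< (s≤s d) (Finₚ.toℕ<n (w ⟨$⟩ʳ lo i)))
    desc : Descent y i
    desc = descent-s {z} i asc
    u : List (Fin (n ∸ 1))
    u = proj₁ (word (y · s i))
    wu : Word (y · s i) u
    wu = proj₂ (word (y · s i))
    reduced : IsReducedWord u (w ⁻¹ · w₀)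
    reduced = reduced-cong {v = (y · s i) ⁻¹} (word⇒reduced wu) (⁻¹-cong {v = y · s i} {w = z} (·ss z i))

  T̄-descent : ∀ w i → Descent w i → T̄ i (𝒴 w) ≈ᴹ 𝒴 (w · s i) +ᴹ A *ₗ 𝒴 w
  T̄-descent w i d = +ᴹ-congʳ (τ-descent w i d)

  T̄-ascent : ∀ w i → Ascent w i → T̄ i (𝒴 w) ≈ᴹ (p̂ * q̂) *ₗ 𝒴 (w · s i)
  T̄-ascent w i a = ≈ᴹ-trans (f-cong (T̄-linear i) (≈ᴹ-trans (𝒴-cong λ b → ≡.sym (·ss w i b))
    (≈ᴹ-sym (τ-descent (w · s i) i (descent-s {w} i a))))) (T̄τ i _)

  -- Up to the factor ev₁, the functional extracts the coefficient of 𝒴 w.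

  record Dual (w : Permutation′ n) (φ : Carrierᴹ → Carrier) : Set (c ⊔ ℓ₁) where
    field
      on  : ∀ {v} → v Perm.≈ w → φ (𝒴 v) ≈ ev₁
      off : ∀ {v} → ¬ v Perm.≈ w → φ (𝒴 v) ≈ 0#

  open Dual

  dual-cong : ∀ {v w φ} → v Perm.≈ w → Dual v φ → Dual w φ
  dual-cong e d = record
    { on = λ e′ → on d λ a → ≡.trans (e′ a) (≡.sym (e a))
    ; off = λ ¬e → off d λ e′ → ¬e λ a → ≡.trans (e′ a) (e a) }

  dual-ev : Dual Perm.id ev
  dual-ev = record { on = λ {v} e → f-cong ev-linear (𝒴-cong {v} {Perm.id} e) ; off = λ {v} → ev-off v }

  -- Among the T̄_i 𝒴_v only the one with v = w involves the element indexed by w s_i, and with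
  -- coefficient 1: the factor pq belongs to ascents, and the extra term (p - q) 𝒴_v belongs to v
  -- with a descent at i, whereas w s_i has an ascent there.
  dual-T̄ : ∀ {w i φ} → Linear V 𝔽 φ → Descent w i → Dual (w · s i) φ → Dual w (λ u → φ (T̄ i u))
  dual-T̄ {w} {i} {φ} Φ desc d = record { on = on′ ; off = off′ }
    where
    φ-ascent : ∀ v → Ascent v i → φ (T̄ i (𝒴 v)) ≈ (p̂ * q̂) * φ (𝒴 (v · s i))
    φ-ascent v a = ≈-trans (f-cong Φ (T̄-ascent v i a)) (f-* Φ _ _)
    φ-descent : ∀ v → Descent v i → φ (T̄ i (𝒴 v)) ≈ φ (𝒴 (v · s i)) + A * φ (𝒴 v)
    φ-descent v b = ≈-trans (f-cong Φ (T̄-descent v i b)) (≈-trans (f-+ Φ _ _) (+-congˡ (f-* Φ _ _)))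
    transport : ∀ {v} → v · s i Perm.≈ w · s i → v Perm.≈ w
    transport {v} e a = ≡.trans (≡.cong (v ⟨$⟩ʳ_) (≡.sym (s-involutive i a))) (≡.trans (e (s i ⟨$⟩ʳ a)) (≡.cong (w ⟨$⟩ʳ_) (s-involutive i a)))
    descent-off : ∀ {v} → Descent v i → φ (𝒴 v) ≈ 0#
    descent-off {v} b = off d {v} λ e → ℕₚ.<-asym b (≡.subst₂ (λ a b → toℕ a < toℕ b) (≡.sym (e (lo i))) (≡.sym (e (hi i))) (ascent-s {w} i desc))
    vanish : ∀ {a b r} → a ≈ b → r ≈ 0# → a + A * r ≈ b
    vanish e e′ = ≈-trans (+-cong e (≈-trans (*-congˡ e′) (zeroʳ A))) (+-identityʳ _)
    on′ : ∀ {v} → v Perm.≈ w → φ (T̄ i (𝒴 v)) ≈ ev₁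
    on′ {v} e = ≈-trans (φ-descent v desc′) (vanish (on d {v · s i} λ a → e (s i ⟨$⟩ʳ a)) (descent-off {v} desc′))
      where
      desc′ : Descent v i
      desc′ = ≡.subst₂ (λ a b → toℕ a < toℕ b) (≡.sym (e (hi i))) (≡.sym (e (lo i))) desc
    off′ : ∀ {v} → ¬ v Perm.≈ w → φ (T̄ i (𝒴 v)) ≈ 0#
    off′ {v} ¬e with direction v i
    ... | inj₁ a = ≈-trans (φ-ascent v a) (≈-trans (*-congˡ (off d {v · s i} λ e → ¬e (transport {v} e))) (zeroʳ _))
    ... | inj₂ b = ≈-trans (φ-descent v b) (vanish (off d {v · s i} λ e → ¬e (transport {v} e)) (descent-off {v} b))

  dual-word : ∀ {w u} → Word w u → Dual w (λ v → ev (act (map toℕ u) v))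
  dual-word ([] e) = dual-cong (λ a → ≡.sym (e a)) dual-ev
  dual-word {w} (_∷_ {i = i} {u} d wu) = record
    { on = λ e → ≈-trans (rewriteT _) (on D e) ; off = λ e → ≈-trans (rewriteT _) (off D e) }
    where
    D : Dual w (λ v → ev (act (map toℕ u) (T̄ i v)))
    D = dual-T̄ (∘-linear ev-linear (act-linear (map toℕ u))) d (dual-word wu)
    rewriteT : ∀ v → ev (act (map toℕ u) (𝕋ₙ (toℕ i) v)) ≈ ev (act (map toℕ u) (T̄ i v))
    rewriteT v = ≡.subst (λ y → ev (act (map toℕ u) y) ≈ ev (act (map toℕ u) (T̄ i v))) (≡.sym (𝕋ₙ≡ i v refl)) ≈-refl

  -- The words given by `word` yield for each `w` the coefficient at `𝒴 w` times `ev₁`, and `ev₁` is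
  -- invertible.
  separation : ∀ y → (∀ u → All (λ i → suc i < n) u → ev (act u y) ≈ 0#) → y ≈ᴹ 0ᴹ
  separation y van with spans y
  ... | a , ext , y≈ = ≈ᴹ-trans y≈ (Vₛ.∑-0 (permutations n) λ w → ≈ᴹ-trans (*ₗ-congʳ (ev₁-cancel (a w) (coefficient≈ w))) (*ₗ-zeroˡ _))
    where
    letters : ∀ (u : List (Fin (n ∸ 1))) → All (λ i → suc i < n) (map toℕ u)
    letters []      = []
    letters (i ∷ u) = ≡.subst (_< n) (toℕ-hi i) (Finₚ.toℕ<n (hi i)) ∷ letters u
    coefficient≈ : ∀ w → a w * ev₁ ≈ 0#
    coefficient≈ w with word w
    ... | u , wu = ≈-trans (≈-sym (≈-trans (f-cong Φ y≈) (≈-trans (𝔽ₛ.∑-linear Φ (permutations n) _)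
            (≈-trans (𝔽ₛ.∑-permutations _ w same different) (at w λ _ → refl))))) (van (map toℕ u) (letters u))
      where
      Φ = ∘-linear ev-linear (act-linear (map toℕ u))
      D = dual-word wu
      at : ∀ v → v Perm.≈ w → ev (act (map toℕ u) (a v *ₗ 𝒴 v)) ≈ a w * ev₁
      at v e = ≈-trans (f-* Φ _ _) (*-cong (ext {v} {w} e) (on D {v} e))
      same : ∀ {v} → v Perm.≈ w → ev (act (map toℕ u) (a v *ₗ 𝒴 v)) ≈ ev (act (map toℕ u) (a w *ₗ 𝒴 w))
      same {v} e = ≈-trans (at v e) (≈-sym (at w λ _ → refl))
      different : ∀ v → ¬ v Perm.≈ w → ev (act (map toℕ u) (a v *ₗ 𝒴 v)) ≈ 0#
      different v ¬e = ≈-trans (f-* Φ _ _) (≈-trans (*-congˡ (off D {v} ¬e)) (zeroʳ _))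

  -- Each letter of `B k z` meets a descent of the partial cycle, because the value being moved
  -- exceeds all those that it passes; so `dual-T̄` applies letter by letter.
  dual-B : ∀ k z {w φ} → Linear V 𝔽 φ → z ℕ.+ k < n → (∀ j → k < j → j ≤ z ℕ.+ k → val w j < val w k) →
           Dual (cycle w k z) φ → Dual w (λ u → φ (B k z u))
  dual-B k zero    Φ l larger d = d
  dual-B k (suc z) {w} {φ} Φ l larger d with index (z ℕ.+ k) l
  ... | i , i≡ = dual-B k z (∘-linear Φ (Strands′.𝕋-linear (z ℕ.+ k))) (ℕₚ.<⇒≤ l) (λ j k<j j≤ → larger j k<j (ℕₚ.m≤n⇒m≤1+n j≤)) step
    where
    module Strands′ = Parameters.HeckeAction action
    w′ = cycle w k z
    desc : Descent w′ i
    desc = ≡.subst₂ _<_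
      (≡.trans (≡.sym (cycle-outside w k z (ℕₚ.<⇒≤ l) (inj₂ ℕₚ.≤-refl)))
        (≡.trans (≡.cong (val w′) (≡.trans (≡.cong suc (≡.sym i≡)) (≡.sym (toℕ-hi i)))) (val-toℕ w′ (hi i))))
      (≡.trans (≡.sym (cycle-end w k z (ℕₚ.<⇒≤ l)))
        (≡.trans (≡.cong (val w′) (≡.trans (≡.sym i≡) (≡.sym (toℕ-lo i)))) (val-toℕ w′ (lo i))))
      (larger (suc (z ℕ.+ k)) (s≤s (ℕₚ.m≤n+m k z)) ℕₚ.≤-refl)
    D : Dual w′ (λ u → φ (T̄ i u))
    D = dual-T̄ Φ desc (≡.subst (λ σ → Dual (w′ · σ) φ) (σ≡ i i≡) d)
    T≡ : ∀ u → φ (𝕋ₙ (z ℕ.+ k) u) ≈ φ (T̄ i u)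
    T≡ u = ≡.subst (λ y → φ y ≈ φ (T̄ i u)) (≡.sym (𝕋ₙ≡ i u i≡)) ≈-refl
    step : Dual w′ (λ u → φ (𝕋ₙ (z ℕ.+ k) u))
    step = record { on = λ e → ≈-trans (T≡ _) (on D e) ; off = λ e → ≈-trans (T≡ _) (off D e) }

  -- The recursion of `Y` on the top site is matched by `grass-false` and `grass-true`, so no
  -- reduced word of `w` has to be written down.
  dual-Y : ∀ b {k z w} → z ℕ.+ k ≤ n → length b ≡ z ℕ.+ k → Grass b k z w → Dual w (λ u → ev (Y b k z u))
  dual-Y []          {zero}  {zero}  l e g = dual-cong
    (λ a → Finₚ.toℕ-injective (≡.sym (≡.trans (≡.sym (val-toℕ _ a)) (Grass.fixes g (toℕ a) z≤n)))) dual-ev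
  dual-Y []          {suc k} {zero}  l () g
  dual-Y []          {k}     {suc z} l () g
  dual-Y (false ∷ b) l e g with grass-false e g
  ... | z , refl , g′ = dual-Y b (ℕₚ.<⇒≤ l) (ℕₚ.suc-injective e) g′
  dual-Y (true ∷ b) {z = z} l e g with grass-true l e g
  ... | k , refl , L<n , larger , g′ = dual-B k z (∘-linear ev-linear (Y-linear b k z)) L<n larger
    (dual-Y b (ℕₚ.<⇒≤ L<n) (ℕₚ.suc-injective (≡.trans e (ℕₚ.+-suc z k))) g′)

  module _ {k : ℕ} (k≤n : k ≤ n) where

    open Grassmannian k≤n
    open GrassmannianPermutations k≤n

    private
      term : Partition k (n ∸ k) → Permutation′ n → Carrierᴹ
      term ν v = (p̂ ^ ℓ v) *ₗ 𝒴 (w[ ν ] · v)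

      -- The terms of 𝒴_ν extended by 0 to all of S_n, so that the sum can be reindexed by right
      -- multiplication with s_i.
      G : Partition k (n ∸ k) → Permutation′ n → Carrierᴹ
      G ν v = Vₛ.when (inYoung? k v) (term ν v)

      term-cong : ∀ ν {v w} → v Perm.≈ w → term ν v ≈ᴹ term ν w
      term-cong ν {v} {w} e = *ₗ-cong (≡.subst (λ d → p̂ ^ ℓ v ≈ p̂ ^ d) (ℓ-cong {v} {w} e) ≈-refl)
        (𝒴-cong {w[ ν ] · v} {w[ ν ] · w} λ a → ≡.cong (w[ ν ] ⟨$⟩ʳ_) (e a))

      young-cong : ∀ {v w : Permutation′ n} → v Perm.≈ w → InYoung k v → InYoung k w
      young-cong e y j j<k = ≡.subst (λ a → toℕ a < k) (e j) (y j j<k)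

      G-yes : ∀ ν v → InYoung k v → G ν v ≈ᴹ term ν v
      G-yes ν v y = Vₛ.when-yes (inYoung? k v) y

      G-no : ∀ ν v → ¬ InYoung k v → G ν v ≈ᴹ 0ᴹ
      G-no ν v ¬y = Vₛ.when-no (inYoung? k v) ¬y

      G-cong : ∀ ν {v w} → v Perm.≈ w → G ν v ≈ᴹ G ν w
      G-cong ν {v} {w} e = split (inYoung? k v)
        where
        split : Dec (InYoung k v) → G ν v ≈ᴹ G ν w
        split (yes y) = ≈ᴹ-trans (G-yes ν v y) (≈ᴹ-trans (term-cong ν {v} {w} e) (≈ᴹ-sym (G-yes ν w (young-cong {v} {w} e y))))
        split (no ¬y) = ≈ᴹ-trans (G-no ν v ¬y) (≈ᴹ-sym (G-no ν w λ y → ¬y (young-cong {w} {v} (λ a → ≡.sym (e a)) y)))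

    𝒴[]≈ : ∀ ν → 𝒴[ ν ] ≈ᴹ Vₛ.∑ (permutations n) (G ν)
    𝒴[]≈ ν = Vₛ.∑-filter (inYoung? k) (permutations n) (term ν)

    private
      -- With the weights p^ℓ(v) the factors 1 at a descent and pq at an ascent of `T̄ i` become p
      -- and q.
      above diagonal : Fin (n ∸ 1) → Permutation′ n → Carrier
      above i v with direction v i
      ... | inj₁ _ = q̂
      ... | inj₂ _ = p̂
      diagonal i v with direction v i
      ... | inj₁ _ = 0#
      ... | inj₂ _ = A

      above-diagonal : ∀ i v → above i (v · s i) + diagonal i v ≈ p̂
      above-diagonal i v with direction v i | direction (v · s i) i
      ... | inj₁ a | inj₁ a′ = ⊥-elim (ℕₚ.<-asym a′ (descent-s {v} i a))
      ... | inj₁ a | inj₂ d′ = +-identityʳ p̂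
      ... | inj₂ d | inj₁ a′ = ≈-trans (CommutativeRing.+-comm K q̂ A) A+q≈p
      ... | inj₂ d | inj₂ d′ = ⊥-elim (ℕₚ.<-asym d′ (ascent-s {v} i d))

      T̄-G : ∀ ν i → suc (toℕ i) ≢ k → ∀ v → T̄ i (G ν v) ≈ᴹ above i v *ₗ G ν (v · s i) +ᴹ diagonal i v *ₗ G ν v
      T̄-G ν i i≢ v = split (inYoung? k v)
        where
        open ModuleSolver V
        split : Dec (InYoung k v) → T̄ i (G ν v) ≈ᴹ above i v *ₗ G ν (v · s i) +ᴹ diagonal i v *ₗ G ν v
        split (no ¬y) = ≈ᴹ-trans (≈ᴹ-trans (f-cong (T̄-linear i) (G-no ν v ¬y)) (f-0 (T̄-linear i)))
          (≈ᴹ-sym (≈ᴹ-trans (+ᴹ-cong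
            (≈ᴹ-trans (*ₗ-congˡ (G-no ν (v · s i) λ y → ¬y (young-cong {v · s i · s i} {v} (·ss v i) (young-s {v · s i} y i i≢)))) (*ₗ-zeroʳ _))
            (≈ᴹ-trans (*ₗ-congˡ (G-no ν v ¬y)) (*ₗ-zeroʳ _))) (+ᴹ-identityʳ _)))
        split (yes y) = ≈ᴹ-trans (≈ᴹ-trans (f-cong (T̄-linear i) (G-yes ν v y)) (f-* (T̄-linear i) _ _))
          (≈ᴹ-trans action′ (≈ᴹ-sym (+ᴹ-cong (*ₗ-congˡ (G-yes ν (v · s i) (young-s {v} y i i≢))) (*ₗ-congˡ (G-yes ν v y)))))
          where
          power : ∀ {a b} → a ≡ suc b → p̂ ^ a ≈ p̂ * p̂ ^ b
          power refl = ≈-refl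
          action′ : (p̂ ^ ℓ v) *ₗ T̄ i (𝒴 (w[ ν ] · v)) ≈ᴹ above i v *ₗ term ν (v · s i) +ᴹ diagonal i v *ₗ term ν v
          action′ with direction v i
          ... | inj₁ a = begin
            (p̂ ^ ℓ v) *ₗ T̄ i (𝒴 (w[ ν ] · v))
              ≈⟨ *ₗ-congˡ (T̄-ascent (w[ ν ] · v) i (young-ascent ν {v} y i i≢ a)) ⟩
            (p̂ ^ ℓ v) *ₗ (p̂ * q̂) *ₗ 𝒴 (w[ ν ] · (v · s i))
              ≈⟨ solve (p̂ ∷ q̂ ∷ p̂ ^ ℓ v ∷ []) (𝒴 (w[ ν ] · (v · s i)) ∷ term ν v ∷ [])
                   (λ { (π ∷ κ ∷ r ∷ []) (u ∷ w ∷ []) → r ⊡ (π :* κ) ⊡ u , κ ⊡ (π :* r) ⊡ u ⊞ con 0 ⊡ w }) (≈-refl , ≈-refl , tt) ⟩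
            q̂ *ₗ (p̂ * p̂ ^ ℓ v) *ₗ 𝒴 (w[ ν ] · (v · s i)) +ᴹ 0# *ₗ term ν v
              ≈⟨ +ᴹ-congʳ (*ₗ-congˡ (*ₗ-congʳ (≈-sym (power (ℓ-·s i v a))))) ⟩
            q̂ *ₗ term ν (v · s i) +ᴹ 0# *ₗ term ν v ∎
          ... | inj₂ d = begin
            (p̂ ^ ℓ v) *ₗ T̄ i (𝒴 (w[ ν ] · v))
              ≈⟨ *ₗ-congˡ (T̄-descent (w[ ν ] · v) i (young-descent ν {v} y i i≢ d)) ⟩
            (p̂ ^ ℓ v) *ₗ (𝒴 (w[ ν ] · (v · s i)) +ᴹ A *ₗ 𝒴 (w[ ν ] · v))
              ≈⟨ solve (p̂ ^ ℓ v ∷ A ∷ []) (𝒴 (w[ ν ] · (v · s i)) ∷ 𝒴 (w[ ν ] · v) ∷ [])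
                   (λ { (r ∷ α ∷ []) (u ∷ w ∷ []) → r ⊡ (u ⊞ α ⊡ w) , r ⊡ u ⊞ α ⊡ r ⊡ w }) (≈-refl , ≈-refl , tt) ⟩
            (p̂ ^ ℓ v) *ₗ 𝒴 (w[ ν ] · (v · s i)) +ᴹ A *ₗ term ν v
              ≈⟨ +ᴹ-congʳ (*ₗ-congʳ (power (≡.trans (≡.sym (ℓ-cong {v · s i · s i} {v} (·ss v i)))
                   (ℓ-·s i (v · s i) (ascent-s {v} i d))))) ⟩
            (p̂ * p̂ ^ ℓ (v · s i)) *ₗ 𝒴 (w[ ν ] · (v · s i)) +ᴹ A *ₗ term ν v
              ≈⟨ +ᴹ-congʳ (*ₗ-assoc _ _ _) ⟩
            p̂ *ₗ term ν (v · s i) +ᴹ A *ₗ term ν v ∎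

    -- Collecting at each v what comes from v and from v s_i gives the coefficient p + 0 if v
    -- ascends at i, and q + (p - q) if it descends.
    T̄-𝒴[] : ∀ ν i → suc (toℕ i) ≢ k → T̄ i 𝒴[ ν ] ≈ᴹ p̂ *ₗ 𝒴[ ν ]
    T̄-𝒴[] ν i i≢ = begin
      T̄ i 𝒴[ ν ]
        ≈⟨ f-cong (T̄-linear i) (𝒴[]≈ ν) ⟩
      T̄ i (∑ₙ (G ν))
        ≈⟨ Vₛ.∑-linear (T̄-linear i) (permutations n) (G ν) ⟩
      ∑ₙ (λ v → T̄ i (G ν v))
        -- The coefficient `above i v` is rewritten in terms of v s_i, so that the whole summand
        -- becomes a function of v s_i and `∑-reindex` applies.
        ≈⟨ Vₛ.∑-cong (permutations n) (λ v → ≈ᴹ-trans (T̄-G ν i i≢ v) (+ᴹ-congʳ (*ₗ-congʳ (above-cong v)))) ⟩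
      ∑ₙ (λ v → above i (v · s i · s i) *ₗ G ν (v · s i) +ᴹ diagonal i v *ₗ G ν v)
        ≈⟨ Vₛ.∑-+ (permutations n) _ _ ⟩
      ∑ₙ (λ v → above i (v · s i · s i) *ₗ G ν (v · s i)) +ᴹ ∑ₙ (λ v → diagonal i v *ₗ G ν v)
        ≈⟨ +ᴹ-congʳ (Vₛ.∑-reindex (λ v → above i (v · s i) *ₗ G ν v)
             (λ {v} {w} e → *ₗ-cong (above-ext {v · s i} {w · s i} λ a → e (s i ⟨$⟩ʳ a)) (G-cong ν {v} {w} e)) (s i) (s-involutive i)) ⟩
      ∑ₙ (λ v → above i (v · s i) *ₗ G ν v) +ᴹ ∑ₙ (λ v → diagonal i v *ₗ G ν v)
        ≈⟨ ≈ᴹ-sym (Vₛ.∑-+ (permutations n) _ _) ⟩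
      ∑ₙ (λ v → above i (v · s i) *ₗ G ν v +ᴹ diagonal i v *ₗ G ν v)
        ≈⟨ Vₛ.∑-cong (permutations n) (λ v → ≈ᴹ-trans (≈ᴹ-sym (*ₗ-distribʳ _ _ _)) (*ₗ-congʳ (above-diagonal i v))) ⟩
      ∑ₙ (λ v → p̂ *ₗ G ν v)
        ≈⟨ ≈ᴹ-sym (Vₛ.∑-linear (*-linear p̂ id-linear) (permutations n) (G ν)) ⟩
      p̂ *ₗ ∑ₙ (G ν)
        ≈⟨ *ₗ-congˡ (≈ᴹ-sym (𝒴[]≈ ν)) ⟩
      p̂ *ₗ 𝒴[ ν ] ∎
      where
      ∑ₙ = Vₛ.∑ (permutations n)
      above-ext : ∀ {v w} → v Perm.≈ w → above i v ≈ above i w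
      above-ext {v} {w} e with direction v i | direction w i
      ... | inj₁ _ | inj₁ _ = ≈-refl
      ... | inj₂ _ | inj₂ _ = ≈-refl
      ... | inj₁ a | inj₂ d = ⊥-elim (ℕₚ.<-asym a (≡.subst₂ (λ a b → toℕ a < toℕ b) (≡.sym (e (hi i))) (≡.sym (e (lo i))) d))
      ... | inj₂ d | inj₁ a = ⊥-elim (ℕₚ.<-asym d (≡.subst₂ (λ a b → toℕ a < toℕ b) (≡.sym (e (lo i))) (≡.sym (e (hi i))) a))
      above-cong : ∀ v → above i v ≈ above i (v · s i · s i)
      above-cong v = above-ext {v} {v · s i · s i} λ a → ≡.sym (·ss v i a)

    module _ {μ φ} (Φ : Linear V 𝔽 φ) (D : Dual w[ μ ] φ) where

      private
        φ-G : ∀ ν v → InYoung k v → φ (G ν v) ≈ (p̂ ^ ℓ v) * φ (𝒴 (w[ ν ] · v))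
        φ-G ν v y = ≈-trans (f-cong Φ (G-yes ν v y)) (f-* Φ _ _)

        φ-G-off : ∀ ν v → (InYoung k v → ¬ (w[ ν ] · v Perm.≈ w[ μ ])) → φ (G ν v) ≈ 0#
        φ-G-off ν v off′ = split (inYoung? k v)
          where
          split : Dec (InYoung k v) → φ (G ν v) ≈ 0#
          split (yes y) = ≈-trans (φ-G ν v y) (≈-trans (*-congˡ (off D {w[ ν ] · v} (off′ y))) (zeroʳ _))
          split (no ¬y) = ≈-trans (f-cong Φ (G-no ν v ¬y)) (f-0 Φ)

        expansion : ∀ ν → φ 𝒴[ ν ] ≈ 𝔽ₛ.∑ (permutations n) (λ v → φ (G ν v))
        expansion ν = ≈-trans (f-cong Φ (𝒴[]≈ ν)) (𝔽ₛ.∑-linear Φ (permutations n) (G ν))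

      -- By `young-unique` only v = id contributes, with weight p⁰.
      dual-𝒴[]-on : φ 𝒴[ μ ] ≈ ev₁
      dual-𝒴[]-on = ≈-trans (expansion μ) (≈-trans
        (𝔽ₛ.∑-permutations (λ v → φ (G μ v)) Perm.id (λ {v} e → f-cong Φ (G-cong μ {v} {Perm.id} e))
          (λ v v≉id → φ-G-off μ v λ y e → v≉id (proj₁ (young-unique {μ} {μ} {v} y e))))
        (≈-trans (φ-G μ Perm.id (λ j j<k → j<k)) (≈-trans
          (*-cong (≡.subst (λ d → p̂ ^ d ≈ 1#) (≡.sym (ℓ-identity {Perm.id} λ _ → refl)) ≈-refl) (on D {w[ μ ] · Perm.id} λ _ → refl))
          (*-identityˡ ev₁))))

      dual-𝒴[]-off : ∀ {ν} → μ ≢ ν → φ 𝒴[ ν ] ≈ 0#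
      dual-𝒴[]-off {ν} μ≢ν = ≈-trans (expansion ν)
        (𝔽ₛ.∑-0 (permutations n) λ v → φ-G-off ν v λ y e → μ≢ν (proj₂ (young-unique {μ} {ν} {v} y e)))

module _ {c ℓc} (K : CommutativeRing c ℓc) where

  open LinearAlgebra K

  module _ {m₁ ℓm₁ m₂ ℓm₂} {M : Module m₁ ℓm₁} {N : Module m₂ ℓm₂}
           {f : LeftModule.Carrierᴹ M → LeftModule.Carrierᴹ N} (F : Linear M N f) where

    private module M = LeftModule M
    open LeftModule N
    open Linear F

    f-neg : ∀ v → f (M.-ᴹ v) ≈ᴹ -ᴹ f v
    f-neg v = GroupProperties.inverseˡ-unique +ᴹ-group _ _
      (≈ᴹ-trans (≈ᴹ-sym (f-+ _ _)) (≈ᴹ-trans (f-cong (M.-ᴹ‿inverseˡ v)) f-0))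

  fromIsLinear : ∀ {m₁ ℓm₁ m₂ ℓm₂} {M : Module m₁ ℓm₁} {N : Module m₂ ℓm₂} {f} → IsLinear M N f → Linear M N f
  fromIsLinear {M = M} {N} isL = record { f-cong = ⟦⟧-cong ; f-+ = +ᴹ-homo ; f-* = *ₗ-homo }
    where open LeftModuleMorphisms.IsLeftModuleHomomorphism isL

  module _ {P Q N H : CommutativeRing.Carrier K} where

    open CommutativeRing K using (Carrier; *-comm)
    open Parameters K P Q N H
    open Linear

    -- The operators of R act by the scalars t_j.

    scalarOperators : (ℕ → Carrier) → ∀ {m ℓm} (M : Module m ℓm) → Operators M
    scalarOperators t M = record
      { X = λ j v → t j *ₗ v
      ; X-linear = λ j → *-linear (t j) id-linear
      ; Z = λ _ → 0ᴹ
      ; Z-linear = 0-linear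
      }
      where open LeftModule M

    module _ {m ℓm} {W : Module m ℓm} (S : Operators W) where

      open LeftModule W
      open Operators S
      open RibbonOperators K S

      R-+ : ∀ i g h b → R i (λ a → g a +ᴹ h a) b ≈ᴹ R i g b +ᴹ R i h b
      R-+ i       g h []          = ≈ᴹ-sym (+ᴹ-identityˡ _)
      R-+ zero    g h (false ∷ b) = ≈ᴹ-trans
        (+ᴹ-cong (R-+ zero _ _ b) (≈ᴹ-trans (f-cong (C-linear _) (D-+ _ _ b)) (f-+ (C-linear _) _ _)))
        (interchange W _ _ _ _)
      R-+ zero    g h (true ∷ b)  = f-+ (X-linear _) _ _
      R-+ (suc i) g h (false ∷ b) = R-+ (suc i) _ _ b
      R-+ (suc i) g h (true ∷ b)  = R-+ i _ _ b

      R-∑ : ∀ {ℓI} {I : Set ℓI} i (is : List I) (g : I → List Bool → Carrierᴹ) b →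
            R i (λ a → Sums.∑ K W is (λ j → g j a)) b ≈ᴹ Sums.∑ K W is (λ j → R i (g j) b)
      R-∑ i []       g b = RibbonEntries.R-0 K S 0ᴹ i b
      R-∑ i (j ∷ is) g b = ≈ᴹ-trans (R-+ i _ _ b) (+ᴹ-congˡ (R-∑ i is g b))

      δ-≢ : ∀ e b a → b ≢ a → δ e b a ≡ 0ᴹ
      δ-≢ e []          []          b≢a = ⊥-elim (b≢a refl)
      δ-≢ e []          (_ ∷ a)     b≢a = refl
      δ-≢ e (false ∷ b) []          b≢a = refl
      δ-≢ e (true ∷ b)  []          b≢a = refl
      δ-≢ e (false ∷ b) (false ∷ a) b≢a = δ-≢ e b a λ { refl → b≢a refl }
      δ-≢ e (false ∷ b) (true ∷ a)  b≢a = refl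
      δ-≢ e (true ∷ b)  (false ∷ a) b≢a = refl
      δ-≢ e (true ∷ b)  (true ∷ a)  b≢a = δ-≢ e b a λ { refl → b≢a refl }

bits-injective : ∀ {k m} {μ ν : Partition k m} → bits μ ≡ bits ν → μ ≡ ν
bits-injective {zero}  {μ = []} {[]} e = refl
bits-injective {suc k} {m} {a ∷ μ} {b ∷ ν} e with prefix (m ∸ toℕ a) (m ∸ toℕ b) e
  where
  prefix : ∀ y z {u v} → replicate y false ++ true ∷ u ≡ replicate z false ++ true ∷ v → y ≡ z × u ≡ v
  prefix zero    zero    refl = refl , refl
  prefix (suc y) (suc z) e with prefix y z (Listₚ.∷-injectiveʳ e)
  ... | refl , e′ = refl , e′
... | y≡z , e′ with Finₚ.toℕ-injective (ℕₚ.∸-cancelˡ-≡ (Finₚ.toℕ≤pred[n] a) (Finₚ.toℕ≤pred[n] b) y≡z)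
...   | refl = ≡.cong (a ∷_) (bits-injective e′)

strip-irreflexive : ∀ {k m i h w} {ν : Partition k m} → ¬ Strip i ν ν h w
strip-irreflexive s with strip⇒band s
... | _ , band , _ = ℕₚ.<-irrefl refl (Band.top band)

bits-surjective′ : ∀ {k l} b → length b ≡ l ℕ.+ k → ones b ≡ k → ∃[ ν ] bits {k} {l} ν ≡ b
bits-surjective′ {l = l} b len o = bits-surjective b o
  (ℕₚ.+-cancelʳ-≡ (ones b) _ _ (≡.trans (zeros+ones b) (≡.trans len (≡.cong (l ℕ.+_) (≡.sym o)))))

-- Compositions of ribbon operators

module RibbonCompositions {c ℓc} (K : CommutativeRing c ℓc) {P Q N H : CommutativeRing.Carrier K}
  (t : ℕ → CommutativeRing.Carrier K) {m ℓm} (M : LeftModule (CommutativeRing.ring K) m ℓm)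
  {k l : ℕ} (y : Partition k l → LeftModule.Carrierᴹ M) where

  open CommutativeRing K using (Carrier; _≈_; _+_; _*_) renaming (refl to ≈-refl; sym to ≈-sym; trans to ≈-trans)
  open LinearAlgebra K
  open Parameters K P Q N H
  open LeftModule M
  open Sums K M
  open Linear

  S₀ : Operators M
  S₀ = scalarOperators K t M

  Sˢ : Operators (series M)
  Sˢ = Series.seriesOperators K S₀

  private
    module S₀ = Operators S₀
    module R₀ = RibbonOperators K S₀
    module Rˢ = RibbonOperators K Sˢ

  -- `y` carried over from partitions to strings, with the value 0 at strings that encode no
  -- partition in the rectangle.
  g₀ : List Bool → Carrierᴹ
  g₀ a = ∑ (partitions k l) (λ μ → R₀.δ (y μ) (bits μ) a)

  g : List Bool → ℕ → Carrierᴹ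
  g a = constant M (g₀ a)

  g₀-bits : ∀ ν → g₀ (bits ν) ≈ᴹ y ν
  g₀-bits ν = ≈ᴹ-trans
    (∑-partitions _ ν λ μ μ≢ν → ≈ᴹ-reflexive (δ-≢ K S₀ (y μ) (bits μ) (bits ν) λ e → μ≢ν (bits-injective e)))
    (≈ᴹ-reflexive (RibbonEntries.δ-refl K S₀ (y ν) (bits ν)))

  module Formula (diagonal : Fin k → Partition k l → Carrier) (ribbon : Fin k → Partition k l → Partition k l → Carrier)
    (diagonal≈ : ∀ i ν → diagonal i ν ≈ t (position ν i))
    (ribbon≈ : ∀ i μ ν → ribbon i μ ν ≈ (H + N * t (position μ i)) * P ^ (Skew.ht μ ν ∸ 1) * Q ^ (Skew.wd μ ν ∸ 1)) where

    private
      C≈ : ∀ {i : Fin k} {μ ν : Partition k l} {h w} → Skew.ht μ ν ∸ 1 ≡ h → Skew.wd μ ν ∸ 1 ≡ w →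
           ∀ v → S₀.C (position μ i) ((P ^ h) *ₗ (Q ^ w) *ₗ v) ≈ᴹ ribbon i μ ν *ₗ v
      C≈ {i} {μ} {ν} {h} {w} refl refl v = ≈ᴹ-trans
        (solve (H ∷ N ∷ t (position μ i) ∷ P ^ h ∷ Q ^ w ∷ []) (v ∷ [])
          (λ { (η ∷ ν ∷ θ ∷ π ∷ κ ∷ []) (v ∷ []) → η ⊡ π ⊡ κ ⊡ v ⊞ ν ⊡ θ ⊡ π ⊡ κ ⊡ v , ((η :+ ν :* θ) :* π :* κ) ⊡ v })
          (≈-refl , tt))
        (*ₗ-congʳ (≈-sym (ribbon≈ i μ ν)))
        where open ModuleSolver M

    -- The entries computed by `R-entry` are sorted into the diagonal one and those of ribbons. The
    -- two kinds exclude each other because a strip is never empty.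
    ribbonFormula : ∀ i ν → (diagonal i ν *ₗ y ν) +ᴹ
      sumᴹ M (map (λ μ → ribbon i μ ν *ₗ y μ) (filter (λ μ → Skew.ribbonWithHeadInRow? μ ν i) (partitions k l)))
      ≈ᴹ R₀.R (toℕ i) g₀ (bits ν)
    ribbonFormula i ν = ≈ᴹ-sym (≈ᴹ-trans (R-∑ K S₀ (toℕ i) (partitions k l) _ (bits ν))
      (≈ᴹ-trans (∑-cong (partitions k l) entry)
      (≈ᴹ-trans (∑-+ (partitions k l) _ _)
        (+ᴹ-cong
          (≈ᴹ-trans (∑-partitions _ ν λ μ → when-no (μ ≟ᴾ ν)) (when-yes (ν ≟ᴾ ν) refl))
          (≈ᴹ-sym (∑-filter (λ μ → Skew.ribbonWithHeadInRow? μ ν i) (partitions k l) _))))))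
      where
      ribbon? : ∀ μ → Dec (Skew.RibbonWithHeadInRow μ ν i)
      ribbon? μ = Skew.ribbonWithHeadInRow? μ ν i
      irreflexive : ∀ {μ} → μ ≡ ν → ¬ Skew.RibbonWithHeadInRow μ ν i
      irreflexive refl rib = let (_ , _ , s) = Geometry.ribbon⇒strip ν ν rib in strip-irreflexive s
      entry : ∀ μ → R₀.R (toℕ i) (R₀.δ (y μ) (bits μ)) (bits ν) ≈ᴹ
              when (μ ≟ᴾ ν) (diagonal i ν *ₗ y μ) +ᴹ when (ribbon? μ) (ribbon i μ ν *ₗ y μ)
      entry μ = split (RibbonEntries.R-entry K S₀ (y μ) i μ ν)
        where
        v : Carrierᴹ
        v = R₀.R (toℕ i) (R₀.δ (y μ) (bits μ)) (bits ν)
        split : RibbonEntries.Entry K S₀ (y μ) i μ ν v →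
                v ≈ᴹ when (μ ≟ᴾ ν) (diagonal i ν *ₗ y μ) +ᴹ when (ribbon? μ) (ribbon i μ ν *ₗ y μ)
        split (RibbonEntries.same μ≡ν e) = ≈ᴹ-trans e (≈ᴹ-trans (*ₗ-congʳ (≈-sym (diagonal≈ i ν)))
          (≈ᴹ-sym (≈ᴹ-trans (+ᴹ-cong (when-yes (μ ≟ᴾ ν) μ≡ν) (when-no (ribbon? μ) (irreflexive μ≡ν))) (+ᴹ-identityʳ _))))
        split (RibbonEntries.strip s e) = let (rib , ht≡ , wd≡) = Geometry.strip⇒ribbon μ ν s in
          ≈ᴹ-trans e (≈ᴹ-trans (C≈ {i} {μ} {ν} ht≡ wd≡ (y μ))
          (≈ᴹ-sym (≈ᴹ-trans (+ᴹ-cong (when-no (μ ≟ᴾ ν) λ { refl → strip-irreflexive s }) (when-yes (ribbon? μ) rib)) (+ᴹ-identityˡ _))))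
        split (RibbonEntries.none μ≢ν ¬s e) = ≈ᴹ-trans e
          (≈ᴹ-sym (≈ᴹ-trans (+ᴹ-cong (when-no (μ ≟ᴾ ν) μ≢ν)
            (when-no (ribbon? μ) λ rib → let (_ , _ , s) = Geometry.ribbon⇒strip μ ν rib in ¬s _ _ s)) (+ᴹ-identityˡ _)))

    module _ (R : Fin k → Carrierᴹ → Carrierᴹ) (R-linear : ∀ i → Linear M M (R i))
      (R-y : ∀ i ν → R i (y ν) ≈ᴹ (diagonal i ν *ₗ y ν) +ᴹ
        sumᴹ M (map (λ μ → ribbon i μ ν *ₗ y μ) (filter (λ μ → Skew.ribbonWithHeadInRow? μ ν i) (partitions k l)))) where

      private
        composite : Carrierᴹ → List (Fin k) → Carrierᴹ
        composite = foldl (λ u i → R i u)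

        composite-linear : ∀ js → Linear M M (λ u → composite u js)
        composite-linear []       = id-linear
        composite-linear (i ∷ js) = ∘-linear (composite-linear js) (R-linear i)

        ∑-composite-linear : ∀ jss → Linear M M (λ u → ∑ jss (composite u))
        ∑-composite-linear []         = 0-linear
        ∑-composite-linear (js ∷ jss) = +-linear (composite-linear js) (∑-composite-linear jss)

        at-linear : ∀ r → Linear (series M) M (λ u → u r)
        at-linear r = record { f-cong = λ e → e r ; f-+ = λ _ _ → ≈ᴹ-refl ; f-* = λ _ _ → ≈ᴹ-refl }

      -- `choose` splits according to whether i is used, as the factor 1 + Z R_i does. If it is
      -- used, R_i acts first, and its value, a combination of the `y μ`, enters the linear map
      -- formed by the remaining compositions, to which the induction hypothesis applies string by
      -- string.
      compositions≈ : ∀ is r ν → ∑ (choose r is) (composite (y ν)) ≈ᴹ Rˢ.∏R (map toℕ is) g (bits ν) r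
      compositions≈ []       zero    ν = ≈ᴹ-trans (+ᴹ-identityʳ _) (≈ᴹ-sym (g₀-bits ν))
      compositions≈ []       (suc r) ν = ≈ᴹ-refl
      compositions≈ (i ∷ is) zero    ν = ≈ᴹ-trans (compositions≈ is zero ν) (≈ᴹ-sym (+ᴹ-identityʳ _))
      compositions≈ (i ∷ is) (suc r) ν = ≈ᴹ-trans
        (≈ᴹ-trans (∑-++ (map (i ∷_) (choose r is)) (choose (suc r) is) _) (+ᴹ-congʳ (∑-map (i ∷_) (choose r is) _)))
        (≈ᴹ-trans (+ᴹ-comm _ _) (+ᴹ-cong (compositions≈ is (suc r) ν) first))
        where
        L = ∑-composite-linear (choose r is)
        entries : ∀ a → length a ≡ length (bits ν) → ones a ≡ ones (bits ν) →
                  ∑ (choose r is) (composite (g₀ a)) ≈ᴹ Rˢ.∏R (map toℕ is) g a r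
        entries a len o = let (ν′ , e) = bits-surjective′ {k} {l} a (≡.trans len (length-bits ν)) (≡.trans o (ones-bits ν)) in
          ≡.subst (λ a → ∑ (choose r is) (composite (g₀ a)) ≈ᴹ Rˢ.∏R (map toℕ is) g a r) e
            (≈ᴹ-trans (f-cong L (g₀-bits ν′)) (compositions≈ is r ν′))
        first : ∑ (choose r is) (composite (R i (y ν))) ≈ᴹ Rˢ.R (toℕ i) (Rˢ.∏R (map toℕ is) g) (bits ν) r
        first = ≈ᴹ-trans (f-cong L (≈ᴹ-trans (R-y i ν) (ribbonFormula i ν)))
          (≈ᴹ-trans (R-hom K S₀ S₀ L (λ j v → f-* L _ _) (toℕ i) g₀ (bits ν))
          (≈ᴹ-trans (R₀.R-cong (toℕ i) (bits ν) entries)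
          (≈ᴹ-sym (R-hom K Sˢ S₀ (at-linear r) (λ j v → ≈ᴹ-refl) (toℕ i) _ (bits ν)))))

-- Comparison of the two sides under the functionals

module Pieri {c ℓ₁ ℓ₂ m ℓm} (F : HeytingField c ℓ₁ ℓ₂) (n k : ℕ) (k≤n : k ≤ n) (t : Fin n → HeytingField.Carrier F)
  (rep : SchubertRepresentation F n t m ℓm) where

  open SchubertRepresentation rep hiding (_^_)
  open Grassmannian k≤n
  open Representation F n t rep
  open Basis F n t rep
  open CommutativeRing K using (Carrier; _≈_; _+_; _*_; -_; 0#; *-congˡ; *-congʳ; *-comm; +-congˡ; -‿inverseʳ; zeroˡ; distribʳ)
    renaming (refl to ≈-refl; sym to ≈-sym; trans to ≈-trans)
  open LinearAlgebra K
  open Parameters K p̂ q̂ N ħ̂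
  open Linear
  open Presented ℚ[p,q,ħ] (Generator n) using (gen)
  open GrassmannianPermutations k≤n using (w-grass; shifted≡)
  open LeftModule Y-span using () renaming (Carrierᴹ to SpanCarrier; _≈ᴹ_ to _≈ˢ_)

  private
    z : ℕ
    z = n ∸ k

    z+k≡n : z ℕ.+ k ≡ n
    z+k≡n = ℕₚ.m∸n+n≡m k≤n

    z+k≤n : z ℕ.+ k ≤ n
    z+k≤n = ℕₚ.≤-reflexive z+k≡n

    module ▷ = ModuleStructures.IsLeftModule ▷-isModule
    module Vₛ = Strands K action
    module Wₛ = Strands K (Series.seriesAction K operators action)

  -- Extended by 0 as `Xₙ` is, so that `ev-Xₙ` holds for every index.
  tₙ : ℕ → Carrier
  tₙ j with j ℕₚ.<? n
  ... | yes l = t (fromℕ< l)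
  ... | no _  = 0#

  tₙ≡ : ∀ a {j} → toℕ a ≡ j → tₙ j ≡ t a
  tₙ≡ a refl with toℕ a ℕₚ.<? n
  ... | yes l = ≡.cong t (Finₚ.fromℕ<-toℕ a l)
  ... | no ¬l = ⊥-elim (¬l (Finₚ.toℕ<n a))

  ev-Xₙ : ∀ j v → ev (Xₙ j v) ≈ tₙ j * ev v
  ev-Xₙ j v with j ℕₚ.<? n
  ... | yes l = ev-ξ (fromℕ< l) v
  ... | no _  = ≈-trans (f-0 ev-linear) (≈-sym (zeroˡ _))

  private
    W : Module m ℓm
    W = series V

    SW : Operators W
    SW = Series.seriesOperators K operators

    module W = LeftModule W
    module SW = Operators SW
    module 𝓗W = HeckeAction (Series.seriesAction K operators action)

  -- The factors with the smallest index outermost, as the recursion on the list of variables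
  -- produces them; `E` has them in the opposite order.
  interval : ℕ → ℕ → W.Carrierᴹ → W.Carrierᴹ
  interval zero    a u = u
  interval (suc l) a u = SW.factor a (interval l (suc a) u)

  private
    factor-comm : ∀ i j u → SW.factor i (SW.factor j u) W.≈ᴹ SW.factor j (SW.factor i u)
    factor-comm i j u = begin
      (u W.+ᴹ SW.Z (SW.X j u)) W.+ᴹ SW.Z (SW.X i (u W.+ᴹ SW.Z (SW.X j u)))
        ≈⟨ W.+ᴹ-congˡ (spread i j) ⟩
      (u W.+ᴹ SW.Z (SW.X j u)) W.+ᴹ (SW.Z (SW.X i u) W.+ᴹ SW.Z (SW.Z (SW.X i (SW.X j u))))
        ≈⟨ W.+ᴹ-congˡ (W.+ᴹ-congˡ (f-cong SW.Z-linear (f-cong SW.Z-linear (𝓗W.X-X i j u)))) ⟩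
      (u W.+ᴹ SW.Z (SW.X j u)) W.+ᴹ (SW.Z (SW.X i u) W.+ᴹ SW.Z (SW.Z (SW.X j (SW.X i u))))
        ≈⟨ interchange W _ _ _ _ ⟩
      (u W.+ᴹ SW.Z (SW.X i u)) W.+ᴹ (SW.Z (SW.X j u) W.+ᴹ SW.Z (SW.Z (SW.X j (SW.X i u))))
        ≈⟨ W.+ᴹ-congˡ (W.≈ᴹ-sym (spread j i)) ⟩
      (u W.+ᴹ SW.Z (SW.X i u)) W.+ᴹ SW.Z (SW.X j (u W.+ᴹ SW.Z (SW.X i u))) ∎
      where
      open SetoidReasoning W.≈ᴹ-setoid
      spread : ∀ i j → SW.Z (SW.X i (u W.+ᴹ SW.Z (SW.X j u))) W.≈ᴹ SW.Z (SW.X i u) W.+ᴹ SW.Z (SW.Z (SW.X i (SW.X j u)))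
      spread i j = W.≈ᴹ-trans (f-cong SW.Z-linear (W.≈ᴹ-trans (f-+ (SW.X-linear i) _ _) (W.+ᴹ-congˡ (𝓗W.X-Z i _)))) (f-+ SW.Z-linear _ _)

  interval-suc : ∀ l a u → interval (suc l) a u W.≈ᴹ SW.factor (l ℕ.+ a) (interval l a u)
  interval-suc zero    a u = W.≈ᴹ-refl
  interval-suc (suc l) a u = W.≈ᴹ-trans (f-cong (SW.factor-linear a) (interval-suc l (suc a) u))
    (W.≈ᴹ-trans (factor-comm a (l ℕ.+ suc a) _) (≡.subst (λ j → SW.factor (l ℕ.+ suc a) v W.≈ᴹ SW.factor j v) (ℕₚ.+-suc l a) W.≈ᴹ-refl))
    where v = SW.factor a (interval l (suc a) u)

  E≈interval : ∀ l u → Wₛ.E l u W.≈ᴹ interval l 0 u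
  E≈interval zero    u = W.≈ᴹ-refl
  E≈interval (suc l) u = W.≈ᴹ-trans (f-cong (SW.factor-linear l) (E≈interval l u)) (W.≈ᴹ-sym (W.≈ᴹ-trans (interval-suc l 0 u)
    (≡.subst (λ j → SW.factor (l ℕ.+ 0) v W.≈ᴹ SW.factor j v) (ℕₚ.+-identityʳ l) W.≈ᴹ-refl)))
    where v = interval l 0 u

  private
    monomial : List (Fin k) → Ring.Carrier (Ĥ n)
    monomial js = foldr (Ring._*_ (Ĥ n)) (Ring.1# (Ĥ n)) (map (λ i → 𝕩 (inject≤ i k≤n)) js)

    eᴴ : List (Fin k) → ℕ → Ring.Carrier (Ĥ n)
    eᴴ is r = foldr (Ring._+_ (Ĥ n)) (Ring.0# (Ĥ n)) (map monomial (choose r is))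

    ∑▷ : ∀ {ℓI} {I : Set ℓI} (is : List I) (h : I → Ring.Carrier (Ĥ n)) v →
         foldr (Ring._+_ (Ĥ n)) (Ring.0# (Ĥ n)) (map h is) ▷ v ≈ᴹ Sums.∑ K V is (λ i → h i ▷ v)
    ∑▷ []       h v = ▷.*ₗ-zeroˡ v
    ∑▷ (i ∷ is) h v = ≈ᴹ-trans (▷.*ₗ-distribʳ v _ _) (+ᴹ-congˡ (∑▷ is h v))

    factors : List (Fin k) → W.Carrierᴹ → W.Carrierᴹ
    factors is u = foldr (λ i → SW.factor (toℕ i)) u is

    -- The splitting in `choose` is the recursion for the coefficients of a polynomial multiplied by
    -- 1 + Z x_i.
    eᴴ≈ : ∀ is v r → eᴴ is r ▷ v ≈ᴹ factors is (constant V v) r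
    eᴴ≈ []       v zero    = ≈ᴹ-trans (∑▷ (choose 0 []) monomial v) (≈ᴹ-trans (+ᴹ-identityʳ _) (▷.*ₗ-identityˡ v))
    eᴴ≈ []       v (suc r) = ▷.*ₗ-zeroˡ v
    eᴴ≈ (i ∷ is) v zero    = ≈ᴹ-trans (eᴴ≈ is v zero) (≈ᴹ-sym (+ᴹ-identityʳ _))
    eᴴ≈ (i ∷ is) v (suc r) = begin
      eᴴ (i ∷ is) (suc r) ▷ v
        ≈⟨ ∑▷ (map (i ∷_) (choose r is) ++ choose (suc r) is) monomial v ⟩
      ∑ (map (i ∷_) (choose r is) ++ choose (suc r) is) (λ js → monomial js ▷ v)
        ≈⟨ ≈ᴹ-trans (Sums.∑-++ K V (map (i ∷_) (choose r is)) (choose (suc r) is) _) (+ᴹ-cong (Sums.∑-map K V (i ∷_) (choose r is) _) ≈ᴹ-refl) ⟩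
      ∑ (choose r is) (λ js → monomial (i ∷ js) ▷ v) +ᴹ ∑ (choose (suc r) is) (λ js → monomial js ▷ v)
        ≈⟨ +ᴹ-cong (Sums.∑-cong K V (choose r is) λ js → ▷.*ₗ-assoc _ _ v) (≈ᴹ-sym (∑▷ (choose (suc r) is) monomial v)) ⟩
      ∑ (choose r is) (λ js → ξ (inject≤ i k≤n) (monomial js ▷ v)) +ᴹ eᴴ is (suc r) ▷ v
        ≈⟨ +ᴹ-congʳ (≈ᴹ-trans (≈ᴹ-sym (Sums.∑-linear K V (▷-Linear (gen (x (inject≤ i k≤n)))) (choose r is) _))
             (f-cong (▷-Linear (gen (x (inject≤ i k≤n)))) (≈ᴹ-sym (∑▷ (choose r is) monomial v)))) ⟩
      ξ (inject≤ i k≤n) (eᴴ is r ▷ v) +ᴹ eᴴ is (suc r) ▷ v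
        ≈⟨ +ᴹ-cong (≈ᴹ-trans (f-cong (▷-Linear (gen (x (inject≤ i k≤n)))) (eᴴ≈ is v r))
             (≡.subst (_≈ᴹ Xₙ (toℕ i) (factors is (constant V v) r)) (Xₙ≡ (inject≤ i k≤n) _ (Finₚ.toℕ-inject≤ i k≤n)) ≈ᴹ-refl))
             (eᴴ≈ is v (suc r)) ⟩
      Xₙ (toℕ i) (factors is (constant V v) r) +ᴹ factors is (constant V v) (suc r)
        ≈⟨ +ᴹ-comm _ _ ⟩
      factors (i ∷ is) (constant V v) (suc r) ∎
      where
      open SetoidReasoning ≈ᴹ-setoid
      open Sums K V using (∑)

    factors-tabulate : ∀ l a (f : Fin l → Fin k) u → (∀ i → toℕ (f i) ≡ toℕ i ℕ.+ a) → factors (tabulate f) u ≡ interval l a u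
    factors-tabulate zero    a f u e = refl
    factors-tabulate (suc l) a f u e = ≡.cong₂ SW.factor (e zero) (factors-tabulate l (suc a) (λ i → f (suc i)) u
      λ i → ≡.trans (e (suc i)) (≡.sym (ℕₚ.+-suc (toℕ i) a)))

  elementary≈E : ∀ v r → elementary k≤n r ▷ v ≈ᴹ Wₛ.E k (constant V v) r
  elementary≈E v r = ≈ᴹ-trans (eᴴ≈ (allFin k) v r) (≡.subst (λ u → u r ≈ᴹ Wₛ.E k (constant V v) r)
    (≡.sym (factors-tabulate k 0 (λ i → i) _ λ i → ≡.sym (ℕₚ.+-identityʳ _))) (≈ᴹ-sym (E≈interval k _ r)))

  𝒴-symmetric : ∀ ν → Vₛ.Symmetric k z 𝒴[ ν ]
  𝒴-symmetric ν j j<n j≢k with Values.index n j (≡.subst (suc j <_) z+k≡n j<n)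
  ... | i , refl = ≡.subst (_≈ᴹ p̂ *ₗ 𝒴[ ν ]) (≡.sym (𝕋ₙ≡ i _ refl)) (T̄-𝒴[] k≤n ν i j≢k)

  symmetric-constant : ∀ {v} → Vₛ.Symmetric k z v → Wₛ.Symmetric k z (constant V v)
  symmetric-constant sym j l j≢k zero    = sym j l j≢k
  symmetric-constant sym j l j≢k (suc r) = ≈ᴹ-trans (f-0 (𝕋ₙ-linear j)) (≈ᴹ-sym (*ₗ-zeroʳ _))

  private
    p-linear : Linear V V (p̂ *ₗ_)
    p-linear = *-linear p̂ id-linear

  span-symmetric : ∀ {v} → InSpan V 𝒴[_] v → Vₛ.Symmetric k z v
  span-symmetric (member ν) = 𝒴-symmetric ν
  span-symmetric 0-in       j l e = ≈ᴹ-trans (f-0 (𝕋ₙ-linear j)) (≈ᴹ-sym (*ₗ-zeroʳ _))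
  span-symmetric (+-in s s′) j l e = ≈ᴹ-trans (f-+ (𝕋ₙ-linear j) _ _)
    (≈ᴹ-trans (+ᴹ-cong (span-symmetric s j l e) (span-symmetric s′ j l e)) (≈ᴹ-sym (*ₗ-distribˡ _ _ _)))
  span-symmetric (neg-in s) j l e = ≈ᴹ-trans (f-neg K (𝕋ₙ-linear j) _)
    (≈ᴹ-trans (-ᴹ‿cong (span-symmetric s j l e)) (≈ᴹ-sym (f-neg K p-linear _)))
  span-symmetric (*ₗ-in a s) j l e = ≈ᴹ-trans (f-* (𝕋ₙ-linear j) _ _)
    (≈ᴹ-trans (*ₗ-congˡ (span-symmetric s j l e)) (≈ᴹ-sym (f-* p-linear _ _)))
  span-symmetric (≈-in u≈v s) j l e = ≈ᴹ-trans (f-cong (𝕋ₙ-linear j) (≈ᴹ-sym u≈v))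
    (≈ᴹ-trans (span-symmetric s j l e) (*ₗ-congˡ u≈v))

  difference-symmetric : ∀ {u v} → Vₛ.Symmetric k z u → Vₛ.Symmetric k z v → Vₛ.Symmetric k z (u +ᴹ -ᴹ v)
  difference-symmetric s s′ j l e = ≈ᴹ-trans (f-+ (𝕋ₙ-linear j) _ _) (≈ᴹ-trans
    (+ᴹ-cong (s j l e) (≈ᴹ-trans (f-neg K (𝕋ₙ-linear j) _) (≈ᴹ-trans (-ᴹ‿cong (s′ j l e)) (≈ᴹ-sym (f-neg K p-linear _)))))
    (≈ᴹ-sym (*ₗ-distribˡ _ _ _)))

  Φ : List Bool → Carrierᴹ → Carrier
  Φ b v = ev (Vₛ.Y b k z v)

  Φ-linear : ∀ b → Linear V 𝔽 (Φ b)
  Φ-linear b = ∘-linear ev-linear (Vₛ.Y-linear b k z)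

  Φ-bits-on : ∀ ν → Φ (bits ν) 𝒴[ ν ] ≈ ev₁
  Φ-bits-on ν = dual-𝒴[]-on k≤n (Φ-linear (bits ν)) (dual-Y (bits ν) z+k≤n (length-bits ν) (w-grass ν))

  Φ-bits-off : ∀ {μ ν} → μ ≢ ν → Φ (bits μ) 𝒴[ ν ] ≈ 0#
  Φ-bits-off {μ} μ≢ν = dual-𝒴[]-off k≤n (Φ-linear (bits μ)) (dual-Y (bits μ) z+k≤n (length-bits μ) (w-grass μ)) μ≢ν

  Y-off : ∀ b k z v → ones b ≢ k → Vₛ.Y b k z v ≈ᴹ 0ᴹ
  Y-off (false ∷ b) k       zero    v e = ≈ᴹ-refl
  Y-off (false ∷ b) k       (suc z) v e = Y-off b k z v e
  Y-off (true ∷ b)  zero    z       v e = ≈ᴹ-refl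
  Y-off (true ∷ b)  (suc k) z       v e = Y-off b k z _ λ o → e (≡.cong suc o)
  Y-off []          zero    zero    v e = ⊥-elim (e refl)
  Y-off []          zero    (suc z) v e = ≈ᴹ-refl
  Y-off []          (suc k) z       v e = ≈ᴹ-refl

  -- The difference `Δ` is the value of `Y` at the sorted string, so by `vanishing` the functionals
  -- `Φ b` decide about all words applied to it, and `separation` concludes. At strings with another
  -- number of beads `Y` is 0.
  determined : ∀ {u v} → Vₛ.Symmetric k z u → Vₛ.Symmetric k z v → (∀ μ → Φ (bits μ) u ≈ Φ (bits μ) v) → u ≈ᴹ v
  determined {u} {v} su sv e = GroupProperties.x∙y⁻¹≈ε⇒x≈y +ᴹ-group _ _ (separation Δ λ w w< → ≈-trans
    (f-cong ev-linear (f-cong (Vₛ.act-linear w) (≈ᴹ-sym (Vₛ.Y-sorted k z Δ))))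
    (Vₛ.vanishing ev-linear (Vₛ.Y-equivariant {k} {z} z+k≤n (difference-symmetric su sv)) z+k≤n vanish
      w (≡.subst (λ n → All (λ i → suc i < n) w) (≡.sym z+k≡n) w<) (sorted z k)
      (≡.trans (≡.sym (zeros+ones (sorted z k))) (≡.cong₂ ℕ._+_ (zeros-sorted z k) (ones-sorted z k)))))
    where
    Δ = u +ᴹ -ᴹ v
    vanish : ∀ b → length b ≡ z ℕ.+ k → Φ b Δ ≈ 0#
    vanish b l with ones b ℕₚ.≟ k
    ... | no o≢ = ≈-trans (f-cong ev-linear (Y-off b k z Δ o≢)) (f-0 ev-linear)
    ... | yes o≡ = let (μ , b≡) = bits-surjective′ {k} {z} b l o≡ in ≡.subst (λ b → Φ b Δ ≈ 0#) b≡
            (≈-trans (f-+ (Φ-linear (bits μ)) _ _) (≈-trans (+-congˡ (≈-trans (f-neg K (Φ-linear (bits μ)) v)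
              (CommutativeRing.-‿cong K (≈-sym (e μ))))) (-‿inverseʳ _)))

  private
    U : Module c ℓ₁
    U = series 𝔽
    module U = LeftModule U

    scalarOps : ∀ {m ℓm} (M : Module m ℓm) → Operators (series M)
    scalarOps M = Series.seriesOperators K (scalarOperators K tₙ M)

    SU : Operators U
    SU = scalarOps 𝔽

    module RU = RibbonOperators K SU

  e₁ : ℕ → Carrier
  e₁ = constant 𝔽 ev₁

  Φ-δ : ∀ μ ν r → constant 𝔽 (Φ (bits μ) 𝒴[ ν ]) r ≈ RU.δ e₁ (bits μ) (bits ν) r
  Φ-δ μ ν r = split (μ ≟ᴾ ν)
    where
    split : Dec (μ ≡ ν) → constant 𝔽 (Φ (bits μ) 𝒴[ ν ]) r ≈ RU.δ e₁ (bits μ) (bits ν) r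
    split (yes refl) = ≡.subst (λ u → constant 𝔽 (Φ (bits μ) 𝒴[ μ ]) r ≈ u r) (≡.sym (RibbonEntries.δ-refl K SU e₁ (bits μ)))
      (f-cong (constant-linear 𝔽) (Φ-bits-on μ) r)
    split (no μ≢ν) = ≡.subst (λ u → constant 𝔽 (Φ (bits μ) 𝒴[ ν ]) r ≈ u r) (≡.sym (δ-≢ K SU e₁ (bits μ) (bits ν) λ e → μ≢ν (bits-injective e)))
      (≈-trans (f-cong (constant-linear 𝔽) (Φ-bits-off μ≢ν) r) (f-0 (constant-linear 𝔽) r))

  -- `ev` carries the transfer matrix of V to the scalar one, because by `ev-Xₙ` it intertwines
  -- `Xₙ j` with multiplication by `tₙ j`. The input of that matrix is the Kronecker delta of `Φ-δ`,
  -- so `M-δ` and `∏R≈Pr` identify the result.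
  Φ-E : ∀ ƛ μ r → Φ (bits μ) (Wₛ.E k (constant V 𝒴[ ƛ ]) r) ≈ RU.∏R (RU.below k) (RU.δ e₁ (bits μ)) (bits ƛ) r
  Φ-E ƛ μ r = ≈-trans
    (≡.subst (λ u → ev u ≈ ev (Wₛ.Y b k z (Wₛ.E k y) r)) (Series.Y-series K operators action b k z _ r) ≈-refl)
    (≈-trans (f-cong ev-linear (Wₛ.Y-E {k} {z} z+k≤n (symmetric-constant (𝒴-symmetric ƛ)) b (ones-bits μ) (zeros-bits μ) r))
    (≈-trans (M-hom SW SU (series-linear ev-linear) (series-shift ev-linear) 0 _ b (λ j _ v r → ev-Xₙ j (v r)) r)
    (≈-trans (SU.M-cong 0 b entries r)
    (≈-trans (RU.M-δ p+N≈q e₁ 0 (z ℕ.+ k) b (bits ƛ) (length-bits μ) (length-bits ƛ) r)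
    (≈-sym (≡.subst (λ j → RU.∏R (RU.below j) (RU.δ e₁ b) (bits ƛ) U.≈ᴹ RU.Pr (z ℕ.+ k) (RU.δ e₁ b) (bits ƛ)) (ones-bits ƛ)
      (RU.∏R≈Pr (z ℕ.+ k) (bits ƛ) (length-bits ƛ) (RU.δ e₁ b)) r))))))
    where
    b = bits μ
    y = constant V 𝒴[ ƛ ]
    module SU = Operators SU
    point : ∀ a → length a ≡ length b → ∀ r → Φ a (y r) ≈ RU.δ e₁ a (bits ƛ) r
    point a l r with ones a ℕₚ.≟ k
    ... | no o≢ = ≈-trans (≈-trans (f-cong ev-linear (Y-off a k z (y r) o≢)) (f-0 ev-linear))
            (≡.subst (λ u → 0# ≈ u r) (≡.sym (δ-≢ K SU e₁ a (bits ƛ) λ { refl → o≢ (ones-bits ƛ) })) ≈-refl)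
    ... | yes o≡ = let (ν , a≡) = bits-surjective′ {k} {z} a (≡.trans l (length-bits μ)) o≡ in
            ≡.subst (λ a → Φ a (y r) ≈ RU.δ e₁ a (bits ƛ) r) a≡ (≈-trans (series-constant (Φ-linear (bits ν)) 𝒴[ ƛ ] r) (Φ-δ ν ƛ r))
    entries : ∀ a → length a ≡ length b → (λ r → ev (Wₛ.Y a k z y r)) U.≈ᴹ RU.δ e₁ a (bits ƛ)
    entries a l r = ≡.subst (λ u → ev u ≈ RU.δ e₁ a (bits ƛ) r) (≡.sym (Series.Y-series K operators action a k z y r)) (point a l r)

  private
    N≈-A : ∀ a → N * a ≈ - (A * a)
    N≈-A a = GroupProperties.inverseʳ-unique (CommutativeRing.+-group K) _ _
      (≈-trans (≈-sym (distribʳ a A N)) (≈-trans (*-congʳ A+N≈0) (zeroˡ a)))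

  module _ (R : Fin k → SpanCarrier → SpanCarrier) (isR : ∀ i → IsRibbonOperator i (R i)) where

    private
      open module Compositions = RibbonCompositions K {p̂} {q̂} {N} {ħ̂} tₙ Y-span ⟦_⟧ using (module Formula)
      module RS = RibbonOperators K Compositions.Sˢ

      coefficient≈ : ∀ i μ ν → ribbonCoefficient i μ ν ≈
        (ħ̂ + N * tₙ (position μ i)) * p̂ ^ (Skew.ht μ ν ∸ 1) * q̂ ^ (Skew.wd μ ν ∸ 1)
      coefficient≈ i μ ν = ≈-sym (*-congʳ (*-congʳ (+-congˡ (≈-trans (N≈-A _) (CommutativeRing.-‿cong K
        (*-congˡ (≡.subst (tₙ (position μ i) ≈_) (tₙ≡ (shifted μ i) (shifted≡ μ i)) ≈-refl)))))))

    compositions≈ : ∀ is r ν → sumᴹ Y-span (map (foldl (λ u i → R i u) ⟦ ν ⟧) (choose r is)) ≈ˢ RS.∏R (map toℕ is) Compositions.g (bits ν) r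
    compositions≈ = Formula.compositions≈ (λ i ν → t (shifted ν i)) ribbonCoefficient
      (λ i ν → ≡.subst (t (shifted ν i) ≈_) (≡.sym (tₙ≡ (shifted ν i) (shifted≡ ν i))) ≈-refl) coefficient≈
      R (λ i → fromIsLinear K (proj₁ (isR i))) (λ i ν → proj₂ (isR i) ν)

    private
      below-allFin : ∀ l → map toℕ (allFin l) ≡ RU.below l
      below-allFin zero    = refl
      below-allFin (suc l) = ≡.cong (zero ∷_) (≡.trans (≡.cong (map toℕ) (≡.sym (Listₚ.map-tabulate (λ i → i) suc)))
        (≡.trans (≡.sym (Listₚ.map-∘ (allFin l))) (≡.trans (Listₚ.map-∘ (allFin l)) (≡.cong (map suc) (below-allFin l)))))

    -- The `X j` are the same scalars on the span and in the field, so the functional moves inside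
    -- the product of ribbon operators and acts on the strings alone, where it is the Kronecker
    -- delta.
    Φ-compositions : ∀ ƛ μ r → Φ (bits μ) (proj₁ (sumOfCompositions R r ⟦ ƛ ⟧)) ≈ RU.∏R (RU.below k) (RU.δ e₁ (bits μ)) (bits ƛ) r
    Φ-compositions ƛ μ r = ≈-trans (f-cong (Φ-linear (bits μ)) (compositions≈ (allFin k) r ƛ))
      (≈-trans (∏R-hom K Compositions.Sˢ SU (series-linear Ψ) (λ j v r → f-* (Φ-linear (bits μ)) _ (proj₁ (v r))) (series-shift Ψ) (map toℕ (allFin k)) Compositions.g (bits ƛ) r)
      (≈-trans (RU.∏R-cong (map toℕ (allFin k)) (bits ƛ) entries r)
        (≡.subst (λ u → RU.∏R (map toℕ (allFin k)) (RU.δ e₁ (bits μ)) (bits ƛ) r ≈ RU.∏R u (RU.δ e₁ (bits μ)) (bits ƛ) r)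
          (below-allFin k) ≈-refl)))
      where
      proj-linear : Linear Y-span V proj₁
      proj-linear = record { f-cong = λ e → e ; f-+ = λ _ _ → ≈ᴹ-refl ; f-* = λ _ _ → ≈ᴹ-refl }
      Ψ : Linear Y-span 𝔽 (λ u → Φ (bits μ) (proj₁ u))
      Ψ = ∘-linear (Φ-linear (bits μ)) proj-linear
      entries : ∀ a → length a ≡ length (bits ƛ) → ones a ≡ ones (bits ƛ) →
                (λ r → Φ (bits μ) (proj₁ (Compositions.g a r))) U.≈ᴹ RU.δ e₁ (bits μ) a
      entries a l o r = let (ν , a≡) = bits-surjective′ {k} {z} a (≡.trans l (length-bits ƛ)) (≡.trans o (ones-bits ƛ)) in
        ≡.subst (λ a → Φ (bits μ) (proj₁ (Compositions.g a r)) ≈ RU.δ e₁ (bits μ) a r) a≡ (at-bits ν)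
        where
        at-bits : ∀ ν → Φ (bits μ) (proj₁ (Compositions.g (bits ν) r)) ≈ RU.δ e₁ (bits μ) (bits ν) r
        at-bits ν = ≈-trans (series-constant Ψ (Compositions.g₀ (bits ν)) r)
          (≈-trans (f-cong (constant-linear 𝔽) (f-cong (Φ-linear (bits μ)) (Compositions.g₀-bits ν)) r) (Φ-δ μ ν r))

    elementary≈compositions : ∀ ƛ r → elementary k≤n r ▷ 𝒴[ ƛ ] ≈ᴹ proj₁ (sumOfCompositions R r ⟦ ƛ ⟧)
    elementary≈compositions ƛ r = ≈ᴹ-trans (elementary≈E 𝒴[ ƛ ] r) (determined
      (λ j l e → Wₛ.E-symmetric {k} {z} z+k≤n (symmetric-constant (𝒴-symmetric ƛ)) j l e r)
      (span-symmetric (proj₂ (sumOfCompositions R r ⟦ ƛ ⟧)))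
      (λ μ → ≈-trans (Φ-E ƛ μ r) (≈-sym (Φ-compositions ƛ μ r))))

theorem5p1 :
    ∀ {c ℓ₁ ℓ₂ m ℓm} (F : HeytingField c ℓ₁ ℓ₂) (n k : ℕ) (k≤n : k ≤ n)
      (t : Fin n → HeytingField.Carrier F)
      (rep : SchubertRepresentation F n t m ℓm) →
      let open SchubertRepresentation rep
          open Grassmannian k≤n
          open LeftModule Y-span using () renaming (Carrierᴹ to SpanCarrier)
      in
      (R : Fin k → SpanCarrier → SpanCarrier) →
      (∀ i → IsRibbonOperator i (R i)) →
      (ƛ : Partition k (n ∸ k)) (r : ℕ) → r ≤ k →
      elementary k≤n r ▷ 𝒴[ ƛ ] ≈ᴹ proj₁ (sumOfCompositions R r ⟦ ƛ ⟧)
theorem5p1 F n k k≤n t rep R isR ƛ r _ = Pieri.elementary≈compositions F n k k≤n t rep R isR ƛ r
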